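{- The following decision problem is EXPSPACE-complete: given a formula $\varphi$ of the logic $\mathsf{ABD}_{hom}$, decide whether there exists a (finite) homogeneous model $\mathbf{M}=(N,\mathcal{V})$ such that $\mathbf{M},[0,N]\models\varphi$.
   Context: Syntax. Let $\mathrm{Prop}$ be a countable set of proposition letters. $\mathsf{ABD}_{hom}$ formulas are generated by $\varphi ::= p \mid \neg\varphi \mid \varphi\vee\varphi \mid \langle A\rangle\varphi \mid \langle B\rangle\varphi \mid \langle D\rangle\varphi$ with $p\in\mathrm{Prop}$. Models. For $N\in\mathbb{N}$ let $\mathbb{I}_N=\{[x,y] : 0\le x\le y\le N\}$ (point intervals $[x,x]$ included). A finite model is a pair $\mathbf{M}=(N,\mathcal{V})$ with $\mathcal{V}:\mathbb{I}_N\to 2^{\mathrm{Prop}}$. It is homogeneous if for all $p\in\mathrm{Prop}$ and $[x,y]\in\mathbb{I}_N$: $p\in\mathcal{V}([x,y])$ iff $p\in\mathcal{V}([z,z])$ for all $z\in[x,y]$. Semantics. $\mathbf{M},[x,y]\models p$ iff $p\in\mathcal{V}([x,y])$; $\neg,\vee$ as usual; $\mathbf{M},[x,y]\models\langle A\rangle\psi$ iff there is $y'$ with $y\le y'\le N$ and $\mathbf{M},[y,y']\models\psi$; $\mathbf{M},[x,y]\models\langle B\rangle\psi$ iff there is $y'$ with $x\le y'<y$ and $\mathbf{M},[x,y']\models\psi$; $\mathbf{M},[x,y]\models\langle D\rangle\psi$ iff there are $x',y'$ with $x<x'\le y'<y$ and $\mathbf{M},[x',y']\models\psi$. EXPSPACE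 is the class of problems decidable in space $2^{p(n)}$ for a polynomial $p$, where $n$ is the size of the input formula. -}

module Defs where

open import Data.Bool.Base using (Bool; true; false; T)
open import Data.Fin.Base using (Fin)
open import Data.List.Base using (List; []; _∷_; _++_; map; foldr; concatMap; length)
open import Data.List.Properties using (foldr-++; ∷-injectiveˡ)
open import Data.Maybe.Base using (Maybe; just; nothing)
open import Data.Nat.Base using (ℕ; suc; _+_; _*_; _^_; _≤_; _<_; z≤n)
open import Data.Nat.Binary.Base using (ℕᵇ; zero; 2[1+_]; 1+[2_]; toℕ; fromℕ)
open import Data.Nat.Binary.Properties using (toℕ-fromℕ)
open import Data.Nat.Properties using (≤-refl; ≤-trans)
open import Data.Product.Base using (_×_; _,_; ∃-syntax)
open import Data.Sum.Base using (_⊎_)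
open import Data.Vec.Base as Vec using (Vec; _∷_)
open import Function.Base using (_∘_)
open import Function.Bundles using (_⇔_)
open import Relation.Binary.PropositionalEquality using (_≡_; refl; sym; trans; cong; module ≡-Reasoning)
open import Relation.Nullary.Negation.Core using (¬_)

------------------------------------------------------------------------
-- The logic ABD over homogeneous finite interval models

Letter : Set
Letter = ℕ

infix  30 `_
infixr 25 ¬′_ ⟨A⟩_ ⟨B⟩_ ⟨D⟩_
infixr 20 _∨′_

data Formula : Set where
  `_   : Letter → Formula
  ¬′_  : Formula → Formula
  _∨′_ : Formula → Formula → Formula
  ⟨A⟩_ : Formula → Formula
  ⟨B⟩_ : Formula → Formula
  ⟨D⟩_ : Formula → Formula

record Interval (N : ℕ) : Set where
  constructor [_,_]⟨_,_⟩
  field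
    lo hi : ℕ
    lo≤hi : lo ≤ hi
    hi≤N  : hi ≤ N

open Interval public

point : ∀ {N} z → z ≤ N → Interval N
point z z≤N = [ z , z ]⟨ ≤-refl , z≤N ⟩

whole : ∀ N → Interval N
whole N = [ 0 , N ]⟨ z≤n , ≤-refl ⟩

-- Subsets of Letter are Boolean-valued, so that truth at an interval is
-- decidable and the connectives below have their classical meaning.
record Model : Set where
  field
    N : ℕ
    V : Interval N → Letter → Bool

open Model public

Homogeneous : Model → Set
Homogeneous M = ∀ (p : Letter) (I : Interval (N M)) →
  T (V M I p) ⇔
  (∀ z → lo I ≤ z → (z≤hi : z ≤ hi I) → T (V M (point z (≤-trans z≤hi (hi≤N I))) p))

infix 4 _,_⊨_

_,_⊨_ : (M : Model) → Interval (N M) → Formula → Set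
M , I ⊨ ` p    = T (V M I p)
M , I ⊨ ¬′ φ   = ¬ (M , I ⊨ φ)
M , I ⊨ φ ∨′ ψ = (M , I ⊨ φ) ⊎ (M , I ⊨ ψ)
M , I ⊨ ⟨A⟩ φ  = ∃[ J ] lo J ≡ hi I × (M , J ⊨ φ)
M , I ⊨ ⟨B⟩ φ  = ∃[ J ] lo J ≡ lo I × hi J < hi I × (M , J ⊨ φ)
M , I ⊨ ⟨D⟩ φ  = ∃[ J ] lo I < lo J × hi J < hi I × (M , J ⊨ φ)

Satisfiable : Formula → Set
Satisfiable φ = ∃[ M ] Homogeneous M × (M , whole (N M) ⊨ φ)

------------------------------------------------------------------------
-- Formulas as bit strings: Polish notation, with letters written in
-- (bijective) binary, least significant digit first, and three bits for
-- each of the eight symbols. The size of a formula is the length of its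
-- encoding.

data Token : Set where
  neg or diaA diaB diaD digit1 digit2 end : Token

digits : ℕᵇ → List Token
digits zero     = end ∷ []
digits 1+[2 b ] = digit1 ∷ digits b
digits 2[1+ b ] = digit2 ∷ digits b

tokens : Formula → List Token
tokens (` p)    = digits (fromℕ p)
tokens (¬′ φ)   = neg ∷ tokens φ
tokens (φ ∨′ ψ) = or ∷ tokens φ ++ tokens ψ
tokens (⟨A⟩ φ)  = diaA ∷ tokens φ
tokens (⟨B⟩ φ)  = diaB ∷ tokens φ
tokens (⟨D⟩ φ)  = diaD ∷ tokens φ

bits : Token → List Bool
bits neg    = false ∷ false ∷ false ∷ []
bits or     = false ∷ false ∷ true  ∷ []
bits diaA   = false ∷ true  ∷ false ∷ []
bits diaB   = false ∷ true  ∷ true  ∷ []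
bits diaD   = true  ∷ false ∷ false ∷ []
bits digit1 = true  ∷ false ∷ true  ∷ []
bits digit2 = true  ∷ true  ∷ false ∷ []
bits end    = true  ∷ true  ∷ true  ∷ []

encode : Formula → List Bool
encode = concatMap bits ∘ tokens

-- Distinct formulas have distinct codes.

private
  unbits : List Bool → List Token
  unbits (false ∷ false ∷ false ∷ w) = neg    ∷ unbits w
  unbits (false ∷ false ∷ true  ∷ w) = or     ∷ unbits w
  unbits (false ∷ true  ∷ false ∷ w) = diaA   ∷ unbits w
  unbits (false ∷ true  ∷ true  ∷ w) = diaB   ∷ unbits w
  unbits (true  ∷ false ∷ false ∷ w) = diaD   ∷ unbits w
  unbits (true  ∷ false ∷ true  ∷ w) = digit1 ∷ unbits w
  unbits (true  ∷ true  ∷ false ∷ w) = digit2 ∷ unbits w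
  unbits (true  ∷ true  ∷ true  ∷ w) = end    ∷ unbits w
  unbits _                           = []

  unbits-bits : ∀ ts → unbits (concatMap bits ts) ≡ ts
  unbits-bits []            = refl
  unbits-bits (neg    ∷ ts) = cong (neg    ∷_) (unbits-bits ts)
  unbits-bits (or     ∷ ts) = cong (or     ∷_) (unbits-bits ts)
  unbits-bits (diaA   ∷ ts) = cong (diaA   ∷_) (unbits-bits ts)
  unbits-bits (diaB   ∷ ts) = cong (diaB   ∷_) (unbits-bits ts)
  unbits-bits (diaD   ∷ ts) = cong (diaD   ∷_) (unbits-bits ts)
  unbits-bits (digit1 ∷ ts) = cong (digit1 ∷_) (unbits-bits ts)
  unbits-bits (digit2 ∷ ts) = cong (digit2 ∷_) (unbits-bits ts)
  unbits-bits (end    ∷ ts) = cong (end    ∷_) (unbits-bits ts)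

  -- Polish notation is evaluated from right to left with a stack; a
  -- partially read letter is kept on the stack as a letter.
  push : Token → List Formula → List Formula
  push neg    (φ ∷ s)     = ¬′ φ ∷ s
  push or     (φ ∷ ψ ∷ s) = (φ ∨′ ψ) ∷ s
  push diaA   (φ ∷ s)     = ⟨A⟩ φ ∷ s
  push diaB   (φ ∷ s)     = ⟨B⟩ φ ∷ s
  push diaD   (φ ∷ s)     = ⟨D⟩ φ ∷ s
  push digit1 (` n ∷ s)   = ` suc (2 * n) ∷ s
  push digit2 (` n ∷ s)   = ` (2 * suc n) ∷ s
  push end    s           = ` 0 ∷ s
  push _      s           = s

  push-digits : ∀ b s → foldr push s (digits b) ≡ ` toℕ b ∷ s
  push-digits zero     s = refl
  push-digits 1+[2 b ] s = cong (push digit1) (push-digits b s)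
  push-digits 2[1+ b ] s = cong (push digit2) (push-digits b s)

  push-tokens : ∀ φ s → foldr push s (tokens φ) ≡ φ ∷ s
  push-tokens (` p) s =
    trans (push-digits (fromℕ p) s) (cong (λ n → ` n ∷ s) (toℕ-fromℕ p))
  push-tokens (¬′ φ)   s = cong (push neg) (push-tokens φ s)
  push-tokens (φ ∨′ ψ) s = cong (push or) (begin
    foldr push s (tokens φ ++ tokens ψ)             ≡⟨ foldr-++ push s (tokens φ) (tokens ψ) ⟩
    foldr push (foldr push s (tokens ψ)) (tokens φ) ≡⟨ cong (λ s′ → foldr push s′ (tokens φ)) (push-tokens ψ s) ⟩
    foldr push (ψ ∷ s) (tokens φ)                   ≡⟨ push-tokens φ (ψ ∷ s) ⟩
    φ ∷ ψ ∷ s                                       ∎)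
    where open ≡-Reasoning
  push-tokens (⟨A⟩ φ)  s = cong (push diaA) (push-tokens φ s)
  push-tokens (⟨B⟩ φ)  s = cong (push diaB) (push-tokens φ s)
  push-tokens (⟨D⟩ φ)  s = cong (push diaD) (push-tokens φ s)

  decode : List Bool → List Formula
  decode = foldr push [] ∘ unbits

  decode-encode : ∀ φ → decode (encode φ) ≡ φ ∷ []
  decode-encode φ =
    trans (cong (foldr push []) (unbits-bits (tokens φ))) (push-tokens φ [])

encode-injective : ∀ {φ ψ} → encode φ ≡ encode ψ → φ ≡ ψ
encode-injective {φ} {ψ} eq =
  ∷-injectiveˡ (trans (sym (decode-encode φ)) (trans (cong decode eq) (decode-encode ψ)))

------------------------------------------------------------------------
-- Deterministic multi-tape Turing machines

data Symbol (a : ℕ) : Set where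
  blank : Symbol a
  bit   : Bool → Symbol a
  aux   : Fin a → Symbol a

data Move : Set where
  left stay right : Move

-- The machine halts when δ is undefined.
record Machine : Set where
  field
    extraTapes auxSymbols states : ℕ
    start     : Fin states
    accepting : Fin states → Bool
    δ         : Fin states → Vec (Symbol auxSymbols) (suc extraTapes) →
                Maybe (Fin states × Vec (Symbol auxSymbols × Move) (suc extraTapes))

-- A two-way infinite tape. Cells outside the lists are blank and have
-- never been visited; the cells to the left are listed nearest first.
record Tape (a : ℕ) : Set where
  constructor tape
  field
    before : List (Symbol a)
    head   : Symbol a
    after  : List (Symbol a)

open Tape public

emptyTape : ∀ {a} → Tape a
emptyTape = tape [] blank []

load : ∀ {a} → List Bool → Tape a
load []      = emptyTape
load (b ∷ w) = tape [] (bit b) (map bit w)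

-- Lists are never trimmed, so the number of cells used never decreases.
move : ∀ {a} → Move → Tape a → Tape a
move left  (tape []       s rs)       = tape [] blank (s ∷ rs)
move left  (tape (l ∷ ls) s rs)       = tape ls l (s ∷ rs)
move stay  t                          = t
move right (tape ls       s [])       = tape (s ∷ ls) blank []
move right (tape ls       s (r ∷ rs)) = tape (s ∷ ls) r rs

act : ∀ {a} → Symbol a × Move → Tape a → Tape a
act (s , m) (tape ls _ rs) = move m (tape ls s rs)

cells : ∀ {a} → Tape a → ℕ
cells t = length (before t) + suc (length (after t))

readBits : ∀ {a} → List (Symbol a) → List Bool
readBits (bit b ∷ ss) = b ∷ readBits ss
readBits _            = []

module _ (M : Machine) where
  open Machine M

  Config : Set
  Config = Fin states × Vec (Tape auxSymbols) (suc extraTapes)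

  initial : List Bool → Config
  initial w = start , load w ∷ Vec.replicate extraTapes emptyTape

  step : Config → Maybe Config
  step (q , ts) with δ q (Vec.map head ts)
  ... | nothing        = nothing
  ... | just (q′ , as) = just (q′ , Vec.zipWith act as ts)

  data Run : ℕ → Config → Config → Set where
    done : ∀ {c} → Run 0 c c
    _∷_  : ∀ {n c c′ c″} → step c ≡ just c′ → Run n c′ c″ → Run (suc n) c c″

  HaltsIn : ℕ → List Bool → Config → Set
  HaltsIn n w c = Run n (initial w) c × step c ≡ nothing

  Accepting : Config → Set
  Accepting (q , _) = T (accepting q)

  space : Config → ℕ
  space (_ , ts) = Vec.sum (Vec.map cells ts)

  -- The output is on the first tape, from the head up to the first
  -- non-bit symbol.
  output : Config → List Bool
  output (_ , ts) = readBits (head t ∷ after t)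
    where t = Vec.head ts

------------------------------------------------------------------------
-- Complexity

Language : Set₁
Language = List Bool → Set

-- Coefficients in ascending order of degree.
Polynomial : Set
Polynomial = List ℕ

eval : Polynomial → ℕ → ℕ
eval p n = foldr (λ a r → a + n * r) 0 p

DecidesInSpace : Machine → (ℕ → ℕ) → Language → Set
DecidesInSpace M s L = ∀ w →
  (∃[ n ] ∃[ c ] HaltsIn M n w c × (Accepting M c ⇔ L w)) ×
  (∀ n c → Run M n (initial M w) c → space M c ≤ s (length w))

ComputesInTime : Machine → (ℕ → ℕ) → (List Bool → List Bool) → Set
ComputesInTime M t f = ∀ w →
  ∃[ n ] ∃[ c ] HaltsIn M n w c × n ≤ t (length w) × output M c ≡ f w

InEXPSPACE : Language → Set
InEXPSPACE L = ∃[ M ] ∃[ p ] DecidesInSpace M (λ n → 2 ^ eval p n) L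

PolyTime : (List Bool → List Bool) → Set
PolyTime f = ∃[ M ] ∃[ p ] ComputesInTime M (eval p) f

infix 4 _≤ₚ_

_≤ₚ_ : Language → Language → Set
L ≤ₚ L′ = ∃[ f ] PolyTime f × (∀ w → L w ⇔ L′ (f w))

EXPSPACE-hard : Language → Set₁
EXPSPACE-hard L = ∀ L′ → InEXPSPACE L′ → L′ ≤ₚ L

EXPSPACE-complete : Language → Set₁
EXPSPACE-complete L = InEXPSPACE L × EXPSPACE-hard L

ABDhom-SAT : Language
ABDhom-SAT w = ∃[ φ ] encode φ ≡ w × Satisfiable φ

-- Membership: read a model from right to left, and keep one item for every possible right end: the formulas true at some interval starting
-- there, those true at some interval between the current point and that right end, and the letters that hold throughout. The
-- items determine the truths at the next point. An item is superfluous if sufficiently many nested blocks of other items repeat what lies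
-- between them and it, so states with exponentially many items suffice; reachability between states is decided as in Savitch's theorem.
-- Hardness: a computation in exponential space is a word whose points carry the state, the symbols read and, in binary, the head
-- positions, after a prefix that writes the input cell by cell. The intervals between consecutive visits to the same cell are
-- definable with ⟨B⟩, and the symbol read at the right end must be the one written at the left end.

module Submission where

open import Defs
open import Data.Bool.Base using (Bool; T; _xor_; _∧_; _∨_; false; if_then_else_; not; true)
open import Data.Bool.Properties using (T-∧; T-∨; T?; not-involutive; xor-identityʳ; ∧-inverseʳ)
open import Data.Empty using (⊥; ⊥-elim)
open import Data.Fin using (#_)
open import Data.Fin.Base as Fin using (Fin; suc; zero)
open import Data.Fin.Properties as Fin using (pigeonhole; remQuot-combine; splitAt-join; toℕ-fromℕ<; toℕ-injective; toℕ<n)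
open import Data.List.Base as List using (List; []; _++_; _ʳ++_; _∷_; concatMap; drop; length; map; replicate; reverse)
open import Data.List.Properties using (++-assoc; ++-identityʳ; concatMap-++; drop-drop; length-++; length-map; length-replicate; length-reverse; reverse-involutive)
open import Data.List.Relation.Unary.All as AllL using ([]; _∷_)
open import Data.Maybe.Base as Maybe using (Maybe; fromMaybe; just; maybe; nothing)
open import Data.Maybe.Properties using (just-injective)
open import Data.Nat.Base
open import Data.Nat.Binary.Base using (1+[2_]; 2[1+_]; fromℕ; toℕ; zero; ℕᵇ)
open import Data.Nat.Binary.Properties using (fromℕ-toℕ)
open import Data.Nat.DivMod using (+-distrib-/; [m+kn]%n≡m%n; _%_; _/_; m%n<n; m%n≡m∸m/n*n; m*n%n≡0; m*n/n≡m; m/n*n≤m; m/n≤m; m<n⇒m%n≡m; m<n⇒m/n≡0; m≡m%n+[m/n]*n)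
open import Data.Nat.Induction using (<-wellFounded; Acc; acc)
open import Data.Nat.Properties
open import Data.Nat.Tactic.RingSolver using (solve-∀)
open import Data.Product.Base using (_,_; _×_; map₁; map₂; proj₁; proj₂; uncurry; ∃-syntax)
open import Data.Sum.Base as Sum using ([_,_]′; _⊎_; inj₁; inj₂)
open import Data.Sum.Properties using (inj₁-injective)
open import Data.Unit.Base using (tt; ⊤)
open import Data.Vec.Base as Vec using (Vec; []; _∷_; lookup; updateAt)
open import Data.Vec.Properties using (lookup-map; lookup-replicate; lookup-zipWith; lookup∘update; lookup∘updateAt; lookup∘updateAt′; lookup∘update′; map-cong)
open import Data.Vec.Relation.Binary.Pointwise.Inductive using (Pointwise; []; _∷_)
open import Data.Vec.Relation.Unary.All as AllV using (All; []; _∷_)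
open import Function.Base using (_∘_; case_of_; id)
open import Function.Bundles using (Equivalence; _⇔_; mk⇔)
open import Relation.Binary.Construct.Closure.ReflexiveTransitive using (Star; _◅_; _◅◅_; ε)
open import Relation.Binary.Definitions using (tri<; tri>; tri≈)
open import Relation.Binary.PropositionalEquality
open import Relation.Nullary using (Dec; contradiction; does; no; yes; ¬_)
open import Relation.Nullary.Decidable using (True; _×-dec_; _→-dec_; _⊎-dec_; fromWitness; map′; toWitness; ¬?; ⌊_⌋)

-- The membership argument has to forget right ends, of which a long model has unboundedly many.
-- Nested blocks make an item dispensable at one step; it stays so only if enough blocks are in
-- stock, since a step may ruin up to `n` of them. That happens only when a formula enters `C` at
-- the item for the first time, at most `n` times in all, so polynomially many blocks suffice, and
-- exponentially many items provide them. The step relation itself is never programmed. A state is a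
-- number with exponentially many bits, a step is a bounded arithmetic formula about such numbers,
-- and a general theorem evaluates these formulas on counters stored in binary, hence in exponential
-- space. For hardness, addresses are taken modulo twice the space, so that the cells in use have
-- distinct addresses of polynomially many bits, and the sweep touches every address, so that each
-- symbol read has an earlier visit to be compared with.

infixr 6 _∙_
infixr 5 _≤∙_ _≡∙≤_ _≤∙≡_

_∙_ : ∀ {ℓ} {A : Set ℓ} {x y z : A} → x ≡ y → y ≡ z → x ≡ z
_∙_ = trans

_≤∙_ : ∀ {x y z} → x ≤ y → y ≤ z → x ≤ z
_≤∙_ = ≤-trans

_≡∙≤_ : ∀ {x y z} → x ≡ y → y ≤ z → x ≤ z
e ≡∙≤ le = ≤-trans (≤-reflexive e) le

_≤∙≡_ : ∀ {x y z} → x ≤ y → y ≡ z → x ≤ z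
le ≤∙≡ e = ≤-trans le (≤-reflexive e)

-- Stack programs and their simulation by Turing machines.

data Prog (R : ℕ) : Set where
  push  : Fin R → Bool → Prog R
  pop   : Fin R → Prog R
  skip  : Prog R
  _⨾_   : Prog R → Prog R → Prog R
  cond  : Fin R → (Maybe Bool → Bool) → Prog R → Prog R → Prog R
  while : Fin R → (Maybe Bool → Bool) → Prog R → Prog R

infixr 5 _⨾_

Store : ℕ → Set
Store R = Vec (List Bool) R

top : List Bool → Maybe Bool
top = List.head

-- `Small` constrains the stack heights that a push may create. It becomes `_≤ S` where space is
-- measured and the trivial predicate where only time counts.
module Semantics {R : ℕ} (Small : ℕ → Set) where

  data Exec : Prog R → ℕ → Store R → Store R → Set where
    -- Two machine steps: the machine writes before it moves, so the head first moves left and only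
    -- then writes the new symbol.
    push   : ∀ {i b σ} → Small (suc (length (lookup σ i))) → Exec (push i b) 2 σ (updateAt σ i (b ∷_))
    pop    : ∀ {i σ} → Exec (pop i) 1 σ (updateAt σ i (drop 1))
    skip   : ∀ {σ} → Exec skip 1 σ σ
    _⨾_    : ∀ {P Q s t σ σ' σ''} → Exec P s σ σ' → Exec Q t σ' σ'' → Exec (P ⨾ Q) (s + t) σ σ''
    then   : ∀ {i c P Q t σ σ'} → c (top (lookup σ i)) ≡ true →
             Exec P t σ σ' → Exec (cond i c P Q) (suc t) σ σ'
    else   : ∀ {i c P Q t σ σ'} → c (top (lookup σ i)) ≡ false →
             Exec Q t σ σ' → Exec (cond i c P Q) (suc t) σ σ'
    stop   : ∀ {i c P σ} → c (top (lookup σ i)) ≡ false → Exec (while i c P) 1 σ σ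
    repeat : ∀ {i c P s t σ σ' σ''} → c (top (lookup σ i)) ≡ true →
             Exec P s σ σ' → Exec (while i c P) t σ' σ'' → Exec (while i c P) (suc (s + t)) σ σ''

-- Control points of a program; they become the states of a Turing machine.
Loc : ∀ {R} → Prog R → Set
Loc (push i b)     = Bool
Loc (pop i)        = ⊤
Loc skip           = ⊤
Loc (P ⨾ Q)        = Loc P ⊎ Loc Q
Loc (cond i c P Q) = Maybe (Loc P ⊎ Loc Q)
Loc (while i c P)  = Maybe (Loc P)

entry : ∀ {R} (P : Prog R) → Loc P
entry (push i b)     = false
entry (pop i)        = tt
entry skip           = tt
entry (P ⨾ Q)        = inj₁ (entry P)
entry (cond i c P Q) = nothing
entry (while i c P)  = nothing

readTop : Symbol 0 → Maybe Bool
readTop blank   = nothing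
readTop (bit b) = just b

idle : ∀ {R} → Vec (Symbol 0) R → Vec (Symbol 0 × Move) R
idle = Vec.map (_, stay)

at : ∀ {R} → Fin R → (Symbol 0 → Symbol 0 × Move) → Vec (Symbol 0) R → Vec (Symbol 0 × Move) R
at i f h = updateAt (idle h) i (f ∘ proj₁)

-- A pop erases the cell before leaving it, so that everything to the left of the head stays blank.
-- On an empty stack the head does not move.
popAct : Symbol 0 → Symbol 0 × Move
popAct blank   = blank , stay
popAct (bit b) = blank , right

-- The exit of a program is represented by nothing.
trans' : ∀ {R} (P : Prog R) → Loc P → Vec (Symbol 0) R → Maybe (Loc P) × Vec (Symbol 0 × Move) R
trans' (push i b) false h = just true , at i (_, left) h
trans' (push i b) true h = nothing , at i (λ _ → bit b , stay) h
trans' (pop i) tt h = nothing , at i popAct h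
trans' skip tt h = nothing , idle h
trans' (P ⨾ Q) (inj₁ l) h = map₁ (maybe (just ∘ inj₁) (just (inj₂ (entry Q)))) (trans' P l h)
trans' (P ⨾ Q) (inj₂ l) h = map₁ (maybe (just ∘ inj₂) nothing) (trans' Q l h)
trans' (cond i c P Q) nothing h =
  just (just (if c (readTop (lookup h i)) then inj₁ (entry P) else inj₂ (entry Q))) , idle h
trans' (cond i c P Q) (just (inj₁ l)) h = map₁ (maybe (just ∘ just ∘ inj₁) nothing) (trans' P l h)
trans' (cond i c P Q) (just (inj₂ l)) h = map₁ (maybe (just ∘ just ∘ inj₂) nothing) (trans' Q l h)
trans' (while i c P) nothing h = (if c (readTop (lookup h i)) then just (just (entry P)) else nothing) , idle h
trans' (while i c P) (just l) h = map₁ (maybe (just ∘ just) (just nothing)) (trans' P l h)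

Tapes : ℕ → Set
Tapes R = Vec (Tape 0) R

advance : ∀ {R} {L : Set} → L × Vec (Symbol 0 × Move) R → Tapes R → L × Tapes R
advance (l , as) ts = l , Vec.zipWith act as ts

module Simulation {R : ℕ} (Small : ℕ → Set) where

  open Semantics {R} Small

  -- One cell more than the stack height is allowed: popping the last symbol moves the head onto the
  -- blank cell behind the bottom.
  Fits : Tape 0 → Set
  Fits t = ∃[ s ] Small s × cells t ≤ suc s

  data Path (P : Prog R) : ℕ → Maybe (Loc P) × Tapes R → Maybe (Loc P) × Tapes R → Set where
    done : ∀ {c} → Path P 0 c c
    next : ∀ {n l ts c} → All Fits ts → Path P n (advance (trans' P l (Vec.map head ts)) ts) c →
           Path P (suc n) (just l , ts) c

  -- Runs a component inside a larger program: `f` places its control points and `g` is where its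
  -- exit leads, for instance the test of a loop or the entry of the next component.
  embed : ∀ {P P' n m l ts ts' c} (f : Loc P → Loc P') (g : Maybe (Loc P')) →
          (∀ l h → trans' P' (f l) h ≡ map₁ (maybe (just ∘ f) g) (trans' P l h)) →
          Path P n (just l , ts) (nothing , ts') → Path P' m (g , ts') c →
          Path P' (n + m) (just (f l) , ts) c
  embed {P} {P'} {m = m} {l = l} {ts} {ts'} {c = c} f g eq (next {n = n} fit p) q = next fit (subst (λ z → Path P' (n + m) (advance z ts) c) (sym (eq l (Vec.map head ts))) (rest p))
    where
    rest : ∀ {l⁺ n ts} → Path P n (l⁺ , ts) (nothing , ts') → Path P' (n + m) (maybe (just ∘ f) g l⁺ , ts) c
    rest {nothing} done = q
    rest {just l} p@(next _ _)    = embed f g eq p q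

  -- The head is on the top of the stack and the bottom lies to the right. The `b` blank cells on
  -- the left were vacated by pops, `c` records the blank cell that exists behind the bottom once
  -- the stack has been empty, and `s` bounds the height reached so far.
  data Holds : List Bool → Tape 0 → Set where
    empty : ∀ {b s} → b ≤ s → Small s → Holds [] (tape (replicate b blank) blank [])
    full  : ∀ {b s c x xs} → b + suc (length xs) ≤ s → Small s → c ≤ 1 →
            Holds (x ∷ xs) (tape (replicate b blank) (bit x) (List.map bit xs ++ replicate c blank))

  Represents : Store R → Tapes R → Set
  Represents = Pointwise Holds

  length-content : ∀ (xs : List Bool) c → length (List.map (bit {0}) xs ++ replicate c blank) ≡ length xs + c
  length-content xs c = length-++ (List.map bit xs) ∙ cong₂ _+_ (length-map bit xs) (length-replicate c)

  fits : ∀ {xs t} → Holds xs t → Fits t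
  fits (empty {b} {s} b≤s small) = s , small , (cong (_+ 1) (length-replicate b) ≡∙≤ +-comm b 1 ≡∙≤ s≤s b≤s)
  fits (full {b} {s} {c} {x} {xs} le small c≤1) = s , small , (begin
    length (replicate b (blank {0})) + suc (length (List.map (bit {0}) xs ++ replicate c blank))
      ≡⟨ cong₂ (λ m n → m + suc n) (length-replicate b) (length-content xs c) ⟩
    b + (suc (length xs) + c) ≡⟨ +-assoc b _ c ⟨
    b + suc (length xs) + c ≤⟨ +-mono-≤ le c≤1 ⟩
    s + 1 ≡⟨ +-comm s 1 ⟩
    suc s ∎)
    where open ≤-Reasoning

  pop-holds : ∀ {xs t} → Holds xs t → Holds (drop 1 xs) (act (popAct (head t)) t)
  pop-holds (empty b≤s small) = empty b≤s small
  pop-holds (full {b} {s} {zero} {x} {[]} le small c≤1) = empty (subst (_≤ s) (+-comm b 1) le) small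
  pop-holds (full {b} {s} {suc zero} {x} {[]} le small c≤1) = empty (subst (_≤ s) (+-comm b 1) le) small
  pop-holds (full {c = suc (suc _)} {xs = []} le small (s≤s ()))
  pop-holds (full {b} {s} {c} {x} {y ∷ ys} le small c≤1) = full (subst (_≤ s) (+-suc b _) le) small c≤1

  -- Between the two steps of a push the head is on a blank cell above the stack, a situation that
  -- `Holds` does not cover; only the size matters there. A new cell is created only if `b` is 0,
  -- and then the smallness of the new height pays for it.
  push-holds₁ : ∀ {xs t} → Holds xs t → Small (suc (length xs)) → Fits (act (head t , left) t)
  push-holds₁ (empty {zero} b≤s small) sm = 1 , sm , ≤-refl
  push-holds₁ (empty {suc b} {s} b≤s small) sm = s , small , (cong (_+ 2) (length-replicate b) ≡∙≤ +-comm b 2 ≡∙≤ s≤s b≤s)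
  push-holds₁ (full {zero} {s} {c} {x} {xs} le small c≤1) sm = _ , sm , s≤s (s≤s (length-content xs c ≡∙≤ +-monoʳ-≤ (length xs) c≤1 ≤∙≡ +-comm _ 1))
  push-holds₁ (full {suc b} {s} {c} {x} {xs} le small c≤1) sm =
    subst (λ n → ∃[ s ] Small s × n ≤ suc s) (sym (+-suc (length (replicate b blank)) (suc (length (List.map bit xs ++ replicate c blank)))))
      (fits (full {suc b} {c = c} {x = x} {xs} le small c≤1))

  push-holds : ∀ {xs t} b → Holds xs t → Small (suc (length xs)) →
               Holds (b ∷ xs) (act (bit b , stay) (act (head t , left) t))
  push-holds b (empty {zero} b≤s small) sm = full {0} {c = 1} ≤-refl sm ≤-refl
  push-holds b (empty {suc n} {s} b≤s small) sm = full {n} {c = 1} (subst (_≤ s) (+-comm 1 n) b≤s) small ≤-refl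
  push-holds b (full {zero} le small c≤1) sm = full {0} ≤-refl sm c≤1
  push-holds b (full {suc n} {s} {xs = xs} le small c≤1) sm = full {n} (subst (_≤ s) (sym (+-suc n _)) le) small c≤1

  zipWith-idle : ∀ {n} (ts : Vec (Tape 0) n) → Vec.zipWith act (idle (Vec.map head ts)) ts ≡ ts
  zipWith-idle []       = refl
  zipWith-idle (t ∷ ts) = cong (t ∷_) (zipWith-idle ts)

  zipWith-at : ∀ {n} (ts : Vec (Tape 0) n) i f →
               Vec.zipWith act (at i f (Vec.map head ts)) ts ≡ updateAt ts i (λ t → act (f (head t)) t)
  zipWith-at (t ∷ ts) zero f = cong (act (f (head t)) t ∷_) (zipWith-idle ts)
  zipWith-at (t ∷ ts) (suc i) f = cong (t ∷_) (zipWith-at ts i f)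

  pointwise-updateAt : ∀ {A B : Set} {_~_ : A → B → Set} {n} {xs : Vec A n} {ys : Vec B n} {f g} i →
                       Pointwise _~_ xs ys → (lookup xs i ~ lookup ys i → f (lookup xs i) ~ g (lookup ys i)) →
                       Pointwise _~_ (updateAt xs i f) (updateAt ys i g)
  pointwise-updateAt zero (r ∷ rs) k = k r ∷ rs
  pointwise-updateAt (suc i) (r ∷ rs) k = r ∷ pointwise-updateAt i rs k

  fits-all : ∀ {n} {σ : Store n} {ts : Vec (Tape 0) n} → Pointwise Holds σ ts → All Fits ts
  fits-all []       = []
  fits-all (h ∷ hs) = fits h ∷ fits-all hs

  fits-updateAt : ∀ {n} {σ : Store n} {ts : Vec (Tape 0) n} {f} i → Pointwise Holds σ ts →
                  (Holds (lookup σ i) (lookup ts i) → Fits (f (lookup ts i))) → All Fits (updateAt ts i f)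
  fits-updateAt zero (h ∷ hs) k = k h ∷ fits-all hs
  fits-updateAt (suc i) (h ∷ hs) k = fits h ∷ fits-updateAt i hs k

  updateAt-twice : ∀ {A : Set} {n} (ts : Vec A n) i (f g : A → A) → updateAt (updateAt ts i f) i g ≡ updateAt ts i (g ∘ f)
  updateAt-twice (t ∷ ts) zero f g = refl
  updateAt-twice (t ∷ ts) (suc i) f g = cong (t ∷_) (updateAt-twice ts i f g)

  readTop-head : ∀ {n} {σ : Store n} {ts : Vec (Tape 0) n} i → Pointwise Holds σ ts →
                 readTop (lookup (Vec.map head ts) i) ≡ top (lookup σ i)
  readTop-head zero (empty _ _ ∷ hs)    = refl
  readTop-head zero (full _ _ _ ∷ hs) = refl
  readTop-head (suc i) (h ∷ hs) = readTop-head i hs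

  one : ∀ {P l l' as ts ts'} → All Fits ts → trans' P l (Vec.map head ts) ≡ (l' , as) →
        Vec.zipWith act as ts ≡ ts' → Path P 1 (just l , ts) (l' , ts')
  one {P} fit eq refl = next fit (subst (λ z → Path P 0 (advance z _) _) (sym eq) done)

  next' : ∀ {P n l l' as ts ts' c} → All Fits ts → trans' P l (Vec.map head ts) ≡ (l' , as) →
          Vec.zipWith act as ts ≡ ts' → Path P n (l' , ts') c → Path P (suc n) (just l , ts) c
  next' {P} {n} {c = c} fit eq refl p = next fit (subst (λ z → Path P n (advance z _) c) (sym eq) p)

  simulate : ∀ {P t σ σ' ts} → Exec P t σ σ' → Represents σ ts →
             ∃[ ts' ] Represents σ' ts' × Path P t (just (entry P) , ts) (nothing , ts')
  simulate {push i b} {σ = σ} {ts = ts} (push sm) r =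
    _ ,
    pointwise-updateAt i r (λ h → push-holds b h sm) ,
    next' (fits-all r) refl (zipWith-at ts i (_, left))
      (one (fits-updateAt i r (λ h → push-holds₁ h sm)) refl
        (zipWith-at (updateAt ts i _) i (λ _ → bit b , stay) ∙ updateAt-twice ts i _ _))
  simulate {pop i} {ts = ts} pop r = _ , pointwise-updateAt i r pop-holds , one (fits-all r) refl (zipWith-at ts i popAct)
  simulate {skip} {ts = ts} skip r = _ , r , one (fits-all r) refl (zipWith-idle ts)
  simulate {P ⨾ Q} (e ⨾ f) r with simulate e r
  ... | ts' , r' , p with simulate f r'
  ... | ts'' , r'' , q = ts'' , r'' ,
    embed inj₁ (just (inj₂ (entry Q))) (λ _ _ → refl) p
      (subst (λ n → Path (P ⨾ Q) n _ _) (+-identityʳ _) (embed inj₂ nothing (λ _ _ → refl) q done))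
  simulate {cond i c P Q} {ts = ts} (then eq e) r with simulate e r
  ... | ts' , r' , p = ts' , r' ,
    next' (fits-all r)
      (cong (λ z → just (just (if z then inj₁ (entry P) else inj₂ (entry Q))) , idle (Vec.map head ts)) (cong c (readTop-head i r) ∙ eq))
      (zipWith-idle ts)
      (subst (λ n → Path (cond i c P Q) n _ _) (+-identityʳ _) (embed (just ∘ inj₁) nothing (λ _ _ → refl) p done))
  simulate {cond i c P Q} {ts = ts} (else eq e) r with simulate e r
  ... | ts' , r' , p = ts' , r' ,
    next' (fits-all r)
      (cong (λ z → just (just (if z then inj₁ (entry P) else inj₂ (entry Q))) , idle (Vec.map head ts)) (cong c (readTop-head i r) ∙ eq))
      (zipWith-idle ts)
      (subst (λ n → Path (cond i c P Q) n _ _) (+-identityʳ _) (embed (just ∘ inj₂) nothing (λ _ _ → refl) p done))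
  simulate {while i c P} {ts = ts} (stop eq) r = ts , r ,
    one (fits-all r)
      (cong (λ z → (if z then just (just (entry P)) else nothing) , idle (Vec.map head ts)) (cong c (readTop-head i r) ∙ eq))
      (zipWith-idle ts)
  simulate {while i c P} {ts = ts} (repeat eq e f) r with simulate e r
  ... | ts' , r' , p with simulate f r'
  ... | ts'' , r'' , q = ts'' , r'' ,
    next' (fits-all r)
      (cong (λ z → (if z then just (just (entry P)) else nothing) , idle (Vec.map head ts)) (cong c (readTop-head i r) ∙ eq))
      (zipWith-idle ts)
      (embed just (just nothing) (λ _ _ → refl) p q)

-- A retraction onto `A` is enough for naming control points and labels by numbers; numbers outside
-- the image of `index` may denote anything.
record Finite (A : Set) : Set where
  field
    card    : ℕ
    index     : A → Fin card
    element     : Fin card → A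
    element-index : ∀ x → element (index x) ≡ x

open Finite

finite-⊤ : Finite ⊤
finite-⊤ = record { card = 1 ; index = λ _ → zero ; element = λ _ → tt ; element-index = λ _ → refl }

finite-Bool : Finite Bool
finite-Bool = record
  { card = 2 ; index = λ { false → zero ; true → suc zero } ; element = λ { zero → false ; (suc zero) → true }
  ; element-index = λ { false → refl ; true → refl } }

finite-⊎ : ∀ {A B} → Finite A → Finite B → Finite (A ⊎ B)
finite-⊎ {A} {B} F G = record
  { card = card F + card G ; index = index' ; element = element' ; element-index = element-index' }
  where
  index' : A ⊎ B → Fin (card F + card G)
  index' (inj₁ x) = Fin.join (card F) (card G) (inj₁ (index F x))
  index' (inj₂ y) = Fin.join (card F) (card G) (inj₂ (index G y))
  back : Fin (card F) ⊎ Fin (card G) → A ⊎ B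
  back (inj₁ i) = inj₁ (element F i)
  back (inj₂ i) = inj₂ (element G i)
  element' : Fin (card F + card G) → A ⊎ B
  element' i = back (Fin.splitAt (card F) i)
  element-index' : ∀ x → element' (index' x) ≡ x
  element-index' (inj₁ x) = cong back (splitAt-join (card F) (card G) (inj₁ (index F x))) ∙ cong inj₁ (element-index F x)
  element-index' (inj₂ y) = cong back (splitAt-join (card F) (card G) (inj₂ (index G y))) ∙ cong inj₂ (element-index G y)

finite-Maybe : ∀ {A} → Finite A → Finite (Maybe A)
finite-Maybe F = record
  { card = suc (card F) ; index = λ { nothing → zero ; (just x) → suc (index F x) }
  ; element = λ { zero → nothing ; (suc i) → just (element F i) }
  ; element-index = λ { nothing → refl ; (just x) → cong just (element-index F x) } }

finite-Loc : ∀ {R} (P : Prog R) → Finite (Loc P)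
finite-Loc (push i b)     = finite-Bool
finite-Loc (pop i)        = finite-⊤
finite-Loc skip           = finite-⊤
finite-Loc (P ⨾ Q)        = finite-⊎ (finite-Loc P) (finite-Loc Q)
finite-Loc (cond i c P Q) = finite-Maybe (finite-⊎ (finite-Loc P) (finite-Loc Q))
finite-Loc (while i c P)  = finite-Maybe (finite-Loc P)

nonempty : Maybe Bool → Bool
nonempty (just _) = true
nonempty nothing  = false

module _ {k : ℕ} (P : Prog (suc k)) where

  -- The running program, the state after its exit, in which the first stack is tested for emptiness, and the two verdicts.
  Control : Set
  Control = Loc P ⊎ Maybe Bool

  finite-Control : Finite Control
  finite-Control = finite-⊎ (finite-Loc P) (finite-Maybe finite-Bool)

  stateCode : Control → Fin (card finite-Control)
  stateCode = index finite-Control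

  δ' : Control → Vec (Symbol 0) (suc k) → Maybe (Fin (card finite-Control) × Vec (Symbol 0 × Move) (suc k))
  δ' (inj₁ l) h = just (map₁ (stateCode ∘ maybe inj₁ (inj₂ nothing)) (trans' P l h))
  δ' (inj₂ nothing) h = just (stateCode (inj₂ (just (nonempty (readTop (Vec.head h))))) , idle h)
  δ' (inj₂ (just b)) h = nothing

  verdict : Control → Bool
  verdict (inj₂ (just b)) = b
  verdict _               = false

  machine : Machine
  machine = record
    { extraTapes = k ; auxSymbols = 0 ; states = card finite-Control
    ; start = stateCode (inj₁ (entry P)) ; accepting = verdict ∘ element finite-Control ; δ = δ' ∘ element finite-Control }

  step-stateCode : ∀ s ts → step machine (stateCode s , ts) ≡
              Maybe.map (λ { (q , as) → q , Vec.zipWith act as ts }) (δ' s (Vec.map head ts))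
  step-stateCode s ts rewrite element-index finite-Control s with δ' s (Vec.map head ts)
  ... | nothing      = refl
  ... | just (q , a) = refl

  module _ (Small : ℕ → Set) where

    open Semantics {suc k} Small
    open Simulation {suc k} Small

    data FitRun : ℕ → Config machine → Config machine → Set where
      done : ∀ {q ts} → All Fits ts → FitRun 0 (q , ts) (q , ts)
      next : ∀ {n q ts c c'} → All Fits ts → step machine (q , ts) ≡ just c → FitRun n c c' → FitRun (suc n) (q , ts) c'

    toRun : ∀ {n c c'} → FitRun n c c' → Run machine n c c'
    toRun (done _)     = done
    toRun (next _ s r) = s ∷ toRun r

    -- Since the machine is deterministic, a halting run contains every reachable configuration.
    fits-reachable : ∀ {n m c c' q ts} → FitRun n c c' → step machine c' ≡ nothing → Run machine m c (q , ts) → All Fits ts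
    fits-reachable (done f) h done    = f
    fits-reachable (next f s r) h done    = f
    fits-reachable (done f) h (s' ∷ r') with () ← trans (sym h) s'
    fits-reachable (next f s r) h (s' ∷ r') with refl ← trans (sym s) s' = fits-reachable r h r'

    control : Maybe (Loc P) → Control
    control = maybe inj₁ (inj₂ nothing)

    fitRun-path : ∀ {n m l ts ts' c} → Path P n (l , ts) (nothing , ts') → FitRun m (stateCode (inj₂ nothing) , ts') c →
                  FitRun (n + m) (stateCode (control l) , ts) c
    fitRun-path done r = r
    fitRun-path (next {l = l} {ts} fit p) r = next fit (step-stateCode (inj₁ l) ts) (fitRun-path p r)

    readTop-first : ∀ {σ : Store (suc k)} {ts : Tapes (suc k)} → Represents σ ts →
                    nonempty (readTop (Vec.head (Vec.map head ts))) ≡ nonempty (top (Vec.head σ))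
    readTop-first (empty _ _ ∷ _) = refl
    readTop-first (full _ _ _ ∷ _) = refl

    run : ∀ {t σ σ' ts} → Exec P t σ σ' → Represents σ ts → ∃[ ts' ] Represents σ' ts' ×
          FitRun (t + 1) (stateCode (inj₁ (entry P)) , ts) (stateCode (inj₂ (just (nonempty (top (Vec.head σ'))))) , ts')
    run {σ' = σ'} e r with simulate e r
    ... | ts' , r' , p = ts' , r' , fitRun-path p
      (next (fits-all r')
        (step-stateCode (inj₂ nothing) ts' ∙ cong just (cong₂ (λ b ts → stateCode (inj₂ (just b)) , ts) (readTop-first r') (zipWith-idle ts')))
        (done (fits-all r')))

    halted : ∀ b ts → step machine (stateCode (inj₂ (just b)) , ts) ≡ nothing
    halted b ts = step-stateCode (inj₂ (just b)) ts

    load-holds : ∀ w → Small (length w) → Holds w (load w)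
    load-holds [] sm = empty z≤n sm
    load-holds (b ∷ w) sm =
      subst (λ rs → Holds (b ∷ w) (tape [] (bit b) rs)) (++-identityʳ _) (full {0} {c = 0} ≤-refl sm z≤n)

    empty-holds : ∀ n → Small 0 → Pointwise Holds (Vec.replicate n []) (Vec.replicate n emptyTape)
    empty-holds zero sm = []
    empty-holds (suc n) sm = empty {0} z≤n sm ∷ empty-holds n sm

    initial-represents : ∀ w → Small (length w) → Small 0 → Represents (w ∷ Vec.replicate k []) (proj₂ (initial machine w))
    initial-represents w sm sm₀ = load-holds w sm ∷ empty-holds k sm₀

    verdict-stateCode : ∀ b → verdict (element finite-Control (stateCode (inj₂ (just b)))) ≡ b
    verdict-stateCode b rewrite element-index finite-Control (inj₂ (just b)) = refl

  read-holds : ∀ {Small xs t} → Simulation.Holds {suc k} Small xs t → readBits (head t ∷ after t) ≡ xs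
  read-holds (Simulation.empty _ _)    = refl
  read-holds (Simulation.full {c = c} {x = x} {xs} _ _ _) = cong (x ∷_) (go xs c)
    where
    go : ∀ xs c → readBits (List.map bit xs ++ replicate c (blank {0})) ≡ xs
    go [] zero    = refl
    go [] (suc c) = refl
    go (x ∷ xs) c       = cong (x ∷_) (go xs c)

  computes : ∀ {t w o σ} → Semantics.Exec {suc k} (λ _ → ⊤) P t (w ∷ Vec.replicate k []) (o ∷ σ) →
             ∃[ n ] ∃[ c ] HaltsIn machine n w c × n ≤ t + 1 × output machine c ≡ o
  computes {w = w} e with run (λ _ → ⊤) e (initial-represents (λ _ → ⊤) w tt tt)
  ... | ts' , (h ∷ _) , r = _ , _ , (toRun (λ _ → ⊤) r , halted (λ _ → ⊤) _ ts') , ≤-refl , read-holds h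

  sum-cells : ∀ {S n} (ts : Vec (Tape 0) n) → All (Simulation.Fits {suc k} (_≤ S)) ts → Vec.sum (Vec.map cells ts) ≤ n * suc S
  sum-cells [] []                 = z≤n
  sum-cells (t ∷ ts) ((s , s≤S , c≤s) ∷ fs) = +-mono-≤ (c≤s ≤∙ s≤s s≤S) (sum-cells ts fs)

  decides : ∀ {t w S σ} → length w ≤ S → Semantics.Exec {suc k} (_≤ S) P t (w ∷ Vec.replicate k []) σ →
            (∃[ n ] ∃[ c ] HaltsIn machine n w c × (Accepting machine c ⇔ T (nonempty (top (Vec.head σ))))) ×
            (∀ n c → Run machine n (initial machine w) c → space machine c ≤ suc k * suc S)
  decides {w = w} {S} le e with run (_≤ S) e (initial-represents (_≤ S) w le z≤n)
  ... | ts' , _ , r =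
    (_ , _ , (toRun (_≤ S) r , halted (_≤ S) _ ts') , mk⇔ (subst T (verdict-stateCode (_≤ S) _)) (subst T (sym (verdict-stateCode (_≤ S) _)))) ,
    λ n c r' → sum-cells (proj₂ c) (fits-reachable (_≤ S) r (halted (_≤ S) _ ts') r')

-- Counter programs on stacks that hold binary numerals.

data NProg : Set where
  inc dec : ℕ → NProg
  noop    : NProg
  _⨾_     : NProg → NProg → NProg
  loop    : ℕ → NProg → NProg

-- Register contents are functions and are only ever compared pointwise, so each rule below admits
-- as final contents every function with the right values.
Regs : Set
Regs = ℕ → ℕ

-- m bounds every value that occurs.
data NExec (m : ℕ) : NProg → Regs → Regs → Set where
  inc  : ∀ {i σ σ'} → suc (σ i) ≤ m → σ' i ≡ suc (σ i) → (∀ j → j ≢ i → σ' j ≡ σ j) → NExec m (inc i) σ σ'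
  dec  : ∀ {i σ σ'} → σ' i ≡ pred (σ i) → (∀ j → j ≢ i → σ' j ≡ σ j) → NExec m (dec i) σ σ'
  noop : ∀ {σ σ'} → (∀ j → σ' j ≡ σ j) → NExec m noop σ σ'
  _⨾_  : ∀ {P Q σ σ' σ''} → NExec m P σ σ' → NExec m Q σ' σ'' → NExec m (P ⨾ Q) σ σ''
  stop : ∀ {i P σ σ'} → σ i ≡ 0 → (∀ j → σ' j ≡ σ j) → NExec m (loop i P) σ σ'
  iter : ∀ {i P σ σ' σ''} → σ i ≢ 0 → NExec m P σ σ' → NExec m (loop i P) σ' σ'' → NExec m (loop i P) σ σ''

-- Bijective binary numerals, least significant digit first; false is the digit 1 and true the digit 2.
sucᵈ : List Bool → List Bool
sucᵈ []          = false ∷ []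
sucᵈ (false ∷ w) = true ∷ w
sucᵈ (true ∷ w)  = false ∷ sucᵈ w

numeral : ℕ → List Bool
numeral zero    = []
numeral (suc n) = sucᵈ (numeral n)

value : List Bool → ℕ
value []          = 0
value (false ∷ w) = suc (2 * value w)
value (true ∷ w)  = suc (suc (2 * value w))

value-suc : ∀ w → value (sucᵈ w) ≡ suc (value w)
value-suc []          = refl
value-suc (false ∷ w) = refl
value-suc (true ∷ w)  = cong suc (cong (2 *_) (value-suc w) ∙ solve-dbl (value w))
  where
  solve-dbl : ∀ n → 2 * suc n ≡ suc (suc (2 * n))
  solve-dbl = solve-∀

value-numeral : ∀ n → value (numeral n) ≡ n
value-numeral zero    = refl
value-numeral (suc n) = value-suc (numeral n) ∙ cong suc (value-numeral n)

numeral-double : ∀ n → numeral (suc (2 * n)) ≡ false ∷ numeral n × numeral (suc (suc (2 * n))) ≡ true ∷ numeral n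
numeral-double zero    = refl , refl
numeral-double (suc n) rewrite +-suc n (n + 0) | proj₂ (numeral-double n) = refl , refl

numeral-value : ∀ w → numeral (value w) ≡ w
numeral-value []          = refl
numeral-value (false ∷ w) = proj₁ (numeral-double (value w)) ∙ cong (false ∷_) (numeral-value w)
numeral-value (true ∷ w)  = proj₂ (numeral-double (value w)) ∙ cong (true ∷_) (numeral-value w)

-- Numerals have logarithmic length. This turns bounds on values into bounds on stack heights.
length-value : ∀ w → 2 ^ length w ≤ suc (value w)
length-value []      = ≤-refl
length-value (b ∷ w) = *-monoʳ-≤ 2 (length-value w) ≤∙ digit b
  where
  dbl : ∀ n → 2 * suc n ≡ suc (suc (2 * n))
  dbl = solve-∀
  digit : ∀ b → 2 * suc (value w) ≤ suc (value (b ∷ w))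
  digit false = ≤-reflexive (dbl (value w))
  digit true  = dbl (value w) ≡∙≤ n≤1+n _

pushes : Bool → ℕ → List Bool → List Bool
pushes b zero w = w
pushes b (suc n) w = pushes b n (b ∷ w)

pushes-∷ : ∀ b n w → pushes b n (b ∷ w) ≡ b ∷ pushes b n w
pushes-∷ b zero w = refl
pushes-∷ b (suc n) w = pushes-∷ b n (b ∷ w)

length-pushes : ∀ b n w → length (pushes b n w) ≡ n + length w
length-pushes b zero w = refl
length-pushes b (suc n) w = length-pushes b n (b ∷ w) ∙ +-suc n (length w)

run-length : Bool → List Bool → ℕ
run-length true (true ∷ w)  = suc (run-length true w)
run-length false (false ∷ w) = suc (run-length false w)
run-length _ _           = 0

after-run : Bool → List Bool → List Bool
after-run true (true ∷ w)  = after-run true w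
after-run false (false ∷ w) = after-run false w
after-run _ w           = w

bump : List Bool → List Bool
bump []      = false ∷ []
bump (_ ∷ w) = true ∷ w

-- A carry turns the leading 2s into 1s and raises the digit behind them, or appends a 1 if there is
-- none. In this form two stacks can perform it.
sucᵈ-run : ∀ w → pushes false (run-length true w) (bump (after-run true w)) ≡ sucᵈ w
sucᵈ-run []          = refl
sucᵈ-run (false ∷ w) = refl
sucᵈ-run (true ∷ w)  = pushes-∷ false (run-length true w) _ ∙ cong (false ∷_) (sucᵈ-run w)

lower : List Bool → ℕ → List Bool
lower [] a = pushes true (pred a) []
lower (_ ∷ w) a = pushes true a (false ∷ w)

-- Borrowing reverses the carry: leading 1s become 2s and the 2 behind them becomes a 1. Without
-- such a digit the numeral gets shorter, whence `pred a` in `lower`.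
predᵈ-run : ∀ w → lower (after-run false (sucᵈ w)) (run-length false (sucᵈ w)) ≡ w
predᵈ-run []          = refl
predᵈ-run (false ∷ w) = refl
predᵈ-run (true ∷ w)  = shift (sucᵈ w) (positive w) ∙ cong (true ∷_) (predᵈ-run w)
  where
  positive : ∀ w → after-run false (sucᵈ w) ≡ [] → run-length false (sucᵈ w) ≢ 0
  positive [] _ ()
  positive (false ∷ w) ()
  positive (true ∷ w) _ ()
  shift : ∀ v → (after-run false v ≡ [] → run-length false v ≢ 0) →
          lower (after-run false v) (suc (run-length false v)) ≡ true ∷ lower (after-run false v) (run-length false v)
  shift v pos with after-run false v | run-length false v
  ... | [] | zero  = ⊥-elim (pos refl refl)
  ... | [] | suc a = pushes-∷ true a []
  ... | x ∷ u | a     = pushes-∷ true a (false ∷ u)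

isDigit : Bool → Maybe Bool → Bool
isDigit true (just b) = b
isDigit false (just b) = not b
isDigit _ nothing  = false

module _ {R : ℕ} (u : Fin R) where

  -- The scratch stack merely counts the digits of the run; `restore` decides which digit replaces
  -- them.
  transfer : Bool → Fin R → Prog R
  transfer b r = while r (isDigit b) (pop r ⨾ push u (not b))

  restore : Bool → Fin R → Prog R
  restore b r = while u nonempty (pop u ⨾ push r b)

  incᵖ : Fin R → Prog R
  incᵖ r = transfer true r ⨾ cond r nonempty (pop r ⨾ push r true) (push r false) ⨾ restore false r

  decᵖ : Fin R → Prog R
  decᵖ r = transfer false r ⨾ cond r nonempty (pop r ⨾ push r false) (pop u) ⨾ restore true r

module Binary {R : ℕ} (S : ℕ) (u : Fin R) where

  open Semantics {R} (_≤ S)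

  Effect : Prog R → Fin R → Store R → List Bool → List Bool → Set
  Effect P r σ x y = ∃[ t ] ∃[ σ' ] Exec P t σ σ' × lookup σ' r ≡ x × lookup σ' u ≡ y ×
    (∀ j → j ≢ r → j ≢ u → lookup σ' j ≡ lookup σ j)

  module _ (r : Fin R) (r≢u : r ≢ u) where

    seq : ∀ {P Q σ x y z w} → Effect P r σ x y →
          (∀ {σ'} → lookup σ' r ≡ x → lookup σ' u ≡ y → Effect Q r σ' z w) → Effect (P ⨾ Q) r σ z w
    seq (_ , _ , e , p , q , o) k with k p q
    ... | _ , _ , e' , p' , q' , o' = _ , _ , e ⨾ e' , p' , q' , λ j a b → o' j a b ∙ o j a b

    push-r : ∀ {σ x y} b → lookup σ r ≡ x → lookup σ u ≡ y → suc (length x) ≤ S → Effect (push r b) r σ (b ∷ x) y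
    push-r {σ} b p q le = _ , _ , push (subst (λ x → suc (length x) ≤ S) (sym p) le) ,
      lookup∘updateAt r σ ∙ cong (b ∷_) p , lookup∘updateAt′ u r (r≢u ∘ sym) σ ∙ q ,
      λ j a c → lookup∘updateAt′ j r a σ

    push-u : ∀ {σ x y} b → lookup σ r ≡ x → lookup σ u ≡ y → suc (length y) ≤ S → Effect (push u b) r σ x (b ∷ y)
    push-u {σ} b p q le = _ , _ , push (subst (λ x → suc (length x) ≤ S) (sym q) le) ,
      lookup∘updateAt′ r u r≢u σ ∙ p , lookup∘updateAt u σ ∙ cong (b ∷_) q ,
      λ j a c → lookup∘updateAt′ j u c σ

    pop-r : ∀ {σ x y} → lookup σ r ≡ x → lookup σ u ≡ y → Effect (pop r) r σ (drop 1 x) y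
    pop-r {σ} p q = _ , _ , pop ,
      lookup∘updateAt r σ ∙ cong (drop 1) p , lookup∘updateAt′ u r (r≢u ∘ sym) σ ∙ q ,
      λ j a c → lookup∘updateAt′ j r a σ

    pop-u : ∀ {σ x y} → lookup σ r ≡ x → lookup σ u ≡ y → Effect (pop u) r σ x (drop 1 y)
    pop-u {σ} p q = _ , _ , pop ,
      lookup∘updateAt′ r u r≢u σ ∙ p , lookup∘updateAt u σ ∙ cong (drop 1) q ,
      λ j a c → lookup∘updateAt′ j u c σ

    again : ∀ {i c P σ x y z w} → c (top (lookup σ i)) ≡ true → Effect P r σ x y →
            (∀ {σ'} → lookup σ' r ≡ x → lookup σ' u ≡ y → Effect (while i c P) r σ' z w) → Effect (while i c P) r σ z w
    again t (_ , _ , e , p , q , o) k with k p q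
    ... | _ , _ , e' , p' , q' , o' = _ , _ , repeat t e e' , p' , q' , λ j a b → o' j a b ∙ o j a b

    transfer-effect : ∀ b x {y σ} → lookup σ r ≡ x → lookup σ u ≡ y → length x + length y ≤ S →
                      Effect (transfer u b r) r σ (after-run b x) (pushes (not b) (run-length b x) y)
    transfer-effect true [] p q le = _ , _ , stop (cong (isDigit true ∘ top) p) , p , q , λ _ _ _ → refl
    transfer-effect false [] p q le = _ , _ , stop (cong (isDigit false ∘ top) p) , p , q , λ _ _ _ → refl
    transfer-effect true (false ∷ x) p q le = _ , _ , stop (cong (isDigit true ∘ top) p) , p , q , λ _ _ _ → refl
    transfer-effect false (true ∷ x) p q le = _ , _ , stop (cong (isDigit false ∘ top) p) , p , q , λ _ _ _ → refl
    transfer-effect true (true ∷ x) {y} p q le = again (cong (isDigit true ∘ top) p)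
      (seq (pop-r p q) (λ p' q' → push-u false p' q' (s≤s (m≤n+m (length y) (length x)) ≤∙ le)))
      (λ p' q' → transfer-effect true x p' q' (+-suc (length x) (length y) ≡∙≤ le))
    transfer-effect false (false ∷ x) {y} p q le = again (cong (isDigit false ∘ top) p)
      (seq (pop-r p q) (λ p' q' → push-u true p' q' (s≤s (m≤n+m (length y) (length x)) ≤∙ le)))
      (λ p' q' → transfer-effect false x p' q' (+-suc (length x) (length y) ≡∙≤ le))

    restore-effect : ∀ b y {x σ} → lookup σ r ≡ x → lookup σ u ≡ y → length y + length x ≤ S →
                     Effect (restore u b r) r σ (pushes b (length y) x) []
    restore-effect b [] p q le = _ , _ , stop (cong (nonempty ∘ top) q) , p , q , λ _ _ _ → refl
    restore-effect b (_ ∷ y) {x} p q le = again (cong (nonempty ∘ top) q)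
      (seq (pop-u p q) (λ p' q' → push-r b p' q' (s≤s (m≤n+m (length x) (length y)) ≤∙ le)))
      (λ p' q' → restore-effect b y p' q' (+-suc (length y) (length x) ≡∙≤ le))

    length-run : ∀ b x → run-length b x + length (after-run b x) ≡ length x
    length-run true []          = refl
    length-run true (true ∷ x)  = cong suc (length-run true x)
    length-run true (false ∷ x) = refl
    length-run false []          = refl
    length-run false (false ∷ x) = cong suc (length-run false x)
    length-run false (true ∷ x)  = refl

    length-run-pushes : ∀ b c x → length (pushes b (run-length c x) []) ≡ run-length c x
    length-run-pushes b c x = (length-pushes b (run-length c x) []) ∙ +-identityʳ _

    cond-effect : ∀ {P Q σ x y} → lookup σ r ≡ x →
                  (∀ b w → x ≡ b ∷ w → Effect P r σ (proj₁ y) (proj₂ y)) → (x ≡ [] → Effect Q r σ (proj₁ y) (proj₂ y)) →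
                  Effect (cond r nonempty P Q) r σ (proj₁ y) (proj₂ y)
    cond-effect {x = []} p k l with l refl
    ... | _ , _ , e , rest = _ , _ , else (cong (nonempty ∘ top) p) e , rest
    cond-effect {x = b ∷ w} p k l with k b w refl
    ... | _ , _ , e , rest = _ , _ , then (cong (nonempty ∘ top) p) e , rest

    inc-effect : ∀ {x σ} → lookup σ r ≡ x → lookup σ u ≡ [] → length x ≤ S → length (sucᵈ x) ≤ S →
                 Effect (incᵖ u r) r σ (sucᵈ x) []
    inc-effect {x} p q le le' = seq (transfer-effect true x p q (+-identityʳ _ ≡∙≤ le)) λ p₁ q₁ →
      seq {x = bump (after-run true x)} {y = pushes false (run-length true x) []}
        (cond-effect p₁
          (λ b w eq → seq (pop-r (p₁ ∙ eq) q₁) λ p₂ q₂ →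
            subst (λ v → Effect (push r true) r _ (bump v) y₁) (sym eq)
              (push-r true p₂ q₂ (m≤n+m (length (b ∷ w)) (run-length true x) ≤∙ cong (λ v → run-length true x + length v) (sym eq) ∙ length-run true x ≡∙≤ le)))
          (λ eq → subst (λ v → Effect (push r false) r _ (bump v) y₁) (sym eq)
            (push-r false (p₁ ∙ eq) q₁ (nonzero x le'))))
        λ p₂ q₂ → subst (λ v → Effect _ r _ v _) result
          (restore-effect false (pushes false (run-length true x) []) p₂ q₂
            (cong (_+ length (bump (after-run true x))) (length-run-pushes false true x) ∙ len ≡∙≤ le'))
      where
      y₁ = pushes false (run-length true x) []
      result : pushes false (length (pushes false (run-length true x) [])) (bump (after-run true x)) ≡ sucᵈ x
      result = cong (λ n → pushes false n (bump (after-run true x))) (length-run-pushes false true x) ∙ sucᵈ-run x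
      len : run-length true x + length (bump (after-run true x)) ≡ length (sucᵈ x)
      len = sym (length-pushes false (run-length true x) _) ∙ cong length (sucᵈ-run x)
      nonzero : ∀ x → length (sucᵈ x) ≤ S → 1 ≤ S
      nonzero [] le = le
      nonzero (false ∷ x) le = s≤s z≤n ≤∙ le
      nonzero (true ∷ x) le = s≤s z≤n ≤∙ le

    dec-effect : ∀ {x σ} → lookup σ r ≡ sucᵈ x → lookup σ u ≡ [] → length (sucᵈ x) ≤ S →
                 Effect (decᵖ u r) r σ x []
    dec-effect {x} p q le = seq (transfer-effect false z p q (+-identityʳ _ ≡∙≤ le)) λ p₁ q₁ →
      seq {x = proj₁ mid} {y = proj₂ mid}
        (cond-effect {y = mid} p₁
          (λ b w eq → seq (pop-r (p₁ ∙ eq) q₁) λ p₂ q₂ →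
            subst (λ v → Effect _ r _ (proj₁ (middle v)) (proj₂ (middle v))) (sym eq)
              (push-r false p₂ q₂ (m≤n+m (length (b ∷ w)) (run-length false z) ≤∙ cong (λ v → run-length false z + length v) (sym eq) ∙ length-run false z ≡∙≤ le)))
          (λ eq → subst (λ v → Effect _ r _ (proj₁ (middle v)) (proj₂ (middle v))) (sym eq) (pop-u (p₁ ∙ eq) q₁)))
        λ p₂ q₂ → subst (λ v → Effect _ r _ v _) (result (after-run false z) ∙ predᵈ-run x)
          (restore-effect true (proj₂ mid) p₂ q₂ (bound (after-run false z) ≤∙ length-run false z ≡∙≤ le))
      where
      z = sucᵈ x
      a = run-length false z
      middle : List Bool → List Bool × List Bool
      middle []      = [] , drop 1 (pushes true a [])
      middle (b ∷ w) = false ∷ w , pushes true a []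
      mid = middle (after-run false z)
      drop-pushes : ∀ a → length (drop 1 (pushes true a [])) ≡ pred a
      drop-pushes zero    = refl
      drop-pushes (suc a) = cong (length ∘ drop 1) (pushes-∷ true a []) ∙ (length-pushes true a []) ∙ +-identityʳ a
      result : ∀ v → pushes true (length (proj₂ (middle v))) (proj₁ (middle v)) ≡ lower v a
      result []      = cong (λ n → pushes true n []) (drop-pushes a)
      result (b ∷ w) = cong (λ n → pushes true n (false ∷ w)) (length-run-pushes true false z)
      bound : ∀ v → length (proj₂ (middle v)) + length (proj₁ (middle v)) ≤ a + length v
      bound []      = +-monoˡ-≤ 0 (drop-pushes a ≡∙≤ pred[n]≤n {a})
      bound (b ∷ w) = +-monoˡ-≤ (suc (length w)) (≤-reflexive (length-run-pushes true false z))

-- Register 0 lives on the first stack, the scratch stack is the second one.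
clamp : ∀ M → ℕ → Fin (suc M)
clamp M zero    = zero
clamp zero (suc r) = zero
clamp (suc M) (suc r) = suc (clamp M r)

clamp-injective : ∀ {M r s} → r ≤ M → s ≤ M → clamp M r ≡ clamp M s → r ≡ s
clamp-injective {M} {zero} {zero} _ _ _ = refl
clamp-injective {suc M} {zero} {suc s} _ _ ()
clamp-injective {suc M} {suc r} {zero} _ _ ()
clamp-injective {suc M} {suc r} {suc s} (s≤s p) (s≤s q) eq = cong suc (clamp-injective p q (suc-inj eq))
  where
  suc-inj : ∀ {n} {i j : Fin n} → Fin.suc i ≡ suc j → i ≡ j
  suc-inj refl = refl

scratch : ∀ {M} → Fin (2 + suc M)
scratch = suc zero

loc : ∀ M → ℕ → Fin (2 + suc M)
loc M zero    = zero
loc M (suc r) = suc (suc (clamp M r))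

loc-injective : ∀ {M r s} → r ≤ suc M → s ≤ suc M → loc M r ≡ loc M s → r ≡ s
loc-injective {r = zero} {zero} _ _ _ = refl
loc-injective {r = suc r} {suc s} (s≤s p) (s≤s q) eq = cong suc (clamp-injective p q (inj eq))
  where
  inj : ∀ {n} {i j : Fin n} → Fin.suc (Fin.suc i) ≡ suc (suc j) → i ≡ j
  inj refl = refl

loc≢scratch : ∀ {M} r → loc M r ≢ scratch
loc≢scratch zero ()
loc≢scratch (suc r) ()

binary : ∀ M → NProg → Prog (2 + suc M)
binary M (inc i)    = incᵖ scratch (loc M i)
binary M (dec i)    = cond (loc M i) nonempty (decᵖ scratch (loc M i)) skip
binary M noop       = skip
binary M (P ⨾ Q)    = binary M P ⨾ binary M Q
binary M (loop i P) = while (loc M i) nonempty (binary M P)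

maxReg : NProg → ℕ
maxReg (inc i)    = i
maxReg (dec i)    = i
maxReg noop       = 0
maxReg (P ⨾ Q)    = maxReg P ⊔ maxReg Q
maxReg (loop i P) = i ⊔ maxReg P

record Encodes (M : ℕ) (σ : Regs) (v : Store (2 + suc M)) : Set where
  field
    regs    : ∀ r → r ≤ suc M → lookup v (loc M r) ≡ numeral (σ r)
    scratch-empty : lookup v scratch ≡ []

open Encodes

nonempty-numeral : ∀ n → n ≢ 0 → nonempty (top (numeral n)) ≡ true
nonempty-numeral zero n≢0 = ⊥-elim (n≢0 refl)
nonempty-numeral (suc n) _   = go (numeral n)
  where
  go : ∀ w → nonempty (top (sucᵈ w)) ≡ true
  go []          = refl
  go (false ∷ w) = refl
  go (true ∷ w)  = refl

module _ {m S : ℕ} (fit : suc (suc m) ≤ 2 ^ suc S) where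

  length-numeral : ∀ {n} → n ≤ m → length (numeral n) ≤ S
  length-numeral {n} n≤m = s≤s⁻¹ (2^-cancel-< (begin-strict
    2 ^ length (numeral n) ≤⟨ length-value (numeral n) ⟩
    suc (value (numeral n)) ≡⟨ cong suc (value-numeral n) ⟩
    suc n <⟨ s≤s (s≤s n≤m) ⟩
    suc (suc m) ≤⟨ fit ⟩
    2 ^ suc S ∎))
    where
    open ≤-Reasoning
    2^-cancel-< : ∀ {a b} → 2 ^ a < 2 ^ b → a < b
    2^-cancel-< {a} {b} lt = ≰⇒> λ b≤a → <⇒≱ lt (^-monoʳ-≤ 2 b≤a)

  module _ {M : ℕ} where

    open Semantics {2 + suc M} (_≤ S)
    open Binary {2 + suc M} S scratch

    Below : Regs → Set
    Below σ = ∀ r → σ r ≤ m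

    stays : ∀ {σ σ' : Regs} → Below σ → (∀ j → σ' j ≡ σ j) → Below σ'
    stays b eq r = eq r ≡∙≤ b r

    re-encode : ∀ {σ σ' v} → Encodes M σ v → (∀ j → σ' j ≡ σ j) → Encodes M σ' v
    re-encode e eq = record { regs = λ r le → regs e r le ∙ cong numeral (sym (eq r)) ; scratch-empty = scratch-empty e }

    updated : ∀ {P i σ σ' v} → i ≤ suc M → Encodes M σ v → (∀ j → j ≢ i → σ' j ≡ σ j) →
              Effect P (loc M i) v (numeral (σ' i)) [] → ∃[ t ] ∃[ v' ] Exec P t v v' × Encodes M σ' v'
    updated {i = i} {σ' = σ'} i≤ e eq (t , v' , ex , p , q , o) = t , v' , ex , record { regs = reg ; scratch-empty = q }
      where
      reg : ∀ r → r ≤ suc M → lookup v' (loc M r) ≡ numeral (σ' r)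
      reg r r≤ with r ≟ i
      ... | yes refl = p
      ... | no r≢i   = o _ (r≢i ∘ loc-injective r≤ i≤) (loc≢scratch r) ∙ regs e r r≤ ∙ cong numeral (sym (eq r r≢i))

    below-updated : ∀ {σ σ' : Regs} {i} → Below σ → σ' i ≤ m → (∀ j → j ≢ i → σ' j ≡ σ j) → Below σ'
    below-updated {i = i} b le eq r with r ≟ i
    ... | yes refl = le
    ... | no r≢i   = eq r r≢i ≡∙≤ b r

    Result : NProg → Regs → Store (2 + suc M) → Set
    Result P σ' v = ∃[ t ] ∃[ v' ] Exec (binary M P) t v v' × Encodes M σ' v' × Below σ'

    from-effect : ∀ {P Q i σ σ' v} → i ≤ suc M → Below σ → Encodes M σ v → σ' i ≤ m → (∀ j → j ≢ i → σ' j ≡ σ j) →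
             Effect P (loc M i) v (numeral (σ' i)) [] →
             (∀ {t v'} → Exec P t v v' → ∃[ t' ] Exec (binary M Q) t' v v') → Result Q σ' v
    from-effect mr b e le o eff k =
      let t , v' , ex , e' = updated mr e o eff
          t' , ex' = k ex
      in t' , v' , ex' , e' , below-updated b le o

    execute-inc : ∀ {i σ σ' v} → i ≤ suc M → Below σ → suc (σ i) ≤ m → σ' i ≡ suc (σ i) →
                  (∀ j → j ≢ i → σ' j ≡ σ j) → Encodes M σ v → Result (inc i) σ' v
    execute-inc {i} {σ' = σ'} {v} mr b le eq o e =
      from-effect {P = incᵖ scratch (loc M i)} {inc i} mr b e (eq ≡∙≤ le) o
        (subst (λ n → Effect (incᵖ scratch (loc M i)) (loc M i) v (numeral n) []) (sym eq)
          (inc-effect (loc M i) (loc≢scratch i) (regs e i mr) (scratch-empty e) (length-numeral (b i)) (length-numeral le)))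
        (λ ex → _ , ex)

    execute-dec : ∀ {i σ σ' v} n → i ≤ suc M → Below σ → σ i ≡ n → σ' i ≡ pred n →
                  (∀ j → j ≢ i → σ' j ≡ σ j) → Encodes M σ v → Result (dec i) σ' v
    execute-dec {i} {σ} {σ'} zero mr b σi eq o e =
      _ , _ , else (cong (nonempty ∘ top) (regs e i mr ∙ cong numeral σi)) skip , re-encode e same , stays b same
      where
      same : ∀ j → σ' j ≡ σ j
      same j with j ≟ i
      ... | yes refl = eq ∙ sym σi
      ... | no j≢i   = o j j≢i
    execute-dec {i} {σ} {σ'} {v} (suc n) mr b σi eq o e =
      from-effect {P = decᵖ scratch (loc M i)} {dec i} mr b e
        (eq ≡∙≤ n≤1+n n ≤∙ subst (_≤ m) σi (b i)) o
        (subst (λ n → Effect (decᵖ scratch (loc M i)) (loc M i) v (numeral n) []) (sym eq)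
          (dec-effect (loc M i) (loc≢scratch i) (regs e i mr ∙ cong numeral σi) (scratch-empty e)
            (length-numeral (subst (_≤ m) σi (b i)))))
        (λ ex → _ , then (cong (nonempty ∘ top) (regs e i mr) ∙ nonempty-numeral (σ i) (λ z → case trans (sym σi) z of λ ())) ex)

    -- Values up to `m` have numerals of at most `S` digits, so bounded values become bounded
    -- heights. The scratch stack is empty between any two instructions.
    execute : ∀ {P σ σ' v} → maxReg P ≤ suc M → Below σ → NExec m P σ σ' → Encodes M σ v → Result P σ' v
    execute mr b (inc le eq o) e = execute-inc mr b le eq o e
    execute mr b (dec eq o) e = execute-dec _ mr b refl eq o e
    execute {P = noop} mr b (noop eq) e = _ , _ , skip , re-encode e eq , stays b eq
    execute {P = P ⨾ Q} mr b (x ⨾ y) e with execute (m≤m⊔n _ _ ≤∙ mr) b x e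
    ... | t , v' , ex , e' , b' with execute (m≤n⊔m (maxReg P) _ ≤∙ mr) b' y e'
    ... | t' , v'' , ex' , e'' , b'' = _ , _ , ex ⨾ ex' , e'' , b''
    execute {P = loop i P} mr b (stop eq o) e =
      _ , _ , stop (cong (nonempty ∘ top) (regs e i (m≤m⊔n i (maxReg P) ≤∙ mr) ∙ cong numeral eq)) , re-encode e o , stays b o
    execute {P = loop i P} {σ} mr b (iter ne x y) e with execute (m≤n⊔m i (maxReg P) ≤∙ mr) b x e
    ... | t , v' , ex , e' , b' with execute {P = loop i P} mr b' y e'
    ... | t' , v'' , ex' , e'' , b'' =
      _ , _ , repeat (cong (nonempty ∘ top) (regs e i (m≤m⊔n i (maxReg P) ≤∙ mr)) ∙ nonempty-numeral (σ i) ne) ex ex' , e'' , b''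

-- Polynomially bounded functions computed by counter programs.

_[_≔_] : Regs → ℕ → ℕ → Regs
(σ [ i ≔ v ]) j with j ≟ i
... | yes _ = v
... | no _  = σ j

≔-same : ∀ (σ : Regs) i v → (σ [ i ≔ v ]) i ≡ v
≔-same σ i v with i ≟ i
... | yes _ = refl
... | no ne = ⊥-elim (ne refl)

≔-other : ∀ (σ : Regs) {i j} v → j ≢ i → (σ [ i ≔ v ]) j ≡ σ j
≔-other σ {i} {j} v ne with j ≟ i
... | yes eq = ⊥-elim (ne eq)
... | no _   = refl

module _ {m : ℕ} where

  inc-≔ : ∀ {σ : Regs} i → suc (σ i) ≤ m → NExec m (inc i) σ (σ [ i ≔ suc (σ i) ])
  inc-≔ {σ} i le = inc le (≔-same σ i _) (λ j → ≔-other σ _)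

  dec-≔ : ∀ {σ : Regs} i → NExec m (dec i) σ (σ [ i ≔ pred (σ i) ])
  dec-≔ {σ} i = dec (≔-same σ i _) (λ j → ≔-other σ _)

  clear : ∀ r n {σ : Regs} → σ r ≡ n → ∃[ σ' ] NExec m (loop r (dec r)) σ σ' × σ' r ≡ 0 × (∀ j → j ≢ r → σ' j ≡ σ j)
  clear r zero eq = _ , stop eq (λ _ → refl) , eq , λ _ _ → refl
  clear r (suc n) {σ} eq with clear r n {σ [ r ≔ pred (σ r) ]} (≔-same σ r _ ∙ cong pred eq)
  ... | σ' , e , p , o = σ' , iter (λ z → case trans (sym eq) z of λ ()) (dec-≔ r) e , p ,
    λ j ne → o j ne ∙ ≔-other σ _ ne

  drain : ∀ r s → r ≢ s → ∀ n {σ : Regs} → σ r ≡ n → σ s + n ≤ m → ∃[ σ' ] NExec m (loop r (dec r ⨾ inc s)) σ σ' ×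
          σ' r ≡ 0 × σ' s ≡ σ s + n × (∀ j → j ≢ r → j ≢ s → σ' j ≡ σ j)
  drain r s r≢s zero eq le = _ , stop eq (λ _ → refl) , eq , sym (+-identityʳ _) , λ _ _ _ → refl
  drain r s r≢s (suc n) {σ} eq le
    with drain r s r≢s n {σ₂} (≔-other σ₁ _ r≢s ∙ ≔-same σ r _ ∙ cong pred eq) (sum ≡∙≤ le)
    where
    σ₁ = σ [ r ≔ pred (σ r) ]
    σ₂ = σ₁ [ s ≔ suc (σ₁ s) ]
    sum : σ₂ s + n ≡ σ s + suc n
    sum = cong (_+ n) (≔-same σ₁ s _ ∙ cong suc (≔-other σ _ (r≢s ∘ sym))) ∙ sym (+-suc (σ s) n)
  ... | σ' , e , p , q , o = σ' ,
    iter (λ z → case trans (sym eq) z of λ ())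
      (dec-≔ r ⨾ inc-≔ s (cong suc (≔-other σ _ (r≢s ∘ sym)) ≡∙≤ s≤s (m≤m+n (σ s) n) ≤∙ sym (+-suc (σ s) n) ≡∙≤ le)) e ,
    p , q ∙ sum₂ , λ j a b → o j a b ∙ ≔-other (σ [ r ≔ pred (σ r) ]) _ b ∙ ≔-other σ _ a
    where
    sum₂ : (σ [ r ≔ pred (σ r) ] [ s ≔ suc ((σ [ r ≔ pred (σ r) ]) s) ]) s + n ≡ σ s + suc n
    sum₂ = cong (_+ n) (≔-same (σ [ r ≔ pred (σ r) ]) s _ ∙ cong suc (≔-other σ _ (r≢s ∘ sym))) ∙ sym (+-suc (σ s) n)

  -- Reading a register destroys it. A copy is therefore made by filling two registers at once and
  -- moving one of them back.
  split : ∀ r s t → r ≢ s → r ≢ t → s ≢ t → ∀ n {σ : Regs} → σ r ≡ n → σ s + n ≤ m → σ t + n ≤ m →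
          ∃[ σ' ] NExec m (loop r (dec r ⨾ inc s ⨾ inc t)) σ σ' ×
          σ' r ≡ 0 × σ' s ≡ σ s + n × σ' t ≡ σ t + n × (∀ j → j ≢ r → j ≢ s → j ≢ t → σ' j ≡ σ j)
  split r s t r≢s r≢t s≢t zero eq le le' = _ , stop eq (λ _ → refl) , eq , sym (+-identityʳ _) , sym (+-identityʳ _) , λ _ _ _ _ → refl
  split r s t r≢s r≢t s≢t (suc n) {σ} eq le le' = result
    where
    σ₁ = σ [ r ≔ pred (σ r) ]
    σ₂ = σ₁ [ s ≔ suc (σ₁ s) ]
    σ₃ = σ₂ [ t ≔ suc (σ₂ t) ]
    σ₁s : σ₁ s ≡ σ s
    σ₁s = ≔-other σ _ (r≢s ∘ sym)
    σ₂t : σ₂ t ≡ σ t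
    σ₂t = ≔-other σ₁ _ (s≢t ∘ sym) ∙ ≔-other σ _ (r≢t ∘ sym)
    σ₃r : σ₃ r ≡ n
    σ₃r = ≔-other σ₂ _ r≢t ∙ ≔-other σ₁ _ r≢s ∙ ≔-same σ r _ ∙ cong pred eq
    σ₃s : σ₃ s + n ≡ σ s + suc n
    σ₃s = cong (_+ n) (≔-other σ₂ _ s≢t ∙ ≔-same σ₁ s _ ∙ cong suc σ₁s) ∙ sym (+-suc (σ s) n)
    σ₃t : σ₃ t + n ≡ σ t + suc n
    σ₃t = cong (_+ n) (≔-same σ₂ t _ ∙ cong suc σ₂t) ∙ sym (+-suc (σ t) n)
    step-≤ : ∀ {x y} → x ≡ y → y + suc n ≤ m → suc x ≤ m
    step-≤ {x} refl le = s≤s (m≤m+n x n) ≤∙ sym (+-suc x n) ≡∙≤ le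
    result : ∃[ σ' ] NExec m (loop r (dec r ⨾ inc s ⨾ inc t)) σ σ' ×
          σ' r ≡ 0 × σ' s ≡ σ s + suc n × σ' t ≡ σ t + suc n × (∀ j → j ≢ r → j ≢ s → j ≢ t → σ' j ≡ σ j)
    result with split r s t r≢s r≢t s≢t n {σ₃} σ₃r (σ₃s ≡∙≤ le) (σ₃t ≡∙≤ le')
    ... | σ' , e , p , q , q' , o = σ' ,
      iter (λ z → case trans (sym eq) z of λ ()) (dec-≔ r ⨾ inc-≔ s (step-≤ σ₁s le) ⨾ inc-≔ t (step-≤ σ₂t le')) e ,
      p , q ∙ σ₃s , q' ∙ σ₃t ,
      λ j a b c → o j a b c ∙ ≔-other σ₂ _ c ∙ ≔-other σ₁ _ b ∙ ≔-other σ _ a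

Spec : ℕ → NProg → Regs → ℕ → ℕ → Set
Spec m P σ out v = ∃[ σ' ] NExec m P σ σ' × σ' out ≡ v × (∀ j → j ≢ out → σ' j ≡ σ j)

-- The calling convention: scratch registers are found empty and, by `Spec`, also left empty.
record Ready {k} (args : Vec ℕ k) (out free : ℕ) (σ : Regs) : Set where
  field
    args<free : ∀ i → lookup args i < free
    out<free  : out < free
    args≢out  : ∀ i → lookup args i ≢ out
    free≡0    : ∀ j → free ≤ j → σ j ≡ 0
    out≡0     : σ out ≡ 0

open Ready

-- f is computed by a number program all of whose values are polynomially bounded in the arguments.
-- The program reads its arguments, adds the result to an empty register and uses the registers from free on as scratch space.
record Comp {k} (f : Vec ℕ k → ℕ) : Set where
  field
    prog  : Vec ℕ k → ℕ → ℕ → NProg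
    deg   : ℕ
    spec  : ∀ {args out free σ b m} → Ready args out free σ → (∀ i → σ (lookup args i) ≤ b) → (2 + b) ^ deg ≤ m →
            Spec m (prog args out free) σ out (f (Vec.map σ args))
    bound : ∀ {ρ b} → (∀ i → lookup ρ i ≤ b) → f ρ ≤ (2 + b) ^ deg

open Comp

Comp₁ : (ℕ → ℕ) → Set
Comp₁ h = ∀ {k} {f : Vec ℕ k → ℕ} → Comp f → Comp (λ ρ → h (f ρ))

Comp₂ : (ℕ → ℕ → ℕ) → Set
Comp₂ h = ∀ {k} {f g : Vec ℕ k → ℕ} → Comp f → Comp g → Comp (λ ρ → h (f ρ) (g ρ))

Comp₃ : (ℕ → ℕ → ℕ → ℕ) → Set
Comp₃ h = ∀ {k} {c f g : Vec ℕ k → ℕ} → Comp c → Comp f → Comp g → Comp (λ ρ → h (c ρ) (f ρ) (g ρ))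

Comp-≗ : ∀ {k} {f g : Vec ℕ k → ℕ} → (∀ ρ → f ρ ≡ g ρ) → Comp f → Comp g
Comp-≗ eq c = record
  { prog = prog c ; deg = deg c
  ; spec = λ {args} {σ = σ} r le le' → subst (Spec _ _ _ _) (eq (Vec.map σ args)) (spec c r le le')
  ; bound = λ {ρ} {b} le → subst (_≤ (2 + b) ^ deg c) (eq ρ) (bound c le) }

arg≤ : ∀ b {x} → x ≤ b → x ≤ (2 + b) ^ 1
arg≤ b le = le ≤∙ m≤n+m b 2 ≤∙≡ sym (*-identityʳ (2 + b))

Comp-lookup : ∀ {k} (i : Fin k) → Comp (λ ρ → lookup ρ i)
Comp-lookup {k} i = record { prog = prg ; deg = 1 ; spec = spc ; bound = λ {ρ} {b} le → arg≤ b (le i) }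
  where
  prg : Vec ℕ k → ℕ → ℕ → NProg
  prg args out free = loop x (dec x ⨾ inc out ⨾ inc free) ⨾ loop free (dec free ⨾ inc x)
    where x = lookup args i
  spc : ∀ {args out free σ b m} → Ready args out free σ → (∀ i → σ (lookup args i) ≤ b) → (2 + b) ^ 1 ≤ m →
        Spec m (prg args out free) σ out (lookup (Vec.map σ args) i)
  spc {args} {out} {free} {σ} {b} {m} r le le'
    with split (lookup args i) out free (args≢out r i) (<⇒≢ (args<free r i)) (<⇒≢ (out<free r)) (σ (lookup args i)) {σ} refl
           (cong (_+ σ (lookup args i)) (out≡0 r) ≡∙≤ arg≤ b (le i) ≤∙ le')
           (cong (_+ σ (lookup args i)) (free≡0 r free ≤-refl) ≡∙≤ arg≤ b (le i) ≤∙ le')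
  ... | σ₁ , e , p , q , q' , o
    with drain free (lookup args i) (>⇒≢ (args<free r i)) (σ (lookup args i)) {σ₁}
           (q' ∙ cong (_+ σ (lookup args i)) (free≡0 r free ≤-refl))
           (cong (_+ σ (lookup args i)) p ≡∙≤ arg≤ b (le i) ≤∙ le')
  ... | σ₂ , e' , p' , q'' , o' = σ₂ , e ⨾ e' ,
    o' out (<⇒≢ (out<free r)) (args≢out r i ∘ sym) ∙ q ∙ cong (_+ σ (lookup args i)) (out≡0 r) ∙ sym (lookup-map i σ args) ,
    others
    where
    others : ∀ j → j ≢ out → σ₂ j ≡ σ j
    others j ne with j ≟ lookup args i | j ≟ free
    ... | yes refl | _        = q'' ∙ cong (_+ σ (lookup args i)) p
    ... | no _ | yes refl = p' ∙ sym (free≡0 r free ≤-refl)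
    ... | no a | no c     = o' j c a ∙ o j a ne c

Comp-zero : ∀ {k} → Comp {k} (λ _ → 0)
Comp-zero = record
  { prog = λ _ _ _ → noop ; deg = 0
  ; spec = λ {_} {_} {_} {σ} r _ _ → σ , noop (λ _ → refl) , out≡0 r , λ _ _ → refl
  ; bound = λ _ → z≤n }

Comp-suc : Comp₁ suc
Comp-suc {k} {f} c = record { prog = λ args out free → prog c args out free ⨾ inc out ; deg = suc (deg c) ; spec = spc
  ; bound = λ {ρ} {b} le → suc-^ b (bound c le) }
  where
  suc-^ : ∀ b {x} → x ≤ (2 + b) ^ deg c → suc x ≤ (2 + b) ^ suc (deg c)
  suc-^ b {x} le = +-mono-≤ (m^n>0 (2 + b) (deg c)) le ≤∙
    sym (cong ((2 + b) ^ deg c +_) (+-identityʳ _)) ≡∙≤ *-monoˡ-≤ ((2 + b) ^ deg c) (m≤m+n 2 b)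
  spc : ∀ {args out free σ b m} → Ready args out free σ → (∀ i → σ (lookup args i) ≤ b) → (2 + b) ^ suc (deg c) ≤ m →
        Spec m (prog c args out free ⨾ inc out) σ out (suc (f (Vec.map σ args)))
  spc {args} {out} {free} {σ} {b} {m} r le le'
    with spec c r le (^-monoʳ-≤ (2 + b) (n≤1+n (deg c)) ≤∙ le')
  ... | σ₁ , e , p , o = _ ,
    e ⨾ inc-≔ out (cong suc p ≡∙≤ suc-^ b (bound c vals) ≤∙ le') ,
    ≔-same σ₁ out _ ∙ cong suc p , λ j ne → ≔-other σ₁ _ ne ∙ o j ne
    where
    vals : ∀ i → lookup (Vec.map σ args) i ≤ b
    vals i = lookup-map i σ args ≡∙≤ le i

interval : ℕ → (l : ℕ) → Vec ℕ l
interval c zero    = []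
interval c (suc l) = c ∷ interval (suc c) l

interval-bounds : ∀ c l i → c ≤ lookup (interval c l) i × lookup (interval c l) i < c + l
interval-bounds c (suc l) zero    = ≤-refl , s≤s (m≤m+n c l) ≤∙≡ sym (+-suc c l)
interval-bounds c (suc l) (suc i) with interval-bounds (suc c) l i
... | p , q = n≤1+n c ≤∙ p , q ≤∙≡ sym (+-suc c l)

clears : ℕ → ℕ → NProg
clears c zero    = noop
clears c (suc l) = loop c (dec c) ⨾ clears (suc c) l

clears-spec : ∀ {m} c l {σ : Regs} → ∃[ σ' ] NExec m (clears c l) σ σ' × (∀ j → c ≤ j → j < c + l → σ' j ≡ 0) ×
              (∀ j → j < c → σ' j ≡ σ j) × (∀ j → c + l ≤ j → σ' j ≡ σ j)
clears-spec c zero {σ} = σ , noop (λ _ → refl) ,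
  (λ j a b → ⊥-elim (<⇒≱ b (+-identityʳ c ≡∙≤ a))) , (λ _ _ → refl) , (λ _ _ → refl)
clears-spec {m} c (suc l) {σ} with clear {m} c (σ c) {σ} refl
... | σ₁ , e , p , o with clears-spec {m} (suc c) l {σ₁}
... | σ₂ , e' , z , lo , hi = σ₂ , e ⨾ e' , zeros , (λ j lt → lo j (lt ≤∙ n≤1+n c) ∙ o j (<⇒≢ lt)) ,
        λ j le → hi j (sym (+-suc c l) ≡∙≤ le) ∙ o j (>⇒≢ (s≤s (m≤m+n c l) ≤∙ sym (+-suc c l) ≡∙≤ le))
  where
  zeros : ∀ j → c ≤ j → j < c + suc l → σ₂ j ≡ 0
  zeros j a b with j ≟ c
  ... | yes refl = lo c ≤-refl ∙ p
  ... | no ne    = z j (≤∧≢⇒< a (ne ∘ sym)) (b ≤∙≡ +-suc c l)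

map-cong-lookup : ∀ {k} {σ τ : Regs} (args : Vec ℕ k) → (∀ i → σ (lookup args i) ≡ τ (lookup args i)) → Vec.map σ args ≡ Vec.map τ args
map-cong-lookup [] eq = refl
map-cong-lookup (x ∷ args) eq = cong₂ _∷_ (eq zero) (map-cong-lookup args (eq ∘ suc))

-- Substituting a bound `(2 + b) ^ D` into a bound of the same shape raises the base to
-- `2 + (2 + b) ^ D`. Two more degrees absorb the summand, because the base `2 + b` is at least 2
-- even for `b = 0`.
2+^≤ : ∀ b D → 2 + (2 + b) ^ D ≤ (2 + b) ^ (2 + D)
2+^≤ b D = +-monoˡ-≤ X (*-monoʳ-≤ 2 (m^n>0 (2 + b) D)) ≤∙ three X ≡∙≤ *-monoˡ-≤ X (n≤1+n 3 ≤∙ *-mono-≤ {2} {2 + b} {2} {2 + b} (m≤m+n 2 b) (m≤m+n 2 b)) ≤∙≡ *-assoc (2 + b) (2 + b) X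
  where
  X = (2 + b) ^ D
  three : ∀ X → 2 * X + X ≡ 3 * X
  three = solve-∀

^-compose : ∀ b D d → (2 + (2 + b) ^ D) ^ d ≤ (2 + b) ^ ((2 + D) * d)
^-compose b D d = ^-monoˡ-≤ d (2+^≤ b D) ≤∙≡ ^-*-assoc (2 + b) (2 + D) d

module _ {k : ℕ} where

  degs : ∀ {l} {gs : Vec (Vec ℕ k → ℕ) l} → All Comp gs → ℕ
  degs []       = 0
  degs (c ∷ cs) = deg c + degs cs

  evals : ∀ {l} {gs : Vec (Vec ℕ k → ℕ) l} → All Comp gs → Vec ℕ k → ℕ → ℕ → NProg
  evals [] args c F = noop
  evals (g ∷ gs) args c F = prog g args c F ⨾ evals gs args (suc c) F

  bounds : ∀ {l} {gs : Vec (Vec ℕ k → ℕ) l} (cs : All Comp gs) {ρ b} → (∀ i → lookup ρ i ≤ b) →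
           ∀ i → lookup (Vec.map (λ g → g ρ) gs) i ≤ (2 + b) ^ degs cs
  bounds (c ∷ cs) {b = b} le zero    = bound c le ≤∙ ^-monoʳ-≤ (2 + b) (m≤m+n (deg c) _)
  bounds (c ∷ cs) {b = b} le (suc i) = bounds cs le i ≤∙ ^-monoʳ-≤ (2 + b) (m≤n+m _ (deg c))

  evals-spec : ∀ {l} {gs : Vec (Vec ℕ k → ℕ) l} (cs : All Comp gs) {args c F σ b m} → c + l ≡ F →
               (∀ i → lookup args i < c) → (∀ j → c ≤ j → σ j ≡ 0) → (∀ i → σ (lookup args i) ≤ b) → (2 + b) ^ degs cs ≤ m →
               ∃[ σ' ] NExec m (evals cs args c F) σ σ' × Vec.map σ' (interval c l) ≡ Vec.map (λ g → g (Vec.map σ args)) gs ×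
               (∀ j → j < c → σ' j ≡ σ j) × (∀ j → F ≤ j → σ' j ≡ 0)
  evals-spec [] {c = c} {σ = σ} eq lt z le le' = σ , noop (λ _ → refl) , refl , (λ _ _ → refl) ,
    λ j F≤j → z j (sym (+-identityʳ c) ∙ eq ≡∙≤ F≤j)
  evals-spec {suc l} {g ∷ gs} (C ∷ cs) {args} {c} {F} {σ} {b} {m} eq lt z le le'
    with spec C {args} {c} {F} {σ} {b} {m}
           (record { args<free = λ i → lt i ≤∙ c≤F ; out<free = c<F ; args≢out = λ i → <⇒≢ (lt i)
                   ; free≡0 = λ j F≤j → z j (c≤F ≤∙ F≤j) ; out≡0 = z c ≤-refl })
           le (^-monoʳ-≤ (2 + b) (m≤m+n (deg C) (degs cs)) ≤∙ le')
    where
    c<F : c < F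
    c<F = s≤s (m≤m+n c l) ≤∙≡ sym (+-suc c l) ∙ eq
    c≤F : c ≤ F
    c≤F = <⇒≤ c<F
  ... | σ₁ , e , p , o
    with evals-spec cs {args} {suc c} {F} {σ₁} {b} {m} (sym (+-suc c l) ∙ eq) (λ i → lt i ≤∙ n≤1+n c)
           (λ j lt' → o j (>⇒≢ lt') ∙ z j (<⇒≤ lt'))
           (λ i → o _ (<⇒≢ (lt i)) ≡∙≤ le i)
           (^-monoʳ-≤ (2 + b) (m≤n+m (degs cs) (deg C)) ≤∙ le')
  ... | σ₂ , e' , vals , lo , hi = σ₂ , e ⨾ e' ,
    cong₂ _∷_ (lo c ≤-refl ∙ p)
      (vals ∙ map-cong (λ g → cong g (map-cong-lookup args (λ i → o _ (<⇒≢ (lt i))))) gs) ,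
    (λ j lt' → lo j (lt' ≤∙ n≤1+n c) ∙ o j (<⇒≢ lt')) , hi

  -- The inner results occupy the registers from `free` on and the outer program works above them;
  -- clearing them at the end restores the convention.
  Comp-compose : ∀ {l} {f : Vec ℕ l → ℕ} {gs : Vec (Vec ℕ k → ℕ) l} → Comp f → All Comp gs →
                 Comp (λ ρ → f (Vec.map (λ g → g ρ) gs))
  Comp-compose {l} {f} {gs} c cs = record { prog = prg ; deg = d ; spec = spc
    ; bound = λ {ρ} {b} le → bound c (bounds cs le) ≤∙ ^-compose b (degs cs) (deg c) ≤∙ ^-monoʳ-≤ (2 + b) (m≤n+m _ (degs cs)) }
    where
    d = degs cs + (2 + degs cs) * deg c
    prg : Vec ℕ k → ℕ → ℕ → NProg
    prg args out free = evals cs args free (free + l) ⨾ prog c (interval free l) out (free + l) ⨾ clears free l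
    spc : ∀ {args out free σ b m} → Ready args out free σ → (∀ i → σ (lookup args i) ≤ b) → (2 + b) ^ d ≤ m →
          Spec m (prg args out free) σ out (f (Vec.map (λ g → g (Vec.map σ args)) gs))
    spc {args} {out} {free} {σ} {b} {m} r le le'
      with evals-spec cs {args} {free} {free + l} {σ} {b} {m} refl (args<free r) (free≡0 r) le
             (^-monoʳ-≤ (2 + b) (m≤m+n (degs cs) _) ≤∙ le')
    ... | σ₁ , e₁ , vals , lo , hi
      with spec c {interval free l} {out} {free + l} {σ₁} {(2 + b) ^ degs cs} {m}
             (record { args<free = λ i → proj₂ (interval-bounds free l i)
                     ; out<free = out<free r ≤∙ m≤m+n free l
                     ; args≢out = λ i → >⇒≢ (out<free r ≤∙ proj₁ (interval-bounds free l i))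
                     ; free≡0 = hi ; out≡0 = lo out (out<free r) ∙ out≡0 r })
             (λ i → sym (lookup-map i σ₁ (interval free l)) ∙ cong (λ v → lookup v i) vals ≡∙≤
                      bounds cs (λ i → lookup-map i σ args ≡∙≤ le i) i)
             (^-compose b (degs cs) (deg c) ≤∙ ^-monoʳ-≤ (2 + b) (m≤n+m _ (degs cs)) ≤∙ le')
    ... | σ₂ , e₂ , p , o with clears-spec {m} free l {σ₂}
    ... | σ₃ , e₃ , zs , lo' , hi' = σ₃ , e₁ ⨾ e₂ ⨾ e₃ ,
      lo' out (out<free r) ∙ p ∙ cong f vals , others
      where
      others : ∀ j → j ≢ out → σ₃ j ≡ σ j
      others j ne with j <? free | j <? free + l
      ... | yes a | _     = lo' j a ∙ o j ne ∙ lo j a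
      ... | no a | yes b = zs j (≮⇒≥ a) b ∙ sym (free≡0 r j (≮⇒≥ a))
      ... | no a | no b  = hi' j (≮⇒≥ b) ∙ o j ne ∙ hi j (≮⇒≥ b) ∙ sym (free≡0 r j (≮⇒≥ a))

primrec : ℕ → (ℕ → ℕ → ℕ) → ℕ → ℕ
primrec x f zero    = x
primrec x f (suc n) = f n (primrec x f n)

register-cases : ∀ {P : ℕ → Set} f → (∀ j → j < f → P j) → P f → P (1 + f) → P (2 + f) → (∀ j → 3 + f ≤ j → P j) → ∀ j → P j
register-cases f lo p q r hi j with j <? f | j ≟ f | j ≟ 1 + f | j ≟ 2 + f
... | yes lt | _ | _ | _ = lo j lt
... | no _ | yes refl | _ | _ = p
... | no _ | no _ | yes refl | _ = q
... | no _ | no _ | no _ | yes refl = r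
... | no ge | no a | no b | no c = hi j (≤∧≢⇒< (≤∧≢⇒< (≤∧≢⇒< (≮⇒≥ ge) (a ∘ sym)) (b ∘ sym)) (c ∘ sym))

module _ {k : ℕ} {fn fb : Vec ℕ k → ℕ} {fs : Vec ℕ (2 + k) → ℕ} (N : Comp fn) (B : Comp fb) (S : Comp fs) (d : ℕ) where

  rec : Vec ℕ k → ℕ → ℕ
  rec ρ = primrec (fb ρ) (λ j x → fs (j ∷ x ∷ ρ))

  module _ (rec-bound : ∀ {ρ b} → (∀ i → lookup ρ i ≤ b) → ∀ j → j ≤ fn ρ → rec ρ j ≤ (2 + b) ^ d) where

    -- Unrestricted recursion would leave the polynomially bounded functions, so `rec-bound` demands
    -- a fixed degree for all values up to the last round. The total degree collects the costs of
    -- counter, base and step, the step being run on arguments bounded with degree `D`.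
    Comp-primrec : Comp (λ ρ → rec ρ (fn ρ))
    Comp-primrec = record { prog = prg ; deg = e ; spec = spc
      ; bound = λ {ρ} {b} le → rec-bound le (fn ρ) ≤-refl ≤∙ ^-monoʳ-≤ (2 + b) d≤e }
      where
      D = suc (deg N + d)
      e = D + (deg B + (2 + D) * deg S)
      d≤e : d ≤ e
      d≤e = m≤n+m d (deg N) ≤∙ n≤1+n _ ≤∙ m≤m+n D _
      n≤e : deg N ≤ e
      n≤e = m≤m+n (deg N) d ≤∙ n≤1+n _ ≤∙ m≤m+n D _
      B≤e : deg B ≤ e
      B≤e = m≤m+n (deg B) _ ≤∙ m≤n+m _ D
      S≤e : (2 + D) * deg S ≤ e
      S≤e = m≤n+m _ (deg B) ≤∙ m≤n+m _ D
      -- The step is evaluated into register `2 + free` while `out` still holds the previous value,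
      -- which is one of its arguments; only then is `out` overwritten.
      body : Vec ℕ k → ℕ → ℕ → NProg
      body args out free = dec free ⨾ prog S (suc free ∷ out ∷ args) (2 + free) (3 + free) ⨾ loop out (dec out) ⨾
        loop (2 + free) (dec (2 + free) ⨾ inc out) ⨾ inc (suc free)
      prg : Vec ℕ k → ℕ → ℕ → NProg
      prg args out free = prog N args free (3 + free) ⨾ prog B args out (3 + free) ⨾
        loop free (body args out free) ⨾ loop (suc free) (dec (suc free))

      module _ {args : Vec ℕ k} {out free b m : ℕ} {σ : Regs} (r : Ready args out free σ)
               (le : ∀ i → σ (lookup args i) ≤ b) (le' : (2 + b) ^ e ≤ m) where

        ρ : Vec ℕ k
        ρ = Vec.map σ args

        ρ≤b : ∀ i → lookup ρ i ≤ b
        ρ≤b i = lookup-map i σ args ≡∙≤ le i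

        -- The invariant of the main loop after i rounds, with c rounds left.
        record Inv (i c : ℕ) (τ : Regs) : Set where
          field
            counter : τ free ≡ c
            index   : τ (suc free) ≡ i
            temp    : τ (2 + free) ≡ 0
            accum   : τ out ≡ rec ρ i
            low     : ∀ j → j < free → j ≢ out → τ j ≡ σ j
            high    : ∀ j → 3 + free ≤ j → τ j ≡ 0
        open Inv

        out≢ : ∀ n → out ≢ n + free
        out≢ n = <⇒≢ (out<free r ≤∙ m≤n+m free n)

        args-τ : ∀ {i c τ} → Inv i c τ → ∀ i → τ (lookup args i) ≡ σ (lookup args i)
        args-τ inv i = low inv _ (args<free r i) (args≢out r i)

        pow : ∀ {x y} → x ≤ y → (2 + b) ^ x ≤ (2 + b) ^ y
        pow = ^-monoʳ-≤ (2 + b)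

        loop-body : ∀ {i c τ} → i + suc c ≡ fn ρ → Inv i (suc c) τ → ∃[ τ' ] NExec m (body args out free) τ τ' × Inv (suc i) c τ'
        loop-body {i} {c} {τ} eq inv = τ₄ [ suc free ≔ suc (τ₄ (suc free)) ] ,
            (dec-≔ free ⨾ e₂ ⨾ e₃ ⨾ e₄ ⨾ inc-≔ (suc free) (cong suc τ₄-index ≡∙≤ si≤m)) ,
            record
              { counter = ≔-other τ₄ _ (<⇒≢ ≤-refl) ∙ o₄ free (m≢1+n+m free {1}) (out≢ 0 ∘ sym) ∙ o₃ free (out≢ 0 ∘ sym) ∙
                  o₂ free (m≢1+n+m free {1}) ∙ ≔-same τ free _ ∙ cong pred (counter inv)
              ; index = ≔-same τ₄ (suc free) _ ∙ cong suc τ₄-index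
              ; temp = ≔-other τ₄ _ (>⇒≢ ≤-refl) ∙ p₄
              ; accum = ≔-other τ₄ _ (out≢ 1) ∙ q₄ ∙ cong₂ _+_ p₃ refl
              ; low = λ j lt ne → ≔-other τ₄ _ (<⇒≢ (lt ≤∙ n≤1+n free)) ∙ o₄ j (<⇒≢ (lt ≤∙ m≤n+m free 2)) ne ∙ o₃ j ne ∙
                  o₂ j (<⇒≢ (lt ≤∙ m≤n+m free 2)) ∙ ≔-other τ _ (<⇒≢ lt) ∙ low inv j lt ne
              ; high = λ j le → ≔-other τ₄ _ (>⇒≢ (n≤1+n _ ≤∙ le)) ∙ o₄ j (>⇒≢ le) (>⇒≢ (out<free r ≤∙ m≤n+m free 3 ≤∙ le)) ∙
                  o₃ j (>⇒≢ (out<free r ≤∙ m≤n+m free 3 ≤∙ le)) ∙ o₂ j (>⇒≢ le) ∙ ≔-other τ _ (>⇒≢ (m≤n+m (suc free) 2 ≤∙ le)) ∙ high inv j le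
              }
          where
          i≤ : suc i ≤ fn ρ
          i≤ = s≤s (m≤m+n i c) ≤∙≡ sym (+-suc i c) ∙ eq
          n≤ : fn ρ ≤ (2 + b) ^ deg N
          n≤ = bound N ρ≤b
          si≤m : suc i ≤ m
          si≤m = i≤ ≤∙ n≤ ≤∙ pow n≤e ≤∙ le'
          τ₁ = τ [ free ≔ pred (τ free) ]
          τ₁-args : ∀ a → τ₁ (lookup args a) ≡ σ (lookup args a)
          τ₁-args a = ≔-other τ _ (<⇒≢ (args<free r a)) ∙ args-τ inv a
          vec : Vec.map τ₁ (suc free ∷ out ∷ args) ≡ i ∷ rec ρ i ∷ ρ
          vec = cong₂ _∷_ (≔-other τ _ (>⇒≢ ≤-refl) ∙ index inv)
                  (cong₂ _∷_ (≔-other τ _ (out≢ 0) ∙ accum inv) (map-cong-lookup args τ₁-args))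
          ready : Ready (suc free ∷ out ∷ args) (2 + free) (3 + free) τ₁
          ready = record
            { args<free = λ { zero → s≤s (n≤1+n (suc free)) ; (suc zero) → out<free r ≤∙ m≤n+m free 3
                            ; (suc (suc i)) → args<free r i ≤∙ m≤n+m free 3 }
            ; out<free = ≤-refl
            ; args≢out = λ { zero → <⇒≢ ≤-refl ; (suc zero) → out≢ 2
                           ; (suc (suc i)) → <⇒≢ (args<free r i ≤∙ m≤n+m free 2) }
            ; free≡0 = λ j le → ≔-other τ _ (>⇒≢ (m≤n+m (suc free) 2 ≤∙ le)) ∙ high inv j le
            ; out≡0 = ≔-other τ _ (m≢1+n+m free {1} ∘ sym) ∙ temp inv }
          vals : ∀ a → τ₁ (lookup (suc free ∷ out ∷ args) a) ≤ (2 + b) ^ D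
          vals zero = cong (λ v → lookup v zero) vec ≡∙≤ (<⇒≤ i≤) ≤∙ n≤ ≤∙ pow (m≤m+n (deg N) d ≤∙ n≤1+n _)
          vals (suc zero) = cong (λ v → lookup v (suc zero)) vec ≡∙≤
            rec-bound ρ≤b i (<⇒≤ i≤) ≤∙ pow (m≤n+m d (deg N) ≤∙ n≤1+n _)
          vals (suc (suc a)) = τ₁-args a ≡∙≤ le a ≤∙ arg≤ b ≤-refl ≤∙ pow {1} {D} (s≤s z≤n)
          S-run = spec S {suc free ∷ out ∷ args} {2 + free} {3 + free} {τ₁} {(2 + b) ^ D} {m} ready vals
                    (^-compose b D (deg S) ≤∙ pow S≤e ≤∙ le')
          τ₂ = proj₁ S-run
          e₂ = proj₁ (proj₂ S-run)
          p₂ : τ₂ (2 + free) ≡ rec ρ (suc i)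
          p₂ = proj₁ (proj₂ (proj₂ S-run)) ∙ cong fs vec
          o₂ : ∀ j → j ≢ 2 + free → τ₂ j ≡ τ₁ j
          o₂ = proj₂ (proj₂ (proj₂ S-run))
          C-run = clear {m} out (τ₂ out) {τ₂} refl
          τ₃ = proj₁ C-run
          e₃ = proj₁ (proj₂ C-run)
          p₃ : τ₃ out ≡ 0
          p₃ = proj₁ (proj₂ (proj₂ C-run))
          o₃ : ∀ j → j ≢ out → τ₃ j ≡ τ₂ j
          o₃ = proj₂ (proj₂ (proj₂ C-run))
          D-run = drain {m} (2 + free) out (out≢ 2 ∘ sym) (rec ρ (suc i)) {τ₃} (o₃ _ (out≢ 2 ∘ sym) ∙ p₂)
                    (cong (_+ rec ρ (suc i)) p₃ ≡∙≤ rec-bound ρ≤b (suc i) i≤ ≤∙ pow d≤e ≤∙ le')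
          τ₄ = proj₁ D-run
          e₄ = proj₁ (proj₂ D-run)
          p₄ : τ₄ (2 + free) ≡ 0
          p₄ = proj₁ (proj₂ (proj₂ D-run))
          q₄ : τ₄ out ≡ τ₃ out + rec ρ (suc i)
          q₄ = proj₁ (proj₂ (proj₂ (proj₂ D-run)))
          o₄ : ∀ j → j ≢ 2 + free → j ≢ out → τ₄ j ≡ τ₃ j
          o₄ = proj₂ (proj₂ (proj₂ (proj₂ D-run)))
          τ₄-index : τ₄ (suc free) ≡ i
          τ₄-index = o₄ _ (<⇒≢ ≤-refl) (out≢ 1 ∘ sym) ∙ o₃ _ (out≢ 1 ∘ sym) ∙ o₂ _ (<⇒≢ ≤-refl) ∙ ≔-other τ _ (>⇒≢ ≤-refl) ∙ index inv

        main-loop : ∀ c {i τ} → i + c ≡ fn ρ → Inv i c τ → ∃[ τ' ] NExec m (loop free (body args out free)) τ τ' × Inv (fn ρ) 0 τ'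
        main-loop zero {i} {τ} eq inv = τ , stop (counter inv) (λ _ → refl) , subst (λ n → Inv n 0 τ) (sym (+-identityʳ i) ∙ eq) inv
        main-loop (suc c) {i} eq inv =
          let τ₁ , e , inv₁ = loop-body eq inv
              τ₂ , e' , inv₂ = main-loop c (sym (+-suc i c) ∙ eq) inv₁
          in τ₂ , iter (λ z → case trans (sym (counter inv)) z of λ ()) e e' , inv₂

        spc : Spec m (prg args out free) σ out (rec ρ (fn ρ))
        spc = τ₄ , (e₁ ⨾ e₂ ⨾ e₃ ⨾ e₄) , o₄ out (out≢ 1) ∙ accum inv' , others
          where
          N-run = spec N {args} {free} {3 + free} {σ} {b} {m}
                    (record { args<free = λ i → args<free r i ≤∙ m≤n+m free 3 ; out<free = m≤n+m (suc free) 2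
                            ; args≢out = λ i → <⇒≢ (args<free r i) ; free≡0 = λ j le → free≡0 r j (m≤n+m free 3 ≤∙ le)
                            ; out≡0 = free≡0 r free ≤-refl })
                    le (pow n≤e ≤∙ le')
          τ₁ = proj₁ N-run
          e₁ = proj₁ (proj₂ N-run)
          p₁ : τ₁ free ≡ fn ρ
          p₁ = proj₁ (proj₂ (proj₂ N-run))
          o₁ : ∀ j → j ≢ free → τ₁ j ≡ σ j
          o₁ = proj₂ (proj₂ (proj₂ N-run))
          args₁ : ∀ i → τ₁ (lookup args i) ≡ σ (lookup args i)
          args₁ i = o₁ _ (<⇒≢ (args<free r i))
          B-run = spec B {args} {out} {3 + free} {τ₁} {b} {m}
                    (record { args<free = λ i → args<free r i ≤∙ m≤n+m free 3 ; out<free = out<free r ≤∙ m≤n+m free 3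
                            ; args≢out = args≢out r
                            ; free≡0 = λ j le → o₁ j (>⇒≢ (m≤n+m (suc free) 2 ≤∙ le)) ∙ free≡0 r j (m≤n+m free 3 ≤∙ le)
                            ; out≡0 = o₁ out (out≢ 0) ∙ out≡0 r })
                    (λ i → args₁ i ≡∙≤ le i) (pow B≤e ≤∙ le')
          τ₂ = proj₁ B-run
          e₂ = proj₁ (proj₂ B-run)
          p₂ : τ₂ out ≡ fb ρ
          p₂ = proj₁ (proj₂ (proj₂ B-run)) ∙ cong fb (map-cong-lookup args args₁)
          o₂ : ∀ j → j ≢ out → τ₂ j ≡ τ₁ j
          o₂ = proj₂ (proj₂ (proj₂ B-run))
          above : ∀ n → τ₂ (suc n + free) ≡ 0
          above n = o₂ _ (out≢ (suc n) ∘ sym) ∙ o₁ _ (>⇒≢ (s≤s (m≤n+m free n))) ∙ free≡0 r _ (m≤n+m free (suc n))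
          inv₀ : Inv 0 (fn ρ) τ₂
          inv₀ = record
            { counter = o₂ free (out≢ 0 ∘ sym) ∙ p₁ ; index = above 0 ; temp = above 1 ; accum = p₂
            ; low = λ j lt ne → o₂ j ne ∙ o₁ j (<⇒≢ lt)
            ; high = λ j le → o₂ j (>⇒≢ (out<free r ≤∙ m≤n+m free 3 ≤∙ le)) ∙
                       o₁ j (>⇒≢ (m≤n+m (suc free) 2 ≤∙ le)) ∙ free≡0 r j (m≤n+m free 3 ≤∙ le) }
          L-run = main-loop (fn ρ) refl inv₀
          τ₃ = proj₁ L-run
          e₃ = proj₁ (proj₂ L-run)
          inv' : Inv (fn ρ) 0 τ₃
          inv' = proj₂ (proj₂ L-run)
          C-run = clear {m} (suc free) (fn ρ) {τ₃} (index inv')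
          τ₄ = proj₁ C-run
          e₄ = proj₁ (proj₂ C-run)
          p₄ : τ₄ (suc free) ≡ 0
          p₄ = proj₁ (proj₂ (proj₂ C-run))
          o₄ : ∀ j → j ≢ suc free → τ₄ j ≡ τ₃ j
          o₄ = proj₂ (proj₂ (proj₂ C-run))
          others : ∀ j → j ≢ out → τ₄ j ≡ σ j
          others = register-cases free
            (λ j lt ne → o₄ j (<⇒≢ (lt ≤∙ n≤1+n free)) ∙ low inv' j lt ne)
            (λ _ → o₄ _ (<⇒≢ ≤-refl) ∙ counter inv' ∙ sym (free≡0 r _ ≤-refl))
            (λ _ → p₄ ∙ sym (free≡0 r _ (n≤1+n free)))
            (λ _ → o₄ _ (>⇒≢ ≤-refl) ∙ temp inv' ∙ sym (free≡0 r _ (m≤n+m free 2)))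
            (λ j le _ → o₄ j (>⇒≢ (n≤1+n _ ≤∙ le)) ∙ high inv' j le ∙ sym (free≡0 r j (m≤n+m free 3 ≤∙ le)))

module _ {k : ℕ} where

  Comp-const : ∀ n → Comp {k} (λ _ → n)
  Comp-const zero    = Comp-zero
  Comp-const (suc n) = Comp-suc (Comp-const n)

  select : ∀ n → (Fin n → Fin k) → Vec (Vec ℕ (2 + k) → ℕ) n
  select zero h = []
  select (suc n) h = (λ ρ → lookup ρ (suc (suc (h zero)))) ∷ select n (h ∘ suc)

  Comp-select : ∀ n (h : Fin n → Fin k) → All Comp (select n h)
  Comp-select zero h = []
  Comp-select (suc n) h = Comp-lookup (suc (suc (h zero))) ∷ Comp-select n (h ∘ suc)

  map-select : ∀ (ρ : Vec ℕ (2 + k)) → Vec.map (λ g → g ρ) (select k id) ≡ Vec.tail (Vec.tail ρ)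
  map-select (i ∷ j ∷ ρ) = values k id ∙ tab ρ
    where
    values : ∀ n (h : Fin n → Fin k) → Vec.map (λ g → g (i ∷ j ∷ ρ)) (select n h) ≡ Vec.tabulate (lookup ρ ∘ h)
    values zero h = refl
    values (suc n) h = cong (lookup ρ (h zero) ∷_) (values n (h ∘ suc))
    tab : ∀ {n} (ρ : Vec ℕ n) → Vec.tabulate (lookup ρ) ≡ ρ
    tab []      = refl
    tab (x ∷ ρ) = cong (x ∷_) (tab ρ)

  -- Drops the accumulator from the arguments of a recursion step, for bodies that depend on the
  -- index and the parameters.
  weaken₁ : ∀ {f : Vec ℕ (suc k) → ℕ} → Comp f → Comp {2 + k} (λ ρ → f (Vec.head ρ ∷ Vec.tail (Vec.tail ρ)))
  weaken₁ {f} c = Comp-≗ eq (Comp-compose c (Comp-lookup zero ∷ Comp-select k id))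
    where
    eq : ∀ ρ → f (lookup ρ zero ∷ Vec.map (λ g → g ρ) (select k id)) ≡ f (Vec.head ρ ∷ Vec.tail (Vec.tail ρ))
    eq ρ@(i ∷ j ∷ _) = cong (f ∘ (i ∷_)) (map-select ρ)

  weaken₂ : ∀ {f : Vec ℕ k → ℕ} → Comp f → Comp {2 + k} (λ ρ → f (Vec.tail (Vec.tail ρ)))
  weaken₂ {f} c = Comp-≗ (λ ρ → cong f (map-select ρ)) (Comp-compose c (Comp-select k id))

  lift₁ : ∀ {h : ℕ → ℕ} {f : Vec ℕ k → ℕ} → Comp {1} (λ ρ → h (lookup ρ zero)) → Comp f → Comp (λ ρ → h (f ρ))
  lift₁ c d = Comp-compose c (d ∷ [])

  lift₂ : ∀ {h : ℕ → ℕ → ℕ} {f g : Vec ℕ k → ℕ} → Comp {2} (λ ρ → h (lookup ρ zero) (lookup ρ (suc zero))) → Comp f → Comp g → Comp (λ ρ → h (f ρ) (g ρ))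
  lift₂ c d e = Comp-compose c (d ∷ e ∷ [])

  lift₃ : ∀ {h : ℕ → ℕ → ℕ → ℕ} {f g f' : Vec ℕ k → ℕ} → Comp {3} (λ ρ → h (lookup ρ zero) (lookup ρ (suc zero)) (lookup ρ (suc (suc zero)))) →
          Comp f → Comp g → Comp f' → Comp (λ ρ → h (f ρ) (g ρ) (f' ρ))
  lift₃ c d e e' = Comp-compose c (d ∷ e ∷ e' ∷ [])

Comp-primrec-≗ : ∀ {k} {fn fb g : Vec ℕ k → ℕ} {fs : Vec ℕ (2 + k) → ℕ} → Comp fn → Comp fb → Comp fs → ∀ d →
                 (∀ {ρ b} → (∀ i → lookup ρ i ≤ b) → ∀ j → j ≤ fn ρ → primrec (fb ρ) (λ j x → fs (j ∷ x ∷ ρ)) j ≤ (2 + b) ^ d) →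
                 (∀ ρ → primrec (fb ρ) (λ j x → fs (j ∷ x ∷ ρ)) (fn ρ) ≡ g ρ) → Comp g
Comp-primrec-≗ N B S d le eq = Comp-≗ eq (Comp-primrec N B S d le)

v₀ : ∀ {k} → Comp {1 + k} (λ ρ → lookup ρ zero)
v₀ = Comp-lookup zero
v₁ : ∀ {k} → Comp {2 + k} (λ ρ → lookup ρ (suc zero))
v₁ = Comp-lookup (suc zero)
v₂ : ∀ {k} → Comp {3 + k} (λ ρ → lookup ρ (suc (suc zero)))
v₂ = Comp-lookup (suc (suc zero))
v₃ : ∀ {k} → Comp {4 + k} (λ ρ → lookup ρ (suc (suc (suc zero))))
v₃ = Comp-lookup (suc (suc (suc zero)))

sq : ∀ {b x} → x ≤ b * b → x ≤ (2 + b) ^ 2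
sq {b} le = le ≤∙ *-mono-≤ {b} {2 + b} (m≤n+m b 2) (m≤n+m b 2 ≤∙≡ sym (*-identityʳ (2 + b)))

Comp-+' : Comp {2} (λ ρ → lookup ρ zero + lookup ρ (suc zero))
Comp-+' = Comp-primrec-≗ v₁ v₀ (Comp-suc v₁) 2
  (λ { {x ∷ y ∷ []} {b} le j j≤ → sum x j ≡∙≤
        (+-mono-≤ (j≤ ≤∙ le (suc zero)) (le zero) ≤∙ +-mono-≤ (m≤n+m b 2) (m≤n+m b 2) ≤∙
          cong ((2 + b) +_) (sym (+-identityʳ (2 + b))) ≡∙≤ *-mono-≤ {2} {2 + b} (m≤m+n 2 b) (≤-reflexive (sym (*-identityʳ (2 + b))))) })
  (λ { (x ∷ y ∷ []) → sum x y ∙ +-comm y x })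
  where
  sum : ∀ x j → primrec x (λ _ a → suc a) j ≡ j + x
  sum x zero    = refl
  sum x (suc j) = cong suc (sum x j)

Comp-+ : Comp₂ _+_
Comp-+ = lift₂ {h = _+_} Comp-+'

Comp-*' : Comp {2} (λ ρ → lookup ρ zero * lookup ρ (suc zero))
Comp-*' = Comp-primrec-≗ v₀ Comp-zero (Comp-+ v₃ v₁) 2
  (λ { {x ∷ y ∷ []} {b} le j j≤ → sq {b} (prod y j ≡∙≤ *-mono-≤ (j≤ ≤∙ le zero) (le (suc zero))) })
  (λ { (x ∷ y ∷ []) → prod y x })
  where
  prod : ∀ y j → primrec 0 (λ _ a → y + a) j ≡ j * y
  prod y zero    = refl
  prod y (suc j) = cong (y +_) (prod y j)

Comp-* : Comp₂ _*_
Comp-* = lift₂ {h = _*_} Comp-*'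

Comp-pred : Comp₁ pred
Comp-pred = lift₁ {h = pred} (Comp-primrec-≗ v₀ Comp-zero v₀ 1
  (λ { {x ∷ []} {b} le zero j≤ → z≤n ; {x ∷ []} {b} le (suc j) j≤ → arg≤ b ((<⇒≤ j≤) ≤∙ le zero) })
  (λ { (zero ∷ []) → refl ; (suc x ∷ []) → refl }))

Comp-∸ : Comp₂ _∸_
Comp-∸ = lift₂ {h = _∸_} (Comp-primrec-≗ v₁ v₀ (Comp-pred v₁) 1
  (λ { {x ∷ y ∷ []} {b} le j j≤ → arg≤ b (diff x j ≡∙≤ m∸n≤m x j ≤∙ le zero) })
  (λ { (x ∷ y ∷ []) → diff x y }))
  where
  diff : ∀ x j → primrec x (λ _ a → pred a) j ≡ x ∸ j
  diff x zero    = refl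
  diff x (suc j) = cong pred (diff x j) ∙ pred[m∸n]≡m∸[1+n] x j

choose : ℕ → ℕ → ℕ → ℕ
choose zero x y = y
choose (suc _) x y = x

Comp-choose : Comp₃ choose
Comp-choose = lift₃ {h = choose} (Comp-primrec-≗ v₀ v₂ v₃ 1
  (λ { {c ∷ x ∷ y ∷ []} {b} le zero j≤ → arg≤ b (le (suc (suc zero))) ; {c ∷ x ∷ y ∷ []} {b} le (suc j) j≤ → arg≤ b (le (suc zero)) })
  (λ { (zero ∷ x ∷ y ∷ []) → refl ; (suc c ∷ x ∷ y ∷ []) → refl }))

leq : ℕ → ℕ → ℕ
leq x y = 1 ∸ (x ∸ y)

leq-≤ : ∀ {x y} → x ≤ y → leq x y ≡ 1
leq-≤ le = cong (1 ∸_) (m≤n⇒m∸n≡0 le)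

leq-> : ∀ {x y} → y < x → leq x y ≡ 0
leq-> {x} {y} lt with x ∸ y | m<n⇒0<n∸m lt
... | suc d | _ = 0∸n≡0 d

Comp-leq : Comp₂ leq
Comp-leq c d = Comp-∸ (Comp-const 1) (Comp-∸ c d)

below-next-multiple : ∀ x d → x < suc (x / suc d) * suc d
below-next-multiple x d = begin-strict
  x ≡⟨ m≡m%n+[m/n]*n x (suc d) ⟩
  x % suc d + x / suc d * suc d <⟨ +-monoˡ-< (x / suc d * suc d) (m%n<n x (suc d)) ⟩
  suc d + x / suc d * suc d ∎
  where open ≤-Reasoning

-- Division counts upwards as long as the next multiple still fits. As the quotient is at most `x`,
-- it is reached after `x` rounds, and surplus rounds leave it unchanged.
Comp-/ : Comp₂ (λ x y → x / suc y)
Comp-/ = lift₂ {h = λ x d → x / suc d} (Comp-primrec-≗ v₀ Comp-zero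
  (Comp-choose (Comp-leq (Comp-* (Comp-suc v₁) (Comp-suc v₃)) v₂) (Comp-suc v₁) v₁) 1
  (λ { {x ∷ d ∷ []} {b} le j j≤ → arg≤ b (quot x d j ≡∙≤ m⊓n≤m j _ ≤∙ j≤ ≤∙ le zero) })
  (λ { (x ∷ d ∷ []) → quot x d x ∙ m≥n⇒m⊓n≡n (m/n≤m x (suc d)) }))
  where
  stepᵠ : ℕ → ℕ → ℕ → ℕ
  stepᵠ x d a = choose (leq (suc a * suc d) x) (suc a) a
  below : ∀ x d a → a < x / suc d → stepᵠ x d a ≡ suc a
  below x d a lt rewrite leq-≤ (*-monoˡ-≤ (suc d) lt ≤∙ m/n*n≤m x (suc d)) = refl
  above : ∀ x d a → x / suc d ≤ a → stepᵠ x d a ≡ a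
  above x d a le rewrite leq-> {suc a * suc d} {x} (below-next-multiple x d ≤∙ *-monoˡ-≤ (suc d) (s≤s le)) = refl
  quot : ∀ x d j → primrec 0 (λ _ a → stepᵠ x d a) j ≡ j ⊓ (x / suc d)
  quot x d zero    = refl
  quot x d (suc j) with j <? x / suc d
  ... | yes lt = cong (stepᵠ x d) (quot x d j ∙ m≤n⇒m⊓n≡m (<⇒≤ lt)) ∙ below x d j lt ∙ sym (m≤n⇒m⊓n≡m lt)
  ... | no ge  = cong (stepᵠ x d) (quot x d j ∙ m≥n⇒m⊓n≡n (≮⇒≥ ge)) ∙
                   above x d _ ≤-refl ∙ sym (m≥n⇒m⊓n≡n ((≮⇒≥ ge) ≤∙ n≤1+n j))

Comp-% : Comp₂ (λ x y → x % suc y)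
Comp-% {f = f} {g} c d = Comp-≗ (λ ρ → sym (m%n≡m∸m/n*n (f ρ) (suc (g ρ)))) (Comp-∸ c (Comp-* (Comp-/ c d) (Comp-suc d)))

-- The i-th digit of x in base 1 + d.
shift : ℕ → ℕ → ℕ → ℕ
shift d x i = primrec x (λ _ a → a / suc d) i

digit : ℕ → ℕ → ℕ → ℕ
digit d x i = shift d x i % suc d

Comp-shift : Comp₃ shift
Comp-shift = lift₃ {h = shift} (Comp-primrec v₂ v₁ (Comp-/ v₁ v₂) 1
  (λ { {d ∷ x ∷ i ∷ []} {b} le j j≤ → arg≤ b (shift≤ d x j ≤∙ le (suc zero)) }))
  where
  shift≤ : ∀ d x i → shift d x i ≤ x
  shift≤ d x zero    = ≤-refl
  shift≤ d x (suc i) = m/n≤m (shift d x i) (suc d) ≤∙ shift≤ d x i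

Comp-digit : Comp₃ digit
Comp-digit c d e = Comp-% (Comp-shift c d e) c

shift-suc : ∀ d x i → shift d x (suc i) ≡ shift d (x / suc d) i
shift-suc d x zero    = refl
shift-suc d x (suc i) = cong (_/ suc d) (shift-suc d x i)

digit-suc : ∀ d x i → digit d x (suc i) ≡ digit d (x / suc d) i
digit-suc d x i = cong (_% suc d) (shift-suc d x i)

cons-% : ∀ {d a} x → a ≤ d → (a + x * suc d) % suc d ≡ a
cons-% {d} {a} x le = [m+kn]%n≡m%n a x (suc d) ∙ m<n⇒m%n≡m (s≤s le)

cons-/ : ∀ {d a} x → a ≤ d → (a + x * suc d) / suc d ≡ x
cons-/ {d} {a} x le = +-distrib-/ a (x * suc d) (s≤s (≤-reflexive (cong (a % suc d +_) (m*n%n≡0 x (suc d)) ∙ +-identityʳ _)) ≤∙ m%n<n a (suc d)) ∙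
  cong₂ _+_ (m<n⇒m/n≡0 (s≤s le)) (m*n/n≡m x (suc d))

fromDigits : ℕ → ℕ → (ℕ → ℕ) → ℕ
fromDigits d zero f = 0
fromDigits d (suc m) f = f 0 + fromDigits d m (f ∘ suc) * suc d

fromDigits-< : ∀ d m f → (∀ i → i < m → f i ≤ d) → fromDigits d m f < suc d ^ m
fromDigits-< d zero f le = ≤-refl
fromDigits-< d (suc m) f le = begin-strict
  f 0 + x * suc d <⟨ s≤s (+-monoˡ-≤ (x * suc d) (le 0 (s≤s z≤n))) ⟩
  suc x * suc d ≤⟨ *-monoˡ-≤ (suc d) (fromDigits-< d m (f ∘ suc) (λ i lt → le (suc i) (s≤s lt))) ⟩
  suc d ^ m * suc d ≡⟨ *-comm (suc d ^ m) (suc d) ⟩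
  suc d ^ suc m ∎
  where
  open ≤-Reasoning
  x = fromDigits d m (f ∘ suc)

digit-fromDigits : ∀ d m f → (∀ i → i < m → f i ≤ d) → ∀ {i} → i < m → digit d (fromDigits d m f) i ≡ f i
digit-fromDigits d (suc m) f le {zero} lt =
  cons-% (fromDigits d m (f ∘ suc)) (le 0 (s≤s z≤n))
digit-fromDigits d (suc m) f le {suc i} (s≤s lt) = digit-suc d _ i ∙ cong (λ y → digit d y i) (cons-/ x (le 0 (s≤s z≤n))) ∙ digit-fromDigits d m (f ∘ suc) (λ i lt → le (suc i) (s≤s lt)) lt
  where
  x = fromDigits d m (f ∘ suc)

-- Bounded arithmetic formulas and their characteristic functions.

data Tm (k : ℕ) : Set where
  var : Fin k → Tm k
  lit : ℕ → Tm k
  _⊕_ : Tm k → Tm k → Tm k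
  _⊗_ : Tm k → Tm k → Tm k
  dig : Tm k → Tm k → Tm k → Tm k
  fun : (h : ℕ → ℕ → ℕ) → Comp {2} (λ ρ → h (lookup ρ zero) (lookup ρ (suc zero))) → Tm k → Tm k → Tm k

infixl 6 _⊕_
infixl 7 _⊗_

⟦_⟧ᵗ : ∀ {k} → Tm k → Vec ℕ k → ℕ
⟦ var i ⟧ᵗ ρ = lookup ρ i
⟦ lit n ⟧ᵗ ρ = n
⟦ t ⊕ u ⟧ᵗ ρ = ⟦ t ⟧ᵗ ρ + ⟦ u ⟧ᵗ ρ
⟦ t ⊗ u ⟧ᵗ ρ = ⟦ t ⟧ᵗ ρ * ⟦ u ⟧ᵗ ρ
⟦ dig d x i ⟧ᵗ ρ = digit (⟦ d ⟧ᵗ ρ) (⟦ x ⟧ᵗ ρ) (⟦ i ⟧ᵗ ρ)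
⟦ fun h c t u ⟧ᵗ ρ = h (⟦ t ⟧ᵗ ρ) (⟦ u ⟧ᵗ ρ)

Comp-Tm : ∀ {k} (t : Tm k) → Comp ⟦ t ⟧ᵗ
Comp-Tm (var i) = Comp-lookup i
Comp-Tm (lit n) = Comp-const n
Comp-Tm (t ⊕ u) = Comp-+ (Comp-Tm t) (Comp-Tm u)
Comp-Tm (t ⊗ u) = Comp-* (Comp-Tm t) (Comp-Tm u)
Comp-Tm (dig d x i) = Comp-digit (Comp-Tm d) (Comp-Tm x) (Comp-Tm i)
Comp-Tm (fun h c t u) = lift₂ {h = h} c (Comp-Tm t) (Comp-Tm u)

⟦_⟧ᵗˢ : ∀ {k l} → Vec (Tm k) l → Vec ℕ k → Vec ℕ l
⟦ ts ⟧ᵗˢ ρ = Vec.map (λ t → ⟦ t ⟧ᵗ ρ) ts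

-- Bounded formulas of arithmetic with additional computable relations.
data Fm : ℕ → Set where
  _≐_ _≼_       : ∀ {k} → Tm k → Tm k → Fm k
  ¬̇_            : ∀ {k} → Fm k → Fm k
  _∧̇_ _∨̇_ _⇒̇_ : ∀ {k} → Fm k → Fm k → Fm k
  ∃̇ ∀̇          : ∀ {k} → Tm k → Fm (suc k) → Fm k
  call          : ∀ {k l} → Fm l → Vec (Tm k) l → Fm k
  rel           : ∀ {k} {f : Vec ℕ k → ℕ} → Comp f → Fm k

infix 5 _≐_ _≼_
infixr 4 _∧̇_
infixr 3 _∨̇_
infixr 2 _⇒̇_
infix 6 ¬̇_

⟦_⟧ : ∀ {k} → Fm k → Vec ℕ k → Set
⟦ t ≐ u ⟧ ρ = ⟦ t ⟧ᵗ ρ ≡ ⟦ u ⟧ᵗ ρ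
⟦ t ≼ u ⟧ ρ = ⟦ t ⟧ᵗ ρ ≤ ⟦ u ⟧ᵗ ρ
⟦ ¬̇ F ⟧ ρ = ¬ ⟦ F ⟧ ρ
⟦ F ∧̇ G ⟧ ρ = ⟦ F ⟧ ρ × ⟦ G ⟧ ρ
⟦ F ∨̇ G ⟧ ρ = ⟦ F ⟧ ρ ⊎ ⟦ G ⟧ ρ
⟦ F ⇒̇ G ⟧ ρ = ⟦ F ⟧ ρ → ⟦ G ⟧ ρ
⟦ ∃̇ t F ⟧ ρ = ∃[ i ] i < ⟦ t ⟧ᵗ ρ × ⟦ F ⟧ (i ∷ ρ)
⟦ ∀̇ t F ⟧ ρ = ∀ i → i < ⟦ t ⟧ᵗ ρ → ⟦ F ⟧ (i ∷ ρ)
⟦ call F ts ⟧ ρ = ⟦ F ⟧ (⟦ ts ⟧ᵗˢ ρ)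
⟦ rel {f = f} c ⟧ ρ = f ρ ≢ 0

-- Ties a numerical truth value to a decision of `P`, so that matching on both together settles each
-- connective.
Truth : ℕ → Set → Set
Truth n P = (n ≡ 1 × P) ⊎ (n ≡ 0 × ¬ P)

truth-≤1 : ∀ {n P} → Truth n P → n ≤ 1
truth-≤1 (inj₁ (refl , _)) = ≤-refl
truth-≤1 (inj₂ (refl , _)) = z≤n

anyBelow allBelow : (ℕ → ℕ) → ℕ → ℕ
anyBelow f = primrec 0 (λ i a → 1 ∸ (1 ∸ a) * (1 ∸ f i))
allBelow f = primrec 1 (λ i a → a * f i)

χ : ∀ {k} → Fm k → Vec ℕ k → ℕ
χ (t ≐ u) ρ = leq (⟦ t ⟧ᵗ ρ) (⟦ u ⟧ᵗ ρ) * leq (⟦ u ⟧ᵗ ρ) (⟦ t ⟧ᵗ ρ)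
χ (t ≼ u) ρ = leq (⟦ t ⟧ᵗ ρ) (⟦ u ⟧ᵗ ρ)
χ (¬̇ F) ρ = 1 ∸ χ F ρ
χ (F ∧̇ G) ρ = χ F ρ * χ G ρ
χ (F ∨̇ G) ρ = 1 ∸ (1 ∸ χ F ρ) * (1 ∸ χ G ρ)
χ (F ⇒̇ G) ρ = 1 ∸ χ F ρ * (1 ∸ χ G ρ)
χ (∃̇ t F) ρ = anyBelow (λ i → χ F (i ∷ ρ)) (⟦ t ⟧ᵗ ρ)
χ (∀̇ t F) ρ = allBelow (λ i → χ F (i ∷ ρ)) (⟦ t ⟧ᵗ ρ)
χ (call F ts) ρ = χ F (⟦ ts ⟧ᵗˢ ρ)
χ (rel {f = f} c) ρ = 1 ∸ (1 ∸ f ρ)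

truth-any : ∀ {f : ℕ → ℕ} {P : ℕ → Set} → (∀ i → Truth (f i) (P i)) → ∀ n → Truth (anyBelow f n) (∃[ i ] i < n × P i)
truth-any t zero = inj₂ (refl , λ { (_ , () , _) })
truth-any {f} t (suc n) with anyBelow f n | truth-any t n | f n | t n
... | _ | inj₁ (refl , i , lt , p) | a | _ = inj₁ (refl , i , lt ≤∙ n≤1+n n , p)
... | _ | inj₂ (refl , none) | _ | inj₁ (refl , p) = inj₁ (refl , n , ≤-refl , p)
... | _ | inj₂ (refl , none) | _ | inj₂ (refl , np) = inj₂ (refl , λ { (i , s≤s le , p) → absurd i le p })
  where
  absurd : ∀ i → i ≤ n → _ → ⊥
  absurd i le p with m≤n⇒m<n∨m≡n le
  ... | inj₁ lt   = none (i , lt , p)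
  ... | inj₂ refl = np p

truth-all : ∀ {f : ℕ → ℕ} {P : ℕ → Set} → (∀ i → Truth (f i) (P i)) → ∀ n → Truth (allBelow f n) (∀ i → i < n → P i)
truth-all t zero = inj₁ (refl , λ _ ())
truth-all {f} t (suc n) with allBelow f n | truth-all t n | f n | t n
... | _ | inj₂ (refl , no-all) | _ | _ = inj₂ (refl , λ h → no-all (λ i lt → h i (lt ≤∙ n≤1+n n)))
... | _ | inj₁ (refl , h) | _ | inj₂ (refl , np) = inj₂ (refl , λ h → np (h n ≤-refl))
... | _ | inj₁ (refl , h) | _ | inj₁ (refl , p) = inj₁ (refl , λ i lt → both i (s≤s⁻¹ lt))
  where
  both : ∀ i → i ≤ n → _
  both i le with m≤n⇒m<n∨m≡n le
  ... | inj₁ lt   = h i lt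
  ... | inj₂ refl = p

truth-leq : ∀ x y → Truth (leq x y) (x ≤ y)
truth-leq x y with x ≤? y
... | yes le = inj₁ (leq-≤ le , le)
... | no gt  = inj₂ (leq-> (≰⇒> gt) , gt)

χ-correct : ∀ {k} (F : Fm k) ρ → Truth (χ F ρ) (⟦ F ⟧ ρ)
χ-correct (t ≐ u) ρ with leq (⟦ t ⟧ᵗ ρ) (⟦ u ⟧ᵗ ρ) | truth-leq (⟦ t ⟧ᵗ ρ) (⟦ u ⟧ᵗ ρ) | leq (⟦ u ⟧ᵗ ρ) (⟦ t ⟧ᵗ ρ) | truth-leq (⟦ u ⟧ᵗ ρ) (⟦ t ⟧ᵗ ρ)
... | _ | inj₁ (refl , p) | _ | inj₁ (refl , q) = inj₁ (refl , ≤-antisym p q)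
... | _ | inj₂ (refl , p) | _ | _               = inj₂ (refl , λ eq → p (≤-reflexive eq))
... | _ | inj₁ (refl , p) | _ | inj₂ (refl , q) = inj₂ (refl , λ eq → q (≤-reflexive (sym eq)))
χ-correct (t ≼ u) ρ = truth-leq _ _
χ-correct (¬̇ F) ρ with χ F ρ | χ-correct F ρ
... | _ | inj₁ (refl , p) = inj₂ (refl , λ np → np p)
... | _ | inj₂ (refl , p) = inj₁ (refl , p)
χ-correct (F ∧̇ G) ρ with χ F ρ | χ-correct F ρ | χ G ρ | χ-correct G ρ
... | _ | inj₁ (refl , p) | _ | inj₁ (refl , q) = inj₁ (refl , p , q)
... | _ | inj₁ (refl , p) | _ | inj₂ (refl , q) = inj₂ (refl , q ∘ proj₂)
... | _ | inj₂ (refl , p) | _ | _               = inj₂ (refl , p ∘ proj₁)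
χ-correct (F ∨̇ G) ρ with χ F ρ | χ-correct F ρ | χ G ρ | χ-correct G ρ
... | _ | inj₁ (refl , p) | _ | _               = inj₁ (refl , inj₁ p)
... | _ | inj₂ (refl , p) | _ | inj₁ (refl , q) = inj₁ (refl , inj₂ q)
... | _ | inj₂ (refl , p) | _ | inj₂ (refl , q) = inj₂ (refl , [ p , q ]′)
χ-correct (F ⇒̇ G) ρ with χ F ρ | χ-correct F ρ | χ G ρ | χ-correct G ρ
... | _ | inj₁ (refl , p) | _ | inj₁ (refl , q) = inj₁ (refl , λ _ → q)
... | _ | inj₁ (refl , p) | _ | inj₂ (refl , q) = inj₂ (refl , λ h → q (h p))
... | _ | inj₂ (refl , p) | _ | _               = inj₁ (refl , ⊥-elim ∘ p)
χ-correct (∃̇ t F) ρ = truth-any (λ i → χ-correct F (i ∷ ρ)) (⟦ t ⟧ᵗ ρ)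
χ-correct (∀̇ t F) ρ = truth-all (λ i → χ-correct F (i ∷ ρ)) (⟦ t ⟧ᵗ ρ)
χ-correct (call F ts) ρ = χ-correct F (⟦ ts ⟧ᵗˢ ρ)
χ-correct (rel {f = f} c) ρ with f ρ
... | zero  = inj₂ (refl , λ ne → ne refl)
... | suc n = inj₁ (cong (1 ∸_) (0∸n≡0 n) , λ ())

-- A bounded quantifier is a recursion whose accumulator is a truth value, hence the degree 0 in its
-- bound.
Comp-χ : ∀ {k} (F : Fm k) → Comp (χ F)
Comp-χ (t ≐ u) = Comp-* (Comp-leq (Comp-Tm t) (Comp-Tm u)) (Comp-leq (Comp-Tm u) (Comp-Tm t))
Comp-χ (t ≼ u) = Comp-leq (Comp-Tm t) (Comp-Tm u)
Comp-χ (¬̇ F) = Comp-∸ (Comp-const 1) (Comp-χ F)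
Comp-χ (F ∧̇ G) = Comp-* (Comp-χ F) (Comp-χ G)
Comp-χ (F ∨̇ G) = Comp-∸ (Comp-const 1) (Comp-* (Comp-∸ (Comp-const 1) (Comp-χ F)) (Comp-∸ (Comp-const 1) (Comp-χ G)))
Comp-χ (F ⇒̇ G) = Comp-∸ (Comp-const 1) (Comp-* (Comp-χ F) (Comp-∸ (Comp-const 1) (Comp-χ G)))
Comp-χ (∃̇ t F) = Comp-primrec (Comp-Tm t) Comp-zero
  (Comp-∸ (Comp-const 1) (Comp-* (Comp-∸ (Comp-const 1) v₁) (Comp-∸ (Comp-const 1) (weaken₁ (Comp-χ F))))) 0
  (λ { {ρ} le j j≤ → truth-≤1 (truth-any (λ i → χ-correct F (i ∷ ρ)) j) })
Comp-χ (∀̇ t F) = Comp-primrec (Comp-Tm t) (Comp-const 1)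
  (Comp-* v₁ (weaken₁ (Comp-χ F))) 0
  (λ { {ρ} le j j≤ → truth-≤1 (truth-all (λ i → χ-correct F (i ∷ ρ)) j) })
Comp-χ (call F ts) = Comp-≗ (λ ρ → cong (χ F) (eq ts ρ)) (Comp-compose (Comp-χ F) (comps ts))
  where
  comps : ∀ {k l} (ts : Vec (Tm k) l) → All Comp (Vec.map ⟦_⟧ᵗ ts)
  comps []       = []
  comps (t ∷ ts) = Comp-Tm t ∷ comps ts
  eq : ∀ {k l} (ts : Vec (Tm k) l) ρ → Vec.map (λ g → g ρ) (Vec.map ⟦_⟧ᵗ ts) ≡ ⟦ ts ⟧ᵗˢ ρ
  eq [] ρ = refl
  eq (t ∷ ts) ρ = cong (⟦ t ⟧ᵗ ρ ∷_) (eq ts ρ)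
Comp-χ (rel c) = Comp-∸ (Comp-const 1) (Comp-∸ (Comp-const 1) c)

-- Savitch's reachability test on stacks coded as numbers.

-- Reachability by divide and conquer through a midpoint, as in Savitch's theorem.
Within : (ℕ → ℕ → Set) → ℕ → ℕ → ℕ → ℕ → Set
Within E Z zero x y = x ≡ y ⊎ E x y
Within E Z (suc d) x y = ∃[ m ] m < Z × Within E Z d x m × Within E Z d m y

-- A stack of numbers below 1 + w, coded as a number in base 1 + w.
stack : ℕ → List ℕ → ℕ
stack w []       = 0
stack w (x ∷ xs) = x + stack w xs * suc w

Digits : ℕ → List ℕ → Set
Digits w = AllL.All (_≤ w)

stack-< : ∀ {w xs} → Digits w xs → stack w xs < suc w ^ length xs
stack-< []                     = ≤-refl
stack-< {w} {x ∷ xs} (le ∷ ds) = begin-strict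
  x + stack w xs * suc w <⟨ s≤s (+-monoˡ-≤ (stack w xs * suc w) le) ⟩
  suc (stack w xs) * suc w ≤⟨ *-monoˡ-≤ (suc w) (stack-< ds) ⟩
  suc w ^ length xs * suc w ≡⟨ *-comm (suc w ^ length xs) (suc w) ⟩
  suc w ^ suc (length xs) ∎
  where open ≤-Reasoning

digit-zero : ∀ {w x} xs → x ≤ w → digit w (stack w (x ∷ xs)) 0 ≡ x
digit-zero {w} xs le = cons-% (stack w xs) le

digit-next : ∀ {w x} xs → x ≤ w → ∀ i → digit w (stack w (x ∷ xs)) (suc i) ≡ digit w (stack w xs) i
digit-next {w} {x} xs le i = digit-suc w (stack w (x ∷ xs)) i ∙ cong (λ y → digit w y i) (cons-/ (stack w xs) le)

shift-next : ∀ {w x} xs → x ≤ w → ∀ i → shift w (stack w (x ∷ xs)) (suc i) ≡ shift w (stack w xs) i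
shift-next {w} {x} xs le i = shift-suc w (stack w (x ∷ xs)) i ∙ cong (λ y → shift w y i) (cons-/ (stack w xs) le)

nth : List ℕ → ℕ → ℕ
nth [] i       = 0
nth (x ∷ xs) zero    = x
nth (x ∷ xs) (suc i) = nth xs i

digit-stack : ∀ {w xs} → Digits w xs → ∀ i → i < length xs → digit w (stack w xs) i ≡ nth xs i
digit-stack {xs = x ∷ xs} (le ∷ ds) zero lt       = digit-zero xs le
digit-stack {xs = x ∷ xs} (le ∷ ds) (suc i) (s≤s lt) = digit-next xs le i ∙ digit-stack ds i lt

digit-0 : ∀ w i → digit w 0 i ≡ 0
digit-0 w zero    = refl
digit-0 w (suc i) = digit-suc w 0 i ∙ digit-0 w i

digit-lit : ∀ {w xs} → Digits w xs → ∀ i {_ : T (i <ᵇ length xs)} → digit w (stack w xs) i ≡ nth xs i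
digit-lit ds i {lt} = digit-stack ds i (<ᵇ⇒< i _ lt)

shift-stack : ∀ {w xs} → Digits w xs → ∀ i {_ : T (i ≤ᵇ length xs)} → shift w (stack w xs) i ≡ stack w (drop i xs)
shift-stack ds zero         = refl
shift-stack {xs = x ∷ xs} (le ∷ ds) (suc zero)    = shift-next xs le 0
shift-stack {xs = x ∷ xs} (le ∷ ds) (suc (suc i)) {lt} = shift-next xs le (suc i) ∙ shift-stack ds (suc i) {lt}

module Savitch {k : ℕ} (θ : Fm (2 + k)) (tZ tK tB tx ty : Tm k) where

  leafᶠ : Fm (2 + k)
  leafᶠ = var zero ≐ var (suc zero) ∨̇ θ

  module _ (ρ : Vec ℕ k) where

    -- `Z` bounds the nodes and `K` is the depth of the recursion; the largest digit `w` has room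
    -- for every node, every depth and the tags up to 2. `B` is at once the bound on stack codes and
    -- the number of transitions performed.
    Z K B w : ℕ
    Z = ⟦ tZ ⟧ᵗ ρ
    K = ⟦ tK ⟧ᵗ ρ
    B = ⟦ tB ⟧ᵗ ρ
    w = suc (suc (Z + K))

    Edge : ℕ → ℕ → Set
    Edge x y = ⟦ θ ⟧ (x ∷ y ∷ ρ)

    infixr 5 _▹_
    _▹_ : ℕ → ℕ → ℕ
    x ▹ c = x + c * suc w

    -- A call of depth d on (x , y) is coded by 2, d, x, y and a returned value b by b itself. On the stack below there are
    -- frames t, d, x, y, m: midpoint m is being tried, and its first (t = 1) or second (t = 2) half is being evaluated.
    dispatch : ℕ → ℕ → ℕ → ℕ → ℕ → ℕ → ℕ → ℕ → ℕ → ℕ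
    dispatch c d₀ d₁ d₂ d₃ d₄ d₅ s₄ s₆ = choose (leq 2 d₀)
      (choose d₁ (2 ▹ pred d₁ ▹ d₂ ▹ 0 ▹ 1 ▹ pred d₁ ▹ d₂ ▹ d₃ ▹ 0 ▹ s₄)
                 (χ leafᶠ (d₂ ∷ d₃ ∷ ρ) ▹ s₄))
      (choose d₁
        (choose d₀
          (choose (leq 2 d₁) (1 ▹ s₆) (2 ▹ d₂ ▹ d₅ ▹ d₄ ▹ 2 ▹ d₂ ▹ d₃ ▹ d₄ ▹ d₅ ▹ s₆))
          (choose (leq (2 + d₅) Z) (2 ▹ d₂ ▹ d₃ ▹ suc d₅ ▹ 1 ▹ d₂ ▹ d₃ ▹ d₄ ▹ suc d₅ ▹ s₆) (0 ▹ s₆)))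
        c)

    transition : ℕ → ℕ
    transition c = dispatch c (digit w c 0) (digit w c 1) (digit w c 2) (digit w c 3) (digit w c 4) (digit w c 5) (shift w c 4) (shift w c 6)

    -- Cutting off at `B` provides the a priori bound that bounded recursion asks for. The runs that
    -- matter never exceed `B`.
    clip : ℕ → ℕ
    clip c = choose (leq c B) c 0

    runs : ℕ → ℕ → ℕ
    runs c n = primrec c (λ _ a → clip (transition a)) n

    start : ℕ
    start = 2 ▹ K ▹ ⟦ tx ⟧ᵗ ρ ▹ ⟦ ty ⟧ᵗ ρ ▹ 0

    reachable : ℕ
    reachable = digit w (runs (clip start) B) 0

    clip≤ : ∀ c → clip c ≤ B
    clip≤ c with c ≤? B
    ... | yes le rewrite leq-≤ le = le
    ... | no gt rewrite leq-> (≰⇒> gt) = z≤n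

    clip-≤ : ∀ {c} → c ≤ B → clip c ≡ c
    clip-≤ le rewrite leq-≤ le = refl

    module _ {c d₀ d₁ d₂ d₃ d₄ d₅ s₄ s₆ : ℕ} where
      dispatched : digit w c 0 ≡ d₀ → digit w c 1 ≡ d₁ → digit w c 2 ≡ d₂ → digit w c 3 ≡ d₃ → digit w c 4 ≡ d₄ → digit w c 5 ≡ d₅ →
                   shift w c 4 ≡ s₄ → shift w c 6 ≡ s₆ → transition c ≡ dispatch c d₀ d₁ d₂ d₃ d₄ d₅ s₄ s₆
      dispatched refl refl refl refl refl refl refl refl = refl

    called : ∀ {d x y S} → Digits w (2 ∷ d ∷ x ∷ y ∷ S) →
             transition (stack w (2 ∷ d ∷ x ∷ y ∷ S)) ≡
             choose d (stack w (2 ∷ pred d ∷ x ∷ 0 ∷ 1 ∷ pred d ∷ x ∷ y ∷ 0 ∷ S)) (χ leafᶠ (x ∷ y ∷ ρ) ▹ stack w S)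
    called {d} {x} {y} {S} ds = dispatched {c = stack w (2 ∷ d ∷ x ∷ y ∷ S)} (digit-lit ds 0) (digit-lit ds 1) (digit-lit ds 2) (digit-lit ds 3) refl refl (shift-stack ds 4) refl

    returned : ∀ {b t d x y m S} → Digits w (b ∷ t ∷ d ∷ x ∷ y ∷ m ∷ S) →
               transition (stack w (b ∷ t ∷ d ∷ x ∷ y ∷ m ∷ S)) ≡
               dispatch (stack w (b ∷ t ∷ d ∷ x ∷ y ∷ m ∷ S)) b t d x y m (stack w (y ∷ m ∷ S)) (stack w S)
    returned {b} {t} {d} {x} {y} {m} {S} ds = dispatched {c = stack w (b ∷ t ∷ d ∷ x ∷ y ∷ m ∷ S)} (digit-lit ds 0) (digit-lit ds 1)
        (digit-lit ds 2) (digit-lit ds 3) (digit-lit ds 4) (digit-lit ds 5)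
      (shift-stack ds 4) (shift-stack ds 6)

    _⟶[_]_ : ℕ → ℕ → ℕ → Set
    c ⟶[ t ] c' = ∃[ n ] n ≤ t × runs c n ≡ c'

    runs-+ : ∀ c m n → runs c (m + n) ≡ runs (runs c n) m
    runs-+ c zero n = refl
    runs-+ c (suc m) n = cong (clip ∘ transition) (runs-+ c m n)

    infixr 4 _⟫_
    _⟫_ : ∀ {c c' c'' s t} → c ⟶[ s ] c' → c' ⟶[ t ] c'' → c ⟶[ s + t ] c''
    _⟫_ {c} {s = s} {t} (m , m≤ , refl) (n , n≤ , refl) = n + m , +-mono-≤ n≤ m≤ ≤∙≡ +-comm t s , runs-+ c n m

    record Room (n : ℕ) : Set where
      constructor room
      field
        room-≤ : suc w ^ n ≤ B

    shorter : ∀ {m n} → m ≤ n → Room n → Room m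
    shorter le (room le') = room (^-monoʳ-≤ (suc w) le ≤∙ le')

    stack-≤ : ∀ {xs} → Digits w xs → Room (length xs) → stack w xs ≤ B
    stack-≤ ds (room le) = (<⇒≤ (stack-< ds)) ≤∙ le

    single : ∀ {c} xs → Digits w xs → Room (length xs) → transition c ≡ stack w xs → c ⟶[ 1 ] stack w xs
    single {c} xs ds le eq = 1 , ≤-refl , cong clip eq ∙ clip-≤ (stack-≤ ds le)

    -- Each of the `Z` midpoints costs at most two recursive calls with one transition after each;
    -- the leading 1 is the transition that opens the call.
    time : ℕ → ℕ
    time zero    = 1
    time (suc d) = 1 + Z * (time d + (1 + (time d + 1)))

    x≤w : ∀ {x} → x ≤ Z → x ≤ w
    x≤w le = le ≤∙ m≤m+n Z K ≤∙ n≤1+n _ ≤∙ n≤1+n _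

    d≤w : ∀ {d} → d ≤ K → d ≤ w
    d≤w le = le ≤∙ m≤n+m K Z ≤∙ n≤1+n _ ≤∙ n≤1+n _

    1≤w : 1 ≤ w
    1≤w = s≤s z≤n

    2≤w : 2 ≤ w
    2≤w = s≤s (s≤s z≤n)

    Outcome : ℕ → ℕ → List ℕ → Set → Set
    Outcome c t S P = ∃[ b ] c ⟶[ t ] stack w (b ∷ S) × Truth b P

    truth≤w : ∀ {b P} → Truth b P → b ≤ w
    truth≤w t = truth-≤1 t ≤∙ 1≤w

    -- The room counts digits: every level of the recursion leaves a frame of 5 digits on the stack,
    -- and a call itself takes 4.
    evaluate : ∀ d {x y S} → d ≤ K → x < Z → y < Z → Digits w S → Room (length S + (5 * d + 4)) →
               Outcome (stack w (2 ∷ d ∷ x ∷ y ∷ S)) (time d) S (Within Edge Z d x y)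
    -- After `m` there are `j` more midpoints, and the answer only concerns those from `m` on. This
    -- makes the trial of midpoints an induction inside the induction on the depth.
    midpoints : ∀ d {x y S} j {m} → m + suc j ≡ Z → d ≤ K → x < Z → y < Z → Digits w S → Room (5 + length S + (5 * d + 4)) →
                Outcome (stack w (2 ∷ d ∷ x ∷ m ∷ 1 ∷ d ∷ x ∷ y ∷ m ∷ S)) (suc j * (time d + (1 + (time d + 1)))) S
                  (∃[ n ] m ≤ n × n < Z × Within Edge Z d x n × Within Edge Z d n y)
    evaluate zero {x} {y} {S} d≤ x< y< ds le = _ ,
      single (χ leafᶠ (x ∷ y ∷ ρ) ∷ S) (truth≤w t ∷ ds) (shorter (m≤m+n (suc (length S)) 3 ≤∙≡ len (length S)) le)
        (called (2≤w ∷ z≤n ∷ x≤w (<⇒≤ x<) ∷ x≤w (<⇒≤ y<) ∷ ds)) , t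
      where
      t = χ-correct leafᶠ (x ∷ y ∷ ρ)
      len : ∀ l → suc l + 3 ≡ l + 4
      len = solve-∀
    evaluate (suc d) {x} {y} {S} d≤ x< y< ds le = conclude (midpoints d (pred Z) (suc-pred-Z x<) (<⇒≤ d≤) x< y< ds le')
      where
      suc-pred-Z : ∀ {z} → x < z → suc (pred z) ≡ z
      suc-pred-Z (s≤s _) = refl
      le' : Room (5 + length S + (5 * d + 4))
      le' = subst Room (len (length S) d) le
        where
        len : ∀ l d → l + (5 * suc d + 4) ≡ 5 + l + (5 * d + 4)
        len = solve-∀
      first-step : stack w (2 ∷ suc d ∷ x ∷ y ∷ S) ⟶[ 1 ] stack w (2 ∷ d ∷ x ∷ 0 ∷ 1 ∷ d ∷ x ∷ y ∷ 0 ∷ S)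
      first-step = single (2 ∷ d ∷ x ∷ 0 ∷ 1 ∷ d ∷ x ∷ y ∷ 0 ∷ S)
        (2≤w ∷ d≤w (<⇒≤ d≤) ∷ x≤w (<⇒≤ x<) ∷ z≤n ∷ 1≤w ∷ d≤w (<⇒≤ d≤) ∷ x≤w (<⇒≤ x<) ∷ x≤w (<⇒≤ y<) ∷ z≤n ∷ ds)
        (shorter (len (length S) ≡∙≤ +-monoʳ-≤ (5 + length S) (m≤n+m 4 (5 * d))) le')
        (called (2≤w ∷ d≤w d≤ ∷ x≤w (<⇒≤ x<) ∷ x≤w (<⇒≤ y<) ∷ ds))
        where
        len : ∀ l → 9 + l ≡ 5 + l + 4
        len = solve-∀
      conclude : Outcome (stack w (2 ∷ d ∷ x ∷ 0 ∷ 1 ∷ d ∷ x ∷ y ∷ 0 ∷ S)) (suc (pred Z) * (time d + (1 + (time d + 1)))) S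
                   (∃[ n ] 0 ≤ n × n < Z × Within Edge Z d x n × Within Edge Z d n y) →
                 Outcome (stack w (2 ∷ suc d ∷ x ∷ y ∷ S)) (time (suc d)) S (Within Edge Z (suc d) x y)
      conclude (b , r , t) = b ,
        subst (λ z → stack w (2 ∷ suc d ∷ x ∷ y ∷ S) ⟶[ 1 + z * (time d + (1 + (time d + 1))) ] stack w (b ∷ S)) (suc-pred-Z x<) (first-step ⟫ r) , adjust t
        where
        adjust : Truth b _ → Truth b (Within Edge Z (suc d) x y)
        adjust (inj₁ (eq , n , _ , p)) = inj₁ (eq , n , p)
        adjust (inj₂ (eq , no-mid)) = inj₂ (eq , λ { (n , p) → no-mid (n , z≤n , p) })
    midpoints d {x} {y} {S} j {m} m+j d≤ x< y< ds le =
      first-half (evaluate d {x} {m} {1 ∷ d ∷ x ∷ y ∷ m ∷ S} d≤ x< m< (1≤w ∷ d≤w d≤ ∷ x≤w (<⇒≤ x<) ∷ x≤w (<⇒≤ y<) ∷ x≤w (<⇒≤ m<) ∷ ds) le)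
      where
      τ = time d
      m< : m < Z
      m< = s≤s (m≤m+n m j) ≤∙ sym (+-suc m j) ≡∙≤ ≤-reflexive m+j
      P : ℕ → Set
      P n = Within Edge Z d x n × Within Edge Z d n y
      nine : ∀ l → 9 + l ≡ 5 + l + 4
      nine = solve-∀
      le₉ : Room (9 + length S)
      le₉ = shorter (nine (length S) ≡∙≤ +-monoʳ-≤ (5 + length S) (m≤n+m 4 (5 * d))) le
      le₁ : Room (1 + length S)
      le₁ = shorter (m≤n+m (1 + length S) 8) le₉
      frame : ∀ {b t} → b ≤ w → t ≤ w → Digits w (b ∷ t ∷ d ∷ x ∷ y ∷ m ∷ S)
      frame b t = b ∷ t ∷ d≤w d≤ ∷ x≤w (<⇒≤ x<) ∷ x≤w (<⇒≤ y<) ∷ x≤w (<⇒≤ m<) ∷ ds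
      Goal : ℕ → ℕ → Set
      Goal c t = Outcome c t S (∃[ n ] m ≤ n × n < Z × P n)
      -- The current midpoint has failed; t is the half in which this was found.
      failed : ∀ t → 1 ≤ t → t ≤ 2 → ¬ P m → Goal (stack w (0 ∷ t ∷ d ∷ x ∷ y ∷ m ∷ S)) (1 + j * (τ + (1 + (τ + 1))))
      failed (suc t) _ t≤ np = go j m+j
        where
        retry : ℕ
        retry = stack w (2 ∷ d ∷ x ∷ suc m ∷ 1 ∷ d ∷ x ∷ y ∷ suc m ∷ S)
        np' : ∀ n → m ≤ n → P n → suc m ≤ n
        np' n m≤n p = ≤∧≢⇒< m≤n (λ { refl → np p })
        eq : transition (stack w (0 ∷ suc t ∷ d ∷ x ∷ y ∷ m ∷ S)) ≡
             choose (leq (2 + m) Z) retry (stack w (0 ∷ S))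
        eq = returned (frame z≤n (t≤ ≤∙ 2≤w))
        go : ∀ j → m + suc j ≡ Z → Goal (stack w (0 ∷ suc t ∷ d ∷ x ∷ y ∷ m ∷ S)) (1 + j * (τ + (1 + (τ + 1))))
        go zero m+1 = 0 , single (0 ∷ S) (z≤n ∷ ds) le₁ (eq ∙ cong (λ z → choose z retry (stack w (0 ∷ S))) (leq-> (s≤s (≤-reflexive (sym m+1 ∙ +-comm m 1))))) ,
          inj₂ (refl , λ { (n , m≤n , n< , p) → <⇒≱ n< (sym m+1 ∙ +-comm m 1 ≡∙≤ np' n m≤n p) })
        go (suc j) m+j' =
          let b , r , t' = midpoints d {x} {y} {S} j {suc m} (sym (+-suc m (suc j)) ∙ m+j') d≤ x< y< ds le
          in b ,
          (single (2 ∷ d ∷ x ∷ suc m ∷ 1 ∷ d ∷ x ∷ y ∷ suc m ∷ S)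
            (2≤w ∷ d≤w d≤ ∷ x≤w (<⇒≤ x<) ∷ x≤w m< ∷ 1≤w ∷ d≤w d≤ ∷ x≤w (<⇒≤ x<) ∷ x≤w (<⇒≤ y<) ∷ x≤w m< ∷ ds) le₉
            (eq ∙ cong (λ z → choose z retry (stack w (0 ∷ S))) (leq-≤ 2+m≤))
          ⟫ r) , adjust t'
          where
          2+m≤ : 2 + m ≤ Z
          2+m≤ = m≤m+n (2 + m) j ≤∙ sym (+-suc m (suc j) ∙ cong suc (+-suc m j)) ≡∙≤ ≤-reflexive m+j'
          adjust : ∀ {b} → Truth b (∃[ n ] suc m ≤ n × n < Z × P n) → Truth b (∃[ n ] m ≤ n × n < Z × P n)
          adjust (inj₁ (eq , n , le , p)) = inj₁ (eq , n , <⇒≤ le , p)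
          adjust (inj₂ (eq , no-mid)) = inj₂ (eq , λ { (n , m≤n , n< , p) → no-mid (n , np' n m≤n p , n< , p) })
      second-half : Outcome (stack w (2 ∷ d ∷ m ∷ y ∷ 2 ∷ d ∷ x ∷ y ∷ m ∷ S)) τ (2 ∷ d ∷ x ∷ y ∷ m ∷ S) (Within Edge Z d m y) →
                    Within Edge Z d x m → Goal (stack w (1 ∷ 1 ∷ d ∷ x ∷ y ∷ m ∷ S)) (1 + (τ + 1) + j * (τ + (1 + (τ + 1))))
      second-half (b , r , t) p = finish b r t
        where
        r₀ : stack w (1 ∷ 1 ∷ d ∷ x ∷ y ∷ m ∷ S) ⟶[ 1 ] stack w (2 ∷ d ∷ m ∷ y ∷ 2 ∷ d ∷ x ∷ y ∷ m ∷ S)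
        r₀ = single (2 ∷ d ∷ m ∷ y ∷ 2 ∷ d ∷ x ∷ y ∷ m ∷ S)
          (2≤w ∷ d≤w d≤ ∷ x≤w (<⇒≤ m<) ∷ x≤w (<⇒≤ y<) ∷ 2≤w ∷ d≤w d≤ ∷ x≤w (<⇒≤ x<) ∷ x≤w (<⇒≤ y<) ∷ x≤w (<⇒≤ m<) ∷ ds) le₉
          (returned (frame 1≤w 1≤w))
        finish : ∀ b → stack w (2 ∷ d ∷ m ∷ y ∷ 2 ∷ d ∷ x ∷ y ∷ m ∷ S) ⟶[ τ ] stack w (b ∷ 2 ∷ d ∷ x ∷ y ∷ m ∷ S) → Truth b (Within Edge Z d m y) →
                 Goal (stack w (1 ∷ 1 ∷ d ∷ x ∷ y ∷ m ∷ S)) (1 + (τ + 1) + j * (τ + (1 + (τ + 1))))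
        finish .1 r (inj₁ (refl , q)) = 1 ,
          lengthen (+-monoʳ-≤ 1 (≤-reflexive refl)) (r₀ ⟫ r ⟫ single (1 ∷ S) (1≤w ∷ ds) le₁ (returned (frame 1≤w 2≤w))) ,
          inj₁ (refl , m , ≤-refl , m< , p , q)
          where
          lengthen : ∀ {c c' s} → s ≤ 1 + (τ + 1) → c ⟶[ s ] c' → c ⟶[ 1 + (τ + 1) + j * (τ + (1 + (τ + 1))) ] c'
          lengthen le (n , n≤ , eq) = n , n≤ ≤∙ le ≤∙ m≤m+n _ _ , eq
        finish .0 r (inj₂ (refl , nq)) =
          let b , r' , t = failed 2 (s≤s z≤n) ≤-refl (nq ∘ proj₂)
          in b , subst (λ n → stack w (1 ∷ 1 ∷ d ∷ x ∷ y ∷ m ∷ S) ⟶[ n ] stack w (b ∷ S)) (arith τ (j * (τ + (1 + (τ + 1))))) (r₀ ⟫ r ⟫ r') , t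
          where
          arith : ∀ t u → 1 + (t + (1 + u)) ≡ 1 + (t + 1) + u
          arith = solve-∀
      first-half : Outcome (stack w (2 ∷ d ∷ x ∷ m ∷ 1 ∷ d ∷ x ∷ y ∷ m ∷ S)) τ (1 ∷ d ∷ x ∷ y ∷ m ∷ S) (Within Edge Z d x m) →
                   Goal (stack w (2 ∷ d ∷ x ∷ m ∷ 1 ∷ d ∷ x ∷ y ∷ m ∷ S)) (suc j * (τ + (1 + (τ + 1))))
      first-half (.1 , r , inj₁ (refl , p)) =
        let b , r' , t = second-half (evaluate d {m} {y} {2 ∷ d ∷ x ∷ y ∷ m ∷ S} d≤ m< y< (2≤w ∷ d≤w d≤ ∷ x≤w (<⇒≤ x<) ∷ x≤w (<⇒≤ y<) ∷ x≤w (<⇒≤ m<) ∷ ds) le) p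
        in b , subst (λ n → stack w (2 ∷ d ∷ x ∷ m ∷ 1 ∷ d ∷ x ∷ y ∷ m ∷ S) ⟶[ n ] stack w (b ∷ S)) (sym (+-assoc τ (1 + (τ + 1)) _)) (r ⟫ r') , t
      first-half (.0 , r , inj₂ (refl , np)) =
        let b , r' , t = failed 1 ≤-refl (s≤s z≤n) (np ∘ proj₁)
        in b , lengthen (r ⟫ r') , t
        where
        lengthen : ∀ {c c'} → c ⟶[ τ + (1 + j * (τ + (1 + (τ + 1)))) ] c' → c ⟶[ suc j * (τ + (1 + (τ + 1))) ] c'
        lengthen (n , n≤ , eq) = n , n≤ ≤∙ (+-monoʳ-≤ τ (+-monoˡ-≤ (j * (τ + (1 + (τ + 1)))) (m≤m+n 1 (τ + 1))) ≤∙≡ sym (+-assoc τ (1 + (τ + 1)) _)) , eq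

    -- The factor `1 + 4 * Z` of one level is at most the square of the base. Two digits per level
    -- are less than the five for which there is room, so `B` steps are enough as well.
    time-bound : ∀ d → time d ≤ (suc w ^ 2) ^ d
    time-bound zero    = ≤-refl
    time-bound (suc d) = +-mono-≤ (m^n>0 (suc w ^ 2) d) (*-monoʳ-≤ Z (+-mono-≤ (time-bound d) (+-mono-≤ (m^n>0 (suc w ^ 2) d) (+-mono-≤ (time-bound d) (m^n>0 (suc w ^ 2) d))))) ≤∙
      arith Z ((suc w ^ 2) ^ d) ≡∙≤ *-monoˡ-≤ ((suc w ^ 2) ^ d) (m≤m+n (1 + 4 * Z) (8 + 2 * Z + Z * Z + 6 * K + 2 * (Z * K) + K * K) ≤∙≡ sym (square Z K))
      where
      arith : ∀ z x → x + z * (x + (x + (x + x))) ≡ (1 + 4 * z) * x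
      arith = solve-∀
      square : ∀ z k → suc (suc (suc (z + k))) * (suc (suc (suc (z + k))) * 1) ≡ (1 + 4 * z) + (8 + 2 * z + z * z + 6 * k + 2 * (z * k) + k * k)
      square = solve-∀

    -- With one digit on the stack the next digit reads 0, which is not the tag of a frame. The
    -- configuration then repeats itself, so surplus transitions do no harm.
    halting : ∀ {b} → b ≤ 1 → b ≤ B → transition (stack w (b ∷ [])) ≡ stack w (b ∷ [])
    halting {b} b≤1 b≤B = stays₀ b b≤1
      where
      stays₀ : ∀ b → b ≤ 1 → transition (stack w (b ∷ [])) ≡ stack w (b ∷ [])
      ds : ∀ {b} → b ≤ 1 → Digits w (b ∷ [])
      ds le = ≤-trans le 1≤w ∷ []
      second : ∀ {b} → b ≤ 1 → digit w (stack w (b ∷ [])) 1 ≡ 0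
      second {b} le = (digit-next [] (le ≤∙ 1≤w) 0) ∙ digit-0 w 0
      stays₀ zero le = dispatched (digit-lit (ds le) 0) (second le) refl refl refl refl refl refl
      stays₀ (suc zero) le = dispatched (digit-lit (ds le) 0) (second le) refl refl refl refl refl refl
      stays₀ (suc (suc b)) (s≤s ())

    reachable-correct : ⟦ tx ⟧ᵗ ρ < Z → ⟦ ty ⟧ᵗ ρ < Z → Room (5 * K + 4) →
                        Truth reachable (Within Edge Z K (⟦ tx ⟧ᵗ ρ) (⟦ ty ⟧ᵗ ρ))
    reachable-correct x< y< le = answer (evaluate K {S = []} ≤-refl x< y< [] le)
      where
      x = ⟦ tx ⟧ᵗ ρ
      y = ⟦ ty ⟧ᵗ ρ
      start≤ : start ≤ B
      start≤ = stack-≤ {2 ∷ K ∷ x ∷ y ∷ []} (2≤w ∷ d≤w ≤-refl ∷ x≤w (<⇒≤ x<) ∷ x≤w (<⇒≤ y<) ∷ []) (shorter (m≤n+m 4 (5 * K)) le)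
      time≤ : time K ≤ B
      time≤ = time-bound K ≤∙ ^-*-assoc (suc w) 2 K ≡∙≤ Room.room-≤ (shorter (*-monoˡ-≤ K (m≤m+n 2 3) ≤∙ m≤m+n (5 * K) 4) le)
      1≤B : 1 ≤ B
      1≤B = m^n>0 (suc w) (5 * K + 4) ≤∙ Room.room-≤ le
      answer : Outcome start (time K) [] (Within Edge Z K x y) → Truth reachable (Within Edge Z K x y)
      answer (b , (n , n≤ , eq) , t) = subst (λ z → Truth z _) (sym final) t
        where
        b≤1 = truth-≤1 t
        fixed : ∀ j → runs (stack w (b ∷ [])) j ≡ stack w (b ∷ [])
        fixed zero    = refl
        fixed (suc j) = cong (clip ∘ transition) (fixed j) ∙ cong clip (halting b≤1 (b≤1 ≤∙ 1≤B)) ∙ clip-≤ (+-identityʳ b ≡∙≤ b≤1 ≤∙ 1≤B)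
        n≤B = n≤ ≤∙ time≤
        final : reachable ≡ b
        final = begin
          digit w (runs (clip start) B) 0 ≡⟨ cong (λ c → digit w (runs c B) 0) (clip-≤ start≤) ⟩
          digit w (runs start B) 0 ≡⟨ cong (λ j → digit w (runs start j) 0) (m∸n+n≡m n≤B) ⟨
          digit w (runs start (B ∸ n + n)) 0 ≡⟨ cong (λ c → digit w c 0) (runs-+ start (B ∸ n) n) ⟩
          digit w (runs (runs start n) (B ∸ n)) 0 ≡⟨ cong (λ c → digit w (runs c (B ∸ n)) 0) eq ⟩
          digit w (runs (stack w (b ∷ [])) (B ∸ n)) 0 ≡⟨ cong (λ c → digit w c 0) (fixed (B ∸ n)) ⟩
          digit w (stack w (b ∷ [])) 0 ≡⟨ digit-zero [] (b≤1 ≤∙ 1≤w) ⟩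
          b ∎
          where open ≡-Reasoning

  Comp-w : Comp w
  Comp-w = Comp-suc (Comp-suc (Comp-+ (Comp-Tm tZ) (Comp-Tm tK)))

  Comp-push : ∀ {j} {f g h : Vec ℕ j → ℕ} → Comp h → Comp f → Comp g → Comp (λ ρ → f ρ + g ρ * suc (h ρ))
  Comp-push h f g = Comp-+ f (Comp-* g (Comp-suc h))

  Comp-clip : ∀ {j} {f g : Vec ℕ j → ℕ} → Comp f → Comp g → Comp (λ ρ → choose (leq (g ρ) (f ρ)) (g ρ) 0)
  Comp-clip B c = Comp-choose (Comp-leq c B) c Comp-zero

  Comp-transition : Comp {2 + k} (λ ρ → transition (Vec.tail (Vec.tail ρ)) (lookup ρ (suc zero)))
  Comp-transition = Comp-choose (Comp-leq (Comp-const 2) (d 0))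
      (Comp-choose (d 1) (Comp-const 2 ▸ Comp-pred (d 1) ▸ d 2 ▸ Comp-zero ▸ Comp-const 1 ▸ Comp-pred (d 1) ▸ d 2 ▸ d 3 ▸ Comp-zero ▸ s 4)
                         (leafᶜ ▸ s 4))
      (Comp-choose (d 1)
        (Comp-choose (d 0)
          (Comp-choose (Comp-leq (Comp-const 2) (d 1)) (Comp-const 1 ▸ s 6)
            (Comp-const 2 ▸ d 2 ▸ d 5 ▸ d 4 ▸ Comp-const 2 ▸ d 2 ▸ d 3 ▸ d 4 ▸ d 5 ▸ s 6))
          (Comp-choose (Comp-leq (Comp-suc (Comp-suc (d 5))) (weaken₂ (Comp-Tm tZ)))
            (Comp-const 2 ▸ d 2 ▸ d 3 ▸ Comp-suc (d 5) ▸ Comp-const 1 ▸ d 2 ▸ d 3 ▸ d 4 ▸ Comp-suc (d 5) ▸ s 6)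
            (Comp-zero ▸ s 6)))
        v₁)
    where
    W : Comp {2 + k} (λ ρ → w (Vec.tail (Vec.tail ρ)))
    W = weaken₂ Comp-w
    d : ∀ i → Comp {2 + k} (λ ρ → digit (w (Vec.tail (Vec.tail ρ))) (lookup ρ (suc zero)) i)
    d i = Comp-digit W v₁ (Comp-const i)
    s : ∀ i → Comp {2 + k} (λ ρ → shift (w (Vec.tail (Vec.tail ρ))) (lookup ρ (suc zero)) i)
    s i = Comp-shift W v₁ (Comp-const i)
    infixr 5 _▸_
    _▸_ : ∀ {f g : Vec ℕ (2 + k) → ℕ} → Comp f → Comp g → Comp (λ ρ → f ρ + g ρ * suc (w (Vec.tail (Vec.tail ρ))))
    f ▸ g = Comp-push W f g
    leafᶜ : Comp {2 + k} (λ ρ → χ leafᶠ (digit (w (Vec.tail (Vec.tail ρ))) (lookup ρ (suc zero)) 2 ∷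
                                           digit (w (Vec.tail (Vec.tail ρ))) (lookup ρ (suc zero)) 3 ∷ Vec.tail (Vec.tail ρ)))
    leafᶜ = Comp-≗ (λ ρ → cong (λ v → χ leafᶠ (digit (w (Vec.tail (Vec.tail ρ))) (lookup ρ (suc zero)) 2 ∷ digit (w (Vec.tail (Vec.tail ρ))) (lookup ρ (suc zero)) 3 ∷ v)) (map-select ρ))
        (Comp-compose (Comp-χ leafᶠ) (d 2 ∷ d 3 ∷ Comp-select k id))

  Comp-reachable : Comp reachable
  Comp-reachable = Comp-digit Comp-w
    (Comp-primrec (Comp-Tm tB)
      (Comp-clip (Comp-Tm tB) (Comp-push Comp-w (Comp-const 2) (Comp-push Comp-w (Comp-Tm tK) (Comp-push Comp-w (Comp-Tm tx) (Comp-push Comp-w (Comp-Tm ty) Comp-zero)))))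
      (Comp-clip (weaken₂ (Comp-Tm tB)) Comp-transition) (Comp.deg (Comp-Tm tB))
      λ {ρ} le j _ → clipped ρ j ≤∙ Comp.bound (Comp-Tm tB) le)
    Comp-zero
    where
    clipped : ∀ ρ j → runs ρ (clip ρ (start ρ)) j ≤ B ρ
    clipped ρ zero    = clip≤ ρ (start ρ)
    clipped ρ (suc j) = clip≤ ρ _

module Paths (E : ℕ → ℕ → Set) (Z : ℕ) where

  Below-Z : ℕ → ℕ → Set
  Below-Z x y = E x y × y < Z

  data Steps : ℕ → ℕ → ℕ → Set where
    []  : ∀ {x} → Steps 0 x x
    _∷_ : ∀ {n x y z} → Below-Z x y → Steps n y z → Steps (suc n) x z

  fromStar : ∀ {x y} → Star Below-Z x y → ∃[ n ] Steps n x y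
  fromStar ε       = 0 , []
  fromStar (e ◅ s) = suc (proj₁ (fromStar s)) , e ∷ proj₂ (fromStar s)

  _+++_ : ∀ {m n x y z} → Steps m x y → Steps n y z → Steps (m + n) x z
  [] +++ q = q
  (e ∷ p) +++ q = e ∷ (p +++ q)

  splitSteps : ∀ i {n x y} → i ≤ n → x < Z → Steps n x y → ∃[ z ] z < Z × Steps i x z × Steps (n ∸ i) z y
  splitSteps zero le x< p = _ , x< , [] , p
  splitSteps (suc i) (s≤s le) x< ((e , y<) ∷ p) with splitSteps i le y< p
  ... | z , z< , q , r = z , z< , (e , y<) ∷ q , r

  -- More than `Z` steps visit more than `Z` nodes below `Z`, so two of these coincide and the
  -- detour between them is cut out.
  shorten : ∀ {n x y} → Acc _<_ n → x < Z → Steps n x y → ∃[ m ] m ≤ Z × Steps m x y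
  shorten {n} {x} {y} (acc rs) x< p with n ≤? Z
  ... | yes le = n , le , p
  ... | no gt with pigeonhole (<-≤-trans (≰⇒> gt) (n≤1+n n)) (λ i → Fin.fromℕ< (proj₁ (proj₂ (node i))))
    where
    node : (i : Fin (suc n)) → _
    node i = splitSteps (Fin.toℕ i) (s≤s⁻¹ (toℕ<n i)) x< p
  ... | i , j , i<j , eq = shorten (rs shorter') x< (proj₁ (proj₂ (proj₂ (node i))) +++
          subst (λ z → Steps (n ∸ Fin.toℕ j) z y) (sym same) (proj₂ (proj₂ (proj₂ (node j)))))
    where
    node : (i : Fin (suc n)) → _
    node i = splitSteps (Fin.toℕ i) (s≤s⁻¹ (toℕ<n i)) x< p
    same : proj₁ (node i) ≡ proj₁ (node j)
    same = sym (toℕ-fromℕ< (proj₁ (proj₂ (node i)))) ∙ cong Fin.toℕ eq ∙ toℕ-fromℕ< (proj₁ (proj₂ (node j)))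
    shorter' : Fin.toℕ i + (n ∸ Fin.toℕ j) < n
    shorter' = +-monoˡ-< (n ∸ Fin.toℕ j) i<j ≤∙≡ m+[n∸m]≡n (s≤s⁻¹ (toℕ<n j))

  -- A short path is padded with an empty first half, so that one depth serves all lengths.
  steps→within : ∀ d {n x y} → n ≤ 2 ^ d → x < Z → Steps n x y → Within E Z d x y
  steps→within zero {zero} le x< []            = inj₁ refl
  steps→within zero {suc zero} le x< ((e , _) ∷ []) = inj₂ e
  steps→within zero {suc (suc n)} (s≤s ()) x< p
  steps→within (suc d) {n} {x} {y} le x< p with n ≤? 2 ^ d
  ... | yes le' = x , x< , steps→within d z≤n x< [] , steps→within d le' x< p
  ... | no gt with splitSteps (2 ^ d) (<⇒≤ (≰⇒> gt)) x< p
  ... | z , z< , q , r = z , z< , steps→within d ≤-refl x< q ,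
          steps→within d (∸-monoˡ-≤ (2 ^ d) le ≤∙≡ cong (_∸ 2 ^ d) (cong (2 ^ d +_) (+-identityʳ (2 ^ d))) ∙ m+n∸m≡n (2 ^ d) (2 ^ d)) z< r

  star→within : ∀ {d x y} → Z ≤ 2 ^ d → x < Z → Star Below-Z x y → Within E Z d x y
  star→within {d} Z≤ x< s with fromStar s
  ... | n , p with shorten (<-wellFounded n) x< p
  ... | m , m≤ , q = steps→within d (m≤ ≤∙ Z≤) x< q

  within→star : ∀ d {x y} → y < Z → Within E Z d x y → Star Below-Z x y
  within→star zero y< (inj₁ refl) = ε
  within→star zero y< (inj₂ e)    = (e , y<) ◅ ε
  within→star (suc d) y< (m , m< , p , q) = within→star d m< p ◅◅ within→star d y< q

-- Interval semantics with points numbered from the right end.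

open Equivalence using (to; from)

-- Points are numbered from the right end of the model, and an interval is given by its left end a and its right end i ≤ a.
-- Its truths then only depend on the points 0, …, a, and prepending a point to the model changes nothing.
sat : (ℕ → Letter → Bool) → Formula → ℕ → ℕ → Set
sat u (` p) a i = ∀ k → k < suc a → i ≤ k → T (u k p)
sat u (¬′ φ) a i = ¬ sat u φ a i
sat u (φ ∨′ ψ) a i = sat u φ a i ⊎ sat u ψ a i
sat u (⟨A⟩ φ) a i = ∃[ i' ] i' < suc i × sat u φ i i'
sat u (⟨B⟩ φ) a i = ∃[ i' ] i' < suc a × i < i' × sat u φ a i'
sat u (⟨D⟩ φ) a i = ∃[ a' ] a' < a × ∃[ i' ] i' < suc a' × i < i' × sat u φ a' i'

exists? : ∀ {P : ℕ → Set} → (∀ i → Dec (P i)) → ∀ n → Dec (∃[ i ] i < n × P i)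
exists? P? n = anyUpTo? P? n

forall? : ∀ {P : ℕ → Set} → (∀ i → Dec (P i)) → ∀ n → Dec (∀ i → i < n → P i)
forall? P? n = map′ (λ h i lt → h lt) (λ h {i} lt → h i lt) (allUpTo? P? n)

sat? : ∀ u φ a i → Dec (sat u φ a i)
sat? u (` p) a i = forall? (λ k → (i ≤? k) →-dec T? (u k p)) (suc a)
sat? u (¬′ φ) a i = ¬? (sat? u φ a i)
sat? u (φ ∨′ ψ) a i = sat? u φ a i ⊎-dec sat? u ψ a i
sat? u (⟨A⟩ φ) a i = exists? (λ i' → sat? u φ i i') (suc i)
sat? u (⟨B⟩ φ) a i = exists? (λ i' → (i <? i') ×-dec sat? u φ a i') (suc a)
sat? u (⟨D⟩ φ) a i = exists? (λ a' → exists? (λ i' → (i <? i') ×-dec sat? u φ a' i') (suc a')) a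

sat-cong : ∀ {u v} φ {a} i → (∀ k → k ≤ a → ∀ p → u k p ≡ v k p) → i ≤ a → sat u φ a i → sat v φ a i
sat-cong (` p) i eq i≤a h k k< i≤k = subst T (eq k (s≤s⁻¹ k<) p) (h k k< i≤k)
sat-cong (¬′ φ) i eq i≤a h x = h (sat-cong φ i (λ k le p → sym (eq k le p)) i≤a x)
sat-cong (φ ∨′ ψ) i eq i≤a = Sum.map (sat-cong φ i eq i≤a) (sat-cong ψ i eq i≤a)
sat-cong (⟨A⟩ φ) i eq i≤a (i' , lt , h) = i' , lt , sat-cong φ i' (λ k le → eq k (le ≤∙ i≤a)) (s≤s⁻¹ lt) h
sat-cong (⟨B⟩ φ) i eq i≤a (i' , lt , lt' , h) = i' , lt , lt' , sat-cong φ i' eq (s≤s⁻¹ lt) h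
sat-cong (⟨D⟩ φ) i eq i≤a (a' , a'<a , i' , lt , lt' , h) =
  a' , a'<a , i' , lt , lt' , sat-cong φ i' (λ k le → eq k (le ≤∙ (<⇒≤ a'<a))) (s≤s⁻¹ lt) h

module FromModel (M : Model) (hom : Homogeneous M) where

  Nᴹ = N M

  valuation : ℕ → Letter → Bool
  valuation k p = V M (point (Nᴹ ∸ k) (m∸n≤m Nᴹ k)) p

  interval-≡ : ∀ {I J : Interval Nᴹ} → lo I ≡ lo J → hi I ≡ hi J → I ≡ J
  interval-≡ {[ x , y ]⟨ p , q ⟩} {[ .x , .y ]⟨ p' , q' ⟩} refl refl = cong₂ [ x , y ]⟨_,_⟩ (≤-irrelevant p p') (≤-irrelevant q q')

  leftᴵ rightᴵ : Interval Nᴹ → ℕ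
  leftᴵ I  = Nᴹ ∸ lo I
  rightᴵ I = Nᴹ ∸ hi I

  make : ∀ a i → a ≤ Nᴹ → i ≤ a → Interval Nᴹ
  make a i a≤ i≤ = [ Nᴹ ∸ a , Nᴹ ∸ i ]⟨ ∸-monoʳ-≤ Nᴹ i≤ , m∸n≤m Nᴹ i ⟩

  rightᴵ≤leftᴵ : ∀ I → rightᴵ I ≤ leftᴵ I
  rightᴵ≤leftᴵ I = ∸-monoʳ-≤ Nᴹ (lo≤hi I)

  flip : ∀ {k} → k ≤ Nᴹ → Nᴹ ∸ (Nᴹ ∸ k) ≡ k
  flip = m∸[m∸n]≡n

  flip-< : ∀ {j k} → j ≤ Nᴹ → k < j → Nᴹ ∸ j < Nᴹ ∸ k
  flip-< j≤ lt = ∸-monoʳ-< lt j≤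

  correct : ∀ φ I → (M , I ⊨ φ) ⇔ sat valuation φ (leftᴵ I) (rightᴵ I)
  correct (` p) I = mk⇔
    (λ h k k< le → subst (λ J → T (V M J p)) (interval-≡ refl refl)
      (to (hom p I) h (Nᴹ ∸ k)
        (sym (flip (lo≤hi I ≤∙ hi≤N I)) ≡∙≤ ∸-monoʳ-≤ Nᴹ (s≤s⁻¹ k<))
        (∸-monoʳ-≤ Nᴹ le ≤∙≡ flip (hi≤N I))))
    (λ h → from (hom p I) (λ z lo≤z z≤hi → subst (λ J → T (V M J p))
      (interval-≡ (flip (z≤hi ≤∙ hi≤N I)) (flip (z≤hi ≤∙ hi≤N I)))
      (h (Nᴹ ∸ z) (s≤s (∸-monoʳ-≤ Nᴹ lo≤z)) (∸-monoʳ-≤ Nᴹ z≤hi))))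
  correct (¬′ φ) I = mk⇔ (λ h x → h (from (correct φ I) x)) (λ h x → h (to (correct φ I) x))
  correct (φ ∨′ ψ) I = mk⇔ (Sum.map (to (correct φ I)) (to (correct ψ I))) (Sum.map (from (correct φ I)) (from (correct ψ I)))
  correct (⟨A⟩ φ) I = mk⇔
    (λ { (J , eq , h) → rightᴵ J , s≤s (rightᴵ≤leftᴵ J ≤∙≡ cong (Nᴹ ∸_) eq) ,
           subst (λ a → sat valuation φ a (rightᴵ J)) (cong (Nᴹ ∸_) eq) (to (correct φ J) h) })
    (λ { (i , i< , h) → let a≤ = m∸n≤m Nᴹ (hi I); J = make (rightᴵ I) i a≤ (s≤s⁻¹ i<) in
           J , flip (hi≤N I) , from (correct φ J)
             (subst₂ (sat valuation φ) (sym (flip a≤)) (sym (flip (s≤s⁻¹ i< ≤∙ a≤))) h) })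
  correct (⟨B⟩ φ) I = mk⇔
    (λ { (J , eq , lt , h) → rightᴵ J , s≤s (rightᴵ≤leftᴵ J ≤∙≡ cong (Nᴹ ∸_) eq) , flip-< (hi≤N I) lt ,
           subst (λ a → sat valuation φ a (rightᴵ J)) (cong (Nᴹ ∸_) eq) (to (correct φ J) h) })
    (λ { (i , i< , lt , h) → let a≤ = m∸n≤m Nᴹ (lo I); J = make (leftᴵ I) i a≤ (s≤s⁻¹ i<); i≤ = ≤-trans (s≤s⁻¹ i<) a≤ in
           J , flip (lo≤hi I ≤∙ hi≤N I) , flip-< i≤ lt ≤∙≡ flip (hi≤N I) , from (correct φ J)
             (subst₂ (sat valuation φ) (sym (flip a≤)) (sym (flip i≤)) h) })
  correct (⟨D⟩ φ) I = mk⇔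
    (λ { (J , lt , lt' , h) → leftᴵ J , flip-< (lo≤hi J ≤∙ hi≤N J) lt , rightᴵ J , s≤s (rightᴵ≤leftᴵ J) , flip-< (hi≤N I) lt' , to (correct φ J) h })
    (λ { (a , a< , i , i< , lt , h) →
           let a≤ = (<⇒≤ a<) ≤∙ m∸n≤m Nᴹ (lo I); i≤ = ≤-trans (s≤s⁻¹ i<) a≤; J = make a i a≤ (s≤s⁻¹ i<) in
           J , ≤-reflexive (cong suc (sym (flip (lo≤hi I ≤∙ hi≤N I)))) ≤∙ flip-< (m∸n≤m Nᴹ (lo I)) a< ,
           flip-< i≤ lt ≤∙≡ flip (hi≤N I) ,
           from (correct φ J) (subst₂ (sat valuation φ) (sym (flip a≤)) (sym (flip i≤)) h) })

module ToModel (n : ℕ) (u : ℕ → Letter → Bool) where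

  holds? : ∀ (I : Interval n) p → Dec (∀ z → z < suc (hi I) → lo I ≤ z → T (u (n ∸ z) p))
  holds? I p = forall? (λ z → (lo I ≤? z) →-dec T? (u (n ∸ z) p)) (suc (hi I))

  model : Model
  model = record { N = n ; V = λ I p → does (holds? I p) }

  does-T : ∀ {P : Set} (d : Dec P) → P → T (does d)
  does-T (yes _) _ = _
  does-T (no np) p = contradiction p np

  T-does : ∀ {P : Set} (d : Dec P) → T (does d) → P
  T-does (yes p) _ = p

  homogeneous : Homogeneous model
  homogeneous p I = mk⇔
    (λ h z lo≤z z≤hi → does-T (holds? (point z (z≤hi ≤∙ hi≤N I)) p) (λ z' z'< z≤z' →
       T-does (holds? I p) h z' (z'< ≤∙ s≤s z≤hi) (lo≤z ≤∙ z≤z')))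
    (λ h → does-T (holds? I p) (λ z z< lo≤z → T-does (holds? (point z (s≤s⁻¹ z< ≤∙ hi≤N I)) p) (h z lo≤z (s≤s⁻¹ z<)) z ≤-refl ≤-refl))

  valuation-u : ∀ k → k ≤ n → ∀ p → FromModel.valuation model homogeneous k p ≡ u k p
  valuation-u k k≤n p = T-≡
    (λ h → subst (λ m → T (u m p)) (m∸[m∸n]≡n k≤n) (T-does d h (n ∸ k) ≤-refl ≤-refl))
    (λ h → does-T d (λ z z< le → subst (λ m → T (u m p)) (sym (m∸[m∸n]≡n k≤n) ∙ cong (n ∸_) (≤-antisym le (s≤s⁻¹ z<))) h))
    where
    d = holds? (point (n ∸ k) (m∸n≤m n k)) p
    T-≡ : ∀ {b c} → (T b → T c) → (T c → T b) → b ≡ c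
    T-≡ {false} {false} f g = refl
    T-≡ {false} {true} f g = contradiction (g _) id
    T-≡ {true} {false} f g = contradiction (f _) id
    T-≡ {true} {true} f g = refl

satisfiable⇔sat : ∀ φ → Satisfiable φ ⇔ (∃[ n ] ∃[ u ] sat u φ n 0)
satisfiable⇔sat φ = mk⇔
  (λ { (M , hom , h) → let open FromModel M hom in
         N M , valuation , subst (sat valuation φ (N M)) (n∸n≡0 (N M)) (to (correct φ (whole (N M))) h) })
  (λ { (n , u , h) → let open ToModel n u; open FromModel model homogeneous using (correct; valuation) in
         model , homogeneous , from (correct φ (whole n))
           (subst (sat valuation φ n) (sym (n∸n≡0 n)) (sat-cong φ 0 (λ k le p → sym (valuation-u k le p)) z≤n h)) })

⇔-id : ∀ {A : Set} → A ⇔ A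
⇔-id = mk⇔ id id

⇔-flip : ∀ {A B : Set} → A ⇔ B → B ⇔ A
⇔-flip e = mk⇔ (from e) (to e)

infixr 4 _⟨⇔⟩_
_⟨⇔⟩_ : ∀ {A B C : Set} → A ⇔ B → B ⇔ C → A ⇔ C
e ⟨⇔⟩ f = mk⇔ (to f ∘ to e) (from e ∘ from f)

¬-⇔ : ∀ {A B : Set} → A ⇔ B → (¬ A) ⇔ (¬ B)
¬-⇔ e = mk⇔ (λ na → na ∘ from e) (λ nb → nb ∘ to e)

⊎-⇔ : ∀ {A B C D : Set} → A ⇔ B → C ⇔ D → (A ⊎ C) ⇔ (B ⊎ D)
⊎-⇔ e f = mk⇔ (Sum.map (to e) (to f)) (Sum.map (from e) (from f))

×-⇔ : ∀ {A B C D : Set} → A ⇔ B → C ⇔ D → (A × C) ⇔ (B × D)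
×-⇔ e f = mk⇔ (λ { (a , c) → to e a , to f c }) (λ { (b , d) → from e b , from f d })

count : ∀ {P : ℕ → Set} → (∀ j → Dec (P j)) → ℕ → ℕ
count P? zero    = 0
count P? (suc n) with P? n
... | yes _ = suc (count P? n)
... | no _  = count P? n

count-≤ : ∀ {P : ℕ → Set} (P? : ∀ j → Dec (P j)) n → count P? n ≤ n
count-≤ P? zero    = z≤n
count-≤ P? (suc n) with P? n
... | yes _ = s≤s (count-≤ P? n)
... | no _  = count-≤ P? n ≤∙ n≤1+n n

module _ {P Q : ℕ → Set} (P? : ∀ j → Dec (P j)) (Q? : ∀ j → Dec (Q j)) where

  count-mono : ∀ n → (∀ j → j < n → P j → Q j) → count P? n ≤ count Q? n
  count-mono zero sub = z≤n
  count-mono (suc n) sub with P? n | Q? n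
  ... | yes p | yes q = s≤s (count-mono n (λ j lt → sub j (lt ≤∙ n≤1+n n)))
  ... | yes p | no nq = contradiction (sub n ≤-refl p) nq
  ... | no np | yes q = count-mono n (λ j lt → sub j (lt ≤∙ n≤1+n n)) ≤∙ n≤1+n _
  ... | no np | no nq = count-mono n (λ j lt → sub j (lt ≤∙ n≤1+n n))

  count-strict : ∀ n → (∀ j → j < n → P j → Q j) → ∀ j → j < n → Q j → ¬ P j → suc (count P? n) ≤ count Q? n
  count-strict (suc n) sub j (s≤s j≤n) qj npj with P? n | Q? n | m≤n⇒m<n∨m≡n j≤n
  ... | yes p | yes q | inj₁ lt   = s≤s (count-strict n (λ j lt → sub j (lt ≤∙ n≤1+n n)) j lt qj npj)
  ... | yes p | yes q | inj₂ refl = contradiction p npj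
  ... | yes p | no nq | _         = contradiction (sub n ≤-refl p) nq
  ... | no np | yes q | _         = s≤s (count-mono n (λ j lt → sub j (lt ≤∙ n≤1+n n)))
  ... | no np | no nq | inj₁ lt   = count-strict n (λ j lt → sub j (lt ≤∙ n≤1+n n)) j lt qj npj
  ... | no np | no nq | inj₂ refl = contradiction qj nq

  count-≡ : ∀ n → (∀ j → j < n → P j → Q j) → count P? n ≡ count Q? n → ∀ j → j < n → Q j → P j
  count-≡ n sub eq j lt q with P? j
  ... | yes p = p
  ... | no np = contradiction (count-strict n sub j lt q np ≤∙≡ sym eq) 1+n≰n

-- Otherwise `c` would increase strictly `suc n` times and exceed `n`.
plateau : ∀ n (c : ℕ → ℕ) → (∀ r → r < suc n → c r ≤ c (suc r)) → c (suc n) ≤ n → ∃[ r ] r < suc n × c r ≡ c (suc r)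
plateau n c mono le with exists? (λ r → c r ≟ c (suc r)) (suc n)
... | yes found = found
... | no none   = contradiction (climb (suc n) ≤-refl ≤∙ le) 1+n≰n
  where
  climb : ∀ m → m ≤ suc n → m ≤ c m
  climb zero le = z≤n
  climb (suc m) le = s≤s (climb m (<⇒≤ le)) ≤∙ (≤∧≢⇒< (mono m le) (λ eq → none (m , le , eq)))

-- The nodes of a formula are numbered so that children come later; negᵏ k is a negation of node k, and so on.
data Kind : Set where
  letter          : Kind
  negᵏ Aᵏ Bᵏ Dᵏ : ℕ → Kind
  orᵏ             : ℕ → ℕ → Kind

Inside : ℕ → ℕ → ℕ → Set
Inside n j k = j < k × k < n

WellFormed : ℕ → ℕ → Kind → Set
WellFormed n j letter    = ⊤
WellFormed n j (negᵏ k)  = Inside n j k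
WellFormed n j (Aᵏ k)    = Inside n j k
WellFormed n j (Bᵏ k)    = Inside n j k
WellFormed n j (Dᵏ k)    = Inside n j k
WellFormed n j (orᵏ k l) = Inside n j k × Inside n j l

-- The intervals that start at the current leftmost point, listed by their right ends i < len. For every node j, A i j says that some
-- interval starting at i satisfies j, C i j that some interval starting at or after the current point and ending before i does,
-- and L i j that the letter of j holds on the whole interval.
record State : Set₁ where
  field
    len : ℕ
    A C L : ℕ → ℕ → Set
    A? : ∀ i j → Dec (A i j)
    C? : ∀ i j → Dec (C i j)
    L? : ∀ i j → Dec (L i j)

open State public

Later : (ℕ → ℕ → Set) → ℕ → ℕ → ℕ → Set
Later τ m i j = ∃[ i' ] i' < suc m × i < i' × τ i' j

module Abstraction (n : ℕ) (kind : ℕ → Kind) (wf : ∀ j → j < n → WellFormed n j (kind j)) where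

  -- Induction on subformulas, which carry larger numbers than the formulas that contain them.
  descending : (P : ℕ → Set) → (∀ j → j < n → (∀ k → Inside n j k → P k) → P j) → ∀ j → j < n → P j
  descending P step' j lt = go (n ∸ j) j lt ≤-refl
    where
    go : ∀ f j → j < n → n ∸ j ≤ f → P j
    go zero j lt le = contradiction (m<n⇒0<n∸m lt ≤∙ le) λ ()
    go (suc f) j lt le = step' j lt λ { k (j<k , k<n) → go f k k<n (s≤s⁻¹ (∸-monoʳ-< j<k (<⇒≤ k<n) ≤∙ le)) }

  -- The truth value that a node has at the interval i of the new state t when the truth values of later nodes are given by τ.
  Value : State → State → (ℕ → ℕ → Set) → ℕ → ℕ → Kind → Set
  Value s t τ i j letter    = L t i j
  Value s t τ i j (negᵏ k)  = ¬ τ i k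
  Value s t τ i j (orᵏ k l) = τ i k ⊎ τ i l
  Value s t τ i j (Aᵏ k)    = A t i k
  Value s t τ i j (Bᵏ k)    = Later τ (len s) i k
  Value s t τ i j (Dᵏ k)    = i < len s × C s i k

  -- `ℓ` gives the letters of the new point and `τ` the truths at the intervals that start there. It
  -- is a relation because it must also apply to coded states, which agree with the intended ones
  -- only up to equivalence. The value of `⟨D⟩` uses `C` of the old state: a strictly inner interval
  -- starts after the new point.
  record Next (s : State) (ℓ : ℕ → Set) (t : State) (τ : ℕ → ℕ → Set) : Set where
    field
      len-suc : len t ≡ suc (len s)
      τ?      : ∀ i j → Dec (τ i j)
      A-old   : ∀ i → i < len s → ∀ j → j < n → A t i j ⇔ A s i j
      C-old   : ∀ i → i < len s → ∀ j → j < n → C t i j ⇔ (C s i j ⊎ Later τ (len s) i j)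
      L-old   : ∀ i → i < len s → ∀ j → j < n → L t i j ⇔ (L s i j × ℓ j)
      A-new   : ∀ j → j < n → A t (len s) j ⇔ (∃[ i ] i < suc (len s) × τ i j)
      C-new   : ∀ j → j < n → ¬ C t (len s) j
      L-new   : ∀ j → j < n → L t (len s) j ⇔ ℓ j
      valueᴺ  : ∀ i → i < suc (len s) → ∀ j → j < n → τ i j ⇔ Value s t τ i j (kind j)

  open Next public

  infix 4 _≈_
  record _≈_ (s t : State) : Set where
    field
      len-≡ : len s ≡ len t
      A-≈ : ∀ i → i < len s → ∀ j → j < n → A s i j ⇔ A t i j
      C-≈ : ∀ i → i < len s → ∀ j → j < n → C s i j ⇔ C t i j
      L-≈ : ∀ i → i < len s → ∀ j → j < n → L s i j ⇔ L t i j

  open _≈_ public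

  last-or-old : ∀ {m i} → i < suc m → i < m ⊎ i ≡ m
  last-or-old (s≤s le) = m≤n⇒m<n∨m≡n le

  Later-⇔ : ∀ {τ τ' : ℕ → ℕ → Set} {m i k} → (∀ i' → i' < suc m → τ i' k ⇔ τ' i' k) → Later τ m i k ⇔ Later τ' m i k
  Later-⇔ e = mk⇔ (λ { (i' , a , b , x) → i' , a , b , to (e i' a) x }) (λ { (i' , a , b , x) → i' , a , b , from (e i' a) x })

  -- Truths are determined child before parent. The entry `A` at the new point depends on the truths
  -- of the same node at all items; a parent consults it only for its child, so there is no circle.
  next-unique : ∀ {s s' ℓ t t' τ τ'} → s ≈ s' → Next s ℓ t τ → Next s' ℓ t' τ' →
                t ≈ t' × (∀ j → j < n → ∀ i → i < suc (len s) → τ i j ⇔ τ' i j)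
  next-unique {s} {s'@record { len = _ }} {ℓ} {t} {t'} {τ} {τ'} e@record { len-≡ = refl } N N' = record
      { len-≡ = len-suc N ∙ sym (len-suc N') ; A-≈ = λ i lt j j< → A-t i (cast lt) j j< (λ i lt → same j j< i lt)
      ; C-≈ = λ i lt j j< → C-t i (cast lt) j j< ; L-≈ = λ i lt j j< → L-t i (cast lt) j j< } , same
    where
    cast : ∀ {i} → i < len t → i < suc (len s)
    cast = subst (_ <_) (len-suc N)
    A-t : ∀ i → i < suc (len s) → ∀ k → k < n → (∀ i → i < suc (len s) → τ i k ⇔ τ' i k) → A t i k ⇔ A t' i k
    A-t i i< k k< ih with last-or-old i<
    ... | inj₁ lt   = A-old N i lt k k< ⟨⇔⟩ A-≈ e i lt k k< ⟨⇔⟩ ⇔-flip (A-old N' i lt k k<)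
    ... | inj₂ refl = A-new N k k< ⟨⇔⟩ mk⇔ (λ { (i , a , x) → i , a , to (ih i a) x }) (λ { (i , a , x) → i , a , from (ih i a) x }) ⟨⇔⟩ ⇔-flip (A-new N' k k<)
    L-t : ∀ i → i < suc (len s) → ∀ k → k < n → L t i k ⇔ L t' i k
    L-t i i< k k< with last-or-old i<
    ... | inj₁ lt   = L-old N i lt k k< ⟨⇔⟩ ×-⇔ (L-≈ e i lt k k<) ⇔-id ⟨⇔⟩ ⇔-flip (L-old N' i lt k k<)
    ... | inj₂ refl = L-new N k k< ⟨⇔⟩ ⇔-flip (L-new N' k k<)
    same : ∀ j → j < n → ∀ i → i < suc (len s) → τ i j ⇔ τ' i j
    same = descending (λ j → ∀ i → i < suc (len s) → τ i j ⇔ τ' i j) λ j j< ih i i< →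
      valueᴺ N i i< j j< ⟨⇔⟩ values (kind j) j< (wf j j<) ih i i< ⟨⇔⟩ ⇔-flip (valueᴺ N' i i< j j<)
      where
      values : ∀ {j} κ → j < n → WellFormed n j κ → (∀ k → Inside n j k → ∀ i → i < suc (len s) → τ i k ⇔ τ' i k) → ∀ i → i < suc (len s) →
               Value s t τ i j κ ⇔ Value s' t' τ' i j κ
      values letter j< w ih i i< = L-t i i< _ j<
      values (negᵏ k) j< w ih i i< = ¬-⇔ (ih k w i i<)
      values (Aᵏ k) j< w ih i i< = A-t i i< k (proj₂ w) (ih k w)
      values (Bᵏ k) j< w ih i i< = Later-⇔ {τ} {τ'} {k = k} (ih k w)
      values (Dᵏ k) j< w ih i i< = mk⇔ (λ { (lt , c) → lt , to (C-≈ e i lt k (proj₂ w)) c }) (λ { (lt , c) → lt , from (C-≈ e i lt k (proj₂ w)) c })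
      values (orᵏ k l) j< (w , w') ih i i< = ⊎-⇔ (ih k w i i<) (ih l w' i i<)
    C-t : ∀ i → i < suc (len s) → ∀ k → k < n → C t i k ⇔ C t' i k
    C-t i i< k k< with last-or-old i<
    ... | inj₁ lt   = C-old N i lt k k< ⟨⇔⟩ ⊎-⇔ (C-≈ e i lt k k<) (Later-⇔ {τ} {τ'} {k = k} (same k k<)) ⟨⇔⟩ ⇔-flip (C-old N' i lt k k<)
    ... | inj₂ refl = mk⇔ (λ c → contradiction c (C-new N k k<)) (λ c → contradiction c (C-new N' k k<))

  record Same (s : State) (i i' : ℕ) : Set where
    field
      A-same : ∀ j → j < n → A s i j ⇔ A s i' j
      C-same : ∀ j → j < n → C s i j ⇔ C s i' j
      L-same : ∀ j → j < n → L s i j ⇔ L s i' j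

  open Same public

  -- The intervals from i₀ upwards contain m successive blocks, each of which contains every item found between it and i₀.
  record Redundant (m : ℕ) (s : State) (i₀ : ℕ) : Set where
    field
      p        : ℕ → ℕ
      p-bound  : ∀ r → r < suc m → p r < len s
      pₘ≡i₀    : p m ≡ i₀
      block    : ∀ r → r < m → ∀ i → i < suc (p (suc r)) → i₀ ≤ i → ∃[ i' ] i' < suc (p r) × p (suc r) < i' × Same s i i'
      C-const  : ∀ i → i < suc (p 0) → i₀ ≤ i → ∀ j → j < n → C s i j ⇔ C s i₀ j
      L-const  : ∀ i → i < suc (p 0) → i₀ ≤ i → ∀ j → j < n → L s i j ⇔ L s i₀ j

  room-left : State → ℕ → ℕ
  room-left s i = count (λ j → ¬? (C? s i j)) n + count (L? s i) n

  -- With that many blocks, an item stays redundant forever: every step that splits the blocks lowers room-left.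
  record Superfluous (s : State) (i₀ : ℕ) : Set where
    field
      blocks    : ℕ
      redundant : Redundant blocks s i₀
      enough    : suc n * suc (room-left s i₀) ≤ blocks
      positive  : 0 < i₀

  open Superfluous public

  -- `Latr i` collects what holds at proper prefixes of the new interval `i`. It can grow at most
  -- `n` times from block to block, so among the first `suc n` blocks there is a block `r` that adds
  -- nothing. Every item between this block and `i₀` has a copy in it and so adds nothing either; in
  -- particular everything true at `i₀` has another witness.
  module Preservation {s ℓ t τ i₀} (N : Next s ℓ t τ) (S : Superfluous s i₀) where

    open Redundant (redundant S)
    m = blocks S

    Latr : ℕ → ℕ → Set
    Latr = Later τ (len s)

    Later? : ∀ i j → Dec (Latr i j)
    Later? i j = exists? (λ i' → (i <? i') ×-dec τ? N i' j) (suc (len s))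

    later-mono : ∀ {i i' j} → i ≤ i' → Latr i' j → Latr i j
    later-mono le (x , a , b , h) = x , a , s≤s le ≤∙ b , h

    i₀≤p : ∀ d r → r + d ≡ m → i₀ ≤ p r
    i₀≤p zero r eq = ≤-reflexive (sym pₘ≡i₀ ∙ cong p (sym eq ∙ +-identityʳ r))
    i₀≤p (suc d) r eq with block r (s≤s (m≤m+n r d) ≤∙≡ sym (+-suc r d) ∙ eq) i₀ (s≤s (i₀≤p d (suc r) (sym (+-suc r d) ∙ eq))) ≤-refl
    ... | i' , i'< , lt , _ = i₀≤p d (suc r) (sym (+-suc r d) ∙ eq) ≤∙ (<⇒≤ lt) ≤∙ s≤s⁻¹ i'<

    i₀≤ : ∀ r → r ≤ m → i₀ ≤ p r
    i₀≤ r le = i₀≤p (m ∸ r) r (m+[n∸m]≡n le)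

    p-step : ∀ r → r < m → p (suc r) < p r
    p-step r lt with block r lt i₀ (s≤s (i₀≤ (suc r) lt)) ≤-refl
    ... | i' , i'< , lt' , _ = lt' ≤∙ s≤s⁻¹ i'<

    p≤p₀ : ∀ r → r ≤ m → p r ≤ p 0
    p≤p₀ zero le = ≤-refl
    p≤p₀ (suc r) le = (<⇒≤ (p-step r le)) ≤∙ p≤p₀ r (<⇒≤ le)

    n<m : suc n ≤ m
    n<m = m≤m*n (suc n) (suc (room-left s i₀)) ≤∙ enough S

    abstract
      level : ∃[ r ] r < suc n × count (Later? (p r)) n ≡ count (Later? (p (suc r))) n
      level = plateau n (λ r → count (Later? (p r)) n)
        (λ r lt → count-mono (Later? (p r)) (Later? (p (suc r))) n (λ j j< → later-mono (<⇒≤ (p-step r (lt ≤∙ n<m)))))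
        (count-≤ (Later? (p (suc n))) n)

    r = proj₁ level
    r<m : r < m
    r<m = proj₁ (proj₂ level) ≤∙ n<m

    -- Nothing new becomes true in block r.
    flat : ∀ j → j < n → Latr (p (suc r)) j → Latr (p r) j
    flat = count-≡ (Later? (p r)) (Later? (p (suc r))) n (λ j j< → later-mono (<⇒≤ (p-step r r<m))) (proj₂ (proj₂ level))

    p<len : ∀ q → q ≤ m → p q < len s
    p<len q le = p-bound q (s≤s le)

    p₀<len : p 0 < len s
    p₀<len = p-bound 0 (s≤s z≤n)

    -- Truth at an old item depends on the other items only through `⟨B⟩`, that is, through `Latr`;
    -- everything else is read off the item's own entries.
    determined : ∀ {i i'} → i < len s → i' < len s → Same s i i' → (∀ j → j < n → Latr i j ⇔ Latr i' j) → ∀ j → j < n → τ i j ⇔ τ i' j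
    determined {i} {i'} i< i'< same later = descending (λ j → τ i j ⇔ τ i' j) λ j j< ih →
      valueᴺ N i (i< ≤∙ n≤1+n _) j j< ⟨⇔⟩ values (kind j) j< (wf j j<) ih ⟨⇔⟩ ⇔-flip (valueᴺ N i' (i'< ≤∙ n≤1+n _) j j<)
      where
      values : ∀ {j} κ → j < n → WellFormed n j κ → (∀ k → Inside n j k → τ i k ⇔ τ i' k) → Value s t τ i j κ ⇔ Value s t τ i' j κ
      values letter j< w ih = L-old N i i< _ j< ⟨⇔⟩ ×-⇔ (L-same same _ j<) ⇔-id ⟨⇔⟩ ⇔-flip (L-old N i' i'< _ j<)
      values (negᵏ k) j< w ih = ¬-⇔ (ih k w)
      values (Aᵏ k) j< w ih = A-old N i i< k (proj₂ w) ⟨⇔⟩ A-same same k (proj₂ w) ⟨⇔⟩ ⇔-flip (A-old N i' i'< k (proj₂ w))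
      values (Bᵏ k) j< w ih = later k (proj₂ w)
      values (Dᵏ k) j< w ih = mk⇔ (λ { (_ , c) → i'< , to (C-same same k (proj₂ w)) c }) (λ { (_ , c) → i< , from (C-same same k (proj₂ w)) c })
      values (orᵏ k l) j< (w , w') ih = ⊎-⇔ (ih k w) (ih l w')

    -- Hence no item between block r and i₀ adds anything either.
    settled : ∀ d i → d + i ≡ p (suc r) → i₀ ≤ i → (∀ j → j < n → Latr i j → Latr (p r) j) × (∀ j → j < n → τ i j → Latr (p r) j)
    settled d i eq i₀≤i = laters d eq , absorbs
      where
      i≤ : i ≤ p (suc r)
      i≤ = m≤n+m i d ≤∙≡ eq
      laters : ∀ d → d + i ≡ p (suc r) → ∀ j → j < n → Latr i j → Latr (p r) j
      laters zero eq j j< h = flat j j< (subst (λ x → Latr x j) eq h)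
      laters (suc d) eq j j< (x , x< , i<x , h) with m≤n⇒m<n∨m≡n i<x
      ... | inj₁ lt   = proj₁ (settled d (suc i) (+-suc d i ∙ eq) (i₀≤i ≤∙ n≤1+n i)) j j< (x , x< , lt , h)
      ... | inj₂ refl = proj₂ (settled d (suc i) (+-suc d i ∙ eq) (i₀≤i ≤∙ n≤1+n i)) j j< h
      absorbs : ∀ j → j < n → τ i j → Latr (p r) j
      absorbs j j< h with block r r<m i (s≤s i≤) i₀≤i
      ... | i' , i'< , lt , same = flat j j< (i' , i'<len ≤∙ n≤1+n _ , lt , to (determined (s≤s i≤ ≤∙ p<len (suc r) r<m) i'<len same
              (λ k k< → mk⇔ (later-mono (s≤s⁻¹ i'<) ∘ laters d eq k k<) (later-mono (i≤ ≤∙ (<⇒≤ lt)))) j j<) h)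
        where
        i'<len : i' < len s
        i'<len = i'< ≤∙ p<len r (<⇒≤ r<m)

    absorbed : ∀ j → j < n → τ i₀ j → Latr i₀ j
    absorbed j j< h = later-mono (i₀≤ r (<⇒≤ r<m)) (proj₂ (settled (p (suc r) ∸ i₀) i₀ (m∸n+n≡m (i₀≤ (suc r) r<m)) ≤-refl) j j< h)

    constant : ∀ i → i < suc (p r) → i₀ ≤ i → ∀ j → j < n → Latr i j ⇔ Latr i₀ j
    constant i i< i₀≤i j j< = mk⇔ (later-mono i₀≤i)
      (λ h → later-mono (s≤s⁻¹ i<) (proj₁ (settled (p (suc r) ∸ i₀) i₀ (m∸n+n≡m (i₀≤ (suc r) r<m)) ≤-refl) j j< h))

    i₀<len : i₀ < len s
    i₀<len = s≤s (i₀≤ 0 z≤n) ≤∙ p₀<len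

    -- If C changes uniformly from q-th block on, the remaining blocks survive.
    survive : ∀ q → q ≤ m → (∀ i → i < suc (p q) → i₀ ≤ i → ∀ j → j < n → C t i j ⇔ C t i₀ j) → Redundant (m ∸ q) t i₀
    survive q q≤m C-uniform = record
      { p = λ x → p (q + x)
      ; p-bound = λ x x< → subst (p (q + x) <_) (sym (len-suc N)) (p<len (q + x) (+-monoʳ-≤ q (s≤s⁻¹ x<) ≤∙≡ m+[n∸m]≡n q≤m) ≤∙ n≤1+n _)
      ; pₘ≡i₀ = cong p (m+[n∸m]≡n q≤m) ∙ pₘ≡i₀
      ; block = λ x x< i i< i₀≤i → new-block x x< i i< i₀≤i
      ; C-const = λ i i< i₀≤i → C-uniform i (subst (λ y → i < suc (p y)) (+-identityʳ q) i<) i₀≤i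
      ; L-const = λ i i< i₀≤i j j< → L-const-t i (subst (λ y → i < suc (p y)) (+-identityʳ q) i<) i₀≤i j j<
      }
      where
      old : ∀ {i} → i < suc (p q) → i < len s
      old lt = lt ≤∙ p<len q q≤m
      L-const-t : ∀ i → i < suc (p q) → i₀ ≤ i → ∀ j → j < n → L t i j ⇔ L t i₀ j
      L-const-t i i< i₀≤i j j< = L-old N i (old i<) j j< ⟨⇔⟩ ×-⇔ (L-const i (i< ≤∙ s≤s (p≤p₀ q q≤m)) i₀≤i j j<) ⇔-id ⟨⇔⟩ ⇔-flip (L-old N i₀ i₀<len j j<)
      p-antitone : ∀ x → q + x ≤ m → p (q + x) ≤ p q
      p-antitone zero le = ≤-reflexive (cong p (+-identityʳ q))
      p-antitone (suc x) le = cong p (+-suc q x) ≡∙≤ (<⇒≤ (p-step (q + x) lt)) ≤∙ p-antitone x (<⇒≤ lt)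
        where
        lt : q + x < m
        lt = sym (+-suc q x) ≡∙≤ le
      new-block : ∀ x → x < m ∸ q → ∀ i → i < suc (p (q + suc x)) → i₀ ≤ i → ∃[ i' ] i' < suc (p (q + x)) × p (q + suc x) < i' × Same t i i'
      new-block x x< i i< i₀≤i
        with block (q + x) q+x<m i (subst (λ y → i < suc (p y)) (+-suc q x) i<) i₀≤i
        where
        q+x<m : q + x < m
        q+x<m = sym (+-suc q x) ≡∙≤ +-monoʳ-≤ q x< ≤∙≡ m+[n∸m]≡n q≤m
      ... | i' , i'< , lt , same = i' , i'< , subst (λ y → p y < i') (sym (+-suc q x)) lt , record
          { A-same = λ j j< → A-old N i (old i<q) j j< ⟨⇔⟩ A-same same j j< ⟨⇔⟩ ⇔-flip (A-old N i' (old i'<q) j j<)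
          ; C-same = λ j j< → C-uniform i i<q i₀≤i j j< ⟨⇔⟩ ⇔-flip (C-uniform i' i'<q i₀≤i' j j<)
          ; L-same = λ j j< → L-const-t i i<q i₀≤i j j< ⟨⇔⟩ ⇔-flip (L-const-t i' i'<q i₀≤i' j j<) }
        where
        q+x<m : q + x < m
        q+x<m = sym (+-suc q x) ≡∙≤ +-monoʳ-≤ q x< ≤∙≡ m+[n∸m]≡n q≤m
        i<q : i < suc (p q)
        i<q = i< ≤∙ s≤s (p-antitone (suc x) (+-suc q x ≡∙≤ q+x<m))
        i'<q : i' < suc (p q)
        i'<q = i'< ≤∙ s≤s (p-antitone x (<⇒≤ q+x<m))
        i₀≤i' : i₀ ≤ i'
        i₀≤i' = i₀≤ (suc (q + x)) q+x<m ≤∙ (<⇒≤ lt)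

    L-shrinks : count (L? t i₀) n ≤ count (L? s i₀) n
    L-shrinks = count-mono (L? t i₀) (L? s i₀) n (λ j j< h → proj₁ (to (L-old N i₀ i₀<len j j<) h))

    C-grows : ∀ j → j < n → ¬ C t i₀ j → ¬ C s i₀ j
    C-grows j j< nc c = nc (from (C-old N i₀ i₀<len j j<) (inj₁ c))

    -- If nothing new enters `C` at `i₀`, all blocks survive. Otherwise the blocks from `r` on
    -- survive, because `Latr` is constant there: at most `n` blocks are lost and in exchange
    -- `room-left` drops, which the factor `suc n` in `enough` provides for.
    superfluous : Superfluous t i₀
    superfluous with exists? (λ j → Later? i₀ j ×-dec ¬? (C? s i₀ j)) n
    ... | no none = record
        { blocks = m ; redundant = survive 0 z≤n uniform ; positive = positive S
        ; enough = *-monoʳ-≤ (suc n) (s≤s (+-mono-≤ (count-mono (λ j → ¬? (C? t i₀ j)) (λ j → ¬? (C? s i₀ j)) n C-grows) L-shrinks)) ≤∙ enough S }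
      where
      nothing-new : ∀ i → i < suc (p 0) → i₀ ≤ i → ∀ j → j < n → C t i j ⇔ C s i j
      nothing-new i i< i₀≤i j j< = C-old N i (i< ≤∙ p₀<len) j j< ⟨⇔⟩ mk⇔ collapse inj₁
        where
        collapse : C s i j ⊎ Latr i j → C s i j
        collapse (inj₁ c) = c
        collapse (inj₂ h) with C? s i₀ j
        ... | yes c = from (C-const i i< i₀≤i j j<) c
        ... | no nc = contradiction (j , j< , later-mono i₀≤i h , nc) none
      uniform : ∀ i → i < suc (p 0) → i₀ ≤ i → ∀ j → j < n → C t i j ⇔ C t i₀ j
      uniform i i< i₀≤i j j< = nothing-new i i< i₀≤i j j< ⟨⇔⟩ C-const i i< i₀≤i j j< ⟨⇔⟩ ⇔-flip (nothing-new i₀ (s≤s (i₀≤ 0 z≤n)) ≤-refl j j<)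
    ... | yes (j , j< , h , nc) = record
        { blocks = m ∸ r ; redundant = survive r (<⇒≤ r<m) uniform ; positive = positive S
        ; enough = m+n≤o⇒m≤o∸n _ (+-monoʳ-≤ (suc n * suc (room-left t i₀)) (s≤s⁻¹ (proj₁ (proj₂ level)) ≤∙ n≤1+n n) ≤∙
            arith (suc n) (room-left t i₀) ≡∙≤ *-monoʳ-≤ (suc n) (s≤s smaller) ≤∙ enough S) ≤∙ ≤-refl }
      where
      arith : ∀ a b → a * suc b + a ≡ a * suc (suc b)
      arith = solve-∀
      smaller : suc (room-left t i₀) ≤ room-left s i₀
      smaller = +-mono-≤ (count-strict (λ j → ¬? (C? t i₀ j)) (λ j → ¬? (C? s i₀ j)) n C-grows j j< nc
                  (λ ct → ct (from (C-old N i₀ i₀<len j j<) (inj₂ h)))) L-shrinks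
      uniform : ∀ i → i < suc (p r) → i₀ ≤ i → ∀ j → j < n → C t i j ⇔ C t i₀ j
      uniform i i< i₀≤i j j< = C-old N i (i< ≤∙ p<len r (<⇒≤ r<m)) j j< ⟨⇔⟩
        ⊎-⇔ (C-const i (i< ≤∙ s≤s (p≤p₀ r (<⇒≤ r<m))) i₀≤i j j<) (constant i i< i₀≤i j j<) ⟨⇔⟩ ⇔-flip (C-old N i₀ i₀<len j j<)

-- Nested blocks in long states and the deletion of items.

skipping : ℕ → ℕ → ℕ
skipping zero i       = suc i
skipping (suc i₀) zero    = zero
skipping (suc i₀) (suc i) = suc (skipping i₀ i)

skipping-mono : ∀ i₀ {i i'} → i < i' → skipping i₀ i < skipping i₀ i'
skipping-mono zero lt = s≤s lt
skipping-mono (suc i₀) {zero} {suc i'} lt       = s≤s z≤n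
skipping-mono (suc i₀) {suc i} {suc i'} (s≤s lt) = s≤s (skipping-mono i₀ lt)

skipping-≤ : ∀ i₀ {i i'} → i ≤ i' → skipping i₀ i ≤ skipping i₀ i'
skipping-≤ i₀ {i} {i'} le with m≤n⇒m<n∨m≡n le
... | inj₁ lt   = <⇒≤ (skipping-mono i₀ lt)
... | inj₂ refl = ≤-refl

skipping-reflects : ∀ i₀ {i i'} → skipping i₀ i < skipping i₀ i' → i < i'
skipping-reflects i₀ lt = ≰⇒> λ le → <⇒≱ lt (skipping-≤ i₀ le)

skipping-end : ∀ {i₀ m} → i₀ ≤ m → skipping i₀ m ≡ suc m
skipping-end {zero} le       = refl
skipping-end {suc i₀} (s≤s le) = cong suc (skipping-end le)

unskip : ∀ i₀ x → x ≢ i₀ → ∃[ i ] skipping i₀ i ≡ x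
unskip zero zero ne = contradiction refl ne
unskip zero (suc x) ne = x , refl
unskip (suc i₀) zero ne = zero , refl
unskip (suc i₀) (suc x) ne with unskip i₀ x (ne ∘ cong suc)
... | i , refl = suc i , refl

skipping-zero : ∀ {i₀} → 0 < i₀ → skipping i₀ 0 ≡ 0
skipping-zero (s≤s _) = refl

-- Sufficiently long words over a finite alphabet have many nested blocks: split the word into 1 + M pieces; some piece contains only
-- letters of the pieces before it.
module Nesting (M : ℕ) (c : ℕ → ℕ) where

  width : ℕ → ℕ
  width zero    = 1
  width (suc k) = suc M * width k

  record Nested (k low high : ℕ) : Set where
    field
      q       : ℕ → ℕ
      q₀<high : q 0 < high
      low≤qₖ  : low ≤ q k
      nest    : ∀ r → r < k → ∀ i → i < suc (q (suc r)) → q k ≤ i → ∃[ i' ] i' < suc (q r) × q (suc r) < i' × c i ≡ c i'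

  -- If every piece had a letter that occurs in no higher position outside it, the `suc M` pieces
  -- would yield `suc M` different letters below `M`. So some piece is covered by what lies above
  -- it: the part above is block 0, and the piece itself yields the other `k` blocks.
  nested : ∀ k low high → low + width k ≤ high → (∀ i → i < high → c i < M) → Nested k low high
  nested zero low high le small = record { q = λ _ → low ; q₀<high = +-comm 1 low ≡∙≤ le ; low≤qₖ = ≤-refl ; nest = λ _ () }
  nested (suc k) low high le small = extend (exists? covered? (suc M))
    where
    W = width k
    border : ℕ → ℕ
    border x = low + x * W
    border-mono : ∀ {x y} → x ≤ y → border x ≤ border y
    border-mono le = +-monoʳ-≤ low (*-monoˡ-≤ W le)
    border-≤ : ∀ {x} → x < suc M → border (suc x) ≤ high
    border-≤ lt = border-mono lt ≤∙ le
    Covered : ℕ → Set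
    Covered x = ∀ i → i < border (suc x) → border x ≤ i → ∃[ i' ] i' < high × border (suc x) ≤ i' × c i ≡ c i'
    found? : ∀ x i → Dec (∃[ i' ] i' < high × border (suc x) ≤ i' × c i ≡ c i')
    found? x i = exists? (λ i' → (border (suc x) ≤? i') ×-dec (c i ≟ c i')) high
    covered? : ∀ x → Dec (Covered x)
    covered? x = forall? (λ i → (border x ≤? i) →-dec found? x i) (border (suc x))
    New : ℕ → ℕ → Set
    New x i = border x ≤ i × ¬ (∃[ i' ] i' < high × border (suc x) ≤ i' × c i ≡ c i')
    new? : ∀ x i → Dec (New x i)
    new? x i = (border x ≤? i) ×-dec ¬? (found? x i)
    extend : Dec (∃[ x ] x < suc M × Covered x) → Nested (suc k) low high
    extend (yes (x , x< , cov)) = record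
      { q = q' ; q₀<high = top< ; low≤qₖ = m≤m+n low (x * W) ≤∙ Nested.low≤qₖ ih ; nest = nest' }
      where
      ih : Nested k (border x) (border (suc x))
      ih = nested k (border x) (border (suc x)) (≤-reflexive (+-assoc low (x * W) W ∙ cong (low +_) (+-comm (x * W) W)))
             (λ i lt → small i (lt ≤∙ border-≤ x<))
      0<high : 0 < high
      0<high = s≤s z≤n ≤∙ Nested.q₀<high ih ≤∙ border-≤ x<
      top< : pred high < high
      top< = ≤-reflexive (suc-pred high {{>-nonZero 0<high}})
      q' : ℕ → ℕ
      q' zero    = pred high
      q' (suc r) = Nested.q ih r
      nest' : ∀ r → r < suc k → ∀ i → i < suc (q' (suc r)) → q' (suc k) ≤ i → ∃[ i' ] i' < suc (q' r) × q' (suc r) < i' × c i ≡ c i'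
      nest' zero lt i i≤ le with cov i (i≤ ≤∙ Nested.q₀<high ih) (Nested.low≤qₖ ih ≤∙ le)
      ... | i' , i'< , le' , eq = i' , i'< ≤∙≡ sym (suc-pred high {{>-nonZero 0<high}}) , Nested.q₀<high ih ≤∙ le' , eq
      nest' (suc r) (s≤s lt) i i≤ le = Nested.nest ih r lt i i≤ le
    extend (no none) = contradiction clash (λ { (x , y , x<y , eq) → proj₂ (proj₂ (proj₂ (fresh x)))
        (proj₁ (fresh y) , proj₁ (proj₂ (fresh y)) ≤∙ border-≤ (toℕ<n y) ,
          border-mono x<y ≤∙ proj₁ (proj₂ (proj₂ (fresh y))) ,
          sym (toℕ-fromℕ< (value< x)) ∙ cong Fin.toℕ eq ∙ toℕ-fromℕ< (value< y)) })
      where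
      witness : ∀ x → x < suc M → ∃[ i ] i < border (suc x) × New x i
      witness x x< with exists? (new? x) (border (suc x))
      ... | yes w    = w
      ... | no nowit = contradiction (x , x< , cov) none
        where
        cov : Covered x
        cov i i< le with found? x i
        ... | yes f = f
        ... | no nf = contradiction (i , i< , le , nf) nowit
      fresh : (x : Fin (suc M)) → ∃[ i ] i < border (suc (Fin.toℕ x)) × New (Fin.toℕ x) i
      fresh x = witness (Fin.toℕ x) (toℕ<n x)
      value< : ∀ x → c (proj₁ (fresh x)) < M
      value< x = small _ (proj₁ (proj₂ (fresh x)) ≤∙ border-≤ (toℕ<n x))
      clash : ∃[ x ] ∃[ y ] x Fin.< y × Fin.fromℕ< (value< x) ≡ Fin.fromℕ< (value< y)
      clash = pigeonhole ≤-refl (λ x → Fin.fromℕ< (value< x))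

module Columns (n : ℕ) (kind : ℕ → Kind) (wf : ∀ j → j < n → WellFormed n j (kind j)) where

  open Abstraction n kind wf

  record Deletion (i₀ : ℕ) (s s' : State) : Set where
    field
      len-del : len s ≡ suc (len s')
      A-del   : ∀ i → i < len s' → ∀ j → j < n → A s' i j ⇔ A s (skipping i₀ i) j
      C-del   : ∀ i → i < len s' → ∀ j → j < n → C s' i j ⇔ C s (skipping i₀ i) j
      L-del   : ∀ i → i < len s' → ∀ j → j < n → L s' i j ⇔ L s (skipping i₀ i) j

  open Deletion public

  delete : ℕ → State → State
  delete i₀ s = record
    { len = pred (len s) ; A = λ i → A s (skipping i₀ i) ; C = λ i → C s (skipping i₀ i) ; L = λ i → L s (skipping i₀ i)
    ; A? = λ i → A? s (skipping i₀ i) ; C? = λ i → C? s (skipping i₀ i) ; L? = λ i → L? s (skipping i₀ i) }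

  Deletion-delete : ∀ {i₀ s} → 0 < len s → Deletion i₀ s (delete i₀ s)
  Deletion-delete {s = s} pos = record
    { len-del = sym (suc-pred (len s) {{>-nonZero pos}})
    ; A-del = λ _ _ _ _ → ⇔-id ; C-del = λ _ _ _ _ → ⇔-id ; L-del = λ _ _ _ _ → ⇔-id }

  module _ {s s' ℓ t τ i₀} (N : Next s ℓ t τ) (D : Deletion i₀ s s') (i₀<len : i₀ < len s)
           (absorbed : ∀ j → j < n → τ i₀ j → Later τ (len s) i₀ j) where

    τ-del : ℕ → ℕ → Set
    τ-del i j = τ (skipping i₀ i) j

    private
      l = len s'
      ls : len s ≡ suc l
      ls = len-del D
      i₀≤l : i₀ ≤ l
      i₀≤l = s≤s⁻¹ (subst (i₀ <_) ls i₀<len)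

      bound-skip : ∀ {m i} → i < m → i₀ ≤ m → skipping i₀ i < suc m
      bound-skip {m} {i} lt le = subst (skipping i₀ i <_) (skipping-end le) (skipping-mono i₀ lt)

      bound-unskip : ∀ {m i} → skipping i₀ i < suc m → i₀ ≤ m → i < m
      bound-unskip {m} {i} lt le = skipping-reflects i₀ (subst (skipping i₀ i <_) (sym (skipping-end le)) lt)

      old : ∀ {i} → i < l → skipping i₀ i < len s
      old lt = subst (_ <_) (sym ls) (bound-skip lt i₀≤l)

      endpoint : skipping i₀ l ≡ len s
      endpoint = skipping-end i₀≤l ∙ sym ls

      up : ∀ {i} → i < suc l → skipping i₀ i < suc (len s)
      up lt = subst (λ m → _ < suc m) (sym ls) (bound-skip lt (i₀≤l ≤∙ n≤1+n l))

      down : ∀ {i} → skipping i₀ i < suc (len s) → i < suc l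
      down {i} lt = bound-unskip (subst (λ m → skipping i₀ i < suc m) ls lt) (i₀≤l ≤∙ n≤1+n l)

      -- The deleted item is not needed as a witness.
      witness : ∀ {j} x → j < n → x < suc (len s) → τ x j → ∃[ i ] i < suc l × x ≤ skipping i₀ i × τ-del i j
      witness {j} x j< x< h with x ≟ i₀
      ... | no ne with unskip i₀ x ne
      ... | i , refl = i , down x< , ≤-refl , h
      witness {j} x j< x< h | yes refl with absorbed j j< h
      ... | y , y< , lt , h' with unskip i₀ y (>⇒≢ lt)
      ... | i , refl = i , down y< , <⇒≤ lt , h'

      later : ∀ i j → j < n → Later τ (len s) (skipping i₀ i) j ⇔ Later τ-del l i j
      later i j j< = mk⇔
        (λ { (x , x< , lt , h) → let i' , i'< , le , h' = witness x j< x< h in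
               i' , i'< , skipping-reflects i₀ (lt ≤∙ le) , h' })
        (λ { (i' , i'< , lt , h) → skipping i₀ i' , up i'< , skipping-mono i₀ lt , h })

    -- Item `i₀` could only be missed as an existential witness, in `A-new`, in `C-old` and in
    -- `⟨B⟩`; `absorbed` offers a later item in each case.
    next-delete : Next s' ℓ (delete i₀ t) τ-del
    next-delete = record
      { len-suc = cong pred (len-suc N) ∙ ls
      ; τ? = λ i j → τ? N (skipping i₀ i) j
      ; A-old = λ i i< j j< → A-old N _ (old i<) j j< ⟨⇔⟩ ⇔-flip (A-del D i i< j j<)
      ; C-old = λ i i< j j< → C-old N _ (old i<) j j< ⟨⇔⟩ ⊎-⇔ (⇔-flip (C-del D i i< j j<)) (later i j j<)
      ; L-old = λ i i< j j< → L-old N _ (old i<) j j< ⟨⇔⟩ ×-⇔ (⇔-flip (L-del D i i< j j<)) ⇔-id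
      ; A-new = λ j j< → subst (λ x → A t x j ⇔ _) (sym endpoint) (A-new N j j<) ⟨⇔⟩ mk⇔
          (λ { (x , x< , h) → let i' , i'< , _ , h' = witness x j< x< h in i' , i'< , h' })
          (λ { (i' , i'< , h) → skipping i₀ i' , up i'< , h })
      ; C-new = λ j j< → subst (λ x → ¬ C t x j) (sym endpoint) (C-new N j j<)
      ; L-new = λ j j< → subst (λ x → L t x j ⇔ _) (sym endpoint) (L-new N j j<)
      ; valueᴺ = λ i i< j j< → valueᴺ N _ (up i<) j j< ⟨⇔⟩ values i (kind j) (wf j j<) }
      where
      values : ∀ i {j} κ → WellFormed n j κ → Value s t τ (skipping i₀ i) j κ ⇔ Value s' (delete i₀ t) τ-del i j κ
      values i letter w = ⇔-id
      values i (negᵏ k) w = ⇔-id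
      values i (Aᵏ k) w = ⇔-id
      values i (Bᵏ k) w = later i k (proj₂ w)
      values i (Dᵏ k) w = mk⇔
        (λ { (lt , c) → let lt' = bound-unskip (subst (_ <_) ls lt) i₀≤l in lt' , from (C-del D i lt' k (proj₂ w)) c })
        (λ { (lt , c) → old lt , to (C-del D i lt k (proj₂ w)) c })
      values i (orᵏ k l) w = ⇔-id

  next-≈ : ∀ {s s' ℓ t τ} → s ≈ s' → Next s ℓ t τ → Next s' ℓ t τ
  next-≈ {s} {record { len = _ }} {t = t} {τ} e@record { len-≡ = refl } N = record
    { len-suc = len-suc N ; τ? = τ? N
    ; A-old = λ i i< j j< → A-old N i i< j j< ⟨⇔⟩ A-≈ e i i< j j<
    ; C-old = λ i i< j j< → C-old N i i< j j< ⟨⇔⟩ ⊎-⇔ (C-≈ e i i< j j<) ⇔-id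
    ; L-old = λ i i< j j< → L-old N i i< j j< ⟨⇔⟩ ×-⇔ (L-≈ e i i< j j<) ⇔-id
    ; A-new = A-new N ; C-new = C-new N ; L-new = L-new N
    ; valueᴺ = λ i i< j j< → valueᴺ N i i< j j< ⟨⇔⟩ values i (kind j) (wf j j<) }
    where
    values : ∀ i {j} κ → WellFormed n j κ → Value s t τ i j κ ⇔ Value _ t τ i j κ
    values i letter w = ⇔-id
    values i (negᵏ k) w = ⇔-id
    values i (Aᵏ k) w = ⇔-id
    values i (Bᵏ k) w = ⇔-id
    values i (Dᵏ k) w = mk⇔ (λ { (lt , c) → lt , to (C-≈ e i lt k (proj₂ w)) c }) (λ { (lt , c) → lt , from (C-≈ e i lt k (proj₂ w)) c })
    values i (orᵏ k l) w = ⇔-id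

  ≈-trans : ∀ {s t v} → s ≈ t → t ≈ v → s ≈ v
  ≈-trans {t = record { len = _ }} e@record { len-≡ = refl } f = record
    { len-≡ = len-≡ f
    ; A-≈ = λ i i< j j< → A-≈ e i i< j j< ⟨⇔⟩ A-≈ f i i< j j<
    ; C-≈ = λ i i< j j< → C-≈ e i i< j j< ⟨⇔⟩ C-≈ f i i< j j<
    ; L-≈ = λ i i< j j< → L-≈ e i i< j j< ⟨⇔⟩ L-≈ f i i< j j< }

  Deletion-≈ : ∀ {i₀ s s' t} → Deletion i₀ s s' → s' ≈ t → Deletion i₀ s t
  Deletion-≈ {s' = record { len = _ }} {record { len = _ }} D e@record { len-≡ = refl } = record
    { len-del = len-del D
    ; A-del = λ i i< j j< → ⇔-flip (A-≈ e i i< j j<) ⟨⇔⟩ A-del D i i< j j<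
    ; C-del = λ i i< j j< → ⇔-flip (C-≈ e i i< j j<) ⟨⇔⟩ C-del D i i< j j<
    ; L-del = λ i i< j j< → ⇔-flip (L-≈ e i i< j j<) ⟨⇔⟩ L-del D i i< j j< }

  -- Relates a state of the search to the full state of a word. The whole chain of deletions is
  -- remembered, since each further point is first processed in the full state and every deletion is
  -- then repeated.
  data Derived (s : State) : State → Set₁ where
    intact : ∀ {t} → s ≈ t → Derived s t
    remove : ∀ {t t' i₀} → Derived s t → Superfluous t i₀ → Deletion i₀ t t' → Derived s t'

  derived-≈ : ∀ {s t t'} → Derived s t → t ≈ t' → Derived s t'
  derived-≈ (intact e) f = intact (≈-trans e f)
  derived-≈ (remove d S D) f = remove d S (Deletion-≈ D f)

  derived-next : ∀ {s s' ℓ t τ} → Derived s s' → Next s ℓ t τ →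
                 ∃[ t' ] ∃[ τ' ] Next s' ℓ t' τ' × Derived t t' × (∀ j → j < n → τ 0 j ⇔ τ' 0 j)
  derived-next (intact e) N = _ , _ , next-≈ e N , intact (record { len-≡ = refl ; A-≈ = λ _ _ _ _ → ⇔-id ; C-≈ = λ _ _ _ _ → ⇔-id ; L-≈ = λ _ _ _ _ → ⇔-id }) , λ _ _ → ⇔-id
  derived-next (remove {i₀ = i₀} d S D) N with derived-next d N
  ... | t₁ , τ₁ , N₁ , d₁ , e₁ =
    delete i₀ t₁ , (λ i j → τ₁ (skipping i₀ i) j) , next-delete N₁ D i₀<len absorbed ,
    remove d₁ superfluous (Deletion-delete (subst (0 <_) (sym (len-suc N₁)) (s≤s z≤n))) ,
    λ j j< → e₁ j j< ⟨⇔⟩ subst (λ i → τ₁ 0 j ⇔ τ₁ i j) (sym (skipping-zero (positive S))) ⇔-id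
    where open Preservation N₁ S

  derived-step : ∀ {s s' ℓ t τ t' τ'} → Derived s s' → Next s ℓ t τ → Next s' ℓ t' τ' →
                 Derived t t' × (∀ j → j < n → τ 0 j ⇔ τ' 0 j)
  derived-step {s' = s'} d N N' with derived-next d N
  ... | t₁ , τ₁ , N₁ , d₁ , e₁ with next-unique (record { len-≡ = refl ; A-≈ = λ _ _ _ _ → ⇔-id ; C-≈ = λ _ _ _ _ → ⇔-id ; L-≈ = λ _ _ _ _ → ⇔-id }) N₁ N'
  ... | f , g = derived-≈ d₁ f , λ j j< → e₁ j j< ⟨⇔⟩ g j j< 0 (s≤s z≤n)

  -- A larger right end, counted from the right, means a shorter interval: fewer intervals lie
  -- inside it and more letters hold throughout.
  record Monotone (s : State) : Set where
    field
      C-mono : ∀ i i' → i ≤ i' → i' < len s → ∀ j → j < n → C s i' j → C s i j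
      L-mono : ∀ i i' → i ≤ i' → i' < len s → ∀ j → j < n → L s i j → L s i' j

  open Monotone

  derived-monotone : ∀ {s t} → Derived s t → Monotone s → Monotone t
  derived-monotone {t = record { len = _ }} (intact e@record { len-≡ = refl }) M = record
    { C-mono = λ i i' le lt j j< c → to (C-≈ e i (s≤s le ≤∙ lt) j j<) (C-mono M i i' le lt j j< (from (C-≈ e i' lt j j<) c))
    ; L-mono = λ i i' le lt j j< c → to (L-≈ e i' lt j j<) (L-mono M i i' le lt j j< (from (L-≈ e i (s≤s le ≤∙ lt) j j<) c)) }
  derived-monotone (remove {t} {t'} {i₀} d S D) M = record
    { C-mono = λ i i' le lt j j< c → from (C-del D i (s≤s le ≤∙ lt) j j<) (C-mono M' _ _ (skipping-≤ i₀ le) (in-range lt) j j< (to (C-del D i' lt j j<) c))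
    ; L-mono = λ i i' le lt j j< c → from (L-del D i' lt j j<) (L-mono M' _ _ (skipping-≤ i₀ le) (in-range lt) j j< (to (L-del D i (s≤s le ≤∙ lt) j j<) c)) }
    where
    M' = derived-monotone d M
    in-range : ∀ {i} → i < len t' → skipping i₀ i < len t
    in-range {i} lt = subst (skipping i₀ i <_) (sym (len-del D)) (s≤s (skip≤ i₀ i) ≤∙ s≤s lt)
      where
      skip≤ : ∀ i₀ i → skipping i₀ i ≤ suc i
      skip≤ zero i       = ≤-refl
      skip≤ (suc i₀) zero    = z≤n
      skip≤ (suc i₀) (suc i) = s≤s (skip≤ i₀ i)

  -- One block more than required is taken; it supplies the item that pins down `C` and `L`. The
  -- blocks are sought from 1 on because item 0 carries the answer and must stay.
  long-redundant : ∀ {s} M (c : ℕ → ℕ) m → Monotone s → (∀ i → i < len s → c i < M) → (∀ i i' → c i ≡ c i' → Same s i i') →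
                   Nesting.width M c (suc m) < len s → ∃[ i₀ ] 0 < i₀ × Redundant m s i₀
  long-redundant {s} M c m mono small same long = q (suc m) , low≤qₖ , record
      { p = λ r → q (suc r) ; p-bound = λ r r< → s≤s (top-most r r<) ≤∙ q₀<high ; pₘ≡i₀ = refl
      ; block = λ r lt i i< le → let i' , a , b , e = nest (suc r) (s≤s lt) i i< le in i' , a , b , same i i' e
      ; C-const = λ i i< le j j< → mk⇔ (C-mono mono _ i le (high i i<) j j<)
          (λ h → C-mono mono i w (below i i<) w< j j< (to (C-same (same _ _ w≡) j j<) h))
      ; L-const = λ i i< le j j< → mk⇔ (λ h → from (L-same (same _ _ w≡) j j<) (L-mono mono i w (below i i<) w< j j< h))
          (L-mono mono _ i le (high i i<) j j<) }
    where
    open Nesting M c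
    open Nested (nested (suc m) 1 (len s) long small)
    floor : ∀ d r → r + d ≡ suc m → q (suc m) ≤ q r
    floor zero r eq = ≤-reflexive (cong q (sym eq ∙ +-identityʳ r))
    floor (suc d) r eq with nest r (s≤s (m≤m+n r d) ≤∙≡ sym (+-suc r d) ∙ eq) (q (suc m)) (s≤s (floor d (suc r) (sym (+-suc r d) ∙ eq))) ≤-refl
    ... | i' , a , b , _ = floor d (suc r) (sym (+-suc r d) ∙ eq) ≤∙ (<⇒≤ b) ≤∙ s≤s⁻¹ a
    descends : ∀ r → r < suc m → q (suc r) < q r
    descends r lt with nest r lt (q (suc m)) (s≤s (floor (m ∸ r) (suc r) (cong suc (m+[n∸m]≡n (s≤s⁻¹ lt))))) ≤-refl
    ... | i' , a , b , _ = b ≤∙ s≤s⁻¹ a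
    top-most : ∀ r → r < suc m → q (suc r) ≤ q 0
    top-most zero lt = <⇒≤ (descends 0 lt)
    top-most (suc r) lt = (<⇒≤ (descends (suc r) lt)) ≤∙ top-most r (<⇒≤ lt)
    -- An item of block 0 that equals the last one; by monotonicity C and L cannot change between the two.
    found : ∃[ i' ] i' < suc (q 0) × q 1 < i' × c (q (suc m)) ≡ c i'
    found = nest 0 (s≤s z≤n) (q (suc m)) (s≤s (floor m 1 refl)) ≤-refl
    w = proj₁ found
    w< : w < len s
    w< = proj₁ (proj₂ found) ≤∙ q₀<high
    w≡ : c (q (suc m)) ≡ c w
    w≡ = proj₂ (proj₂ (proj₂ found))
    below : ∀ i → i < suc (q 1) → i ≤ w
    below i lt = s≤s⁻¹ lt ≤∙ (<⇒≤ (proj₁ (proj₂ (proj₂ found))))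
    high : ∀ i → i < suc (q 1) → i < len s
    high i lt = s≤s (below i lt) ≤∙ w<

  Denotes : (ℕ → Formula) → (ℕ → ℕ) → ℕ → Kind → Set
  Denotes F v j letter    = F j ≡ ` v j
  Denotes F v j (negᵏ k)  = F j ≡ ¬′ F k
  Denotes F v j (Aᵏ k)    = F j ≡ ⟨A⟩ F k
  Denotes F v j (Bᵏ k)    = F j ≡ ⟨B⟩ F k
  Denotes F v j (Dᵏ k)    = F j ≡ ⟨D⟩ F k
  Denotes F v j (orᵏ k l) = F j ≡ F k ∨′ F l

  module Words (F : ℕ → Formula) (v : ℕ → ℕ) (den : ∀ j → j < n → Denotes F v j (kind j)) (u : ℕ → Letter → Bool) where

    -- The state after the points below a have been processed.
    column : ℕ → State
    column a = record
      { len = a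
      ; A = λ i j → ∃[ i' ] i' < suc i × sat u (F j) i i'
      ; C = λ i j → ∃[ a' ] a' < a × ∃[ i' ] i' < suc a' × i < i' × sat u (F j) a' i'
      ; L = λ i j → ∀ k → k < a → i ≤ k → T (u k (v j))
      ; A? = λ i j → exists? (λ i' → sat? u (F j) i i') (suc i)
      ; C? = λ i j → exists? (λ a' → exists? (λ i' → (i <? i') ×-dec sat? u (F j) a' i') (suc a')) a
      ; L? = λ i j → forall? (λ k → (i ≤? k) →-dec T? (u k (v j))) a }

    truths : ℕ → ℕ → ℕ → Set
    truths a i j = sat u (F j) a i

    column-next : ∀ a → Next (column a) (λ j → T (u a (v j))) (column (suc a)) (truths a)
    column-next a = record
      { len-suc = refl ; τ? = λ i j → sat? u (F j) a i
      ; A-old = λ _ _ _ _ → ⇔-id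
      ; C-old = λ i i< j j< → mk⇔ C-to [ (λ { (a' , lt , h) → a' , lt ≤∙ n≤1+n a , h }) , (λ h → a , ≤-refl , h) ]′
      ; L-old = λ i i< j j< → mk⇔ (λ h → (λ k k< le → h k (k< ≤∙ n≤1+n a) le) , h a ≤-refl (<⇒≤ i<))
          (λ { (h , h') k k< le → [ (λ lt → h k lt le) , (λ { refl → h' }) ]′ (m≤n⇒m<n∨m≡n (s≤s⁻¹ k<)) })
      ; A-new = λ _ _ → ⇔-id
      ; C-new = λ { j j< (a' , a'< , i' , i'< , lt , h) → <⇒≱ lt (s≤s⁻¹ i'< ≤∙ s≤s⁻¹ a'<) }
      ; L-new = λ j j< → mk⇔ (λ h → h a ≤-refl ≤-refl) (λ h k k< le → subst (λ k → T (u k (v j))) (≤-antisym le (s≤s⁻¹ k<)) h)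
      ; valueᴺ = λ i i< j j< → values i (s≤s⁻¹ i<) (kind j) (den j j<) }
      where
      C-to : ∀ {i j} → C (column (suc a)) i j → C (column a) i j ⊎ Later (truths a) a i j
      C-to (a' , a'< , h) with m≤n⇒m<n∨m≡n (s≤s⁻¹ a'<)
      ... | inj₁ lt   = inj₁ (a' , lt , h)
      ... | inj₂ refl = inj₂ h
      rewritten : ∀ {i φ ψ} → φ ≡ ψ → sat u φ a i ⇔ sat u ψ a i
      rewritten refl = ⇔-id
      values : ∀ i {j} → i ≤ a → ∀ κ → Denotes F v j κ → truths a i j ⇔ Value (column a) (column (suc a)) (truths a) i j κ
      values i i≤ letter eq = rewritten eq
      values i i≤ (negᵏ k) eq = rewritten eq
      values i i≤ (Aᵏ k) eq = rewritten eq
      values i i≤ (Bᵏ k) eq = rewritten eq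
      values i i≤ (Dᵏ k) eq = rewritten eq ⟨⇔⟩ mk⇔
        (λ { h@(a' , a'< , i' , i'< , lt , _) → lt ≤∙ s≤s⁻¹ i'< ≤∙ (<⇒≤ a'<) , h }) proj₂
      values i i≤ (orᵏ k l) eq = rewritten eq

    column-monotone : ∀ a → Monotone (column a)
    column-monotone a = record
      { C-mono = λ { i i' le lt j j< (a' , a'< , x , x< , lt' , h) → a' , a'< , x , x< , s≤s le ≤∙ lt' , h }
      ; L-mono = λ i i' le lt j j< h k k< le' → h k k< (le ≤∙ le') }

  column-cong : ∀ {F v} {den : ∀ j → j < n → Denotes F v j (kind j)} {u u' a} → (∀ k → k < a → ∀ p → u k p ≡ u' k p) →
                Words.column F v den u a ≈ Words.column F v den u' a
  column-cong {F} {v} {den} {u} {u'} {a} eq = record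
    { len-≡ = refl
    ; A-≈ = λ i i< j j< → mk⇔
        (λ { (i' , lt , h) → i' , lt , sat-cong (F j) i' (λ k le → eq k (s≤s le ≤∙ i<)) (s≤s⁻¹ lt) h })
        (λ { (i' , lt , h) → i' , lt , sat-cong (F j) i' (λ k le p → sym (eq k (s≤s le ≤∙ i<) p)) (s≤s⁻¹ lt) h })
    ; C-≈ = λ i i< j j< → mk⇔
        (λ { (a' , a'< , i' , lt , lt' , h) → a' , a'< , i' , lt , lt' , sat-cong (F j) i' (λ k le → eq k (s≤s le ≤∙ a'<)) (s≤s⁻¹ lt) h })
        (λ { (a' , a'< , i' , lt , lt' , h) → a' , a'< , i' , lt , lt' , sat-cong (F j) i' (λ k le p → sym (eq k (s≤s le ≤∙ a'<) p)) (s≤s⁻¹ lt) h })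
    ; L-≈ = λ i i< j j< → mk⇔ (λ h k k< le → subst T (eq k k< (v j)) (h k k< le)) (λ h k k< le → subst T (sym (eq k k< (v j))) (h k k< le)) }

-- Parsing a coded formula arithmetically.

-- The word with a given value in bijective binary, one digit at a time.
tailᵈ bitᵈ : ℕ → ℕ → ℕ
tailᵈ x i = primrec x (λ _ y → pred y / 2) i
bitᵈ x i = 1 ∸ tailᵈ x i % 2

tokenᵈ : ℕ → ℕ → ℕ
tokenᵈ x j = 4 * bitᵈ x (3 * j) + (2 * bitᵈ x (1 + 3 * j) + bitᵈ x (2 + 3 * j))

-- Counts the nonempty tails; `x` rounds are enough because no word is longer than its value.
lengthᵈ : ℕ → ℕ
lengthᵈ x = primrec 0 (λ i a → a + (1 ∸ (1 ∸ tailᵈ x i))) x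

tailᵈ-suc : ∀ x i → tailᵈ x (suc i) ≡ tailᵈ (pred x / 2) i
tailᵈ-suc x zero    = refl
tailᵈ-suc x (suc i) = cong (λ y → pred y / 2) (tailᵈ-suc x i)

value-tail : ∀ b w → pred (value (b ∷ w)) / 2 ≡ value w
value-tail false w = cong (_/ 2) (*-comm 2 (value w)) ∙ cons-/ {1} {0} (value w) z≤n
value-tail true w = cong (λ y → suc y / 2) (*-comm 2 (value w)) ∙ cons-/ {1} {1} (value w) (s≤s z≤n)

tailᵈ-value : ∀ w i → tailᵈ (value w) i ≡ value (drop i w)
tailᵈ-value w zero    = refl
tailᵈ-value [] (suc i) = tailᵈ-suc 0 i ∙ zeros i
  where
  zeros : ∀ i → tailᵈ 0 i ≡ 0
  zeros zero    = refl
  zeros (suc i) = tailᵈ-suc 0 i ∙ zeros i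
tailᵈ-value (b ∷ w) (suc i) = tailᵈ-suc (value (b ∷ w)) i ∙ cong (λ y → tailᵈ y i) (value-tail b w) ∙ tailᵈ-value w i

boolean : Bool → ℕ
boolean false = 0
boolean true  = 1

bitᵈ-value : ∀ w i {b v} → drop i w ≡ b ∷ v → bitᵈ (value w) i ≡ boolean b
bitᵈ-value w i {b} {v} eq = cong (λ y → 1 ∸ y % 2) (tailᵈ-value w i ∙ cong value eq) ∙ last-digit b
  where
  last-digit : ∀ b → 1 ∸ value (b ∷ v) % 2 ≡ boolean b
  last-digit false = cong (1 ∸_) (cong (λ y → suc y % 2) (*-comm 2 (value v)) ∙ cons-% {1} {1} (value v) (s≤s z≤n))
  last-digit true  = cong (1 ∸_) (cong (_% 2) (twice (value v)) ∙ cons-% {1} {0} (suc (value v)) z≤n)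
    where
    twice : ∀ x → suc (suc (2 * x)) ≡ suc x * 2
    twice = solve-∀

tokenCode : Token → ℕ
tokenCode neg    = 0
tokenCode or     = 1
tokenCode diaA   = 2
tokenCode diaB   = 3
tokenCode diaD   = 4
tokenCode digit1 = 5
tokenCode digit2 = 6
tokenCode end    = 7

word : List Token → List Bool
word = concatMap bits

drop-word : ∀ ts j → drop (3 * j) (word ts) ≡ word (drop j ts)
drop-word ts zero    = refl
drop-word [] (suc j) = drop-[] (3 * suc j)
  where
  drop-[] : ∀ i → drop i (word []) ≡ []
  drop-[] zero    = refl
  drop-[] (suc i) = refl
drop-word (t ∷ ts) (suc j) = cong (λ i → drop i (bits t ++ word ts)) (three j) ∙ drop₃ t (3 * j) ∙ drop-word ts j
  where
  three : ∀ j → 3 * suc j ≡ 3 + 3 * j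
  three = solve-∀
  drop₃ : ∀ t i → drop (3 + i) (bits t ++ word ts) ≡ drop i (word ts)
  drop₃ neg i = refl
  drop₃ or i = refl
  drop₃ diaA i = refl
  drop₃ diaB i = refl
  drop₃ diaD i = refl
  drop₃ digit1 i = refl
  drop₃ digit2 i = refl
  drop₃ end i = refl

drop-suc : ∀ {A : Set} i (w : List A) {x v} → drop i w ≡ x ∷ v → drop (suc i) w ≡ v
drop-suc zero (x ∷ w) refl = refl
drop-suc (suc i) (x ∷ w) eq   = drop-suc i w eq

tokenᵈ-value : ∀ ts j {t us} → drop j ts ≡ t ∷ us → tokenᵈ (value (word ts)) j ≡ tokenCode t
tokenᵈ-value ts j {t} {us} eq = three t (drop-word ts j ∙ cong word eq)
  where
  w = word ts
  three : ∀ t → drop (3 * j) w ≡ bits t ++ word us → tokenᵈ (value w) j ≡ tokenCode t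
  bits₃ : ∀ {a b c v} → drop (3 * j) w ≡ a ∷ b ∷ c ∷ v → tokenᵈ (value w) j ≡ 4 * boolean a + (2 * boolean b + boolean c)
  bits₃ e = cong₂ (λ x y → 4 * x + y) (bitᵈ-value w (3 * j) e)
    (cong₂ (λ x y → 2 * x + y) (bitᵈ-value w (1 + 3 * j) (drop-suc (3 * j) w e)) (bitᵈ-value w (2 + 3 * j) (drop-suc (1 + 3 * j) w (drop-suc (3 * j) w e))))
  three neg e = bits₃ e
  three or e = bits₃ e
  three diaA e = bits₃ e
  three diaB e = bits₃ e
  three diaD e = bits₃ e
  three digit1 e = bits₃ e
  three digit2 e = bits₃ e
  three end e = bits₃ e

length-word : ∀ ts → length (word ts) ≡ 3 * length ts
length-word []       = refl
length-word (t ∷ ts) = length-++ (bits t) ∙ cong₂ _+_ (length-bits t) (length-word ts) ∙ three (length ts)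
  where
  three : ∀ j → 3 + 3 * j ≡ 3 * suc j
  three = solve-∀
  length-bits : ∀ t → length (bits t) ≡ 3
  length-bits neg    = refl
  length-bits or     = refl
  length-bits diaA   = refl
  length-bits diaB   = refl
  length-bits diaD   = refl
  length-bits digit1 = refl
  length-bits digit2 = refl
  length-bits end    = refl

fromWord : ∀ n w → length w ≡ 3 * n → ∃[ ts ] word ts ≡ w × length ts ≡ n
fromWord zero [] eq = [] , refl , refl
fromWord (suc n) w eq = split₃ w (eq ∙ three n)
  where
  three : ∀ j → 3 * suc j ≡ 3 + 3 * j
  three = solve-∀
  token : Bool → Bool → Bool → Token
  token false false false = neg
  token false false true  = or
  token false true false = diaA
  token false true true  = diaB
  token true false false = diaD
  token true false true  = digit1
  token true true false = digit2
  token true true true  = end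
  bits-token : ∀ a b c w → bits (token a b c) ++ w ≡ a ∷ b ∷ c ∷ w
  bits-token false false false w = refl
  bits-token false false true w = refl
  bits-token false true false w = refl
  bits-token false true true w = refl
  bits-token true false false w = refl
  bits-token true false true w = refl
  bits-token true true false w = refl
  bits-token true true true w = refl
  split₃ : ∀ w → length w ≡ 3 + 3 * n → ∃[ ts ] word ts ≡ w × length ts ≡ suc n
  split₃ (a ∷ b ∷ c ∷ w) eq with fromWord n w (suc-injective (suc-injective (suc-injective eq)))
  ... | ts , p , q = token a b c ∷ ts , cong (bits (token a b c) ++_) p ∙ bits-token a b c w , cong suc q

lengthᵈ-value : ∀ w → lengthᵈ (value w) ≡ length w
lengthᵈ-value w = upto (value w) ∙ m≥n⇒m⊓n≡n (length≤value w)
  where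
  length≤value : ∀ w → length w ≤ value w
  length≤value []          = z≤n
  length≤value (false ∷ w) = s≤s (length≤value w ≤∙ m≤m+n _ _)
  length≤value (true ∷ w)  = s≤s (length≤value w ≤∙ m≤m+n _ _ ≤∙ n≤1+n _)
  positive-drop : ∀ i w → i < length w → 1 ∸ (1 ∸ value (drop i w)) ≡ 1
  positive-drop zero (false ∷ w) lt = cong (1 ∸_) (0∸n≡0 (2 * value w))
  positive-drop zero (true ∷ w) lt = refl
  positive-drop (suc i) (b ∷ w) (s≤s lt) = positive-drop i w lt
  zero-drop : ∀ i w → length w ≤ i → value (drop i w) ≡ 0
  zero-drop zero [] le = refl
  zero-drop (suc i) [] le = refl
  zero-drop (suc i) (b ∷ w) (s≤s le) = zero-drop i w le
  upto : ∀ m → primrec 0 (λ i a → a + (1 ∸ (1 ∸ tailᵈ (value w) i))) m ≡ m ⊓ length w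
  upto zero    = refl
  upto (suc m) with m <? length w
  ... | yes lt = cong₂ _+_ (upto m ∙ m≤n⇒m⊓n≡m (<⇒≤ lt)) (cong (λ y → 1 ∸ (1 ∸ y)) (tailᵈ-value w m) ∙ positive-drop m w lt) ∙
                   +-comm m 1 ∙ sym (m≤n⇒m⊓n≡m lt)
  ... | no ge = cong₂ _+_ (upto m ∙ m≥n⇒m⊓n≡n (≮⇒≥ ge)) (cong (λ y → 1 ∸ (1 ∸ y)) (tailᵈ-value w m ∙ zero-drop m w (≮⇒≥ ge))) ∙
                  +-identityʳ _ ∙ sym (m≥n⇒m⊓n≡n ((≮⇒≥ ge) ≤∙ n≤1+n m))

-- tok j is the code of token j, sz j the number of tokens of the subformula starting at j, and v j the letter starting there.
record Rule (tok sz v : ℕ → ℕ) (n j : ℕ) : Set where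
  field
    unary   : ∀ c → c < 5 → c ≢ 1 → tok j ≡ c → suc j < n × sz j ≡ suc (sz (suc j))
    binaryᵗ : tok j ≡ 1 → suc j < n × suc j + sz (suc j) < n × sz j ≡ suc (sz (suc j) + sz (suc j + sz (suc j)))
    digitᵗ  : ∀ c → c < 2 → tok j ≡ 5 + c → suc j < n × 5 ≤ tok (suc j) × sz j ≡ suc (sz (suc j)) × v j ≡ suc (c + 2 * v (suc j))
    endᵗ    : tok j ≡ 7 → sz j ≡ 1 × v j ≡ 0

open Rule

kindOf : (tok sz : ℕ → ℕ) → ℕ → Kind
kindOf tok sz j = kind (tok j)
  where
  kind : ℕ → Kind
  kind 0 = negᵏ (suc j)
  kind 1 = orᵏ (suc j) (suc j + sz (suc j))
  kind 2 = Aᵏ (suc j)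
  kind 3 = Bᵏ (suc j)
  kind 4 = Dᵏ (suc j)
  kind _ = letter

-- Soundness of guessed tables: the rules tie each position to later ones only, so induction from
-- the end recovers the formula whose code starts there.
module Parsed (tok sz v : ℕ → ℕ) (n : ℕ) (rules : ∀ j → j < n → Rule tok sz v n j) where

  kind : ℕ → Kind
  kind = kindOf tok sz

  wf : ∀ j → j < n → WellFormed n j (kind j)
  wf j lt with tok j in eq
  ... | 0 = ≤-refl , proj₁ (unary (rules j lt) 0 (s≤s z≤n) (λ ()) eq)
  ... | 1 = (≤-refl , proj₁ (binaryᵗ (rules j lt) eq)) , s≤s (m≤m+n j _) , proj₁ (proj₂ (binaryᵗ (rules j lt) eq))
  ... | 2 = ≤-refl , proj₁ (unary (rules j lt) 2 (m≤m+n 3 _) (λ ()) eq)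
  ... | 3 = ≤-refl , proj₁ (unary (rules j lt) 3 (m≤m+n 4 _) (λ ()) eq)
  ... | 4 = ≤-refl , proj₁ (unary (rules j lt) 4 (m≤m+n 5 _) (λ ()) eq)
  ... | suc (suc (suc (suc (suc _)))) = tt

  build : ℕ → Kind → (ℕ → Formula) → Formula
  build j letter F = ` v j
  build j (negᵏ k) F = ¬′ F k
  build j (Aᵏ k) F = ⟨A⟩ F k
  build j (Bᵏ k) F = ⟨B⟩ F k
  build j (Dᵏ k) F = ⟨D⟩ F k
  build j (orᵏ k l) F = F k ∨′ F l

  formulaFrom : ℕ → ℕ → Formula
  formulaFrom zero j = ` 0
  formulaFrom (suc f) j = build j (kind j) (formulaFrom f)

  formula : ℕ → Formula
  formula = formulaFrom n

  build-cong : ∀ j κ {F G} → WellFormed n j κ → (∀ k → Inside n j k → F k ≡ G k) → build j κ F ≡ build j κ G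
  build-cong j letter w eq = refl
  build-cong j (negᵏ k) w eq = cong ¬′_ (eq k w)
  build-cong j (Aᵏ k) w eq = cong ⟨A⟩_ (eq k w)
  build-cong j (Bᵏ k) w eq = cong ⟨B⟩_ (eq k w)
  build-cong j (Dᵏ k) w eq = cong ⟨D⟩_ (eq k w)
  build-cong j (orᵏ k l) (w , w') eq = cong₂ _∨′_ (eq k w) (eq l w')

  enough-fuel : ∀ f g j → j < n → n ≤ f + j → n ≤ g + j → formulaFrom f j ≡ formulaFrom g j
  enough-fuel zero g j j< le le' = contradiction j< (≤⇒≯ le)
  enough-fuel (suc f) zero j j< le le' = contradiction j< (≤⇒≯ le')
  enough-fuel (suc f) (suc g) j j< le le' = build-cong j (kind j) (wf j j<) λ { k (j<k , k<) →
    enough-fuel f g k k< (le ≤∙ sym (+-suc f j) ≡∙≤ +-monoʳ-≤ f j<k)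
                         (le' ≤∙ sym (+-suc g j) ≡∙≤ +-monoʳ-≤ g j<k) }

  formula-build : ∀ j → j < n → formula j ≡ build j (kind j) formula
  formula-build j j< = enough-fuel n (suc n) j j< (m≤m+n n j) (n≤1+n n ≤∙ m≤m+n (suc n) j) ∙ refl

  denotes : ∀ j → j < n → Columns.Denotes n kind wf formula v j (kind j)
  denotes j j< = reading (kind j) (formula-build j j<)
    where
    reading : ∀ κ → formula j ≡ build j κ formula → Columns.Denotes n kind wf formula v j κ
    reading letter eq = eq
    reading (negᵏ k) eq = eq
    reading (Aᵏ k) eq = eq
    reading (Bᵏ k) eq = eq
    reading (Dᵏ k) eq = eq
    reading (orᵏ k l) eq = eq

  module _ (ts : List Token) (len : length ts ≡ n) (tok-ts : ∀ j {t us} → drop j ts ≡ t ∷ us → tok j ≡ tokenCode t) where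

    uncons : ∀ j → j < n → ∃[ t ] drop j ts ≡ t ∷ drop (suc j) ts
    uncons j lt = go j ts (subst (j <_) (sym len) lt)
      where
      go : ∀ j (ts : List Token) → j < length ts → ∃[ t ] drop j ts ≡ t ∷ drop (suc j) ts
      go zero (t ∷ ts) lt       = t , refl
      go (suc j) (t ∷ ts) (s≤s lt) = go j ts lt

    Letters : ℕ → Set
    Letters j = ∃[ b ] v j ≡ toℕ b × drop j ts ≡ digits b ++ drop (sz j + j) ts

    letters-end : ∀ j → j < n → tok j ≡ 7 → drop j ts ≡ end ∷ drop (suc j) ts → Letters j
    letters-end j j< eq e with endᵗ (rules j j<) eq
    ... | p , q = zero , q , e ∙ cong (λ x → end ∷ drop (x + j) ts) (sym p)

    letters-digit : ∀ j → j < n → Letters (suc j) → ∀ c → c < 2 → tok j ≡ 5 + c → (∀ b → ∃[ b' ] toℕ b' ≡ suc (c + 2 * toℕ b) × ∀ us →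
      drop j ts ≡ us → ∀ vs → drop (suc j) ts ≡ digits b ++ vs → us ≡ digits b' ++ vs) → Letters j
    letters-digit j j< (b , p , q) c c< eq cons with digitᵗ (rules j j<) c c< eq | cons b
    ... | _ , _ , s , w | b' , r , k = b' , w ∙ cong (λ x → suc (c + 2 * x)) p ∙ sym r ,
      k (drop j ts) refl (drop (sz (suc j) + suc j) ts) q ∙
        cong (λ x → digits b' ++ drop x ts) (+-suc (sz (suc j)) j ∙ cong (_+ j) (sym s))

    letters : ∀ f j → j < n → n ≤ f + j → 5 ≤ tok j → Letters j
    letters zero j j< le 5≤ = contradiction j< (≤⇒≯ le)
    letters (suc f) j j< le 5≤ with uncons j j<
    ... | t , e = byToken t e (tok-ts j e)
      where
      le' : n ≤ f + suc j
      le' = le ≤∙≡ sym (+-suc f j)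
      following : ∀ c → c < 2 → tok j ≡ 5 + c → Letters (suc j)
      following c c< eq with digitᵗ (rules j j<) c c< eq
      ... | j+1< , 5≤' , _ = letters f (suc j) j+1< le' 5≤'
      small : ∀ {c} → c < 5 → tok j ≡ c → Letters j
      small c< eq = contradiction (5≤ ≤∙≡ eq) (<⇒≱ c<)
      byToken : ∀ t → drop j ts ≡ t ∷ drop (suc j) ts → tok j ≡ tokenCode t → Letters j
      byToken digit1 e eq = letters-digit j j< (following 0 (s≤s z≤n) eq) 0 (s≤s z≤n) eq
        (λ b → 1+[2 b ] , refl , λ us p vs q → sym p ∙ e ∙ cong (digit1 ∷_) q)
      byToken digit2 e eq = letters-digit j j< (following 1 ≤-refl eq) 1 ≤-refl eq
        (λ b → 2[1+ b ] , twice (toℕ b) , λ us p vs q → sym p ∙ e ∙ cong (digit2 ∷_) q)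
        where
        twice : ∀ x → 2 * suc x ≡ suc (suc (2 * x))
        twice = solve-∀
      byToken end e eq = letters-end j j< eq e
      byToken neg e eq = small (s≤s z≤n) eq
      byToken or e eq = small (s≤s (s≤s z≤n)) eq
      byToken diaA e eq = small (m≤m+n 3 _) eq
      byToken diaB e eq = small (m≤m+n 4 _) eq
      byToken diaD e eq = small (m≤m+n 5 _) eq

    Reads : ℕ → Set
    Reads j = drop j ts ≡ tokens (formula j) ++ drop (sz j + j) ts

    reads-letter : ∀ j → j < n → 5 ≤ tok j → formula j ≡ ` v j → Reads j
    reads-letter j j< 5≤ eq with letters n j j< (m≤m+n n j) 5≤
    ... | b , p , q = q ∙ cong (_++ drop (sz j + j) ts) (cong digits (sym (cong fromℕ p ∙ fromℕ-toℕ b)) ∙ cong tokens (sym eq))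

    -- The code of a subformula ends exactly where `sz` says, which is what makes the second
    -- argument of a disjunction start at the right place.
    reads : ∀ f j → j < n → n ≤ f + j → Reads j
    reads zero j j< le = contradiction j< (≤⇒≯ le)
    reads (suc f) j j< le with uncons j j<
    ... | t , e = byToken t e (tok-ts j e)
      where
      le' : n ≤ f + suc j
      le' = le ≤∙≡ sym (+-suc f j)
      one-child : ∀ {c t} (op : Formula → Formula) → (∀ φ → tokens (op φ) ≡ t ∷ tokens φ) → c < 5 → c ≢ 1 → tok j ≡ c →
                  drop j ts ≡ t ∷ drop (suc j) ts → formula j ≡ op (formula (suc j)) → Reads j
      one-child {c} {t} op op-t c< c≢ eq e form with unary (rules j j<) c c< c≢ eq
      ... | j+1< , s = e ∙ cong (t ∷_) (reads f (suc j) j+1< le') ∙ cong₂ _++_ (sym (op-t _) ∙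
          cong tokens (sym form)) (cong (λ x → drop x ts) (+-suc (sz (suc j)) j ∙ cong (_+ j) (sym s)))
      at-kind : ∀ {c} → tok j ≡ c → formula j ≡ build j (kindOf (λ _ → c) sz j) formula
      at-kind refl = formula-build j j<
      byToken : ∀ t → drop j ts ≡ t ∷ drop (suc j) ts → tok j ≡ tokenCode t → Reads j
      byToken neg e eq = one-child ¬′_ (λ _ → refl) (s≤s z≤n) (λ ()) eq e (at-kind eq)
      byToken diaA e eq = one-child ⟨A⟩_ (λ _ → refl) (m≤m+n 3 _) (λ ()) eq e (at-kind eq)
      byToken diaB e eq = one-child ⟨B⟩_ (λ _ → refl) (m≤m+n 4 _) (λ ()) eq e (at-kind eq)
      byToken diaD e eq = one-child ⟨D⟩_ (λ _ → refl) (m≤m+n 5 _) (λ ()) eq e (at-kind eq)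
      byToken digit1 e eq = reads-letter j j< (≤-reflexive (sym eq)) (at-kind eq)
      byToken digit2 e eq = reads-letter j j< (n≤1+n 5 ≤∙≡ sym eq) (at-kind eq)
      byToken end e eq = reads-letter j j< (m≤m+n 5 2 ≤∙≡ sym eq) (at-kind eq)
      byToken or e eq with binaryᵗ (rules j j<) eq
      ... | j+1< , l< , s = e ∙ cong (or ∷_) (reads f (suc j) j+1< le') ∙
          cong (λ x → or ∷ tokens φ ++ drop x ts) (+-comm (sz (suc j)) (suc j)) ∙
          cong (λ x → or ∷ tokens φ ++ x) (reads f l l< (le' ≤∙ +-monoʳ-≤ f (m≤m+n (suc j) _))) ∙
          cong (or ∷_) (sym (++-assoc (tokens φ) (tokens ψ) _)) ∙
          cong₂ _++_ (cong tokens (sym (at-kind eq))) (cong (λ x → drop x ts) (arith (sz l) j (sz (suc j)) ∙ cong (_+ j) (sym s)))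
        where
        l = suc j + sz (suc j)
        φ = formula (suc j)
        ψ = formula l
        arith : ∀ x j y → x + (suc j + y) ≡ suc (y + x) + j
        arith = solve-∀

    encode-formula : 0 < n → sz 0 ≡ n → encode (formula 0) ≡ word ts
    encode-formula 0<n s = cong word (sym (reads n 0 0<n (m≤m+n n 0) ∙
      cong (λ x → tokens (formula 0) ++ x) (cong (λ x → drop x ts) (+-identityʳ (sz 0) ∙ s) ∙ drop-all n ts len) ∙ ++-identityʳ _))
      where
      drop-all : ∀ n (ts : List Token) → length ts ≡ n → drop n ts ≡ []
      drop-all zero [] refl = refl
      drop-all (suc n) (t ∷ ts) eq   = drop-all n ts (suc-injective eq)

codeAt : List Token → ℕ → ℕ
codeAt [] j       = 0
codeAt (t ∷ ts) zero    = tokenCode t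
codeAt (t ∷ ts) (suc j) = codeAt ts j

codeAt-++ˡ : ∀ ts us j → j < length ts → codeAt (ts ++ us) j ≡ codeAt ts j
codeAt-++ˡ (t ∷ ts) us zero lt       = refl
codeAt-++ˡ (t ∷ ts) us (suc j) (s≤s lt) = codeAt-++ˡ ts us j lt

codeAt-++ʳ : ∀ ts us j → codeAt (ts ++ us) (length ts + j) ≡ codeAt us j
codeAt-++ʳ [] us j = refl
codeAt-++ʳ (t ∷ ts) us j = codeAt-++ʳ ts us j

codeAt-drop : ∀ ts j → j < length ts → ∃[ t ] ∃[ us ] drop j ts ≡ t ∷ us × codeAt ts j ≡ tokenCode t
codeAt-drop (t ∷ ts) zero lt       = t , ts , refl , refl
codeAt-drop (t ∷ ts) (suc j) (s≤s lt) = codeAt-drop ts j lt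

sizeOf : Formula → ℕ
sizeOf φ = length (tokens φ)

patch : ℕ → (ℕ → ℕ) → (ℕ → ℕ) → ℕ → ℕ
patch zero f g j       = g j
patch (suc m) f g zero    = f 0
patch (suc m) f g (suc j) = patch m (f ∘ suc) g j

patch-< : ∀ m f g j → j < m → patch m f g j ≡ f j
patch-< (suc m) f g zero lt       = refl
patch-< (suc m) f g (suc j) (s≤s lt) = patch-< m (f ∘ suc) g j lt

patch-+ : ∀ m f g j → patch m f g (m + j) ≡ g j
patch-+ zero f g j = refl
patch-+ (suc m) f g j = patch-+ m (f ∘ suc) g j

before' : ℕ → (ℕ → ℕ) → ℕ → ℕ
before' x f zero    = x
before' x f (suc j) = f j

digitSize digitValue : ℕᵇ → ℕ → ℕ
digitSize b j = length (digits b) ∸ j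
digitValue zero _       = 0
digitValue 1+[2 b ] zero    = toℕ 1+[2 b ]
digitValue 1+[2 b ] (suc j) = digitValue b j
digitValue 2[1+ b ] zero    = toℕ 2[1+ b ]
digitValue 2[1+ b ] (suc j) = digitValue b j

sizeAt letterAt : Formula → ℕ → ℕ
sizeAt (` p)    = digitSize (fromℕ p)
sizeAt (¬′ φ)   = before' (suc (sizeOf φ)) (sizeAt φ)
sizeAt (⟨A⟩ φ)  = before' (suc (sizeOf φ)) (sizeAt φ)
sizeAt (⟨B⟩ φ)  = before' (suc (sizeOf φ)) (sizeAt φ)
sizeAt (⟨D⟩ φ)  = before' (suc (sizeOf φ)) (sizeAt φ)
sizeAt (φ ∨′ ψ) = before' (suc (sizeOf φ + sizeOf ψ)) (patch (sizeOf φ) (sizeAt φ) (sizeAt ψ))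
letterAt (` p)    = digitValue (fromℕ p)
letterAt (¬′ φ)   = before' 0 (letterAt φ)
letterAt (⟨A⟩ φ)  = before' 0 (letterAt φ)
letterAt (⟨B⟩ φ)  = before' 0 (letterAt φ)
letterAt (⟨D⟩ φ)  = before' 0 (letterAt φ)
letterAt (φ ∨′ ψ) = before' 0 (patch (sizeOf φ) (letterAt φ) (letterAt ψ))

digitSize-pos : ∀ b → 0 < length (digits b)
digitSize-pos zero     = s≤s z≤n
digitSize-pos 1+[2 b ] = s≤s z≤n
digitSize-pos 2[1+ b ] = s≤s z≤n

sizeOf-pos : ∀ φ → 0 < sizeOf φ
sizeOf-pos (` p)    = digitSize-pos (fromℕ p)
sizeOf-pos (¬′ φ)   = s≤s z≤n
sizeOf-pos (φ ∨′ ψ) = s≤s z≤n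
sizeOf-pos (⟨A⟩ φ)  = s≤s z≤n
sizeOf-pos (⟨B⟩ φ)  = s≤s z≤n
sizeOf-pos (⟨D⟩ φ)  = s≤s z≤n

sizeAt-0 : ∀ φ → sizeAt φ 0 ≡ sizeOf φ
sizeAt-0 (` p)    = refl
sizeAt-0 (¬′ φ)   = refl
sizeAt-0 (φ ∨′ ψ) = cong suc (sym (length-++ (tokens φ)))
sizeAt-0 (⟨A⟩ φ)  = refl
sizeAt-0 (⟨B⟩ φ)  = refl
sizeAt-0 (⟨D⟩ φ)  = refl

open Rule

-- The rules mention positions relative to `j` only, so the tables of a subformula can be placed at
-- any offset inside the tables of the whole formula.
embed-rule : ∀ {tok sz v tok' sz' v' n n' j} o → Rule tok sz v n j → j < n → o + n ≤ n' →
             (∀ k → k < n → tok' (o + k) ≡ tok k) → (∀ k → k < n → sz' (o + k) ≡ sz k) → (∀ k → k < n → v' (o + k) ≡ v k) →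
             Rule tok' sz' v' n' (o + j)
embed-rule {tok} {sz} {v} {tok'} {sz'} {v'} {n} {n'} {j} o R j< le t s w = record
  { unary = λ c c< c≢ eq → let j+1< , q = unary R c c< c≢ (sym (t j j<) ∙ eq) in
      inside (suc j) j+1< , s j j< ∙ q ∙ cong suc (sym (size-next j+1<))
  ; binaryᵗ = λ eq → let j+1< , l< , q = binaryᵗ R (sym (t j j<) ∙ eq) in
      inside (suc j) j+1< ,
      subst (_< n') (sym (second j+1<)) (+-monoʳ-< o l< ≤∙ le) ,
      s j j< ∙ q ∙ cong suc (cong₂ _+_ (sym (size-next j+1<)) (sym (cong sz' (second j+1<) ∙ s _ l<)))
  ; digitᵗ = λ c c< eq → let j+1< , 5≤ , q , r = digitᵗ R c c< (sym (t j j<) ∙ eq) in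
      inside (suc j) j+1< , 5≤ ≤∙≡ sym (cong tok' (sym (+-suc o j)) ∙ t (suc j) j+1<) ,
      s j j< ∙ q ∙ cong suc (sym (size-next j+1<)) ,
      w j j< ∙ r ∙ cong (λ x → suc (c + 2 * x)) (sym (cong v' (sym (+-suc o j)) ∙ w (suc j) j+1<))
  ; endᵗ = λ eq → let q , r = endᵗ R (sym (t j j<) ∙ eq) in s j j< ∙ q , w j j< ∙ r }
  where
  inside : ∀ k → suc j < n → suc (o + j) < n'
  inside k lt = cong suc (sym (+-suc o j)) ≡∙≤ +-monoʳ-< o lt ≤∙ le
  size-next : suc j < n → sz' (suc (o + j)) ≡ sz (suc j)
  size-next lt = cong sz' (sym (+-suc o j)) ∙ s (suc j) lt
  second : suc j < n → suc (o + j) + sz' (suc (o + j)) ≡ o + (suc j + sz (suc j))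
  second lt = cong (suc (o + j) +_) (size-next lt) ∙ cong (_+ sz (suc j)) (sym (+-suc o j)) ∙ +-assoc o (suc j) (sz (suc j))

next-rule : ∀ {tok sz v n j} → Rule (tok ∘ suc) (sz ∘ suc) (v ∘ suc) n j → j < n → Rule tok sz v (suc n) (suc j)
next-rule R lt = embed-rule 1 R lt ≤-refl (λ _ _ → refl) (λ _ _ → refl) (λ _ _ → refl)

first-digit : ∀ b → 5 ≤ codeAt (digits b) 0
first-digit zero     = m≤m+n 5 2
first-digit 1+[2 b ] = ≤-refl
first-digit 2[1+ b ] = m≤m+n 5 1

value-0 : ∀ b → digitValue b 0 ≡ toℕ b
value-0 zero     = refl
value-0 1+[2 b ] = refl
value-0 2[1+ b ] = refl

digit-rules : ∀ b j → j < length (digits b) → Rule (codeAt (digits b)) (digitSize b) (digitValue b) (length (digits b)) j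
digit-rules zero zero lt = record
  { unary = λ { _ (s≤s (s≤s (s≤s (s≤s (s≤s ()))))) _ refl } ; binaryᵗ = λ () ; digitᵗ = λ { (suc zero) _ () ; (suc (suc c)) (s≤s (s≤s ())) _ }
  ; endᵗ = λ _ → refl , refl }
digit-rules zero (suc j) (s≤s ())
digit-rules 1+[2 b ] zero lt = record
  { unary = λ { _ (s≤s (s≤s (s≤s (s≤s (s≤s ()))))) _ refl } ; binaryᵗ = λ () ; endᵗ = λ ()
  ; digitᵗ = λ { zero _ _ → s≤s (digitSize-pos b) , first-digit b , refl , cong (λ x → suc (2 * x)) (sym (value-0 b)) ; (suc zero) _ () } }
digit-rules 2[1+ b ] zero lt = record
  { unary = λ { _ (s≤s (s≤s (s≤s (s≤s (s≤s ()))))) _ refl } ; binaryᵗ = λ () ; endᵗ = λ ()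
  ; digitᵗ = λ { (suc zero) _ _ → s≤s (digitSize-pos b) , first-digit b , refl , twice (toℕ b) ∙ cong (λ x → suc (suc (2 * x))) (sym (value-0 b)) ; (suc (suc c)) (s≤s (s≤s ())) _ } }
  where
  twice : ∀ x → 2 * suc x ≡ suc (suc (2 * x))
  twice = solve-∀
digit-rules 1+[2 b ] (suc j) (s≤s lt) = next-rule (digit-rules b j lt) lt
digit-rules 2[1+ b ] (suc j) (s≤s lt) = next-rule (digit-rules b j lt) lt

FormulaRule : Formula → ℕ → Set
FormulaRule φ = Rule (codeAt (tokens φ)) (sizeAt φ) (letterAt φ) (sizeOf φ)

unary-rule : ∀ {c φ sz v ts} → tokenCode c < 5 → tokenCode c ≢ 1 → ts ≡ tokens φ → sz ≡ sizeAt φ →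
             Rule (codeAt (c ∷ ts)) (before' (suc (sizeOf φ)) sz) v (suc (length ts)) 0
unary-rule {c} {φ} c< c≢ refl refl = record
  { unary = λ _ _ _ _ → s≤s (sizeOf-pos φ) , cong suc (sym (sizeAt-0 φ))
  ; binaryᵗ = λ eq → contradiction eq c≢
  ; digitᵗ = λ x _ eq → contradiction (m≤m+n 5 x ≤∙≡ sym eq) (<⇒≱ c<)
  ; endᵗ = λ eq → contradiction (m≤m+n 5 2 ≤∙≡ sym eq) (<⇒≱ c<) }

formula-rules : ∀ φ j → j < sizeOf φ → FormulaRule φ j
formula-rules (` p) j lt = digit-rules (fromℕ p) j lt
formula-rules (¬′ φ) zero lt = unary-rule {neg} {φ} (s≤s z≤n) (λ ()) refl refl
formula-rules (⟨A⟩ φ) zero lt = unary-rule {diaA} {φ} (m≤m+n 3 _) (λ ()) refl refl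
formula-rules (⟨B⟩ φ) zero lt = unary-rule {diaB} {φ} (m≤m+n 4 _) (λ ()) refl refl
formula-rules (⟨D⟩ φ) zero lt = unary-rule {diaD} {φ} (m≤m+n 5 _) (λ ()) refl refl
formula-rules (¬′ φ) (suc j) (s≤s lt) = next-rule (formula-rules φ j lt) lt
formula-rules (⟨A⟩ φ) (suc j) (s≤s lt) = next-rule (formula-rules φ j lt) lt
formula-rules (⟨B⟩ φ) (suc j) (s≤s lt) = next-rule (formula-rules φ j lt) lt
formula-rules (⟨D⟩ φ) (suc j) (s≤s lt) = next-rule (formula-rules φ j lt) lt
formula-rules (φ ∨′ ψ) zero lt = record
  { unary = λ { _ _ c≢ refl → contradiction refl c≢ }
  ; binaryᵗ = λ _ → s≤s (sizeOf-pos φ ≤∙ m≤m+n (sizeOf φ) (sizeOf ψ) ≤∙≡ sym (length-++ (tokens φ))) ,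
      s≤s (cong suc (first ∙ sym (+-identityʳ (sizeOf φ))) ≡∙≤ +-monoʳ-< (sizeOf φ) (sizeOf-pos ψ) ≤∙≡ sym (length-++ (tokens φ))) ,
      cong suc (cong₂ _+_ (sym first) (sym (cong (patch (sizeOf φ) (sizeAt φ) (sizeAt ψ)) (first ∙ sym (+-identityʳ (sizeOf φ))) ∙ patch-+ (sizeOf φ) (sizeAt φ) (sizeAt ψ) 0 ∙ sizeAt-0 ψ)))
  ; digitᵗ = λ _ _ () ; endᵗ = λ () }
  where
  first : patch (sizeOf φ) (sizeAt φ) (sizeAt ψ) 0 ≡ sizeOf φ
  first = patch-< (sizeOf φ) (sizeAt φ) (sizeAt ψ) 0 (sizeOf-pos φ) ∙ sizeAt-0 φ
formula-rules (φ ∨′ ψ) (suc j) (s≤s lt) with j <? sizeOf φ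
... | yes j< = embed-rule 1 (formula-rules φ j j<) j< (s≤s (m≤m+n (sizeOf φ) (sizeOf ψ) ≤∙≡ sym (length-++ (tokens φ))))
        (codeAt-++ˡ (tokens φ) (tokens ψ)) (patch-< (sizeOf φ) (sizeAt φ) (sizeAt ψ)) (patch-< (sizeOf φ) (letterAt φ) (letterAt ψ))
... | no ge  = subst (FormulaRule (φ ∨′ ψ)) (cong suc (m+[n∸m]≡n (≮⇒≥ ge)))
        (embed-rule (suc (sizeOf φ)) (formula-rules ψ k k<) k< (s≤s (≤-reflexive (sym (length-++ (tokens φ)))))
          (λ i _ → codeAt-++ʳ (tokens φ) (tokens ψ) i) (λ i _ → patch-+ (sizeOf φ) (sizeAt φ) (sizeAt ψ) i) (λ i _ → patch-+ (sizeOf φ) (letterAt φ) (letterAt ψ) i))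
  where
  k = j ∸ sizeOf φ
  k< : k < sizeOf ψ
  k< = +-cancelˡ-< (sizeOf φ) k (sizeOf ψ) (cong suc (m+[n∸m]≡n (≮⇒≥ ge)) ≡∙≤ lt ≤∙≡ length-++ (tokens φ))

patch-all : ∀ {P : ℕ → Set} m f g j → (∀ k → P (f k)) → (∀ k → P (g k)) → P (patch m f g j)
patch-all zero f g j p q = q j
patch-all (suc m) f g zero p q = p 0
patch-all {P} (suc m) f g (suc j) p q = patch-all {P} m (f ∘ suc) g j (p ∘ suc) q

sizeAt-≤ : ∀ φ j → sizeAt φ j ≤ sizeOf φ
sizeAt-≤ (` p) j = m∸n≤m _ j
sizeAt-≤ (¬′ φ) zero    = ≤-refl
sizeAt-≤ (¬′ φ) (suc j) = sizeAt-≤ φ j ≤∙ n≤1+n _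
sizeAt-≤ (⟨A⟩ φ) zero    = ≤-refl
sizeAt-≤ (⟨A⟩ φ) (suc j) = sizeAt-≤ φ j ≤∙ n≤1+n _
sizeAt-≤ (⟨B⟩ φ) zero    = ≤-refl
sizeAt-≤ (⟨B⟩ φ) (suc j) = sizeAt-≤ φ j ≤∙ n≤1+n _
sizeAt-≤ (⟨D⟩ φ) zero    = ≤-refl
sizeAt-≤ (⟨D⟩ φ) (suc j) = sizeAt-≤ φ j ≤∙ n≤1+n _
sizeAt-≤ (φ ∨′ ψ) zero    = ≤-reflexive (cong suc (sym (length-++ (tokens φ))))
sizeAt-≤ (φ ∨′ ψ) (suc j) = patch-all {λ x → x ≤ sizeOf φ + sizeOf ψ} (sizeOf φ) (sizeAt φ) (sizeAt ψ) j
  (λ k → sizeAt-≤ φ k ≤∙ m≤m+n _ (sizeOf ψ)) (λ k → sizeAt-≤ ψ k ≤∙ m≤n+m _ (sizeOf φ)) ≤∙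
  sym (length-++ (tokens φ)) ≡∙≤ n≤1+n _

toℕ-bound : ∀ b → 2 + toℕ b ≤ 2 ^ length (digits b)
toℕ-bound zero     = ≤-refl
toℕ-bound 1+[2 b ] = n≤1+n _ ≤∙ twice (toℕ b) ≡∙≤ *-monoʳ-≤ 2 (toℕ-bound b)
  where
  twice : ∀ x → suc (2 + suc (2 * x)) ≡ 2 * (2 + x)
  twice = solve-∀
toℕ-bound 2[1+ b ] = twice (toℕ b) ≡∙≤ *-monoʳ-≤ 2 (toℕ-bound b)
  where
  twice : ∀ x → 2 + 2 * suc x ≡ 2 * (2 + x)
  twice = solve-∀

digitValue-< : ∀ b j → digitValue b j < 2 ^ length (digits b)
digitValue-< zero j       = s≤s z≤n
digitValue-< 1+[2 b ] zero    = n≤1+n _ ≤∙ (toℕ-bound 1+[2 b ])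
digitValue-< 2[1+ b ] zero    = n≤1+n _ ≤∙ (toℕ-bound 2[1+ b ])
digitValue-< 1+[2 b ] (suc j) = digitValue-< b j ≤∙ m≤m+n _ _
digitValue-< 2[1+ b ] (suc j) = digitValue-< b j ≤∙ m≤m+n _ _

-- A letter can be exponential in the length of its code. The base of the digit tables has to be at
-- least that large.
letterAt-< : ∀ φ j → letterAt φ j < 2 ^ sizeOf φ
letterAt-< (` p) j = digitValue-< (fromℕ p) j
letterAt-< (¬′ φ) zero    = m^n>0 2 (suc (sizeOf φ))
letterAt-< (¬′ φ) (suc j) = letterAt-< φ j ≤∙ m≤m+n _ _
letterAt-< (⟨A⟩ φ) zero    = m^n>0 2 (suc (sizeOf φ))
letterAt-< (⟨A⟩ φ) (suc j) = letterAt-< φ j ≤∙ m≤m+n _ _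
letterAt-< (⟨B⟩ φ) zero    = m^n>0 2 (suc (sizeOf φ))
letterAt-< (⟨B⟩ φ) (suc j) = letterAt-< φ j ≤∙ m≤m+n _ _
letterAt-< (⟨D⟩ φ) zero    = m^n>0 2 (suc (sizeOf φ))
letterAt-< (⟨D⟩ φ) (suc j) = letterAt-< φ j ≤∙ m≤m+n _ _
letterAt-< (φ ∨′ ψ) zero    = m^n>0 2 (sizeOf (φ ∨′ ψ))
letterAt-< (φ ∨′ ψ) (suc j) = patch-all {λ x → x < 2 ^ (sizeOf φ + sizeOf ψ)} (sizeOf φ) (letterAt φ) (letterAt ψ) j
  (λ k → letterAt-< φ k ≤∙ ^-monoʳ-≤ 2 (m≤m+n (sizeOf φ) (sizeOf ψ))) (λ k → letterAt-< ψ k ≤∙ ^-monoʳ-≤ 2 (m≤n+m (sizeOf ψ) (sizeOf φ))) ≤∙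
  ^-monoʳ-≤ 2 (sym (length-++ (tokens φ)) ≡∙≤ n≤1+n _)

Comp-tailᵈ : Comp₂ tailᵈ
Comp-tailᵈ = lift₂ {h = tailᵈ} (Comp-primrec v₁ v₀ (Comp-/ (Comp-pred v₁) (Comp-const 1)) 1
  (λ { {x ∷ i ∷ []} {b} le j j≤ → arg≤ b (tail≤ x j ≤∙ le zero) }))
  where
  tail≤ : ∀ x i → tailᵈ x i ≤ x
  tail≤ x zero    = ≤-refl
  tail≤ x (suc i) = m/n≤m (pred (tailᵈ x i)) 2 ≤∙ pred[n]≤n ≤∙ tail≤ x i

Comp-bitᵈ : Comp₂ bitᵈ
Comp-bitᵈ c d = Comp-∸ (Comp-const 1) (Comp-% (Comp-tailᵈ c d) (Comp-const 1))

Comp-tokenᵈ : Comp {2} (λ ρ → tokenᵈ (lookup ρ zero) (lookup ρ (suc zero)))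
Comp-tokenᵈ = Comp-+ (Comp-* (Comp-const 4) (Comp-bitᵈ v₀ j₃)) (Comp-+ (Comp-* (Comp-const 2) (Comp-bitᵈ v₀ (Comp-+ (Comp-const 1) j₃))) (Comp-bitᵈ v₀ (Comp-+ (Comp-const 2) j₃)))
  where
  j₃ : Comp {2} (λ ρ → 3 * lookup ρ (suc zero))
  j₃ = Comp-* (Comp-const 3) v₁

Comp-lengthᵈ : Comp₁ lengthᵈ
Comp-lengthᵈ = lift₁ {h = lengthᵈ} (Comp-primrec v₀ Comp-zero (Comp-+ v₁ (Comp-∸ (Comp-const 1) (Comp-∸ (Comp-const 1) (Comp-tailᵈ v₂ v₀)))) 1
  (λ { {x ∷ []} {b} le j j≤ → arg≤ b (below x j ≤∙ j≤ ≤∙ le zero) }))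
  where
  below : ∀ x j → primrec 0 (λ i a → a + (1 ∸ (1 ∸ tailᵈ x i))) j ≤ j
  below x zero    = z≤n
  below x (suc j) = +-mono-≤ (below x j) (m∸n≤m 1 (1 ∸ tailᵈ x j)) ≤∙≡ +-comm j 1

ν : ∀ {k} i {lt : True (i <? k)} → Tm k
ν i {lt} = var (#_ i {m<n = lt})

infix 2 _⇔̇_
_⇔̇_ : ∀ {k} → Fm k → Fm k → Fm k
F ⇔̇ G = (F ⇒̇ G) ∧̇ (G ⇒̇ F)

-- States as numbers, and the search graph as an arithmetic formula.

-- A number s represents a state: its digit 0 in base 1 + d is the number of items, its digit 1 + i is item i, in which the bits
-- j, n + j and 2 n + j are A i j, C i j and L i j.
item : ℕ → ℕ → ℕ → ℕ
item d s i = digit d s (suc i)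

Bit : ℕ → ℕ → Set
Bit x j = digit 1 x j ≡ 1

decode : ℕ → ℕ → ℕ → State
decode n d s = record
  { len = digit d s 0
  ; A = λ i j → Bit (item d s i) j ; C = λ i j → Bit (item d s i) (n + j) ; L = λ i j → Bit (item d s i) (n + (n + j))
  ; A? = λ i j → digit 1 (item d s i) j ≟ 1 ; C? = λ i j → digit 1 (item d s i) (n + j) ≟ 1
  ; L? = λ i j → digit 1 (item d s i) (n + (n + j)) ≟ 1 }

lenᵗ : ∀ {k} → Tm k → Tm k → Tm k
lenᵗ d s = dig d s (lit 0)

-- The variables of the formula, in the order ν 0, ν 1, … (likewise below): [ d , s , i , j ]
Abit : Fm 4
Abit = dig (lit 1) (dig (ν 0) (ν 1) (lit 1 ⊕ ν 2)) (ν 3) ≐ lit 1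

-- [ n , d , s , i , j ]
Cbit Lbit : Fm 5
Cbit = dig (lit 1) (dig (ν 1) (ν 2) (lit 1 ⊕ ν 3)) (ν 0 ⊕ ν 4) ≐ lit 1
Lbit = dig (lit 1) (dig (ν 1) (ν 2) (lit 1 ⊕ ν 3)) (ν 0 ⊕ (ν 0 ⊕ ν 4)) ≐ lit 1

-- [ d , τ , i , j ]
Tbit : Fm 4
Tbit = dig (lit 1) (dig (ν 0) (ν 1) (ν 2)) (ν 3) ≐ lit 1

-- [ d , s , τ , i , j ]
laterF : Fm 5
laterF = ∃̇ (lit 1 ⊕ lenᵗ (ν 0) (ν 1)) ((lit 1 ⊕ ν 4 ≼ ν 0) ∧̇ call Tbit (ν 1 ∷ ν 3 ∷ ν 0 ∷ ν 5 ∷ []))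

-- [ j , n , x , z , v , d ]
ruleF : Fm 6
ruleF =
  ∀̇ (lit 5) (¬̇ (ν 0 ≐ lit 1) ⇒̇ tok' (ν 1) ≐ ν 0 ⇒̇
    (lit 2 ⊕ ν 1 ≼ ν 2) ∧̇ dig (ν 6) (ν 4) (ν 1) ≐ lit 1 ⊕ dig (ν 6) (ν 4) (lit 1 ⊕ ν 1)) ∧̇
  (tok (ν 0) ≐ lit 1 ⇒̇
    (lit 2 ⊕ ν 0 ≼ ν 1) ∧̇ (lit 2 ⊕ ν 0 ⊕ dig (ν 5) (ν 3) (lit 1 ⊕ ν 0) ≼ ν 1) ∧̇
    dig (ν 5) (ν 3) (ν 0) ≐ lit 1 ⊕ (dig (ν 5) (ν 3) (lit 1 ⊕ ν 0) ⊕ dig (ν 5) (ν 3) (lit 1 ⊕ ν 0 ⊕ dig (ν 5) (ν 3) (lit 1 ⊕ ν 0)))) ∧̇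
  ∀̇ (lit 2) (tok' (ν 1) ≐ lit 5 ⊕ ν 0 ⇒̇
    (lit 2 ⊕ ν 1 ≼ ν 2) ∧̇ (lit 5 ≼ tok' (lit 1 ⊕ ν 1)) ∧̇
    dig (ν 6) (ν 4) (ν 1) ≐ lit 1 ⊕ dig (ν 6) (ν 4) (lit 1 ⊕ ν 1) ∧̇
    dig (ν 6) (ν 5) (ν 1) ≐ lit 1 ⊕ (ν 0 ⊕ lit 2 ⊗ dig (ν 6) (ν 5) (lit 1 ⊕ ν 1))) ∧̇
  (tok (ν 0) ≐ lit 7 ⇒̇ dig (ν 5) (ν 3) (ν 0) ≐ lit 1 ∧̇ dig (ν 5) (ν 4) (ν 0) ≐ lit 0)
  where
  tok : Tm 6 → Tm 6
  tok t = fun tokenᵈ Comp-tokenᵈ (ν 2) t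
  tok' : Tm 7 → Tm 7
  tok' t = fun tokenᵈ Comp-tokenᵈ (ν 3) t

-- [ n , x , z , v , d ]
parseF : Fm 5
parseF = (lit 1 ≼ ν 0) ∧̇ dig (ν 4) (ν 2) (lit 0) ≐ ν 0 ∧̇ ∀̇ (ν 0) ruleF

-- [ i , j , d , n , x , z , s , t , τ ]
valueF : Fm 9
valueF =
  (tok ≐ lit 0 ⇒̇ (here ⇔̇ ¬̇ (Tᵛ (lit 1 ⊕ ν 1)))) ∧̇
  (tok ≐ lit 1 ⇒̇ (here ⇔̇ (Tᵛ (lit 1 ⊕ ν 1) ∨̇ Tᵛ (lit 1 ⊕ ν 1 ⊕ dig (ν 2) (ν 5) (lit 1 ⊕ ν 1))))) ∧̇
  (tok ≐ lit 2 ⇒̇ (here ⇔̇ call Abit (ν 2 ∷ ν 7 ∷ ν 0 ∷ lit 1 ⊕ ν 1 ∷ []))) ∧̇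
  (tok ≐ lit 3 ⇒̇ (here ⇔̇ call laterF (ν 2 ∷ ν 6 ∷ ν 8 ∷ ν 0 ∷ lit 1 ⊕ ν 1 ∷ []))) ∧̇
  (tok ≐ lit 4 ⇒̇ (here ⇔̇ ((lit 1 ⊕ ν 0 ≼ lenᵗ (ν 2) (ν 6)) ∧̇ call Cbit (ν 3 ∷ ν 2 ∷ ν 6 ∷ ν 0 ∷ lit 1 ⊕ ν 1 ∷ [])))) ∧̇
  (lit 5 ≼ tok ⇒̇ (here ⇔̇ call Lbit (ν 3 ∷ ν 2 ∷ ν 7 ∷ ν 0 ∷ ν 1 ∷ [])))
  where
  tok = fun tokenᵈ Comp-tokenᵈ (ν 4) (ν 1)
  Tᵛ : Tm 9 → Fm 9
  Tᵛ k = call Tbit (ν 2 ∷ ν 8 ∷ ν 0 ∷ k ∷ [])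
  here = Tᵛ (ν 1)

-- [ d , n , x , z , s , ℓ , t , τ ]
nextF : Fm 8
nextF =
  lenᵗ (ν 0) (ν 6) ≐ lit 1 ⊕ lenᵗ (ν 0) (ν 4) ∧̇
  ∀̇ (lenᵗ (ν 0) (ν 4)) (∀̇ (ν 2)
    ((call Abit (ν 2 ∷ ν 8 ∷ ν 1 ∷ ν 0 ∷ []) ⇔̇ call Abit (ν 2 ∷ ν 6 ∷ ν 1 ∷ ν 0 ∷ [])) ∧̇
     (call Cbit (ν 3 ∷ ν 2 ∷ ν 8 ∷ ν 1 ∷ ν 0 ∷ []) ⇔̇
       (call Cbit (ν 3 ∷ ν 2 ∷ ν 6 ∷ ν 1 ∷ ν 0 ∷ []) ∨̇ call laterF (ν 2 ∷ ν 6 ∷ ν 9 ∷ ν 1 ∷ ν 0 ∷ []))) ∧̇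
     (call Lbit (ν 3 ∷ ν 2 ∷ ν 8 ∷ ν 1 ∷ ν 0 ∷ []) ⇔̇
       (call Lbit (ν 3 ∷ ν 2 ∷ ν 6 ∷ ν 1 ∷ ν 0 ∷ []) ∧̇ dig (lit 1) (ν 7) (ν 0) ≐ lit 1)))) ∧̇
  ∀̇ (ν 1)
    ((call Abit (ν 1 ∷ ν 7 ∷ lenᵗ (ν 1) (ν 5) ∷ ν 0 ∷ []) ⇔̇
       ∃̇ (lit 1 ⊕ lenᵗ (ν 1) (ν 5)) (call Tbit (ν 2 ∷ ν 9 ∷ ν 0 ∷ ν 1 ∷ []))) ∧̇
     ¬̇ (call Cbit (ν 2 ∷ ν 1 ∷ ν 7 ∷ lenᵗ (ν 1) (ν 5) ∷ ν 0 ∷ [])) ∧̇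
     (call Lbit (ν 2 ∷ ν 1 ∷ ν 7 ∷ lenᵗ (ν 1) (ν 5) ∷ ν 0 ∷ []) ⇔̇ dig (lit 1) (ν 6) (ν 0) ≐ lit 1)) ∧̇
  ∀̇ (lit 1 ⊕ lenᵗ (ν 0) (ν 4)) (∀̇ (ν 2) (call valueF (ν 1 ∷ ν 0 ∷ ν 2 ∷ ν 3 ∷ ν 4 ∷ ν 5 ∷ ν 6 ∷ ν 8 ∷ ν 9 ∷ [])))

-- [ n , v , d , ℓ ]
consistentF : Fm 4
consistentF = ∀̇ (ν 0) (∀̇ (ν 1) (dig (ν 4) (ν 3) (ν 0) ≐ dig (ν 4) (ν 3) (ν 1) ⇒̇ dig (lit 1) (ν 5) (ν 0) ≐ lit 1 ⇒̇ dig (lit 1) (ν 5) (ν 1) ≐ lit 1))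

-- [ n , d , s , i , i' ]
C-eqF L-eqF : Fm 5
C-eqF = ∀̇ (ν 0) (call Cbit (ν 1 ∷ ν 2 ∷ ν 3 ∷ ν 4 ∷ ν 0 ∷ []) ⇔̇ call Cbit (ν 1 ∷ ν 2 ∷ ν 3 ∷ ν 5 ∷ ν 0 ∷ []))
L-eqF = ∀̇ (ν 0) (call Lbit (ν 1 ∷ ν 2 ∷ ν 3 ∷ ν 4 ∷ ν 0 ∷ []) ⇔̇ call Lbit (ν 1 ∷ ν 2 ∷ ν 3 ∷ ν 5 ∷ ν 0 ∷ []))

sameF : Fm 5
sameF = ∀̇ (ν 0) (call Abit (ν 2 ∷ ν 3 ∷ ν 4 ∷ ν 0 ∷ []) ⇔̇ call Abit (ν 2 ∷ ν 3 ∷ ν 5 ∷ ν 0 ∷ [])) ∧̇ C-eqF ∧̇ L-eqF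

-- [ p , n , d , K , s , i₀ ]
blocksF : Fm 6
blocksF =
  ∀̇ (lit 1 ⊕ ν 3) (lit 1 ⊕ dig (ν 3) (ν 1) (ν 0) ≼ lenᵗ (ν 3) (ν 5)) ∧̇
  dig (ν 2) (ν 0) (ν 3) ≐ ν 5 ∧̇
  ∀̇ (ν 3) (∀̇ (lit 1 ⊕ dig (ν 3) (ν 1) (lit 1 ⊕ ν 0)) (ν 7 ≼ ν 0 ⇒̇
    ∃̇ (lit 1 ⊕ dig (ν 4) (ν 2) (ν 1)) ((lit 1 ⊕ dig (ν 5) (ν 3) (lit 1 ⊕ ν 2) ≼ ν 0) ∧̇ call sameF (ν 4 ∷ ν 5 ∷ ν 7 ∷ ν 1 ∷ ν 0 ∷ [])))) ∧̇
  ∀̇ (lit 1 ⊕ dig (ν 2) (ν 0) (lit 0)) (ν 6 ≼ ν 0 ⇒̇ call C-eqF (ν 2 ∷ ν 3 ∷ ν 5 ∷ ν 0 ∷ ν 6 ∷ []) ∧̇ call L-eqF (ν 2 ∷ ν 3 ∷ ν 5 ∷ ν 0 ∷ ν 6 ∷ []))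

-- [ n , d , K , Q , s , t ]
deleteF : Fm 6
deleteF = ∃̇ (lenᵗ (ν 1) (ν 4))
  ((lit 1 ≼ ν 0) ∧̇ ∃̇ (ν 4) (call blocksF (ν 0 ∷ ν 2 ∷ ν 3 ∷ ν 4 ∷ ν 6 ∷ ν 1 ∷ [])) ∧̇
   lenᵗ (ν 2) (ν 5) ≐ lit 1 ⊕ lenᵗ (ν 2) (ν 6) ∧̇
   ∀̇ (lenᵗ (ν 2) (ν 6))
     ((lit 1 ⊕ ν 0 ≼ ν 1 ⇒̇ dig (ν 3) (ν 7) (lit 1 ⊕ ν 0) ≐ dig (ν 3) (ν 6) (lit 1 ⊕ ν 0)) ∧̇
      (ν 1 ≼ ν 0 ⇒̇ dig (ν 3) (ν 7) (lit 1 ⊕ ν 0) ≐ dig (ν 3) (ν 6) (lit 2 ⊕ ν 0))))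

pair⇔ : ∀ {A B : Set} → (A → B) × (B → A) → A ⇔ B
pair⇔ (f , g) = mk⇔ f g

⇔pair : ∀ {A B : Set} → A ⇔ B → (A → B) × (B → A)
⇔pair e = to e , from e

module Numeric (d n x z v : ℕ) where

  tok sz : ℕ → ℕ
  tok = tokenᵈ x
  sz = digit d z

  kindᴺ : ℕ → Kind
  kindᴺ = kindOf tok sz

  parse-rules : ⟦ parseF ⟧ (n ∷ x ∷ z ∷ v ∷ d ∷ []) ⇔ (0 < n × sz 0 ≡ n × (∀ j → j < n → Rule tok sz (digit d v) n j))
  parse-rules = mk⇔
    (λ { (a , b , c) → a , b , λ j lt → let p , q , r , s = c j lt in record { unary = p ; binaryᵗ = q ; digitᵗ = r ; endᵗ = s } })
    (λ { (a , b , c) → a , b , λ j lt → let R = c j lt in Rule.unary R , Rule.binaryᵗ R , Rule.digitᵗ R , Rule.endᵗ R })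

  state : ℕ → State
  state = decode n d

  truth : ℕ → ℕ → ℕ → Set
  truth τ i j = Bit (digit d τ i) j

  module _ (wf : ∀ j → j < n → WellFormed n j (kindᴺ j)) where

    open Abstraction n kindᴺ wf
    open Columns n kindᴺ wf

    value-equiv : ∀ {s t τ i j} → ⟦ valueF ⟧ (i ∷ j ∷ d ∷ n ∷ x ∷ z ∷ s ∷ t ∷ τ ∷ []) ⇔
                  (truth τ i j ⇔ Value (state s) (state t) (truth τ) i j (kindᴺ j))
    value-equiv {s} {t} {τ} {i} {j} with tok j
    ... | 0 = mk⇔ (λ { (a , _) → pair⇔ (a refl) }) (λ e → (λ _ → ⇔pair e) , (λ ()) , (λ ()) , (λ ()) , (λ ()) , λ ())
    ... | 1 = mk⇔ (λ { (_ , a , _) → pair⇔ (a refl) }) (λ e → (λ ()) , (λ _ → ⇔pair e) , (λ ()) , (λ ()) , (λ ()) , λ { (s≤s ()) })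
    ... | 2 = mk⇔ (λ { (_ , _ , a , _) → pair⇔ (a refl) }) (λ e → (λ ()) , (λ ()) , (λ _ → ⇔pair e) , (λ ()) , (λ ()) , λ { (s≤s (s≤s ())) })
    ... | 3 = mk⇔ (λ { (_ , _ , _ , a , _) → pair⇔ (a refl) }) (λ e → (λ ()) , (λ ()) , (λ ()) , (λ _ → ⇔pair e) , (λ ()) , λ { (s≤s (s≤s (s≤s ()))) })
    ... | 4 = mk⇔ (λ { (_ , _ , _ , _ , a , _) → pair⇔ (a refl) }) (λ e → (λ ()) , (λ ()) , (λ ()) , (λ ()) , (λ _ → ⇔pair e) , λ { (s≤s (s≤s (s≤s (s≤s ())))) })
    ... | suc (suc (suc (suc (suc _)))) = mk⇔ (λ { (_ , _ , _ , _ , _ , a) → pair⇔ (a (m≤m+n 5 _)) })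
          (λ e → (λ ()) , (λ ()) , (λ ()) , (λ ()) , (λ ()) , λ _ → ⇔pair e)

    next-to : ∀ {s ℓ t τ} → ⟦ nextF ⟧ (d ∷ n ∷ x ∷ z ∷ s ∷ ℓ ∷ t ∷ τ ∷ []) → Next (state s) (Bit ℓ) (state t) (truth τ)
    next-to {s} {ℓ} {t} {τ} (a , b , c , e) = record
      { len-suc = a ; τ? = λ i j → digit 1 (digit d τ i) j ≟ 1
      ; A-old = λ i i< j j< → pair⇔ (proj₁ (b i i< j j<)) ; C-old = λ i i< j j< → pair⇔ (proj₁ (proj₂ (b i i< j j<)))
      ; L-old = λ i i< j j< → pair⇔ (proj₂ (proj₂ (b i i< j j<)))
      ; A-new = λ j j< → pair⇔ (proj₁ (c j j<)) ; C-new = λ j j< → proj₁ (proj₂ (c j j<)) ; L-new = λ j j< → pair⇔ (proj₂ (proj₂ (c j j<)))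
      ; valueᴺ = λ i i< j j< → to (value-equiv {s} {t} {τ} {i} {j}) (e i i< j j<) }

    next-from : ∀ {s ℓ t τ} → Next (state s) (Bit ℓ) (state t) (truth τ) → ⟦ nextF ⟧ (d ∷ n ∷ x ∷ z ∷ s ∷ ℓ ∷ t ∷ τ ∷ [])
    next-from {s} {ℓ} {t} {τ} N = len-suc N ,
      (λ i i< j j< → ⇔pair (A-old N i i< j j<) , ⇔pair (C-old N i i< j j<) , ⇔pair (L-old N i i< j j<)) ,
      (λ j j< → ⇔pair (A-new N j j<) , C-new N j j< , ⇔pair (L-new N j j<)) ,
      λ i i< j j< → from (value-equiv {s} {t} {τ} {i} {j}) (valueᴺ N i i< j j<)

    blocks-to : ∀ {p K s i₀} → ⟦ blocksF ⟧ (p ∷ n ∷ d ∷ K ∷ s ∷ i₀ ∷ []) → Redundant K (state s) i₀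
    blocks-to {p} (a , b , c , e) = record
      { p = digit d p ; p-bound = a ; pₘ≡i₀ = b
      ; block = λ r r< i i< le → let i' , i'< , lt , (f , g , h) = c r r< i i< le in
          i' , i'< , lt , record { A-same = λ j j< → pair⇔ (f j j<) ; C-same = λ j j< → pair⇔ (g j j<) ; L-same = λ j j< → pair⇔ (h j j<) }
      ; C-const = λ i i< le j j< → pair⇔ (proj₁ (e i i< le) j j<) ; L-const = λ i i< le j j< → pair⇔ (proj₂ (e i i< le) j j<) }

    blocks-from : ∀ {p K s i₀} (R : Redundant K (state s) i₀) → (∀ r → r < suc K → digit d p r ≡ Redundant.p R r) →
                  ⟦ blocksF ⟧ (p ∷ n ∷ d ∷ K ∷ s ∷ i₀ ∷ [])
    blocks-from {p} {K} R eq =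
      (λ r r< → subst (λ y → suc y ≤ _) (sym (eq r r<)) (p-bound r r<)) , eq K ≤-refl ∙ pₘ≡i₀ ,
      (λ r r< i i< le → let i' , i'< , lt , S = block r r< i (subst (λ y → i < suc y) (eq (suc r) (s≤s r<)) i<) le in
        i' , subst (λ y → i' < suc y) (sym (eq r (r< ≤∙ n≤1+n K))) i'< , subst (_< i') (sym (eq (suc r) (s≤s r<))) lt ,
        (λ j j< → ⇔pair (A-same S j j<)) , (λ j j< → ⇔pair (C-same S j j<)) , (λ j j< → ⇔pair (L-same S j j<))) ,
      λ i i< le → (λ j j< → ⇔pair (C-const i (subst (λ y → i < suc y) (eq 0 (s≤s z≤n)) i<) le j j<)) ,
                  (λ j j< → ⇔pair (L-const i (subst (λ y → i < suc y) (eq 0 (s≤s z≤n)) i<) le j j<))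
      where open Redundant R renaming (p to p')

    skipping-below : ∀ i₀ i → i < i₀ → skipping i₀ i ≡ i
    skipping-below (suc i₀) zero lt       = refl
    skipping-below (suc i₀) (suc i) (s≤s lt) = cong suc (skipping-below i₀ i lt)

    -- `room-left` never exceeds `n + n`, so one fixed number `K` of blocks is enough in every
    -- state.
    delete-to : ∀ {K Q s t} → suc n * suc (n + n) ≤ K → ⟦ deleteF ⟧ (n ∷ d ∷ K ∷ Q ∷ s ∷ t ∷ []) →
                ∃[ i₀ ] Superfluous (state s) i₀ × Deletion i₀ (state s) (state t)
    delete-to {K} {Q} {s} {t} le (i₀ , i₀< , pos , (p , _ , B) , l , c) = i₀ ,
      record { blocks = K ; redundant = blocks-to {p} {K} {s} {i₀} B ; positive = pos
             ; enough = *-monoʳ-≤ (suc n) (s≤s (+-mono-≤ (count-≤ _ n) (count-≤ _ n))) ≤∙ le } ,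
      record { len-del = l
             ; A-del = λ i i< j j< → bits-of i i< j ; C-del = λ i i< j j< → bits-of i i< (n + j) ; L-del = λ i i< j j< → bits-of i i< (n + (n + j)) }
      where
      same-item : ∀ i → i < digit d t 0 → item d t i ≡ item d s (skipping i₀ i)
      same-item i i< with i <? i₀
      ... | yes lt = proj₁ (c i i<) lt ∙ cong (item d s) (sym (skipping-below i₀ i lt))
      ... | no ge  = proj₂ (c i i<) (≮⇒≥ ge) ∙ cong (item d s) (sym (skipping-end (≮⇒≥ ge)))
      bits-of : ∀ i → i < digit d t 0 → ∀ j → Bit (item d t i) j ⇔ Bit (item d s (skipping i₀ i)) j
      bits-of i i< j = mk⇔ (subst (λ y → Bit y j) (same-item i i<)) (subst (λ y → Bit y j) (sym (same-item i i<)))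

    delete-from : ∀ {K Q s t i₀ p} (R : Redundant K (state s) i₀) → 0 < i₀ → i₀ < digit d s 0 → p < Q →
                  (∀ r → r < suc K → digit d p r ≡ Redundant.p R r) → digit d s 0 ≡ suc (digit d t 0) →
                  (∀ i → i < digit d t 0 → item d t i ≡ item d s (skipping i₀ i)) → ⟦ deleteF ⟧ (n ∷ d ∷ K ∷ Q ∷ s ∷ t ∷ [])
    delete-from {K} {Q} {s} {t} {i₀} {p} R pos i₀< p< eq l c = i₀ , i₀< , pos , (p , p< , blocks-from {p} {K} {s} R eq) , l , λ i i< →
      (λ lt → c i i< ∙ cong (item d s) (skipping-below i₀ i lt)) , (λ ge → c i i< ∙ cong (item d s) (skipping-end ge))

-- [ n , d , x , z , v , Q , s , t ]
stepF : Fm 8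
stepF = ∃̇ (ν 5) (∃̇ (ν 6) (call nextF (ν 3 ∷ ν 2 ∷ ν 4 ∷ ν 5 ∷ ν 8 ∷ ν 1 ∷ ν 9 ∷ ν 0 ∷ []) ∧̇ call consistentF (ν 2 ∷ ν 6 ∷ ν 3 ∷ ν 1 ∷ [])))

-- [ n , d , x , z , v , Q , s ]
acceptF : Fm 7
acceptF = ∃̇ (ν 5) (∃̇ (ν 6) (∃̇ (ν 7)
  (call nextF (ν 4 ∷ ν 3 ∷ ν 5 ∷ ν 6 ∷ ν 9 ∷ ν 2 ∷ ν 1 ∷ ν 0 ∷ []) ∧̇ call consistentF (ν 3 ∷ ν 7 ∷ ν 4 ∷ ν 2 ∷ []) ∧̇
   call Tbit (ν 4 ∷ ν 0 ∷ lit 0 ∷ lit 0 ∷ []))))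

-- [ a , b , n , d , x , z , v , K , Q ]; the node 1 + s stands for the state s, and the node 0 for acceptance.
edgeF : Fm 9
edgeF = ∃̇ (ν 8) (ν 1 ≐ lit 1 ⊕ ν 0 ∧̇
  ((ν 2 ≐ lit 0 ∧̇ call acceptF (ν 3 ∷ ν 4 ∷ ν 5 ∷ ν 6 ∷ ν 7 ∷ ν 9 ∷ ν 0 ∷ [])) ∨̇
   ∃̇ (ν 9) (ν 3 ≐ lit 1 ⊕ ν 0 ∧̇
     (call stepF (ν 4 ∷ ν 5 ∷ ν 6 ∷ ν 7 ∷ ν 8 ∷ ν 10 ∷ ν 1 ∷ ν 0 ∷ []) ∨̇ call deleteF (ν 4 ∷ ν 5 ∷ ν 9 ∷ ν 10 ∷ ν 1 ∷ ν 0 ∷ [])))))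

-- `E` is the number of items kept, and in base `suc d` an item of `n + (n + n)` bits is a single
-- digit. Codes have `2 + E` digits, because a state briefly holds `suc E` items besides its length
-- before one of them is deleted. By `E-large`, that many items contain `suc K` nested blocks.
record Large (n d E K Q : ℕ) : Set where
  field
    M≤d      : 2 ^ (n + (n + n)) ≤ suc d
    E≤d      : suc E ≤ d
    n≤E      : n ≤ E
    K≤E      : K ≤ E
    Q-large  : suc d ^ (2 + E) ≤ Q
    K-large  : suc n * suc (n + n) ≤ K
    E-large  : Nesting.width (2 ^ (n + (n + n))) id (suc K) ≤ E

width-irrelevant : ∀ M c c' k → Nesting.width M c k ≡ Nesting.width M c' k
width-irrelevant M c c' zero    = refl
width-irrelevant M c c' (suc k) = cong (suc M *_) (width-irrelevant M c c' k)

bit? : ∀ {P : Set} → Dec P → ℕ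
bit? (yes _) = 1
bit? (no _)  = 0

bit?-⇔ : ∀ {P : Set} (p : Dec P) → (bit? p ≡ 1) ⇔ P
bit?-⇔ (yes p) = mk⇔ (λ _ → p) (λ _ → refl)
bit?-⇔ (no np) = mk⇔ (λ ()) (λ p → contradiction p np)

bit?≤1 : ∀ {P : Set} (p : Dec P) → bit? p ≤ 1
bit?≤1 (yes _) = ≤-refl
bit?≤1 (no _)  = z≤n

module Search (n d E K Q : ℕ) (large : Large n d E K Q) (x z v : ℕ)
              (rules : ∀ j → j < n → Rule (tokenᵈ x) (digit d z) (digit d v) n j) (0<n : 0 < n) where

  open Large large
  open Numeric d n x z v
  open Parsed tok sz (digit d v) n rules using (wf; formula; denotes)
  open Abstraction n kindᴺ wf
  open Columns n kindᴺ wf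

  private
    M = 2 ^ (n + (n + n))
    lv = digit d v

  open Paths (λ a b → ⟦ edgeF ⟧ (a ∷ b ∷ n ∷ d ∷ x ∷ z ∷ v ∷ K ∷ Q ∷ [])) (suc Q)

  ≈-sym : ∀ {s t} → s ≈ t → t ≈ s
  ≈-sym {t = record { len = _ }} e@record { len-≡ = refl } = record
    { len-≡ = refl ; A-≈ = λ i i< j j< → ⇔-flip (A-≈ e i i< j j<) ; C-≈ = λ i i< j j< → ⇔-flip (C-≈ e i i< j j<) ; L-≈ = λ i i< j j< → ⇔-flip (L-≈ e i i< j j<) }

  derived-source : ∀ {s s' t} → s ≈ s' → Derived s t → Derived s' t
  derived-source e (intact f)     = intact (≈-trans (≈-sym e) f)
  derived-source e (remove d S D) = remove (derived-source e d) S D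

  -- Steps are invariant under equivalence of their outcome, so an abstract successor may be
  -- replaced by its code.
  next-resp : ∀ {s ℓ ℓ' t t' τ τ'} → Next s ℓ t τ → (∀ j → j < n → ℓ j ⇔ ℓ' j) → t ≈ t' →
              (∀ i → i < suc (len s) → ∀ j → j < n → τ i j ⇔ τ' i j) → (∀ i j → Dec (τ' i j)) → Next s ℓ' t' τ'
  next-resp {s} {ℓ} {ℓ'} {t} {record { len = _ }} {τ} {τ'} N l e@record { len-≡ = refl } w τ'? = record
    { len-suc = len-suc N ; τ? = τ'?
    ; A-old = λ i i< j j< → ⇔-flip (A-≈ e i (old i<) j j<) ⟨⇔⟩ A-old N i i< j j<
    ; C-old = λ i i< j j< → ⇔-flip (C-≈ e i (old i<) j j<) ⟨⇔⟩ C-old N i i< j j< ⟨⇔⟩ ⊎-⇔ ⇔-id (Later-⇔ {τ} {τ'} {k = j} (λ i i< → w i i< j j<))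
    ; L-old = λ i i< j j< → ⇔-flip (L-≈ e i (old i<) j j<) ⟨⇔⟩ L-old N i i< j j< ⟨⇔⟩ ×-⇔ ⇔-id (l j j<)
    ; A-new = λ j j< → ⇔-flip (A-≈ e (len s) end' j j<) ⟨⇔⟩ A-new N j j< ⟨⇔⟩
        mk⇔ (λ { (i , a , h) → i , a , to (w i a j j<) h }) (λ { (i , a , h) → i , a , from (w i a j j<) h })
    ; C-new = λ j j< h → C-new N j j< (from (C-≈ e (len s) end' j j<) h)
    ; L-new = λ j j< → ⇔-flip (L-≈ e (len s) end' j j<) ⟨⇔⟩ L-new N j j< ⟨⇔⟩ l j j<
    ; valueᴺ = λ i i< j j< → ⇔-flip (w i i< j j<) ⟨⇔⟩ valueᴺ N i i< j j< ⟨⇔⟩ values i i< j j< (kindᴺ j) (wf j j<) }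
    where
    end' : len s < len t
    end' = ≤-reflexive (sym (len-suc N))
    old : ∀ {i} → i < len s → i < len t
    old lt = lt ≤∙ (<⇒≤ end')
    values : ∀ i → i < suc (len s) → ∀ j → j < n → ∀ κ → WellFormed n j κ → Value s t τ i j κ ⇔ Value s _ τ' i j κ
    values i i< j j< letter wk = L-≈ e i (subst (i <_) (sym (len-suc N)) i<) j j<
    values i i< j j< (negᵏ k) wk = ¬-⇔ (w i i< k (proj₂ wk))
    values i i< j j< (Aᵏ k) wk = A-≈ e i (subst (i <_) (sym (len-suc N)) i<) k (proj₂ wk)
    values i i< j j< (Bᵏ k) wk = Later-⇔ {τ} {τ'} {k = k} (λ i i< → w i i< k (proj₂ wk))
    values i i< j j< (Dᵏ k) wk = ⇔-id
    values i i< j j< (orᵏ k l) (wk , wl) = ⊎-⇔ (w i i< k (proj₂ wk)) (w i i< l (proj₂ wl))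

  module Word (u : ℕ → Letter → Bool) = Words formula lv denotes u

  -- The bits of `ℓ` are guessed per node, and nodes with the same letter must agree for `ℓ` to be
  -- realised by a point.
  Consistent : ℕ → Set
  Consistent ℓ = ∀ i → i < n → ∀ j → j < n → lv j ≡ lv i → Bit ℓ j → Bit ℓ i

  -- Soundness rebuilds a word from the guesses: point `a` is added, and a letter holds there if
  -- some node with this letter has its bit set in `ℓ`.
  module Extend (u : ℕ → Letter → Bool) (a ℓ : ℕ) (con : Consistent ℓ) where

    letter? : ∀ p → Dec (∃[ j ] j < n × lv j ≡ p × Bit ℓ j)
    letter? p = exists? (λ j → (lv j ≟ p) ×-dec (digit 1 ℓ j ≟ 1)) n

    extended : ℕ → Letter → Bool
    extended k p with k ≟ a
    ... | yes _ = does (letter? p)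
    ... | no _  = u k p

    extended-old : ∀ k → k < a → ∀ p → u k p ≡ extended k p
    extended-old k lt p with k ≟ a
    ... | yes refl = contradiction lt (<-irrefl refl)
    ... | no _     = refl

    extended-new : ∀ j → j < n → T (extended a (lv j)) ⇔ Bit ℓ j
    extended-new j j< with a ≟ a
    ... | no ne = contradiction refl ne
    ... | yes _ with letter? (lv j)
    ... | yes (i , i< , eq , b) = mk⇔ (λ _ → con j j< i i< eq b) (λ _ → _)
    ... | no none = mk⇔ (λ ()) (λ b → contradiction (j , j< , refl , b) none)

    extend-step : ∀ {s t τ} → Derived (Word.column u a) (state s) → Next (state s) (Bit ℓ) (state t) (truth τ) →
                  Derived (Word.column extended (suc a)) (state t) × (truth τ 0 0 → sat extended (formula 0) a 0)
    extend-step d N =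
      let d' , e = derived-step (derived-source (column-cong {den = denotes} extended-old) d)
            (next-resp (Word.column-next extended a) extended-new (record { len-≡ = refl ; A-≈ = λ _ _ _ _ → ⇔-id ; C-≈ = λ _ _ _ _ → ⇔-id ; L-≈ = λ _ _ _ _ → ⇔-id })
              (λ _ _ _ _ → ⇔-id) (λ i j → sat? extended (formula j) a i)) N
      in d' , from (e 0 0<n)

  Represented : ℕ → Set₁
  Represented s = ∃[ u ] ∃[ a ] Derived (Word.column u a) (state s)

  data Outcomeᴱ : ℕ → Set₁ where
    accepted : ∃[ m ] ∃[ u ] sat u (formula 0) m 0 → Outcomeᴱ 0
    moved    : ∀ {t} → Represented t → Outcomeᴱ (suc t)

  sound-step : ∀ {s b} → Represented s → ⟦ edgeF ⟧ (suc s ∷ b ∷ n ∷ d ∷ x ∷ z ∷ v ∷ K ∷ Q ∷ []) → Outcomeᴱ b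
  sound-step (u , a , D) (s , _ , refl , inj₁ (refl , ℓ , _ , t , _ , τ , _ , N , c , h)) =
    accepted (a , Extend.extended u a ℓ c , proj₂ (Extend.extend-step u a ℓ c {s} {t} {τ} D (next-to wf {s} {ℓ} {t} {τ} N)) h)
  sound-step (u , a , D) (s , _ , refl , inj₂ (t , _ , refl , inj₁ (ℓ , _ , τ , _ , N , c))) =
    moved (Extend.extended u a ℓ c , suc a , proj₁ (Extend.extend-step u a ℓ c {s} {t} {τ} D (next-to wf {s} {ℓ} {t} {τ} N)))
  sound-step (u , a , D) (s , _ , refl , inj₂ (t , _ , refl , inj₂ del)) =
    let i₀ , S , D' = delete-to wf {K} {Q} {s} {t} K-large del in moved (u , a , remove D S D')

  sound : ∀ {s} → Represented s → Star Below-Z (suc s) 0 → ∃[ m ] ∃[ u ] sat u (formula 0) m 0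
  sound {s} R ((e , _) ◅ rest) = continue (sound-step {s} R e) rest
    where
    continue : ∀ {b} → Outcomeᴱ b → Star Below-Z b 0 → ∃[ m ] ∃[ u ] sat u (formula 0) m 0
    continue (accepted h) _    = h
    continue (moved R') rest = sound R' rest

  start-derived : ∀ u → Derived (Word.column u 0) (state 0)
  start-derived u = intact (record { len-≡ = refl ; A-≈ = λ _ () ; C-≈ = λ _ () ; L-≈ = λ _ () })

  module Coding (f : ℕ → ℕ) (m : ℕ) (m≤ : m ≤ 2 + E) (f≤ : ∀ i → i < m → f i ≤ d) where

    code : ℕ
    code = fromDigits d m f

    code< : code < Q
    code< = fromDigits-< d m f f≤ ≤∙ ^-monoʳ-≤ (suc d) m≤ ≤∙ Q-large

    digit-code : ∀ {i} → i < m → digit d code i ≡ f i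
    digit-code = digit-fromDigits d m f f≤

  module Bits {P : ℕ → Set} (P? : ∀ j → Dec (P j)) (m : ℕ) where

    bits-code : ℕ
    bits-code = fromDigits 1 m (λ j → bit? (P? j))

    bits-< : bits-code < 2 ^ m
    bits-< = fromDigits-< 1 m _ (λ j _ → bit?≤1 (P? j))

    bits-⇔ : ∀ {j} → j < m → P j ⇔ Bit bits-code j
    bits-⇔ {j} lt = ⇔-flip (bit?-⇔ (P? j)) ⟨⇔⟩ mk⇔ (trans (digit-fromDigits 1 m _ (λ j _ → bit?≤1 (P? j)) lt)) (trans (sym (digit-fromDigits 1 m _ (λ j _ → bit?≤1 (P? j)) lt)))

  2^n≤ : 2 ^ n ≤ suc d
  2^n≤ = ^-monoʳ-≤ 2 (m≤m+n n (n + n)) ≤∙ M≤d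

  Small : ℕ → Set
  Small s = ∀ i → i < digit d s 0 → item d s i < M

  module EncodeState (t : State) (len≤ : len t ≤ suc E) where

    Field : ℕ → ℕ → Set
    Field i j = (j < n × A t i j) ⊎ (n ≤ j × ((j ∸ n < n × C t i (j ∸ n)) ⊎ (n ≤ j ∸ n × L t i (j ∸ n ∸ n))))

    field? : ∀ i j → Dec (Field i j)
    field? i j = ((j <? n) ×-dec A? t i j) ⊎-dec ((n ≤? j) ×-dec (((j ∸ n <? n) ×-dec C? t i (j ∸ n)) ⊎-dec ((n ≤? j ∸ n) ×-dec L? t i (j ∸ n ∸ n))))

    module It i = Bits (field? i) (n + (n + n))

    entries : ℕ → ℕ
    entries zero    = len t
    entries (suc i) = It.bits-code i

    entries-≤ : ∀ i → i < 2 + E → entries i ≤ d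
    entries-≤ zero _ = len≤ ≤∙ E≤d
    entries-≤ (suc i) _ = s≤s⁻¹ (It.bits-< i ≤∙ M≤d)

    open Coding entries (2 + E) ≤-refl entries-≤ public

    len-code : digit d code 0 ≡ len t
    len-code = digit-code (s≤s z≤n)

    item-code : ∀ i → i < len t → item d code i ≡ It.bits-code i
    item-code i lt = digit-code (s≤s (lt ≤∙ len≤))

    small : Small code
    small i lt = subst (_< M) (sym (item-code i (subst (i <_) len-code lt))) (It.bits-< i)

    through : ∀ i → i < len t → ∀ j → j < n + (n + n) → Field i j ⇔ Bit (item d code i) j
    through i lt j j< = It.bits-⇔ i j< ⟨⇔⟩ mk⇔ (subst (λ y → Bit y j) (sym (item-code i lt))) (subst (λ y → Bit y j) (item-code i lt))

    encoded : t ≈ state code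
    encoded = record
      { len-≡ = sym len-code
      ; A-≈ = λ i i< j j< → mk⇔ (λ h → inj₁ (j< , h)) [ proj₂ , (λ { (ge , _) → contradiction j< (≤⇒≯ ge) }) ]′ ⟨⇔⟩ through i i< j (j< ≤∙ m≤m+n n (n + n))
      ; C-≈ = λ i i< j j< → mk⇔
          (λ h → inj₂ (m≤m+n n j , inj₁ (subst (λ y → y < n × C t i y) (sym (m+n∸m≡n n j)) (j< , h))))
          [ (λ { (lt , _) → contradiction lt (≤⇒≯ (m≤m+n n j)) }) ,
            (λ { (_ , inj₁ (_ , h)) → subst (C t i) (m+n∸m≡n n j) h ; (_ , inj₂ (ge , _)) → contradiction j< (≤⇒≯ (subst (n ≤_) (m+n∸m≡n n j) ge)) }) ]′
          ⟨⇔⟩ through i i< (n + j) (+-monoʳ-< n (j< ≤∙ m≤m+n n n))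
      ; L-≈ = λ i i< j j< → mk⇔
          (λ h → inj₂ (m≤m+n n (n + j) , inj₂ (subst (λ y → n ≤ y × L t i (y ∸ n)) (sym (m+n∸m≡n n (n + j))) (m≤m+n n j , subst (L t i) (sym (m+n∸m≡n n j)) h))))
          [ (λ { (lt , _) → contradiction lt (≤⇒≯ (m≤m+n n (n + j))) }) ,
            (λ { (_ , inj₁ (lt , _)) → contradiction (subst (_< n) (m+n∸m≡n n (n + j)) lt) (≤⇒≯ (m≤m+n n j))
               ; (_ , inj₂ (_ , h)) → subst (L t i) (cong (_∸ n) (m+n∸m≡n n (n + j)) ∙ m+n∸m≡n n j) h }) ]′
          ⟨⇔⟩ through i i< (n + (n + j)) (+-monoʳ-< n (+-monoʳ-< n j<)) }

  module EncodeTruth {τ : ℕ → ℕ → Set} (τ? : ∀ i j → Dec (τ i j)) where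

    module Row i = Bits (τ? i) n

    open Coding Row.bits-code (suc E) (n≤1+n _) (λ i _ → s≤s⁻¹ (Row.bits-< i ≤∙ 2^n≤)) public

    truth-code : ∀ i → i < suc E → ∀ j → j < n → τ i j ⇔ truth code i j
    truth-code i i< j j< = Row.bits-⇔ i j< ⟨⇔⟩ mk⇔ (subst (λ y → Bit y j) (sym (digit-code i<))) (subst (λ y → Bit y j) (digit-code i<))

  2^n≤Q : 2 ^ n ≤ Q
  2^n≤Q = 2^n≤ ≤∙ m≤m*n (suc d) (suc d ^ (1 + E)) {{>-nonZero (m^n>0 (suc d) (1 + E))}} ≤∙ Q-large

  module _ (u : ℕ → Letter → Bool) where

    record Reached (a s : ℕ) : Set₁ where
      field
        path    : Star Below-Z 1 (suc s)
        s<Q     : s < Q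
        derived : Derived (Word.column u a) (state s)
        length≤ : digit d s 0 ≤ E
        smallᵣ  : Small s

    open Reached

    -- One more point of the word is read; the truth values at that point are coded by τ.
    module Read {a s : ℕ} (R : Reached a s) where

      ℓᴾ : ℕ → Set
      ℓᴾ j = T (u a (lv j))

      ℓ? : ∀ j → Dec (ℓᴾ j)
      ℓ? j = T? (u a (lv j))

      module ℓᶜ = Bits ℓ? n

      ℓ = ℓᶜ.bits-code

      consistent : Consistent ℓ
      consistent i i< j j< eq b = to (ℓᶜ.bits-⇔ i<) (subst (λ p → T (u a p)) eq (from (ℓᶜ.bits-⇔ j<) b))

      pure = derived-next (derived R) (Word.column-next u a)
      t₀ = proj₁ pure
      τ₀ = proj₁ (proj₂ pure)
      N₀ : Next (state s) ℓᴾ t₀ τ₀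
      N₀ = proj₁ (proj₂ (proj₂ pure))

      module Tᶜ = EncodeState t₀ (len-suc N₀ ≡∙≤ s≤s (length≤ R))
      module τᶜ = EncodeTruth (τ? N₀)

      t = Tᶜ.code
      τ = τᶜ.code

      Nᴿ : Next (state s) (Bit ℓ) (state t) (truth τ)
      Nᴿ = next-resp N₀ (λ j j< → ℓᶜ.bits-⇔ j<) Tᶜ.encoded (λ i i< j j< → τᶜ.truth-code i (i< ≤∙ s≤s (length≤ R)) j j<) (λ i j → digit 1 (digit d τ i) j ≟ 1)

      derived' : Derived (Word.column u (suc a)) (state t)
      derived' = derived-≈ (proj₁ (proj₂ (proj₂ (proj₂ pure)))) Tᶜ.encoded

      root : sat u (formula 0) a 0 → truth τ 0 0
      root h = to (τᶜ.truth-code 0 (s≤s z≤n) 0 0<n) (to (proj₂ (proj₂ (proj₂ (proj₂ pure))) 0 0<n) h)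

      next-formula : ⟦ nextF ⟧ (d ∷ n ∷ x ∷ z ∷ s ∷ ℓ ∷ t ∷ τ ∷ [])
      next-formula = next-from wf {s} {ℓ} {t} {τ} Nᴿ

      path' : Star Below-Z 1 (suc t)
      path' = path R ◅◅ ((s , s<Q R , refl , inj₂ (t , Tᶜ.code< , refl , inj₁ (ℓ , ℓᶜ.bits-< ≤∙ 2^n≤Q , τ , τᶜ.code< , next-formula , consistent))) , s≤s Tᶜ.code<) ◅ ε

      accepting-path : sat u (formula 0) a 0 → Star Below-Z 1 0
      accepting-path h = path R ◅◅ ((s , s<Q R , refl , inj₁ (refl , ℓ , ℓᶜ.bits-< ≤∙ 2^n≤Q , t , Tᶜ.code< , τ , τᶜ.code< , next-formula , consistent , root h)) , s≤s z≤n) ◅ ε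

      len-t : digit d t 0 ≡ suc (digit d s 0)
      len-t = len-suc Nᴿ

      same-item : ∀ i i' → item d t i ≡ item d t i' → Same (state t) i i'
      same-item i i' eq = record { A-same = λ j _ → transport j ; C-same = λ j _ → transport (n + j) ; L-same = λ j _ → transport (n + (n + j)) }
        where
        transport : ∀ j → Bit (item d t i) j ⇔ Bit (item d t i') j
        transport j = mk⇔ (subst (λ y → Bit y j) eq) (subst (λ y → Bit y j) (sym eq))

      -- If the new state has become too long, a superfluous item is dropped.
      module Compress {i₀} (full : digit d t 0 ≡ suc E) (pos : 0 < i₀) (Rd : Redundant K (state t) i₀) where

        open Redundant Rd

        i₀<len : i₀ < digit d t 0
        i₀<len = subst (_< digit d t 0) pₘ≡i₀ (p-bound K ≤-refl)

        skip< : ∀ {i} → i < E → skipping i₀ i < digit d t 0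
        skip< {i} lt = subst (skipping i₀ i <_) (sym full) (subst (skipping i₀ i <_) (skipping-end (s≤s⁻¹ (subst (i₀ <_) full i₀<len))) (skipping-mono i₀ lt))

        entries : ℕ → ℕ
        entries zero    = E
        entries (suc i) = item d t (skipping i₀ i)

        entries-≤ : ∀ i → i < suc E → entries i ≤ d
        entries-≤ zero _        = n≤1+n E ≤∙ E≤d
        entries-≤ (suc i) (s≤s lt) = s≤s⁻¹ (Tᶜ.small (skipping i₀ i) (skip< lt) ≤∙ M≤d)

        module Dᶜ = Coding entries (suc E) (n≤1+n _) entries-≤
        module Pᶜ = Coding p (suc K) (s≤s (K≤E ≤∙ n≤1+n E)) (λ r lt → (<⇒≤ (p-bound r lt)) ≤∙ full ≡∙≤ E≤d)

        t' = Dᶜ.code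

        len-t' : digit d t' 0 ≡ E
        len-t' = Dᶜ.digit-code (s≤s z≤n)

        items : ∀ i → i < digit d t' 0 → item d t' i ≡ item d t (skipping i₀ i)
        items i lt = Dᶜ.digit-code (s≤s (subst (i <_) len-t' lt))

        del : ⟦ deleteF ⟧ (n ∷ d ∷ K ∷ Q ∷ t ∷ t' ∷ [])
        del = delete-from wf {K} {Q} {t} {t'} {i₀} {Pᶜ.code} Rd pos i₀<len Pᶜ.code< (λ r lt → Pᶜ.digit-code lt) (full ∙ cong suc (sym len-t')) items

        compressed : Reached (suc a) t'
        compressed = record
          { path = path' ◅◅ ((t , Tᶜ.code< , refl , inj₂ (t' , Dᶜ.code< , refl , inj₂ del)) , s≤s Dᶜ.code<) ◅ ε
          ; s<Q = Dᶜ.code<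
          ; derived = let i₁ , S , D = delete-to wf {K} {Q} {t} {t'} K-large del in remove derived' S D
          ; length≤ = ≤-reflexive len-t'
          ; smallᵣ = λ i lt → subst (_< M) (sym (items i lt)) (Tᶜ.small (skipping i₀ i) (skip< (subst (i <_) len-t' lt))) }

      full : ¬ (digit d t 0 ≤ E) → digit d t 0 ≡ suc E
      full gt = ≤-antisym (len-t ≡∙≤ s≤s (length≤ R)) (≰⇒> gt)

      found : digit d t 0 ≡ suc E → ∃[ i₀ ] 0 < i₀ × Redundant K (state t) i₀
      found eq = long-redundant {state t} M (item d t) K (derived-monotone derived' (Word.column-monotone u (suc a))) Tᶜ.small same-item
        (s≤s (width-irrelevant M (item d t) id (suc K) ≡∙≤ E-large) ≤∙≡ sym eq)

      continued : Dec (digit d t 0 ≤ E) → ∃[ s' ] Reached (suc a) s'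
      continued (yes le) = t , record { path = path' ; s<Q = Tᶜ.code< ; derived = derived' ; length≤ = le ; smallᵣ = Tᶜ.small }
      continued (no gt)  = let i₀ , pos , Rd = found (full gt) in _ , Compress.compressed (full gt) pos Rd

    -- Every point read adds one item. If this makes `suc E` of them, a deletion follows at once, so
    -- all codes on the path stay below `Q`.
    reach : ∀ a → ∃[ s ] Reached a s
    reach zero    = 0 , record { path = ε ; s<Q = m^n>0 (suc d) (2 + E) ≤∙ Q-large ; derived = start-derived u ; length≤ = z≤n ; smallᵣ = λ _ () }
    reach (suc a) = Read.continued (proj₂ (reach a)) (_ ≤? E)

    complete : ∀ {m} → sat u (formula 0) m 0 → Star Below-Z 1 0
    complete {m} h = Read.accepting-path (proj₂ (reach m)) h

  search-correct : Star Below-Z 1 0 ⇔ Satisfiable (formula 0)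
  search-correct = mk⇔ (λ p → from (satisfiable⇔sat (formula 0)) (sound {0} ((λ _ _ → false) , 0 , start-derived _) p))
    (λ h → let m , u , h' = to (satisfiable⇔sat (formula 0)) h in complete u h')

-- Polynomials and the sizes of the search parameters.

_+ᴾ_ : Polynomial → Polynomial → Polynomial
[] +ᴾ q       = q
(a ∷ p) +ᴾ []      = a ∷ p
(a ∷ p) +ᴾ (b ∷ q) = (a + b) ∷ (p +ᴾ q)

scale : ℕ → Polynomial → Polynomial
scale a = map (a *_)

_*ᴾ_ : Polynomial → Polynomial → Polynomial
[] *ᴾ q = []
(a ∷ p) *ᴾ q = scale a q +ᴾ (0 ∷ (p *ᴾ q))

eval-+ : ∀ p q n → eval (p +ᴾ q) n ≡ eval p n + eval q n
eval-+ [] q n = refl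
eval-+ (a ∷ p) [] n = sym (+-identityʳ _)
eval-+ (a ∷ p) (b ∷ q) n = cong (λ x → a + b + n * x) (eval-+ p q n) ∙ arith a b n (eval p n) (eval q n)
  where
  arith : ∀ a b n x y → a + b + n * (x + y) ≡ a + n * x + (b + n * y)
  arith = solve-∀

eval-scale : ∀ a p n → eval (scale a p) n ≡ a * eval p n
eval-scale a [] n = sym (*-zeroʳ a)
eval-scale a (b ∷ p) n = cong (λ x → a * b + n * x) (eval-scale a p n) ∙ arith a b n (eval p n)
  where
  arith : ∀ a b n x → a * b + n * (a * x) ≡ a * (b + n * x)
  arith = solve-∀

eval-* : ∀ p q n → eval (p *ᴾ q) n ≡ eval p n * eval q n
eval-* [] q n = refl
eval-* (a ∷ p) q n = eval-+ (scale a q) (0 ∷ (p *ᴾ q)) n ∙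
  cong₂ (λ x y → x + (0 + n * y)) (eval-scale a q n) (eval-* p q n) ∙ arith a n (eval p n) (eval q n)
  where
  arith : ∀ a n x y → a * y + (0 + n * (x * y)) ≡ (a + n * x) * y
  arith = solve-∀

PolyBounded : (ℕ → ℕ) → Set
PolyBounded f = ∃[ p ] ∀ n → f n ≤ eval p n

poly-const : ∀ c → PolyBounded (λ _ → c)
poly-const c = c ∷ [] , λ n → m≤m+n c (n * 0)

poly-id : PolyBounded id
poly-id = 0 ∷ 1 ∷ [] , λ n → ≤-reflexive (arith n)
  where
  arith : ∀ n → n ≡ 0 + n * (1 + n * 0)
  arith = solve-∀

poly-+ : ∀ {f g} → PolyBounded f → PolyBounded g → PolyBounded (λ n → f n + g n)
poly-+ (p , f≤) (q , g≤) = p +ᴾ q , λ n → +-mono-≤ (f≤ n) (g≤ n) ≤∙≡ sym (eval-+ p q n)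

poly-* : ∀ {f g} → PolyBounded f → PolyBounded g → PolyBounded (λ n → f n * g n)
poly-* (p , f≤) (q , g≤) = p *ᴾ q , λ n → *-mono-≤ (f≤ n) (g≤ n) ≤∙≡ sym (eval-* p q n)

poly-eval : ∀ p → PolyBounded (eval p)
poly-eval p = p , λ _ → ≤-refl

-- At most `2 n` changes of `room-left`, each costing fewer than `suc n` blocks, give the number of
-- blocks. An item has `3 n` bits, so `suc (blockCount n)` nested blocks need at most
-- `(1 + 2 ^ (3 n)) ^ suc (blockCount n)` items, which is at most `2 ^ exponent n`.
blockCount exponent : ℕ → ℕ
blockCount n = suc n * suc (n + n)
exponent n = suc (n + (n + n)) * suc (blockCount n)

2^-mono : ∀ {a b} → a ≤ b → 2 ^ a ≤ 2 ^ b
2^-mono = ^-monoʳ-≤ 2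

n≤2^n : ∀ n → n ≤ 2 ^ n
n≤2^n zero    = z≤n
n≤2^n (suc n) = +-mono-≤ (m^n>0 2 n) (n≤2^n n) ≤∙≡ cong (2 ^ n +_) (sym (+-identityʳ (2 ^ n)))

width-≤ : ∀ m c k → Nesting.width (2 ^ m) c k ≤ 2 ^ (suc m * k)
width-≤ m c zero    = m^n>0 2 (suc m * 0)
width-≤ m c (suc k) = *-mono-≤ base (width-≤ m c k) ≤∙≡ sym (^-distribˡ-+-* 2 (suc m) (suc m * k)) ∙ cong (2 ^_) (sym (*-suc (suc m) k))
  where
  base : suc (2 ^ m) ≤ 2 ^ suc m
  base = +-monoˡ-≤ (2 ^ m) (m^n>0 2 m) ≤∙≡ cong (2 ^ m +_) (sym (+-identityʳ (2 ^ m)))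

-- Codes have at most `2 + E` digits in base `2 + E`, and `F` is a power of two not below
-- `(2 + e) * (2 + E)`, so `Q = 2 ^ F` bounds them. With `1 + Q` nodes and depth `1 + F`, the stack
-- of the reachability test has at most `5 * (1 + F) + 4 = 9 + 5 * F` digits in a base of at most
-- `2 ^ (3 + F)`; this is `B`.
module Sizes (n e E F Q B : ℕ) (e≡ : e ≡ exponent n) (E≡ : E ≡ 2 ^ e) (F≡ : F ≡ 2 ^ (4 + 2 * e)) (Q≡ : Q ≡ 2 ^ F)
             (B≡ : B ≡ 2 ^ ((3 + F) * (9 + 5 * F))) where

  k = blockCount n

  3n≤e : n + (n + n) ≤ e
  3n≤e = n≤1+n _ ≤∙ m≤m*n (suc (n + (n + n))) (suc k) ≤∙≡ sym e≡

  k≤e : k ≤ e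
  k≤e = n≤1+n k ≤∙ m≤n*m (suc k) (suc (n + (n + n))) ≤∙≡ sym e≡

  e≤E : e ≤ E
  e≤E = n≤2^n e ≤∙≡ sym E≡

  1≤E : 1 ≤ E
  1≤E = m^n>0 2 e ≤∙≡ sym E≡

  2+e≤ : 2 + E ≤ 2 ^ (2 + e)
  2+e≤ = +-mono-≤ (+-mono-≤ 1≤E 1≤E) (m≤m+n E E) ≤∙≡ arith E ∙ cong (λ x → 2 * (2 * x)) E≡
    where
    arith : ∀ E → E + E + (E + E) ≡ 2 * (2 * E)
    arith = solve-∀

  product : (2 + e) * (2 + E) ≤ F
  product = *-mono-≤ (+-monoʳ-≤ 2 e≤E ≤∙ 2+e≤) 2+e≤ ≤∙≡
    sym (^-distribˡ-+-* 2 (2 + e) (2 + e)) ∙ cong (2 ^_) (arith e) ∙ sym F≡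
    where
    arith : ∀ e → 2 + e + (2 + e) ≡ 4 + 2 * e
    arith = solve-∀

  large : Large n (suc E) E k Q
  large = record
    { M≤d = 2^-mono 3n≤e ≤∙ sym E≡ ≡∙≤ n≤1+n E ≤∙ n≤1+n _
    ; E≤d = ≤-refl
    ; n≤E = m≤m+n n (n + n) ≤∙ 3n≤e ≤∙ e≤E
    ; K≤E = k≤e ≤∙ e≤E
    ; Q-large = ^-monoˡ-≤ (2 + E) 2+e≤ ≤∙ ^-*-assoc 2 (2 + e) (2 + E) ≡∙≤ 2^-mono product ≤∙≡ sym Q≡
    ; K-large = ≤-refl
    ; E-large = width-≤ (n + (n + n)) id (suc k) ≤∙≡ cong (2 ^_) (sym e≡) ∙ sym E≡ }

  F≤Q : F ≤ Q
  F≤Q = n≤2^n F ≤∙≡ sym Q≡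

  1≤Q : 1 ≤ Q
  1≤Q = m^n>0 2 F ≤∙≡ sym Q≡

  nodes : suc Q ≤ 2 ^ suc F
  nodes = +-monoˡ-≤ Q 1≤Q ≤∙≡ cong (Q +_) (sym (+-identityʳ Q)) ∙ cong (2 *_) Q≡

  base≤ : suc (2 + (suc Q + suc F)) ≤ 2 ^ (3 + F)
  base≤ = arith₁ Q F ≡∙≤ +-mono-≤ (+-mono-≤ (*-monoʳ-≤ 5 1≤Q) F≤Q) (m≤m+n Q Q) ≤∙≡
    arith₂ Q ∙ cong (λ x → 2 * (2 * (2 * x))) Q≡
    where
    arith₁ : ∀ Q F → suc (2 + (suc Q + suc F)) ≡ 5 * 1 + F + Q
    arith₁ = solve-∀
    arith₂ : ∀ Q → 5 * Q + Q + (Q + Q) ≡ 2 * (2 * (2 * Q))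
    arith₂ = solve-∀

  room≤ : suc (2 + (suc Q + suc F)) ^ (5 * suc F + 4) ≤ B
  room≤ = ^-monoˡ-≤ (5 * suc F + 4) base≤ ≤∙≡ ^-*-assoc 2 (3 + F) (5 * suc F + 4) ∙
    cong (λ x → 2 ^ ((3 + F) * x)) (arith F) ∙ sym B≡
    where
    arith : ∀ F → 5 * suc F + 4 ≡ 9 + 5 * F
    arith = solve-∀

-- [ x , E , F , Q , B ], then [ v , z , n , x , E , F , Q , B ]
blockᵗ : ∀ {k} → Tm k → Tm k
blockᵗ n = (lit 1 ⊕ n) ⊗ (lit 1 ⊕ (n ⊕ n))

edge₈ : Fm 10
edge₈ = call edgeF (ν 0 ∷ ν 1 ∷ ν 4 ∷ lit 1 ⊕ ν 6 ∷ ν 5 ∷ ν 3 ∷ ν 2 ∷ blockᵗ (ν 4) ∷ ν 8 ∷ [])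

-- The nodes are 0 and `1 + s` for the codes `s < Q`; depth `1 + F` covers all paths of at most
-- `1 + Q` steps. The search leads from node 1, the code 0 of the empty state, to the accepting node
-- 0.
module Reachᶠ = Savitch {8} edge₈ (lit 1 ⊕ ν 6) (lit 1 ⊕ ν 5) (ν 7) (lit 1) (lit 0)

-- The number of tokens and both tables of the parse are guessed. Words that are no codes are
-- rejected here, including those whose length is not a multiple of 3.
satF : Fm 5
satF = ∃̇ (lit 1 ⊕ ν 0) (lit 3 ⊗ ν 0 ≐ fun (λ x _ → lengthᵈ x) (Comp-lengthᵈ v₀) (ν 1) (lit 0) ∧̇
  ∃̇ (ν 4) (∃̇ (ν 5) (call parseF (ν 2 ∷ ν 3 ∷ ν 1 ∷ ν 0 ∷ lit 1 ⊕ ν 4 ∷ []) ∧̇ rel Reachᶠ.Comp-reachable)))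

truth-≢0 : ∀ {b P} → Truth b P → (b ≢ 0) ⇔ P
truth-≢0 (inj₁ (refl , p))  = mk⇔ (λ _ → p) (λ _ ())
truth-≢0 (inj₂ (refl , np)) = mk⇔ (λ ne → contradiction refl ne) (λ p → contradiction p np)

module Correct (w : List Bool) (n e E F Q B : ℕ) (e≡ : e ≡ exponent n) (E≡ : E ≡ 2 ^ e) (F≡ : F ≡ 2 ^ (4 + 2 * e)) (Q≡ : Q ≡ 2 ^ F)
               (B≡ : B ≡ 2 ^ ((3 + F) * (9 + 5 * F))) where

  open Sizes n e E F Q B e≡ E≡ F≡ Q≡ B≡
  open Large large

  x d : ℕ
  x = value w
  d = suc E

  module Given (z v : ℕ) (0<n : 0 < n) (whole-size : digit d z 0 ≡ n) (rules : ∀ j → j < n → Rule (tokenᵈ x) (digit d z) (digit d v) n j)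
               (ts : List Token) (word≡ : word ts ≡ w) (length≡ : length ts ≡ n) where

    open Search n d E k Q large x z v rules 0<n
    open Parsed (tokenᵈ x) (digit d z) (digit d v) n rules using (formula; encode-formula)
    open Paths (λ a b → ⟦ edgeF ⟧ (a ∷ b ∷ n ∷ d ∷ x ∷ z ∷ v ∷ k ∷ Q ∷ [])) (suc Q)

    reachable⇔ : (Reachᶠ.reachable (v ∷ z ∷ n ∷ x ∷ E ∷ F ∷ Q ∷ B ∷ []) ≢ 0) ⇔ Satisfiable (formula 0)
    reachable⇔ = truth-≢0 (Reachᶠ.reachable-correct (v ∷ z ∷ n ∷ x ∷ E ∷ F ∷ Q ∷ B ∷ []) (s≤s 1≤Q) (s≤s z≤n) (Reachᶠ.room room≤)) ⟨⇔⟩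
      mk⇔ (within→star (suc F) (s≤s z≤n)) (star→within {suc F} nodes (s≤s 1≤Q)) ⟨⇔⟩ search-correct

    coded : encode (formula 0) ≡ w
    coded = encode-formula ts length≡ (λ j {t} {us} eq → subst (λ y → tokenᵈ (value y) j ≡ tokenCode t) word≡ (tokenᵈ-value ts j eq)) 0<n whole-size ∙ word≡

  three-length : ∀ {n'} → n' < suc x → 3 * n' ≡ lengthᵈ x → length w ≡ 3 * n'
  three-length _ eq = sym (lengthᵈ-value w) ∙ sym eq

  forward : (∀ n' → length w ≡ 3 * n' → n' ≡ n) → ⟦ satF ⟧ (x ∷ E ∷ F ∷ Q ∷ B ∷ []) → ABDhom-SAT w
  forward unique (n' , n'< , len , z , z< , v , v< , parsed , reach) = go (unique n' lw) parsed reach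
    where
    lw : length w ≡ 3 * n'
    lw = three-length n'< len
    go : n' ≡ n → ⟦ parseF ⟧ (n' ∷ x ∷ z ∷ v ∷ d ∷ []) → Reachᶠ.reachable (v ∷ z ∷ n' ∷ x ∷ E ∷ F ∷ Q ∷ B ∷ []) ≢ 0 → ABDhom-SAT w
    go refl parsed reach =
      let 0<n , s , rules = to (Numeric.parse-rules d n x z v) parsed
          ts , word≡ , length≡ = fromWord n w lw
          open Given z v 0<n s rules ts word≡ length≡
      in Parsed.formula (tokenᵈ x) (digit d z) (digit d v) n rules 0 , coded , to reachable⇔ reach

  -- The parse of a formula is coded by two sequences of digits.
  module Back (φ : Formula) (enc : encode φ ≡ w) (size≡ : sizeOf φ ≡ n) where

    n≤2+E : n ≤ 2 + E
    n≤2+E = n≤E ≤∙ m≤n+m E 2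

    z≤ : ∀ i → i < n → sizeAt φ i ≤ d
    z≤ i _ = sizeAt-≤ φ i ≤∙ size≡ ≡∙≤ n≤E ≤∙ n≤1+n E
    v≤ : ∀ i → i < n → letterAt φ i ≤ d
    v≤ i _ = s≤s⁻¹ (letterAt-< φ i ≤∙ 2^-mono (size≡ ≡∙≤ m≤m+n n (n + n)) ≤∙ M≤d)

    z v : ℕ
    z = fromDigits d n (sizeAt φ)
    v = fromDigits d n (letterAt φ)

    z< : z < Q
    z< = fromDigits-< d n (sizeAt φ) z≤ ≤∙ ^-monoʳ-≤ (suc d) n≤2+E ≤∙ Q-large
    v< : v < Q
    v< = fromDigits-< d n (letterAt φ) v≤ ≤∙ ^-monoʳ-≤ (suc d) n≤2+E ≤∙ Q-large

    tok≡ : ∀ j → j < n → tokenᵈ x j ≡ codeAt (tokens φ) j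
    tok≡ j j< =
      let t , us , eq , c = codeAt-drop (tokens φ) j (subst (j <_) (sym size≡) j<)
      in subst (λ y → tokenᵈ (value y) j ≡ tokenCode t) enc (tokenᵈ-value (tokens φ) j eq) ∙ sym c

    rules : ∀ j → j < n → Rule (tokenᵈ x) (digit d z) (digit d v) n j
    rules j j< = embed-rule 0 (formula-rules φ j (subst (j <_) (sym size≡) j<)) (subst (j <_) (sym size≡) j<) (≤-reflexive size≡)
      (λ i i< → tok≡ i (cast i<)) (λ i i< → digit-fromDigits d n (sizeAt φ) z≤ (cast i<)) (λ i i< → digit-fromDigits d n (letterAt φ) v≤ (cast i<))
      where
      cast : ∀ {i} → i < sizeOf φ → i < n
      cast {i} = subst (i <_) size≡

    0<n : 0 < n
    0<n = subst (0 <_) size≡ (sizeOf-pos φ)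

    whole-size : digit d z 0 ≡ n
    whole-size = digit-fromDigits d n (sizeAt φ) z≤ 0<n ∙ sizeAt-0 φ ∙ size≡

    open Given z v 0<n whole-size rules (tokens φ) enc size≡ public

    n<1+x : n < suc x
    n<1+x = s≤s (m≤n*m n 3 ≤∙ cong (3 *_) (sym size≡) ∙ sym (length-word (tokens φ)) ∙ cong length enc ≡∙≤ s≤s⁻¹ (n<2^n (length w) ≤∙ length-value w))
      where
      n<2^n : ∀ n → suc n ≤ 2 ^ n
      n<2^n zero    = ≤-refl
      n<2^n (suc n) = +-mono-≤ (m^n>0 2 n) (n<2^n n) ≤∙≡ cong (2 ^ n +_) (sym (+-identityʳ (2 ^ n)))

    three-n : 3 * n ≡ lengthᵈ x
    three-n = cong (3 *_) (sym size≡) ∙ sym (length-word (tokens φ)) ∙ cong length enc ∙ sym (lengthᵈ-value w)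

    backward : Satisfiable φ → ⟦ satF ⟧ (x ∷ E ∷ F ∷ Q ∷ B ∷ [])
    backward h = n , n<1+x , three-n , z , z< , v , v< , from (Numeric.parse-rules d n x z v) (0<n , whole-size , rules) ,
      from reachable⇔ (subst Satisfiable (encode-injective {φ} {Parsed.formula (tokenᵈ x) (digit d z) (digit d v) n rules 0} (enc ∙ sym coded)) h)

  -- In the application `n` is the quotient of the length by 3, rounded down. If the length is not a
  -- multiple of 3, the hypothesis is vacuous and both sides fail.
  satF-correct : (∀ n' → length w ≡ 3 * n' → n' ≡ n) → ⟦ satF ⟧ (x ∷ E ∷ F ∷ Q ∷ B ∷ []) ⇔ ABDhom-SAT w
  satF-correct unique = mk⇔ (forward unique)
    (λ { (φ , enc , h) → Back.backward φ enc (unique (sizeOf φ) (cong length (sym enc) ∙ length-word (tokens φ))) h })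

  answer-correct : ∀ {ρ} → ρ ≡ x ∷ E ∷ F ∷ Q ∷ B ∷ [] → (∀ n' → length w ≡ 3 * n' → n' ≡ n) → (χ satF ρ ≢ 0) ⇔ ABDhom-SAT w
  answer-correct refl unique = truth-≢0 (χ-correct satF (x ∷ E ∷ F ∷ Q ∷ B ∷ [])) ⟨⇔⟩ satF-correct unique

open Comp

-- The deciding program and its space.

-- The registers from free on serve as scratch space.
doubling : ℕ → ℕ → NProg
doubling dst free = loop dst (dec dst ⨾ inc (1 + free) ⨾ inc (2 + free)) ⨾ loop (1 + free) (dec (1 + free) ⨾ inc dst) ⨾ loop (2 + free) (dec (2 + free) ⨾ inc dst)

-- Exponentiation is not polynomially bounded and hence not a `Comp`. The few powers of two that
-- occur are computed by repeated doubling, outside the arithmetic formula.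
power : ℕ → ℕ → ℕ → NProg
power src dst free = prog (Comp-lookup {1} zero) (src ∷ []) free (1 + free) ⨾ inc dst ⨾ loop free (dec free ⨾ doubling dst free)

module _ {m : ℕ} where

  doubling-spec : ∀ {dst free σ} a → dst < free → σ dst ≡ a → σ (1 + free) ≡ 0 → σ (2 + free) ≡ 0 → a + a ≤ m →
                  Spec m (doubling dst free) σ dst (a + a)
  doubling-spec {dst} {free} {σ} a lt eq z₁ z₂ le =
    let σ₁ , e₁ , p₁ , q₁ , r₁ , o₁ = split {m} dst (1 + free) (2 + free) d≢1 d≢2 (<⇒≢ ≤-refl) a {σ} eq
          (cong (_+ a) z₁ ≡∙≤ a≤m) (cong (_+ a) z₂ ≡∙≤ a≤m)
        σ₂ , e₂ , p₂ , q₂ , o₂ = drain {m} (1 + free) dst (d≢1 ∘ sym) a {σ₁} (q₁ ∙ cong (_+ a) z₁) (cong (_+ a) p₁ ≡∙≤ a≤m)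
        q₂' = q₂ ∙ cong (_+ a) p₁
        σ₃ , e₃ , p₃ , q₃ , o₃ = drain {m} (2 + free) dst (d≢2 ∘ sym) a {σ₂} (o₂ _ (>⇒≢ ≤-refl) (d≢2 ∘ sym) ∙ r₁ ∙ cong (_+ a) z₂) (cong (_+ a) q₂' ≡∙≤ le)
    in σ₃ , (e₁ ⨾ e₂ ⨾ e₃) , q₃ ∙ cong (_+ a) q₂' ,
       λ j ne → others σ₁ σ₂ σ₃ p₂ p₃ o₁ o₂ o₃ j ne
    where
    d≢1 : dst ≢ 1 + free
    d≢1 = <⇒≢ (lt ≤∙ n≤1+n free)
    d≢2 : dst ≢ 2 + free
    d≢2 = <⇒≢ (lt ≤∙ m≤n+m free 2)
    a≤m : a ≤ m
    a≤m = m≤m+n a a ≤∙ le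
    others : ∀ σ₁ σ₂ σ₃ → σ₂ (1 + free) ≡ 0 → σ₃ (2 + free) ≡ 0 → (∀ j → j ≢ dst → j ≢ 1 + free → j ≢ 2 + free → σ₁ j ≡ σ j) →
             (∀ j → j ≢ 1 + free → j ≢ dst → σ₂ j ≡ σ₁ j) → (∀ j → j ≢ 2 + free → j ≢ dst → σ₃ j ≡ σ₂ j) → ∀ j → j ≢ dst → σ₃ j ≡ σ j
    others σ₁ σ₂ σ₃ p₂ p₃ o₁ o₂ o₃ j ne with j ≟ 1 + free | j ≟ 2 + free
    ... | yes refl | _        = o₃ j (<⇒≢ ≤-refl) ne ∙ p₂ ∙ sym z₁
    ... | no _ | yes refl = p₃ ∙ sym z₂
    ... | no a | no b     = o₃ j b ne ∙ o₂ j a ne ∙ o₁ j ne a b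

  power-loop : ∀ {dst free} c {σ : Regs} a → dst < free → σ free ≡ c → σ dst ≡ a → σ (1 + free) ≡ 0 → σ (2 + free) ≡ 0 → a * 2 ^ c ≤ m →
               ∃[ σ' ] NExec m (loop free (dec free ⨾ doubling dst free)) σ σ' × σ' free ≡ 0 × σ' dst ≡ a * 2 ^ c ×
               (∀ j → j ≢ free → j ≢ dst → σ' j ≡ σ j)
  power-loop zero {σ} a lt eq eq' z₁ z₂ le = σ , stop eq (λ _ → refl) , eq , eq' ∙ sym (*-identityʳ a) , λ _ _ _ → refl
  power-loop {dst} {free} (suc c) {σ} a lt eq eq' z₁ z₂ le =
    let σ₁ = σ [ free ≔ pred (σ free) ]
        σ₂ , e₂ , p₂ , o₂ = doubling-spec {dst} {free} {σ₁} a lt (≔-other σ _ d≢f ∙ eq')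
          (≔-other σ _ (>⇒≢ ≤-refl) ∙ z₁) (≔-other σ _ (m≢1+n+m free {1} ∘ sym) ∙ z₂) (a+a≤ ≤∙ le)
        σ₃ , e₃ , p₃ , q₃ , o₃ = power-loop {dst} {free} c {σ₂} (a + a) lt
          (o₂ free (d≢f ∘ sym) ∙ ≔-same σ free _ ∙ cong pred eq) p₂
          (o₂ _ (<⇒≢ (lt ≤∙ n≤1+n free) ∘ sym) ∙ ≔-other σ _ (>⇒≢ ≤-refl) ∙ z₁)
          (o₂ _ (<⇒≢ (lt ≤∙ m≤n+m free 2) ∘ sym) ∙ ≔-other σ _ (m≢1+n+m free {1} ∘ sym) ∙ z₂)
          (arith a (2 ^ c) ≡∙≤ le)
    in σ₃ , iter (λ z → case trans (sym eq) z of λ ()) (dec-≔ free ⨾ e₂) e₃ , p₃ , q₃ ∙ arith a (2 ^ c) ,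
       λ j a b → o₃ j a b ∙ o₂ j b ∙ ≔-other σ _ a
    where
    d≢f : dst ≢ free
    d≢f = <⇒≢ lt
    arith : ∀ a x → (a + a) * x ≡ a * (2 * x)
    arith = solve-∀
    a+a≤ : a + a ≤ a * 2 ^ suc c
    a+a≤ = m≤m*n (a + a) (2 ^ c) {{>-nonZero (m^n>0 2 c)}} ≤∙≡ arith a (2 ^ c)

  power-spec : ∀ {src dst free σ} → src < free → dst < free → src ≢ dst → (∀ j → free ≤ j → σ j ≡ 0) → σ dst ≡ 0 →
               (2 + σ src) ^ 1 ≤ m → 2 ^ σ src ≤ m → Spec m (power src dst free) σ dst (2 ^ σ src)
  power-spec {src} {dst} {free} {σ} s< d< s≢d zeros dst0 le₁ le₂ =
    let σ₁ , e₁ , p₁ , o₁ = spec (Comp-lookup {1} zero) {src ∷ []} {free} {1 + free} {σ} {σ src} {m}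
          (record { args<free = λ { zero → s< ≤∙ n≤1+n free } ; out<free = ≤-refl ; args≢out = λ { zero → <⇒≢ s< }
                  ; free≡0 = λ j le → zeros j (n≤1+n free ≤∙ le) ; out≡0 = zeros free ≤-refl })
          (λ { zero → ≤-refl }) le₁
        σ₂ = σ₁ [ dst ≔ suc (σ₁ dst) ]
        dst1 : σ₁ dst ≡ 0
        dst1 = o₁ dst (<⇒≢ d<) ∙ dst0
        above : ∀ i → σ₂ (suc i + free) ≡ 0
        above i = ≔-other σ₁ _ (>⇒≢ (d< ≤∙ m≤n+m free (suc i))) ∙ o₁ _ (>⇒≢ (s≤s (m≤n+m free i))) ∙ zeros _ (m≤n+m free (suc i))
        σ₃ , e₃ , p₃ , q₃ , o₃ = power-loop {dst} {free} (σ src) {σ₂} 1 d< (≔-other σ₁ _ (>⇒≢ d<) ∙ p₁)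
          (≔-same σ₁ dst _ ∙ cong suc dst1) (above 0) (above 1) (+-identityʳ _ ≡∙≤ le₂)
    in σ₃ , (e₁ ⨾ inc-≔ dst (cong suc dst1 ≡∙≤ m^n>0 2 (σ src) ≤∙ le₂) ⨾ e₃) , q₃ ∙ +-identityʳ _ ,
       λ j ne → others σ₁ σ₃ p₃ o₁ (λ j a b → o₃ j a b ∙ ≔-other σ₁ _ b) j ne
    where
    others : ∀ σ₁ σ₃ → σ₃ free ≡ 0 → (∀ j → j ≢ free → σ₁ j ≡ σ j) → (∀ j → j ≢ free → j ≢ dst → σ₃ j ≡ σ₁ j) → ∀ j → j ≢ dst → σ₃ j ≡ σ j
    others σ₁ σ₃ p₃ o₁ o₃ j ne with j ≟ free
    ... | yes refl = p₃ ∙ sym (zeros j ≤-refl)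
    ... | no a     = o₃ j a ne ∙ o₁ j a

exponentᶜ : ℕ → ℕ
exponentᶜ x = exponent (lengthᵈ x / 3)

Comp-exponent : Comp {1} (λ ρ → exponentᶜ (lookup ρ zero))
Comp-exponent = Comp-* (Comp-suc (Comp-+ n (Comp-+ n n))) (Comp-suc (Comp-* (Comp-suc n) (Comp-suc (Comp-+ n n))))
  where
  n : Comp {1} (λ ρ → lengthᵈ (lookup ρ zero) / 3)
  n = Comp-/ (Comp-lengthᵈ v₀) (Comp-const 2)

Comp-level : Comp {1} (λ ρ → 4 + 2 * lookup ρ zero)
Comp-level = Comp-+ (Comp-const 4) (Comp-* (Comp-const 2) v₀)

Comp-stack-size : Comp {1} (λ ρ → (3 + lookup ρ zero) * (9 + 5 * lookup ρ zero))
Comp-stack-size = Comp-* (Comp-+ (Comp-const 3) v₀) (Comp-+ (Comp-const 9) (Comp-* (Comp-const 5) v₀))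

-- Register 0 contains the input x, and 1, …, 8 receive e, E = 2 ^ e, 4 + 2 e, F, Q, the exponent of B, B and the answer.
stage : ∀ {k} {f : Vec ℕ k → ℕ} → Comp f → Vec (Fin 9) k → Fin 9 → NProg
stage c args i = prog c (Vec.map Fin.toℕ args) (Fin.toℕ i) 9

decider : ∀ {f : Vec ℕ 5 → ℕ} → Comp f → NProg
decider C =
  stage Comp-exponent (# 0 ∷ []) (# 1) ⨾ power 1 2 9 ⨾ stage Comp-level (# 1 ∷ []) (# 3) ⨾ power 3 4 9 ⨾ power 4 5 9 ⨾
  stage Comp-stack-size (# 4 ∷ []) (# 6) ⨾ power 6 7 9 ⨾ stage C (# 0 ∷ # 2 ∷ # 4 ∷ # 5 ∷ # 7 ∷ []) (# 8) ⨾
  loop 0 (dec 0) ⨾ loop 8 (dec 8 ⨾ inc 0)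

common-bound : ∀ a b c d → ∃[ D ] 1 ≤ D × a ≤ D × b ≤ D × c ≤ D × d ≤ D
common-bound a b c d = suc (a + (b + (c + d))) , s≤s z≤n ,
  m≤m+n a _ ≤∙ n≤1+n _ ,
  m≤m+n b _ ≤∙ m≤n+m _ a ≤∙ n≤1+n _ ,
  m≤m+n c d ≤∙ m≤n+m _ b ≤∙ m≤n+m _ a ≤∙ n≤1+n _ ,
  m≤n+m d c ≤∙ m≤n+m _ b ≤∙ m≤n+m _ a ≤∙ n≤1+n _

value-upper : ∀ w → 2 + value w ≤ 2 ^ suc (length w)
value-upper []          = ≤-refl
value-upper (false ∷ w) = n≤1+n _ ≤∙ twice (value w) ≡∙≤ *-monoʳ-≤ 2 (value-upper w)
  where
  twice : ∀ x → suc (2 + suc (2 * x)) ≡ 2 * (2 + x)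
  twice = solve-∀
value-upper (true ∷ w)  = twice (value w) ≡∙≤ *-monoʳ-≤ 2 (value-upper w)
  where
  twice : ∀ x → 2 + suc (suc (2 * x)) ≡ 2 * (2 + x)
  twice = solve-∀

all-lookup : ∀ {A : Set} {P : A → Set} {n} {xs : Vec A n} → AllV.All P xs → ∀ i → P (lookup xs i)
all-lookup (p ∷ ps) zero    = p
all-lookup (p ∷ ps) (suc i) = all-lookup ps i

-- The values computed by the decider, with all relations between them that matter for its space.
record Values (w : List Bool) (degree n e E r F Q β B m : ℕ) : Set where
  field
    n≡ : n ≡ lengthᵈ (value w) / 3
    e≡ : e ≡ exponent n
    E≡ : E ≡ 2 ^ e
    r≡ : r ≡ 4 + 2 * e
    F≡ : F ≡ 2 ^ r
    Q≡ : Q ≡ 2 ^ F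
    β≡ : β ≡ (3 + F) * (9 + 5 * F)
    B≡ : B ≡ 2 ^ β
    m≡ : m ≡ (2 + B) ^ degree

-- The input and all parameters are at most `B`, so `(2 + B) ^ degree` bounds the values of all
-- stages at once.
module Execution {w degree n e E r F Q β B m} (V : Values w degree n e E r F Q β B m) (one≤degree : 1 ≤ degree) where

  open Values V

  x : ℕ
  x = value w

  B≤m : ∀ d → d ≤ degree → (2 + B) ^ d ≤ m
  B≤m d le = ^-monoʳ-≤ (2 + B) le ≤∙≡ sym m≡

  F≤β : F ≤ β
  F≤β = m≤n+m F 3 ≤∙ m≤m*n (3 + F) (9 + 5 * F) ≤∙≡ sym β≡

  β≤B : β ≤ B
  β≤B = n≤2^n β ≤∙≡ sym B≡

  r≤F : r ≤ F
  r≤F = n≤2^n r ≤∙≡ sym F≡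

  e≤r : e ≤ r
  e≤r = m≤m+n e (e + 0) ≤∙ m≤n+m (2 * e) 4 ≤∙≡ sym r≡

  E≤F : E ≤ F
  E≤F = E≡ ≡∙≤ 2^-mono e≤r ≤∙≡ sym F≡

  F≤B : F ≤ B
  F≤B = F≤β ≤∙ β≤B

  Q≤B : Q ≤ B
  Q≤B = Q≡ ≡∙≤ 2^-mono F≤β ≤∙≡ sym B≡

  length≡ : lengthᵈ x ≡ length w
  length≡ = lengthᵈ-value w

  -- The input need not be a code, so its length is known only up to the remainder; still, its value
  -- `x` has to be at most `B`.
  length<3n+3 : length w < 3 + 3 * n
  length<3n+3 = begin-strict
    length w ≡⟨ m≡m%n+[m/n]*n (length w) 3 ⟩
    length w % 3 + length w / 3 * 3 <⟨ +-monoˡ-< (length w / 3 * 3) (m%n<n (length w) 3) ⟩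
    3 + length w / 3 * 3 ≡⟨ cong (3 +_) (*-comm (length w / 3) 3 ∙ cong (λ l → 3 * (l / 3)) (sym length≡)) ⟩
    3 + 3 * (lengthᵈ x / 3) ≡⟨ cong (λ l → 3 + 3 * l) (sym n≡) ⟩
    3 + 3 * n ∎
    where open ≤-Reasoning

  length≤β : suc (length w) ≤ β
  length≤β = length<3n+3 ≤∙ cong (3 +_) (three n) ≡∙≤ +-monoʳ-≤ 3 (n≤1+n _ ≤∙ m≤m*n (suc (n + (n + n))) (suc (blockCount n)) ≤∙≡ sym e≡) ≤∙
      +-monoʳ-≤ 3 (e≤r ≤∙ r≤F) ≤∙ m≤m*n (3 + F) (9 + 5 * F) ≤∙≡ sym β≡
    where
    three : ∀ n → 3 * n ≡ n + (n + n)
    three = solve-∀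

  x≤B : x ≤ B
  x≤B = m≤n+m x 2 ≤∙ value-upper w ≤∙ 2^-mono length≤β ≤∙≡ sym B≡

  pow≤m : ∀ {a} → a ≤ B → (2 + a) ^ 1 ≤ m
  pow≤m le = ^-monoˡ-≤ 1 (+-monoʳ-≤ 2 le) ≤∙ B≤m 1 one≤degree

  to-m : ∀ {a} → a ≤ B → a ≤ m
  to-m le = le ≤∙ m≤n+m B 2 ≤∙ sym (*-identityʳ (2 + B)) ≡∙≤ B≤m 1 one≤degree

  -- The registers, as a list of the values of 0, …, 8; all others are 0.
  infix 4 _∼_
  record _∼_ (σ : Regs) (v : Vec ℕ 9) : Set where
    constructor _,_
    field
      low  : ∀ i → σ (Fin.toℕ i) ≡ lookup v i
      high : ∀ j → 9 ≤ j → σ j ≡ 0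

  assign : ∀ {σ P v y} (i : Fin 9) → σ ∼ v → Spec m P σ (Fin.toℕ i) y → ∃[ σ' ] NExec m P σ σ' × σ' ∼ (v Vec.[ i ]≔ y)
  assign {σ} {P} {v} {y} i (eq , z) (σ' , ex , p , o) = σ' , ex , (updated-values , λ j le → o j (>⇒≢ (toℕ<n i ≤∙ le)) ∙ z j le)
    where
    updated-values : ∀ j → σ' (Fin.toℕ j) ≡ lookup (v Vec.[ i ]≔ y) j
    updated-values j with j Fin.≟ i
    ... | yes refl = p ∙ sym (lookup∘update i v y)
    ... | no ne    = o _ (ne ∘ toℕ-injective) ∙ eq j ∙ sym (lookup∘update′ ne v y)

  compute : ∀ {k f} (c : Comp {k} f) {σ v} (args : Vec (Fin 9) k) (i : Fin 9) → σ ∼ v → deg c ≤ degree →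
            {_ : True (AllV.all? (λ a → ¬? (a Fin.≟ i)) args)} → lookup v i ≡ 0 → AllV.All (λ a → lookup v a ≤ B) args →
            Spec m (stage c args i) σ (Fin.toℕ i) (f (Vec.map (lookup v) args))
  compute {k} {f} c {σ} {v} args i (eq , z) d≤ {ne} v0 le =
    subst (λ y → Spec m _ σ (Fin.toℕ i) (f y)) same-args
      (spec c {Vec.map Fin.toℕ args} {Fin.toℕ i} {9} {σ} {B} {m}
        (record { args<free = λ a → subst (_< 9) (sym (lookup-map a Fin.toℕ args)) (toℕ<n (lookup args a)) ; out<free = toℕ<n i
                ; args≢out = λ a q → all-lookup (toWitness ne) a (toℕ-injective (sym (lookup-map a Fin.toℕ args) ∙ q)) ; free≡0 = z ; out≡0 = eq i ∙ v0 })
        (λ a → cong σ (lookup-map a Fin.toℕ args) ∙ eq (lookup args a) ≡∙≤ all-lookup le a) (B≤m (deg c) d≤))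
    where
    same-args : Vec.map σ (Vec.map Fin.toℕ args) ≡ Vec.map (lookup v) args
    same-args = go args
      where
      go : ∀ {l} (as : Vec (Fin 9) l) → Vec.map σ (Vec.map Fin.toℕ as) ≡ Vec.map (lookup v) as
      go []       = refl
      go (a ∷ as) = cong₂ _∷_ (eq a) (go as)

  exponentiate : ∀ {σ v} (s i : Fin 9) → σ ∼ v → {_ : True (¬? (s Fin.≟ i))} → lookup v i ≡ 0 → lookup v s ≤ B → 2 ^ lookup v s ≤ B →
                 Spec m (power (Fin.toℕ s) (Fin.toℕ i) 9) σ (Fin.toℕ i) (2 ^ lookup v s)
  exponentiate {σ} {v} s i (eq , z) {ne} v0 le le' = subst (λ y → Spec m _ σ (Fin.toℕ i) (2 ^ y)) (eq s)
    (power-spec {m} (toℕ<n s) (toℕ<n i) (toWitness ne ∘ toℕ-injective) z (eq i ∙ v0)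
      (cong (λ y → (2 + y) ^ 1) (eq s) ≡∙≤ pow≤m le) (cong (2 ^_) (eq s) ≡∙≤ to-m le'))

  andThen : ∀ {σ v P R y} {Post : Regs → Set} (i : Fin 9) → σ ∼ v → Spec m P σ (Fin.toℕ i) y →
            (∀ {σ'} → σ' ∼ (v Vec.[ i ]≔ y) → ∃[ σ'' ] NExec m R σ' σ'' × Post σ'') → ∃[ σ'' ] NExec m (P ⨾ R) σ σ'' × Post σ''
  andThen i s S k =
    let σ' , ex , s' = assign i s S
        σ'' , ex' , post = k s'
    in σ'' , ex ⨾ ex' , post

  8≢0 : 8 ≢ 0
  8≢0 ()

  initialRegs : Regs
  initialRegs zero    = x
  initialRegs (suc _) = 0

  start : initialRegs ∼ (x ∷ 0 ∷ 0 ∷ 0 ∷ 0 ∷ 0 ∷ 0 ∷ 0 ∷ 0 ∷ [])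
  start = (λ { zero → refl ; (suc zero) → refl ; (suc (suc zero)) → refl ; (suc (suc (suc zero))) → refl ; (suc (suc (suc (suc zero)))) → refl
             ; (suc (suc (suc (suc (suc zero))))) → refl ; (suc (suc (suc (suc (suc (suc zero)))))) → refl
             ; (suc (suc (suc (suc (suc (suc (suc zero))))))) → refl ; (suc (suc (suc (suc (suc (suc (suc (suc zero)))))))) → refl }) ,
          λ { (suc j) _ → refl }

  module _ {f : Vec ℕ 5 → ℕ} (C : Comp f) (degree₁ : deg Comp-exponent ≤ degree) (degree₂ : deg Comp-level ≤ degree)
           (degree₃ : deg Comp-stack-size ≤ degree) (degree₄ : deg C ≤ degree) (f≤1 : ∀ ρ → f ρ ≤ 1) where

    answer : ℕ
    answer = f (x ∷ E ∷ F ∷ Q ∷ B ∷ [])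

    stages : ∃[ σ' ] NExec m (decider C) initialRegs σ' × σ' 0 ≡ answer
    stages =
      andThen (# 1) start (subst (Spec m (stage Comp-exponent (# 0 ∷ []) (# 1)) initialRegs 1) (cong exponent (sym n≡) ∙ sym e≡)
        (compute Comp-exponent (# 0 ∷ []) (# 1) start degree₁ refl (x≤B ∷ []))) λ {σ₁} v₁ →
      andThen (# 2) v₁ (subst (Spec m (power 1 2 9) σ₁ 2) (sym E≡) (exponentiate (# 1) (# 2) v₁ refl e≤B (sym E≡ ≡∙≤ E≤B))) λ {σ₂} v₂ →
      andThen (# 3) v₂ (subst (Spec m (stage Comp-level (# 1 ∷ []) (# 3)) σ₂ 3) (sym r≡)
        (compute Comp-level (# 1 ∷ []) (# 3) v₂ degree₂ refl (e≤B ∷ []))) λ {σ₃} v₃ →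
      andThen (# 4) v₃ (subst (Spec m (power 3 4 9) σ₃ 4) (sym F≡) (exponentiate (# 3) (# 4) v₃ refl r≤B (sym F≡ ≡∙≤ F≤B))) λ {σ₄} v₄ →
      andThen (# 5) v₄ (subst (Spec m (power 4 5 9) σ₄ 5) (sym Q≡) (exponentiate (# 4) (# 5) v₄ refl F≤B (sym Q≡ ≡∙≤ Q≤B))) λ {σ₅} v₅ →
      andThen (# 6) v₅ (subst (Spec m (stage Comp-stack-size (# 4 ∷ []) (# 6)) σ₅ 6) (sym β≡)
        (compute Comp-stack-size (# 4 ∷ []) (# 6) v₅ degree₃ refl (F≤B ∷ []))) λ {σ₆} v₆ →
      andThen (# 7) v₆ (subst (Spec m (power 6 7 9) σ₆ 7) (sym B≡) (exponentiate (# 6) (# 7) v₆ refl β≤B (≤-reflexive (sym B≡)))) λ {σ₇} v₇ →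
      andThen (# 8) v₇ (compute C (# 0 ∷ # 2 ∷ # 4 ∷ # 5 ∷ # 7 ∷ []) (# 8) v₇ degree₄
        refl (x≤B ∷ E≤B ∷ F≤B ∷ Q≤B ∷ ≤-refl ∷ []))
        λ {σ₈} v₈ → finish σ₈ (_∼_.low v₈ (# 8))
      where
      r≤B : r ≤ B
      r≤B = r≤F ≤∙ F≤B
      e≤B : e ≤ B
      e≤B = e≤r ≤∙ r≤B
      E≤B : E ≤ B
      E≤B = E≤F ≤∙ F≤B
      answer≤m : answer ≤ m
      answer≤m = f≤1 (x ∷ E ∷ F ∷ Q ∷ B ∷ []) ≤∙ to-m (m^n>0 2 β ≤∙≡ sym B≡)
      finish : ∀ σ → σ 8 ≡ answer → ∃[ σ' ] NExec m (loop 0 (dec 0) ⨾ loop 8 (dec 8 ⨾ inc 0)) σ σ' × σ' 0 ≡ answer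
      finish σ eq =
        let s₉ , x₉ , z₉ , o₉ = clear {m} 0 (σ 0) {σ} refl
            s₁₀ , x₁₀ , _ , q₁₀ , _ = drain {m} 8 0 8≢0 answer {s₉} (o₉ 8 8≢0 ∙ eq) (cong (_+ answer) z₉ ≡∙≤ answer≤m)
        in s₁₀ , (x₉ ⨾ x₁₀) , q₁₀ ∙ cong (_+ answer) z₉

nʷ eʷ rʷ Fʷ βʷ : List Bool → ℕ
nʷ w = lengthᵈ (value w) / 3
eʷ w = exponent (nʷ w)
rʷ w = 4 + 2 * eʷ w
Fʷ w = 2 ^ rʷ w
βʷ w = (3 + Fʷ w) * (9 + 5 * Fʷ w)

arguments : List Bool → Vec ℕ 5
arguments w = value w ∷ 2 ^ eʷ w ∷ Fʷ w ∷ 2 ^ Fʷ w ∷ 2 ^ βʷ w ∷ []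

values : ∀ D w → Values w D (nʷ w) (eʷ w) (2 ^ eʷ w) (rʷ w) (Fʷ w) (2 ^ Fʷ w) (βʷ w) (2 ^ βʷ w) ((2 + 2 ^ βʷ w) ^ D)
values D w = record { n≡ = refl ; e≡ = refl ; E≡ = refl ; r≡ = refl ; F≡ = refl ; Q≡ = refl ; β≡ = refl ; B≡ = refl ; m≡ = refl }

module Space {w degree n e E r F Q β B m} (V : Values w degree n e E r F Q β B m) (one≤degree : 1 ≤ degree) where

  open Values V
  open Execution V one≤degree

  -- The exponent of a power of two above `m`, with one to spare: numerals of values up to `m` have
  -- no more digits. Since `β` is quadratic in `F = 2 ^ r` and `r` is polynomial in `n`, doubly
  -- exponential values take exponential space.
  S : ℕ
  S = suc ((2 + β) * degree)

  2+B≤ : 2 + B ≤ 2 ^ (2 + β)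
  2+B≤ = +-mono-≤ (*-monoʳ-≤ 2 (m^n>0 2 β ≤∙≡ sym B≡)) (m≤m+n B B) ≤∙≡ arith B ∙ cong (λ x → 2 * (2 * x)) B≡
    where
    arith : ∀ B → 2 * B + (B + B) ≡ 2 * (2 * B)
    arith = solve-∀

  m≤ : m ≤ 2 ^ ((2 + β) * degree)
  m≤ = m≡ ≡∙≤ ^-monoˡ-≤ degree 2+B≤ ≤∙≡ ^-*-assoc 2 (2 + β) degree

  2≤m : 2 ≤ m
  2≤m = m≤m+n 2 B ≤∙ sym (*-identityʳ (2 + B)) ≡∙≤ B≤m 1 one≤degree

  fit : suc (suc m) ≤ 2 ^ suc S
  fit = +-monoˡ-≤ m 2≤m ≤∙ cong (m +_) (sym (+-identityʳ m)) ≡∙≤ *-monoʳ-≤ 2 m≤ ≤∙ ^-monoʳ-≤ 2 (n≤1+n S)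

  length≤S : length w ≤ S
  length≤S = n≤1+n _ ≤∙ length≤β ≤∙ m≤n+m β 2 ≤∙ m≤m*n (2 + β) degree {{>-nonZero one≤degree}} ≤∙ n≤1+n _

  1≤F : 1 ≤ F
  1≤F = m^n>0 2 r ≤∙≡ sym F≡

  4+β≤ : 4 + β ≤ 2 ^ (6 + 2 * r)
  4+β≤ = cong (4 +_) β≡ ≡∙≤
      +-mono-≤ (*-monoʳ-≤ 4 (*-mono-≤ 1≤F 1≤F)) (*-mono-≤ (+-monoˡ-≤ F (*-monoʳ-≤ 3 1≤F)) (+-monoˡ-≤ (5 * F) (*-monoʳ-≤ 9 1≤F))) ≤∙
      m≤m+n _ (4 * (F * F)) ≤∙≡ arith F ∙ cong (λ x → 64 * (x * x)) F≡ ∙ cong (2 ^ 6 *_) (sym (^-distribˡ-+-* 2 r r)) ∙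
      sym (^-distribˡ-+-* 2 6 (r + r)) ∙ cong (λ x → 2 ^ (6 + x)) (cong (r +_) (sym (+-identityʳ r)))
    where
    arith : ∀ F → 4 * (F * F) + (3 * F + F) * (9 * F + 5 * F) + 4 * (F * F) ≡ 64 * (F * F)
    arith = solve-∀

  space-bound : ∀ R → R * suc S ≤ 2 ^ (R + (degree + (6 + 2 * r)))
  space-bound R = *-monoʳ-≤ R (+-monoˡ-≤ ((2 + β) * degree) (*-monoʳ-≤ 2 one≤degree) ≤∙≡ sym (*-distribʳ-+ degree 2 (2 + β))) ≤∙
      cong (R *_) (*-comm (4 + β) degree) ≡∙≤ *-mono-≤ (n≤2^n R) (*-mono-≤ (n≤2^n degree) 4+β≤) ≤∙≡
      cong (2 ^ R *_) (sym (^-distribˡ-+-* 2 degree (6 + 2 * r))) ∙ sym (^-distribˡ-+-* 2 R (degree + (6 + 2 * r)))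

  initial-encodes : ∀ M → Encodes M initialRegs (w ∷ Vec.replicate (2 + M) [])
  initial-encodes M = record { regs = λ { zero _ → sym (numeral-value w) ; (suc r) _ → lookup-replicate (suc (clamp M r)) [] } ; scratch-empty = refl }

  initial-below : ∀ r → initialRegs r ≤ m
  initial-below zero    = to-m x≤B
  initial-below (suc _) = z≤n

  nonempty⇔ : ∀ a → T (nonempty (top (numeral a))) ⇔ (a ≢ 0)
  nonempty⇔ zero    = mk⇔ (λ ()) (λ ne → contradiction refl ne)
  nonempty⇔ (suc a) = mk⇔ (λ _ ()) (λ _ → subst T (sym (nonempty-numeral (suc a) (λ ()))) _)

  verdict⇔ : ∀ {M a} (v : Store (3 + M)) → lookup v zero ≡ numeral a → T (nonempty (top (Vec.head v))) ⇔ (a ≢ 0)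
  verdict⇔ {a = a} (s ∷ _) refl = nonempty⇔ a

  decided : ∀ P a → ∃[ σ' ] NExec m P initialRegs σ' × σ' 0 ≡ a →
            (∃[ n ] ∃[ c ] HaltsIn (machine (binary (maxReg P) P)) n w c × (Accepting (machine (binary (maxReg P) P)) c ⇔ (a ≢ 0))) ×
            (∀ n c → Defs.Run (machine (binary (maxReg P) P)) n (initial (machine (binary (maxReg P) P)) w) c →
               space (machine (binary (maxReg P) P)) c ≤ 2 ^ (3 + maxReg P + (degree + (6 + 2 * r))))
  decided P a (σ' , ex , eq) =
    let M = maxReg P
        t , v' , ex' , enc , _ = execute fit {M} (n≤1+n M) initial-below ex (initial-encodes M)
        (k , c , h , accepts) , sp = decides (binary M P) length≤S ex'
    in (k , c , h , accepts ⟨⇔⟩ verdict⇔ v' (Encodes.regs enc 0 z≤n ∙ cong numeral eq)) ,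
       λ k c r → sp k c r ≤∙ space-bound (3 + M)

exponent-mono : ∀ {a b} → a ≤ b → exponent a ≤ exponent b
exponent-mono le = *-mono-≤ (s≤s (+-mono-≤ le (+-mono-≤ le le))) (s≤s (*-mono-≤ (s≤s le) (s≤s (+-mono-≤ le le))))

poly-exponent : PolyBounded exponent
poly-exponent = poly-* (s (poly-+ poly-id (poly-+ poly-id poly-id))) (s (poly-* (s poly-id) (s (poly-+ poly-id poly-id))))
  where
  s : ∀ {f} → PolyBounded f → PolyBounded (λ n → suc (f n))
  s = poly-+ (poly-const 1)

exponent-bound : ∀ R D → PolyBounded (λ l → R + (D + (6 + 2 * (4 + 2 * exponent l))))
exponent-bound R D = poly-+ (poly-const R) (poly-+ (poly-const D) (poly-+ (poly-const 6) (poly-* (poly-const 2) (poly-+ (poly-const 4) (poly-* (poly-const 2) poly-exponent)))))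

in-EXPSPACE : ∀ {L : Language} D (1≤D : 1 ≤ D) (P : NProg) (answer : List Bool → ℕ) →
              (∀ w → ∃[ σ' ] NExec ((2 + 2 ^ βʷ w) ^ D) P (Execution.initialRegs (values D w) 1≤D) σ' × σ' 0 ≡ answer w) →
              (∀ w → (answer w ≢ 0) ⇔ L w) → InEXPSPACE L
in-EXPSPACE D 1≤D P answer runs eq = machine (binary (maxReg P) P) , proj₁ (exponent-bound R D) , λ w →
    let (k , c , h , accepts) , sp = Space.decided (values D w) 1≤D P (answer w) (runs w)
    in (k , c , h , accepts ⟨⇔⟩ eq w) ,
       λ k c r → sp k c r ≤∙ 2^-mono (sum-bound w ≤∙ proj₂ (exponent-bound R D) (length w))
  where
  R : ℕ
  R = 3 + maxReg P
  sum-bound : ∀ w → R + (D + (6 + 2 * rʷ w)) ≤ R + (D + (6 + 2 * (4 + 2 * exponent (length w))))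
  sum-bound w = +-monoʳ-≤ R (+-monoʳ-≤ D (+-monoʳ-≤ 6 (*-monoʳ-≤ 2 (+-monoʳ-≤ 4 (*-monoʳ-≤ 2
    (exponent-mono (m/n≤m (lengthᵈ (value w)) 3 ≤∙≡ lengthᵈ-value w)))))))

Comp-in-EXPSPACE : ∀ {f : Vec ℕ 5 → ℕ} (C : Comp f) {L : Language} → (∀ ρ → f ρ ≤ 1) → (∀ w → (f (arguments w) ≢ 0) ⇔ L w) → InEXPSPACE L
Comp-in-EXPSPACE {f} C f≤1 eq =
  let D , 1≤D , d₁ , d₂ , d₃ , d₄ = common-bound (Comp.deg Comp-exponent) (Comp.deg Comp-level) (Comp.deg Comp-stack-size) (Comp.deg C)
  in in-EXPSPACE D 1≤D (decider C) (f ∘ arguments) (λ w → Execution.stages (values D w) 1≤D C d₁ d₂ d₃ d₄ f≤1) eq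

satF-answer : ∀ {w D n e E r F Q β B m ρ} → Values w D n e E r F Q β B m → ρ ≡ value w ∷ E ∷ F ∷ Q ∷ B ∷ [] → (χ satF ρ ≢ 0) ⇔ ABDhom-SAT w
satF-answer {w} {n = n} {e} {E} {r} {F} {Q} {β} {B} V ρ≡ =
  Correct.answer-correct w n e E F Q B e≡ E≡ (F≡ ∙ cong (2 ^_) r≡) Q≡ (B≡ ∙ cong (2 ^_) β≡) ρ≡
    (λ n' eq → sym (n≡ ∙ cong (_/ 3) (lengthᵈ-value w ∙ eq ∙ *-comm 3 n') ∙ m*n/n≡m n' 3))
  where open Values V

ABDhom-SAT-in-EXPSPACE : InEXPSPACE ABDhom-SAT
ABDhom-SAT-in-EXPSPACE =
  Comp-in-EXPSPACE {χ satF} (Comp-χ satF) (λ ρ → truth-≤1 (χ-correct satF ρ)) λ w → satF-answer {ρ = arguments w} (values 1 w) refl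

-- Binary addresses of tape cells.

isOdd : ℕ → Bool
isOdd zero    = false
isOdd (suc n) = not (isOdd n)

bitOf : ℕ → ℕ → Bool
bitOf x zero    = isOdd x
bitOf x (suc i) = bitOf ⌊ x /2⌋ i

data Halves : ℕ → Set where
  even : ∀ h → Halves (h + h)
  odd  : ∀ h → Halves (suc (h + h))

halves : ∀ x → Halves x
halves zero    = even 0
halves (suc x) with halves x
... | even h = odd h
... | odd h  = subst Halves (cong suc (+-suc h h)) (even (suc h))

isOdd-even : ∀ h → isOdd (h + h) ≡ false
isOdd-even zero    = refl
isOdd-even (suc h) = cong (not ∘ isOdd) (+-suc h h) ∙ cong (not ∘ not) (isOdd-even h)

half-even : ∀ h → ⌊ h + h /2⌋ ≡ h
half-even h = sym (n≡⌊n+n/2⌋ h)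

half-odd : ∀ h → ⌊ suc (h + h) /2⌋ ≡ h
half-odd h = sym (n≡⌈n+n/2⌉ h)

-- Bit `suc i` flips exactly when bit `i` falls from 1 to 0, as in a ripple counter. Only
-- neighbouring bits are compared, so a conjunction over the bits can express it.
bitOf-suc : ∀ x i → bitOf (suc x) (suc i) ≡ bitOf x (suc i) xor (bitOf x i ∧ not (bitOf (suc x) i))
bitOf-suc x i with halves x
bitOf-suc .(h + h) zero | even h rewrite isOdd-even h | half-even h | half-odd h = sym (xor-identityʳ (isOdd h))
bitOf-suc .(suc (h + h)) zero | odd h rewrite isOdd-even h | half-odd h | half-even h with isOdd h
... | true  = refl
... | false = refl
bitOf-suc .(h + h) (suc i) | even h rewrite half-even h | half-odd h | ∧-inverseʳ (bitOf h i) = sym (xor-identityʳ (bitOf h (suc i)))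
bitOf-suc .(suc (h + h)) (suc i) | odd h rewrite half-even h | half-odd h = bitOf-suc h i

Congruent : ℕ → ℕ → ℕ → Set
Congruent K x y = ∀ i → i < K → bitOf x i ≡ bitOf y i

double-< : ∀ {a b} → a + a < b + b → a < b
double-< {a} {b} lt = ≰⇒> λ b≤a → <⇒≱ lt (+-mono-≤ b≤a b≤a)

halve : ∀ {K x y} → Congruent (suc K) x y → Congruent K ⌊ x /2⌋ ⌊ y /2⌋
halve c i i<K = c (suc i) (s≤s i<K)

-- Agreement of the lowest `K` bits is congruence modulo `2 ^ K`.
Congruent-gap : ∀ K {x y} → Congruent K x y → x < y → x + 2 ^ K ≤ y
Congruent-gap zero {x} c lt = +-comm x 1 ≡∙≤ lt
Congruent-gap (suc K) {x} {y} c lt = go (halves x) (halves y) c lt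
  where
  arith : ∀ a b → a + a + 2 * b ≡ (a + b) + (a + b)
  arith = solve-∀
  go : ∀ {x y} → Halves x → Halves y → Congruent (suc K) x y → x < y → x + 2 ^ suc K ≤ y
  go (even a) (even b) c lt = arith a (2 ^ K) ≡∙≤ +-mono-≤ r r
    where
    r = Congruent-gap K (subst₂ (Congruent K) (half-even a) (half-even b) (halve c)) (double-< lt)
  go (odd a) (odd b) c lt = s≤s (arith a (2 ^ K) ≡∙≤ +-mono-≤ r r)
    where
    r = Congruent-gap K (subst₂ (Congruent K) (half-odd a) (half-odd b) (halve c)) (double-< (s≤s⁻¹ lt))
  go (even a) (odd b) c lt = contradiction (sym (isOdd-even a) ∙ c 0 (s≤s z≤n) ∙ cong not (isOdd-even b)) λ ()
  go (odd a) (even b) c lt = contradiction (sym (cong not (isOdd-even a)) ∙ c 0 (s≤s z≤n) ∙ isOdd-even b) λ ()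

-- Adding 2 ^ suc K adds 2 ^ K to the half.
Congruent-+ : ∀ K x → Congruent K (x + 2 ^ K) x
Congruent-+ (suc K) x i i<K with halves x
Congruent-+ (suc K) .(h + h) i i<K | even h = cong (λ y → bitOf y i) (arith h (2 ^ K)) ∙ go i i<K
  where
  arith : ∀ a b → a + a + 2 * b ≡ (a + b) + (a + b)
  arith = solve-∀
  go : Congruent (suc K) ((h + 2 ^ K) + (h + 2 ^ K)) (h + h)
  go zero _ = isOdd-even (h + 2 ^ K) ∙ sym (isOdd-even h)
  go (suc i) lt = subst₂ (λ a b → bitOf a i ≡ bitOf b i) (sym (half-even (h + 2 ^ K))) (sym (half-even h)) (Congruent-+ K h i (s≤s⁻¹ lt))
Congruent-+ (suc K) .(suc (h + h)) i i<K | odd h = cong (λ y → bitOf (suc y) i) (arith h (2 ^ K)) ∙ go i i<K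
  where
  arith : ∀ a b → a + a + 2 * b ≡ (a + b) + (a + b)
  arith = solve-∀
  go : Congruent (suc K) (suc ((h + 2 ^ K) + (h + 2 ^ K))) (suc (h + h))
  go zero _ = cong not (isOdd-even (h + 2 ^ K) ∙ sym (isOdd-even h))
  go (suc i) lt = subst₂ (λ a b → bitOf a i ≡ bitOf b i) (sym (half-odd (h + 2 ^ K))) (sym (half-odd h)) (Congruent-+ K h i (s≤s⁻¹ lt))

-- Allows the end of the sweep to be detected: only the last address has all bits set.
ones-last : ∀ K {x} → (∀ i → i < K → T (bitOf x i)) → x < 2 ^ K → suc x ≡ 2 ^ K
ones-last zero _ (s≤s z≤n) = refl
ones-last (suc K) {x} one lt = go (halves x) one lt
  where
  arith : ∀ a → suc (suc (a + a)) ≡ 2 * suc a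
  arith = solve-∀
  go : ∀ {x} → Halves x → (∀ i → i < suc K → T (bitOf x i)) → x < 2 ^ suc K → suc x ≡ 2 ^ suc K
  go (even h) one lt = ⊥-elim (subst T (isOdd-even h) (one 0 (s≤s z≤n)))
  go (odd h) one lt = arith h ∙ cong (2 *_)
    (ones-last K (λ i i< → subst (λ y → T (bitOf y i)) (half-odd h) (one (suc i) (s≤s i<)))
      (double-< (n≤1+n _ ≤∙ lt ≤∙≡ cong (2 ^ K +_) (+-identityʳ (2 ^ K)))))

last-ones : ∀ K {x} → suc x ≡ 2 ^ K → ∀ i → i < K → T (bitOf x i)
last-ones (suc K) {x} eq = go (halves x) eq
  where
  arith : ∀ a → 2 * suc a ≡ suc (suc (a + a))
  arith = solve-∀
  go : ∀ {x} → Halves x → suc x ≡ 2 ^ suc K → ∀ i → i < suc K → T (bitOf x i)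
  go (even h) eq = contradiction (sym (cong not (isOdd-even h)) ∙ cong isOdd (eq ∙ cong (2 ^ K +_) (+-identityʳ (2 ^ K))) ∙ isOdd-even (2 ^ K)) λ ()
  go (odd h) eq zero _  = subst T (sym (cong not (isOdd-even h))) _
  go (odd h) eq (suc i) lt = subst (λ y → T (bitOf y i)) (sym (half-odd h)) (last-ones K (*-cancelˡ-≡ (suc h) (2 ^ K) 2 (arith h ∙ eq)) i (s≤s⁻¹ lt))

bitOf-0 : ∀ i → bitOf 0 i ≡ false
bitOf-0 zero    = refl
bitOf-0 (suc i) = bitOf-0 i

-- Computation histories and last visits.

shiftHead : Move → ℕ → ℕ
shiftHead left  = pred
shiftHead stay  = id
shiftHead right = suc

cellAt : ∀ {a} → List (Symbol a) → ℕ → Symbol a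
cellAt [] _       = blank
cellAt (s ∷ ss) zero    = s
cellAt (s ∷ ss) (suc k) = cellAt ss k

inputSymbol : ∀ {a} → Maybe Bool → Symbol a
inputSymbol = maybe bit blank

nth-map : ∀ {a} (v : List Bool) k → cellAt (map (bit {a}) v) k ≡ inputSymbol (top (drop k v))
nth-map [] zero    = refl
nth-map [] (suc k) = refl
nth-map (b ∷ v) zero    = refl
nth-map (b ∷ v) (suc k) = nth-map v k

drop-beyond : ∀ (v : List Bool) {k} → length v ≤ k → top (drop k v) ≡ nothing
drop-beyond [] {zero} _        = refl
drop-beyond [] {suc k} _        = refl
drop-beyond (b ∷ v) {suc k} (s≤s le) = drop-beyond v le

-- The symbol in cell y of a tape whose head is in cell x.
data Content {a} : Tape a → ℕ → ℕ → Symbol a → Set where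
  here  : ∀ {ls s rs x} → Content (tape ls s rs) x x s
  west  : ∀ {ls s rs y} k → Content (tape ls s rs) (suc (k + y)) y (cellAt ls k)
  east  : ∀ {ls s rs x y} k → y ≡ suc (k + x) → Content (tape ls s rs) x y (cellAt rs k)

≢-beyond : ∀ k y → y ≢ suc (k + y)
≢-beyond k y eq = <-irrefl eq (s≤s (m≤n+m y k))

Content-head : ∀ {a} {t : Tape a} {x s} → Content t x x s → s ≡ head t
Content-head c = go c refl
  where
  go : ∀ {a} {t : Tape a} {x y s} → Content t x y s → x ≡ y → s ≡ head t
  go here _  = refl
  go (west k) eq = contradiction (sym eq) (≢-beyond k _)
  go (east k eq') eq = contradiction (eq ∙ eq') (≢-beyond k _)

Content-write : ∀ {a} {ls rs : List (Symbol a)} {r x y s} r' → x ≢ y → Content (tape ls r rs) x y s → Content (tape ls r' rs) x y s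
Content-write r' ne here     = contradiction refl ne
Content-write r' ne (west k) = west k
Content-write r' ne (east k eq) = east k eq

Content-move : ∀ {a} m (t : Tape a) {x y s} → 0 < x → Content t x y s → Content (move m t) (shiftHead m x) y s
Content-move left (tape [] r rs) {suc x} _ here           = east 0 refl
Content-move left (tape (l ∷ ls) r rs) {suc x} _ here           = east 0 refl
Content-move left (tape [] r rs) {suc x} _ (west zero)    = here
Content-move left (tape (l ∷ ls) r rs) {suc x} _ (west zero)    = here
Content-move left (tape [] r rs) {suc x} _ (west (suc k)) = west k
Content-move left (tape (l ∷ ls) r rs) {suc x} _ (west (suc k)) = west k
Content-move left (tape [] r rs) {suc x} _ (east k eq)    = east (suc k) (eq ∙ cong suc (+-suc k x))
Content-move left (tape (l ∷ ls) r rs) {suc x} _ (east k eq)    = east (suc k) (eq ∙ cong suc (+-suc k x))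
Content-move stay t _ c = c
Content-move right (tape ls r []) _ here           = west 0
Content-move right (tape ls r (e ∷ rs)) _ here           = west 0
Content-move right (tape ls r []) _ (west k)       = west (suc k)
Content-move right (tape ls r (e ∷ rs)) _ (west k)       = west (suc k)
Content-move right (tape ls r []) _ (east zero refl) = here
Content-move right (tape ls r (e ∷ rs)) _ (east zero refl) = here
Content-move right (tape ls r []) {x} _ (east (suc k) eq) = east k (eq ∙ cong suc (sym (+-suc k x)))
Content-move right (tape ls r (e ∷ rs)) {x} _ (east (suc k) eq) = east k (eq ∙ cong suc (sym (+-suc k x)))

-- The visited cells form an interval that contains the initial cell m.
record Window {a} (m x : ℕ) (t : Tape a) : Set where
  field
    west-end : x ≤ m + length (before t)
    east-end : m ≤ x + length (after t)

open Window

Window-move : ∀ {a} d {m x ls r rs} (s : Symbol a) → 0 < x → Window m x (tape ls r rs) → Window m (shiftHead d x) (act (s , d) (tape ls r rs))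
Window-move left {m} {suc x} {[]} {r} {rs} s _ v = record
  { west-end = n≤1+n x ≤∙ west-end v ; east-end = east-end v ≤∙≡ sym (+-suc x (length rs)) }
Window-move left {m} {suc x} {l ∷ ls} {r} {rs} s _ v = record
  { west-end = s≤s⁻¹ (west-end v ≤∙≡ +-suc m (length ls)) ; east-end = east-end v ≤∙≡ sym (+-suc x (length rs)) }
Window-move stay s _ v = record { west-end = west-end v ; east-end = east-end v }
Window-move right {m} {x} {ls} {r} {[]} s _ v = record
  { west-end = s≤s (west-end v) ≤∙≡ sym (+-suc m (length ls)) ; east-end = east-end v ≤∙ n≤1+n _ }
Window-move right {m} {x} {ls} {r} {e ∷ rs} s _ v = record
  { west-end = s≤s (west-end v) ≤∙≡ sym (+-suc m (length ls)) ; east-end = east-end v ≤∙≡ +-suc x (length rs) }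

snoc : ∀ {𝕄 n c d e} → Run 𝕄 n c d → step 𝕄 d ≡ just e → Run 𝕄 (suc n) c e
snoc done s = s ∷ done
snoc (p ∷ r) s = p ∷ snoc r s

halt-unique : ∀ {𝕄 m n c d e} → Run 𝕄 m c d → step 𝕄 d ≡ nothing → Run 𝕄 n c e → step 𝕄 e ≡ nothing → d ≡ e
halt-unique done h done h' = refl
halt-unique done h (s ∷ r) h' = contradiction (sym h ∙ s) λ ()
halt-unique (s ∷ r) h done h' = contradiction (sym h' ∙ s) λ ()
halt-unique (s ∷ r) h (s' ∷ r') h' with refl ← trans (sym s) s' = halt-unique r h r' h'

cells-≤ : ∀ {a n} (ts : Vec (Tape a) n) j → cells (lookup ts j) ≤ Vec.sum (Vec.map cells ts)
cells-≤ (t ∷ ts) zero    = m≤m+n _ _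
cells-≤ (t ∷ ts) (suc j) = cells-≤ ts j ≤∙ m≤n+m _ _

module Labels (𝕄 : Machine) where

  open Machine 𝕄

  R : ℕ
  R = suc extraTapes

  Label : Set
  Label = Maybe Bool ⊎ (Fin states × Vec (Symbol auxSymbols) R)

  sweepSymbol : Maybe Bool → Fin R → Symbol auxSymbols
  sweepSymbol s zero    = inputSymbol s
  sweepSymbol s (suc _) = blank

  perform : Maybe (Fin states × Vec (Symbol auxSymbols × Move) R) → Fin R → Symbol auxSymbols × Move
  perform nothing j = blank , stay
  perform (just (_ , as)) j = lookup as j

  action : Label → Fin R → Symbol auxSymbols × Move
  action (inj₁ s) j = sweepSymbol s j , right
  action (inj₂ (q , h)) j = perform (δ q h) j

  writes : Label → Fin R → Symbol auxSymbols
  writes l j = proj₁ (action l j)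

  moves : Label → Fin R → Move
  moves l j = proj₂ (action l j)

  simulation : Config 𝕄 → Label
  simulation (q , ts) = inj₂ (q , Vec.map head ts)

  heads : ∀ {n} (ts : Vec (Tape auxSymbols) n) j → lookup (Vec.map head ts) j ≡ head (lookup ts j)
  heads (t ∷ ts) zero    = refl
  heads (t ∷ ts) (suc j) = heads ts j

-- The computation is preceded by a sweep in which all heads move right from cell 0 to cell M and write the input into the cells 0, 1, …; the
-- computation starts in cell M, which is cell 0 if the cells are numbered modulo M.
module Computation (𝕄 : Machine) (w : List Bool) (K S M : ℕ) (M≡2^K : M ≡ 2 ^ K) (M≡S+S : M ≡ S + S) where

  open Machine 𝕄
  open Labels 𝕄 public

  inputs : Fin R → List Bool
  inputs zero    = w
  inputs (suc _) = []

  config : ℕ → Config 𝕄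
  config zero    = initial 𝕄 w
  config (suc s) = fromMaybe (config s) (step 𝕄 (config s))

  label : ℕ → Label
  label t = if t <ᵇ M then inj₁ (top (drop t w)) else simulation (config (t ∸ M))

  position : Fin R → ℕ → ℕ
  position j zero    = 0
  position j (suc t) = shiftHead (moves (label t) j) (position j t)

  label-sweep : ∀ {t} → t < M → label t ≡ inj₁ (top (drop t w))
  label-sweep {t} t<M with t <ᵇ M in eq
  ... | true  = refl
  ... | false = ⊥-elim (subst T eq (<⇒<ᵇ t<M))

  label-simulation : ∀ s → label (M + s) ≡ simulation (config s)
  label-simulation s with (M + s) <ᵇ M in eq
  ... | true  = contradiction (<ᵇ⇒< (M + s) M (subst T (sym eq) _)) (≤⇒≯ (m≤m+n M s))
  ... | false = cong (simulation ∘ config) (m+n∸m≡n M s)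

  position-sweep : ∀ j {t} → t ≤ M → position j t ≡ t
  position-sweep j {zero} _   = refl
  position-sweep j {suc t} t<M = cong (λ l → shiftHead (moves l j) (position j t)) (label-sweep t<M) ∙ cong suc (position-sweep j (<⇒≤ t<M))

  sweep-writes : ∀ {t} → t < M → ∀ j → writes (label t) j ≡ inputSymbol (top (drop t (inputs j)))
  sweep-writes t<M zero    = cong (λ l → writes l zero) (label-sweep t<M)
  sweep-writes {t} t<M (suc j) = cong (λ l → writes l (suc j)) (label-sweep t<M) ∙ cong inputSymbol (sym (drop-beyond [] {t} z≤n))

  Alive : ℕ → Set
  Alive s = ∀ s' → s' < s → step 𝕄 (config s') ≡ just (config (suc s'))

  Alive-pred : ∀ {s} → Alive (suc s) → Alive s
  Alive-pred alive s' lt = alive s' (lt ≤∙ n≤1+n _)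

  Alive-run : ∀ s → Alive s → Run 𝕄 s (initial 𝕄 w) (config s)
  Alive-run zero alive = done
  Alive-run (suc s) alive = snoc (Alive-run s (Alive-pred alive)) (alive s ≤-refl)

  Alive-suc : ∀ {s c} → Alive s → step 𝕄 (config s) ≡ just c → Alive (suc s)
  Alive-suc {s} alive eq s' s'≤s with m≤n⇒m<n∨m≡n (s≤s⁻¹ s'≤s)
  ... | inj₁ lt   = alive s' lt
  ... | inj₂ refl = eq ∙ cong just (sym (cong (fromMaybe (config s)) eq))

  run-config : ∀ {m c s} → Alive s → Run 𝕄 m (config s) c → Alive (s + m) × config (s + m) ≡ c
  run-config {s = s} alive done = subst (λ n → Alive n × config n ≡ config s) (sym (+-identityʳ s)) (alive , refl)
  run-config {suc m} {c} {s} alive (_∷_ {c′ = c'} p r) =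
    subst (λ n → Alive n × config n ≡ c) (sym (+-suc s m))
      (run-config (Alive-suc alive p) (subst (λ d → Run 𝕄 m d c) (sym (cong (fromMaybe (config s)) p)) r))

  tapeAt : Fin R → ℕ → Tape auxSymbols
  tapeAt j s = lookup (proj₂ (config s)) j

  tape-step : ∀ {c c'} → step 𝕄 c ≡ just c' → ∀ j → lookup (proj₂ c') j ≡ act (action (simulation c) j) (lookup (proj₂ c) j)
  tape-step {q , ts} eq j with δ q (Vec.map head ts) | eq
  ... | just (q' , as) | refl = lookup-zipWith act j as ts

  initial-tape : ∀ j → tapeAt j 0 ≡ load (inputs j)
  initial-tape zero    = refl
  initial-tape (suc j) = lookup-replicate j emptyTape

  module Bounded (bounded : ∀ n c → Run 𝕄 n (initial 𝕄 w) c → space 𝕄 c ≤ S) where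

    S<M : 0 < S → S < M
    S<M 0<S = +-monoˡ-≤ S 0<S ≤∙≡ sym M≡S+S

    tape-≤ : ∀ {s} → Alive s → ∀ j → cells (tapeAt j s) ≤ S
    tape-≤ {s} alive j = cells-≤ (proj₂ (config s)) j ≤∙ bounded s _ (Alive-run s alive)

    0<S : 0 < S
    0<S = s≤s z≤n ≤∙ m≤n+m _ (length (before (tapeAt zero 0))) ≤∙ tape-≤ {0} (λ _ ()) zero

    length-w : length w ≤ S
    length-w = go w ≤∙ tape-≤ {0} (λ _ ()) zero
      where
      go : ∀ w → length w ≤ cells (load {auxSymbols} w)
      go []      = z≤n
      go (b ∷ w) = s≤s (≤-reflexive (sym (length-map bit w)))

    -- At most `S` cells of a tape are visited, the initial cell `M` among them, so all lie at a
    -- distance less than `S` from `M`. These are fewer than `2 S = M` cells, whose addresses modulo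
    -- `M` are therefore distinct; cell 0, where `pred` would misrepresent a move to the left, is
    -- not among them.
    record Near (y : ℕ) : Set where
      constructor near
      field
        near-lower : M < y + S
        near-upper : y < M + S

    open Near

    -- The window yields nearness, and nearness keeps the head off cell 0, as the next window
    -- requires; hence the mutual recursion.
    window : ∀ s → Alive s → ∀ j → Window M (position j (M + s)) (tapeAt j s)

    Window-near : ∀ {x} {t : Tape auxSymbols} → cells t ≤ S → Window M x t → Near x
    Window-near {x} {t} le v = near
      (s≤s (Window.east-end v) ≤∙ sym (+-suc x _) ≡∙≤ +-monoʳ-≤ x (m≤n+m _ _ ≤∙ le))
      (s≤s (Window.west-end v) ≤∙ sym (+-suc M _) ≡∙≤ +-monoʳ-≤ M (m<m+n (length (before t)) (s≤s z≤n) ≤∙ refl ≡∙≤ le))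

    position-near : ∀ s → Alive s → ∀ j → Near (position j (M + s))
    position-near s alive j = Window-near (tape-≤ alive j) (window s alive j)

    near-pos : ∀ {y} → Near y → 0 < y
    near-pos {suc y} _ = s≤s z≤n
    near-pos {zero} n = contradiction (near-lower n ≤∙ m≤m+n S S ≤∙≡ sym M≡S+S) (<-irrefl refl)

    position-suc : ∀ s j → position j (M + suc s) ≡ shiftHead (moves (simulation (config s)) j) (position j (M + s))
    position-suc s j = cong (position j) (+-suc M s) ∙ cong (λ l → shiftHead (moves l j) (position j (M + s))) (label-simulation s)

    window zero alive j = subst₂ (Window M) (sym (cong (position j) (+-identityʳ M) ∙ position-sweep j ≤-refl)) (sym (initial-tape j))
      (record { west-end = m≤m+n M _ ; east-end = m≤m+n M _ })
    window (suc s) alive j = subst₂ (Window M) (sym (position-suc s j)) (sym (tape-step (alive s ≤-refl) j))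
      (Window-move (moves (simulation (config s)) j) (writes (simulation (config s)) j) (near-pos (position-near s (Alive-pred alive) j)) (window s (Alive-pred alive) j))

    infix 4 _~_
    _~_ : ℕ → ℕ → Set
    x ~ y = Congruent K x y

    ~-gap : ∀ {x y} → x ~ y → x < y → x + M ≤ y
    ~-gap {x} {y} c lt = subst (λ m → x + m ≤ y) (sym M≡2^K) (Congruent-gap K c lt)

    near-≮ : ∀ {x y} → Near x → Near y → x ~ y → ¬ x < y
    near-≮ {x} {y} nx ny c lt = <-irrefl refl (<-trans (near-lower nx) (subst (x + S <_) (sym M≡S+S) (+-monoˡ-< S x<S)))
      where
      x<S : x < S
      x<S = +-cancelˡ-< M x S (subst (_< M + S) (+-comm x M) (s≤s (~-gap c lt) ≤∙ near-upper ny))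

    near-unique : ∀ {x y} → Near x → Near y → x ~ y → x ≡ y
    near-unique nx ny c = ≤-antisym (≮⇒≥ (near-≮ ny nx (λ i lt → sym (c i lt)))) (≮⇒≥ (near-≮ nx ny c))

    -- Visits are counted by address, as only the lowest `K` bits will be compared. A visit to cell
    -- `y - M` in the sweep thus counts as a visit to `y`.
    record LastVisit (j : Fin R) (t y : ℕ) : Set where
      constructor visit
      field
        time    : ℕ
        earlier : time < t
        same    : position j time ~ y
        last    : ∀ t' → time < t' → t' < t → ¬ position j t' ~ y

    open LastVisit

    last-unique : ∀ {j t y} (v v' : LastVisit j t y) → time v ≡ time v'
    last-unique v v' with <-cmp (time v) (time v')
    ... | tri≈ _ eq _ = eq
    ... | tri< lt _ _ = contradiction (same v') (last v (time v') lt (earlier v'))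
    ... | tri> _ _ gt = contradiction (same v) (last v' (time v) gt (earlier v))

    Memory : Fin R → ℕ → ℕ → Set
    Memory j s y = ∃[ v ] Content (tapeAt j s) (position j (M + s)) y (writes (label (time {j} {M + s} {y} v)) j)

    content-load : ∀ v t → Content (load {auxSymbols} v) M (t + M) (inputSymbol (top (drop t v)))
    content-load [] zero    = here
    content-load [] (suc k) = east k refl
    content-load (b ∷ v) zero    = here
    content-load (b ∷ v) (suc k) = subst (Content _ M (suc k + M)) (nth-map v k) (east k refl)

    content-load-west : ∀ v {y} → y < M → length v ≤ y → Content (load {auxSymbols} v) M y (inputSymbol (top (drop y v)))
    content-load-west v {y} y<M le = subst₂ (λ m s → Content (load v) m y s)
      (sym (+-suc (M ∸ suc y) y) ∙ m∸n+n≡m y<M) (sym (cong inputSymbol (drop-beyond v le))) (go v (M ∸ suc y))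
      where
      go : ∀ v k → Content (load {auxSymbols} v) (suc (k + y)) y blank
      go [] k = west k
      go (b ∷ v) k = west k

    length-inputs : ∀ j → length (inputs j) ≤ S
    length-inputs zero    = length-w
    length-inputs (suc j) = z≤n

    sweep-memory : ∀ j {t y} → t < M → t ~ y → Content (load (inputs j)) M y (inputSymbol (top (drop t (inputs j)))) → Memory j 0 y
    sweep-memory j {t} {y} t<M c e =
      visit t (subst (t <_) (sym (+-identityʳ M)) t<M) (subst (_~ y) (sym (position-sweep j (<⇒≤ t<M))) c)
        (λ t' lt t'< c' → let t'<M = subst (t' <_) (+-identityʳ M) t'< in
          <⇒≱ t'<M (m≤n+m M t ≤∙ ~-gap (λ i i< → c i i< ∙ sym (subst (_~ y) (position-sweep j (<⇒≤ t'<M)) c' i i<)) lt)) ,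
      subst₂ (λ x s → Content (tapeAt j 0) x y s) (sym (cong (position j) (+-identityʳ M) ∙ position-sweep j ≤-refl)) (sym (sweep-writes t<M j))
        (subst (λ τ → Content τ M y (inputSymbol (top (drop t (inputs j))))) (sym (initial-tape j)) e)

    -- The sweep passes every address, so each near cell has a last visit before the computation
    -- starts: a cell `y < M` was passed as itself, beyond the end of the input, and a cell from `M`
    -- on was passed as `y - M` and received its input symbol. Later visits are unambiguous by
    -- `near-unique`.
    memory : ∀ s → Alive s → ∀ j {y} → Near y → Memory j s y
    memory zero alive j {y} ny with y <? M
    ... | yes y<M = sweep-memory j y<M (λ _ _ → refl) (content-load-west (inputs j) y<M (length-inputs j ≤∙
                      (<⇒≤ (+-cancelʳ-< S S y (subst (_< y + S) M≡S+S (near-lower ny))))))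
    ... | no y≮M = subst (Memory j 0) (m∸n+n≡m M≤y) (sweep-memory j {y ∸ M} (+-cancelʳ-< M (y ∸ M) S
                      (subst₂ _<_ (sym (m∸n+n≡m M≤y)) (+-comm M S) (near-upper ny)) ≤∙ (<⇒≤ (S<M 0<S)))
                      (λ i lt → sym (subst (λ m → Congruent K (y ∸ M + m) (y ∸ M)) (sym M≡2^K) (Congruent-+ K (y ∸ M)) i lt)) (content-load (inputs j) (y ∸ M)))
      where
      M≤y : M ≤ y
      M≤y = ≮⇒≥ y≮M
    memory (suc s) alive j {y} ny = go (x ≟ y) (memory s alive' j ny)
      where
      alive' : Alive s
      alive' = Alive-pred alive
      x : ℕ
      x = position j (M + s)
      l : Label
      l = simulation (config s)
      pos-x : 0 < x
      pos-x = near-pos (position-near s alive' j)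
      transport : ∀ {r} → Content (act (action l j) (tapeAt j s)) (shiftHead (moves l j) x) y r → Content (tapeAt j (suc s)) (position j (M + suc s)) y r
      transport {r} = subst₂ (λ τ p → Content τ p y r) (sym (tape-step (alive s ≤-refl) j)) (sym (position-suc s j))
      go : Dec (x ≡ y) → Memory j s y → Memory j (suc s) y
      go (yes refl) _ =
        visit (M + s) (≤-reflexive (sym (+-suc M s))) (λ _ _ → refl) (λ t' lt t'< → contradiction lt (≤⇒≯ (s≤s⁻¹ (t'< ≤∙≡ +-suc M s)))) ,
        transport (subst (λ l' → Content (act (action l j) (tapeAt j s)) (shiftHead (moves l j) x) x (writes l' j)) (sym (label-simulation s)) (Content-move (moves l j) _ pos-x here))
      go (no x≢y) (v , c) =
        visit (time v) (earlier v ≤∙ +-monoʳ-≤ M (n≤1+n s)) (same v)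
          (λ t' lt t'< c' → case m≤n⇒m<n∨m≡n (s≤s⁻¹ (t'< ≤∙≡ +-suc M s)) of λ
            { (inj₁ t'<') → last v t' lt t'<' c' ; (inj₂ refl) → x≢y (near-unique (position-near s alive' j) ny c') }) ,
        transport (Content-move (moves l j) _ pos-x (Content-write {ls = before (tapeAt j s)} {after (tapeAt j s)} (writes l j) x≢y c))

    memory-reads : ∀ s → Alive s → ∀ j → ∃[ v ] writes (label (time {j} {M + s} {position j (M + s)} v)) j ≡ head (tapeAt j s)
    memory-reads s alive j = map₂ Content-head (memory s alive j (position-near s alive j))

-- Formula schemes and their meaning.

iterate₁ : ℕ → ℕᵇ → ℕᵇ
iterate₁ zero b = b
iterate₁ (suc n) b = 1+[2 iterate₁ n b ]

-- Bit i of the position of head j, and label number l, are coded by the letters 1ⁱ21ʲ and 221ˡ in bijective binary.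
bitCode : ℕ → ℕ → ℕᵇ
bitCode j i = iterate₁ i 2[1+ iterate₁ j zero ]

labelCode : ℕ → ℕᵇ
labelCode l = 2[1+ 2[1+ iterate₁ l zero ] ]

bitLetter : ℕ → ℕ → Letter
bitLetter j i = toℕ (bitCode j i)

labelLetter : ℕ → Letter
labelLetter = toℕ ∘ labelCode

countOnes : ℕᵇ → ℕ
countOnes 1+[2 b ] = suc (countOnes b)
countOnes _        = 0

countOnes-iterate₁ : ∀ n → countOnes (iterate₁ n zero) ≡ n
countOnes-iterate₁ zero    = refl
countOnes-iterate₁ (suc n) = cong suc (countOnes-iterate₁ n)

-- Formula schemes with a parameter K and, if the index is true, a variable k < K.
data Scheme : Bool → Set where
  letterˢ : ∀ {b} → ℕᵇ → Scheme b
  bitˢ    : (j s : ℕ) → Scheme true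
  ¬ˢ_     : ∀ {b} → Scheme b → Scheme b
  _∨ˢ_    : ∀ {b} → Scheme b → Scheme b → Scheme b
  Aˢ_ Bˢ_ : ∀ {b} → Scheme b → Scheme b
  allˢ    : Scheme true → Scheme false

infixr 25 ¬ˢ_ Aˢ_ Bˢ_
infixr 20 _∨ˢ_

⊤ᶠ : Formula
⊤ᶠ = ` 0 ∨′ ¬′ ` 0

allᶠ : (ℕ → Formula) → ℕ → Formula
allᶠ φ zero    = ⊤ᶠ
allᶠ φ (suc k) = ¬′ (¬′ φ k ∨′ ¬′ allᶠ φ k)

-- A conjunction: the letter condition holds here, and `⟨A⟩` leads over an interval of length 1 to
-- the rest. Both `φ` and `ψ` enter negated, as `inputˢ` and `stepˢ`.
linkᶠ : (Bool → Formula) → Formula → Bool → Formula → Formula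
linkᶠ φ ψ b χ' = ¬′ (φ b ∨′ ¬′ ⟨A⟩ ¬′ (ψ ∨′ ¬′ χ'))

chainᶠ : (Bool → Formula) → Formula → Formula → List Bool → Formula
chainᶠ φ ψ ξ []      = ξ
chainᶠ φ ψ ξ (b ∷ w) = linkᶠ φ ψ b (chainᶠ φ ψ ξ w)

module _ (K : ℕ) where

  formulaOf : ∀ {b} → ℕ → Scheme b → Formula
  formulaOf k (letterˢ c)    = ` toℕ c
  formulaOf k (bitˢ j s)     = ` bitLetter j (k + s)
  formulaOf k (¬ˢ e)         = ¬′ formulaOf k e
  formulaOf k (e ∨ˢ f)       = formulaOf k e ∨′ formulaOf k f
  formulaOf k (Aˢ e)         = ⟨A⟩ formulaOf k e
  formulaOf k (Bˢ e)         = ⟨B⟩ formulaOf k e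
  formulaOf k (allˢ e)       = allᶠ (λ i → formulaOf i e) K

framedᶠ : ℕ → (Bool → Scheme false) → (f g h : Scheme false) → List Bool → Formula
framedᶠ K e f g h w = ¬′ (¬′ ⟨B⟩ ¬′ (⟨B⟩ ⊤ᶠ ∨′ ¬′ chainᶠ (λ b → formulaOf K 0 (e b)) (formulaOf K 0 f) (formulaOf K 0 g) w) ∨′ ¬′ formulaOf K 0 h)

⊤ˢ properˢ : ∀ {b} → Scheme b
⊤ˢ      = letterˢ zero ∨ˢ ¬ˢ letterˢ zero
properˢ = Bˢ ⊤ˢ

infixr 15 _∧ˢ_
_∧ˢ_ : ∀ {b} → Scheme b → Scheme b → Scheme b
e ∧ˢ f = ¬ˢ (¬ˢ e ∨ˢ ¬ˢ f)

data Side : Set where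
  leftEnd rightEnd : Side

-- Boolean combinations of statements about the letters at the two ends of an interval.
data Expr : Bool → Set where
  properᵉ : ∀ {b} → Expr b
  letterᵉ : ∀ {b} → Side → ℕᵇ → Expr b
  bitᵉ    : Side → (j s : ℕ) → Expr true
  ¬ᵉ_     : ∀ {b} → Expr b → Expr b
  _∨ᵉ_    : ∀ {b} → Expr b → Expr b → Expr b
  allᵉ    : Expr true → Expr false

infixr 25 ¬ᵉ_
infixr 20 _∨ᵉ_

-- The point interval reached by `⟨B⟩` is the left end, the one reached by `⟨A⟩` the right end.
-- Since `⟨B⟩` is strict, the left version fails on point intervals, which explains the conjunct
-- `proper` in `endValue`.
atEnd : ∀ {b} → Side → Scheme b → Scheme b
atEnd leftEnd e = Bˢ ¬ˢ (properˢ ∨ˢ ¬ˢ e)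
atEnd rightEnd e = Aˢ ¬ˢ (properˢ ∨ˢ ¬ˢ e)

scheme : ∀ {b} → Expr b → Scheme b
scheme properᵉ       = properˢ
scheme (letterᵉ z c) = atEnd z (letterˢ c)
scheme (bitᵉ z j s)  = atEnd z (bitˢ j s)
scheme (¬ᵉ e)        = ¬ˢ scheme e
scheme (e ∨ᵉ f)      = scheme e ∨ˢ scheme f
scheme (allᵉ e)      = allˢ (scheme e)

-- From the whole model, `⟨B⟩` followed by `⟨A⟩` reaches every interval that does not start at the
-- last point. Requiring `e` but not `⟨B⟩ e` selects the shortest such interval for each left end;
-- if `e` says that both ends have the same address, these are the pairs of consecutive visits.
ruleˢ : Expr false → Expr false → Scheme false
ruleˢ e c = ¬ˢ Bˢ Aˢ ¬ˢ (¬ˢ scheme e ∨ˢ Bˢ scheme e ∨ˢ scheme c)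

-- The negation says that the interval has length 1.
stepˢ : Scheme false
stepˢ = ¬ˢ properˢ ∨ˢ Bˢ properˢ

conjunction : (ℕ → Bool) → ℕ → Bool
conjunction f zero    = true
conjunction f (suc k) = not (not (f k) ∨ not (conjunction f k))

-- An expression depends only on the letters at both ends and on whether the interval is proper, so
-- it reduces to a Boolean function of these data.
module Evaluation (K : ℕ) (proper : Bool) (l r : Letter → Bool) where

  endValue : Side → Letter → Bool
  endValue leftEnd p = proper ∧ l p
  endValue rightEnd p = r p

  value' : ∀ {b} → ℕ → Expr b → Bool
  value' k properᵉ       = proper
  value' k (letterᵉ z c) = endValue z (toℕ c)
  value' k (bitᵉ z j s)  = endValue z (bitLetter j (k + s))
  value' k (¬ᵉ e)        = not (value' k e)
  value' k (e ∨ᵉ f)      = value' k e ∨ value' k f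
  value' k (allᵉ e)      = conjunction (λ i → value' i e) K

not-T : ∀ {P : Set} x → P ⇔ T x → (¬ P) ⇔ T (not x)
not-T true e = mk⇔ (λ np → np (from e tt)) ⊥-elim
not-T false e = mk⇔ (λ _ → tt) (λ _ → to e)

or-T : ∀ {P Q : Set} x y → P ⇔ T x → Q ⇔ T y → (P ⊎ Q) ⇔ T (x ∨ y)
or-T x y e f = ⊎-⇔ e f ⟨⇔⟩ ⇔-flip (T-∨ {x} {y})

T-stable : ∀ x → ¬ ¬ T x → T x
T-stable true _ = tt
T-stable false h = ⊥-elim (h id)

Chain : (Bool → ℕ → Set) → (ℕ → Set) → ℕ → List Bool → Set
Chain P Q i []      = Q i
Chain P Q i (b ∷ v) = P b i × ∃[ i' ] i ≡ suc i' × Chain P Q i' v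

module Semantics' (u : ℕ → Letter → Bool) (K : ℕ) where

  ⊤ᶠ-holds : ∀ a i → sat u ⊤ᶠ a i
  ⊤ᶠ-holds a i with sat? u (` 0) a i
  ... | yes p = inj₁ p
  ... | no np = inj₂ np

  proper⇔ : ∀ a i → sat u (⟨B⟩ ⊤ᶠ) a i ⇔ i < a
  proper⇔ a i = mk⇔ (λ { (i' , i'≤a , i<i' , _) → i<i' ≤∙ s≤s⁻¹ i'≤a }) (λ lt → a , ≤-refl , lt , ⊤ᶠ-holds a a)

  letter⇔ : ∀ p a → sat u (` p) a a ⇔ T (u a p)
  letter⇔ p a = mk⇔ (λ h → h a ≤-refl ≤-refl) (λ h k k≤a a≤k → subst (λ z → T (u z p)) (≤-antisym a≤k (s≤s⁻¹ k≤a)) h)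

  <ᵇ⇔ : ∀ i a → (i < a) ⇔ T (i <ᵇ a)
  <ᵇ⇔ i a = mk⇔ <⇒<ᵇ (<ᵇ⇒< i a)

  stable : ∀ φ {a i} → ¬ ¬ sat u φ a i → sat u φ a i
  stable φ {a} {i} h with sat? u φ a i
  ... | yes p = p
  ... | no np = contradiction np h

  point⇔ : ∀ φ a i → i ≤ a → sat u (¬′ (⟨B⟩ ⊤ᶠ ∨′ ¬′ φ)) a i ⇔ (i ≡ a × sat u φ a a)
  point⇔ φ a i i≤a = mk⇔ (λ h → go h (i ≟ a))
    (λ { (refl , p) (inj₁ pr) → <-irrefl refl (to (proper⇔ a a) pr) ; (refl , p) (inj₂ np) → np p })
    where
    go : sat u (¬′ (⟨B⟩ ⊤ᶠ ∨′ ¬′ φ)) a i → Dec (i ≡ a) → i ≡ a × sat u φ a a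
    go h (yes refl) = refl , stable φ (h ∘ inj₂)
    go h (no i≢a)   = contradiction (inj₁ (from (proper⇔ a i) (≤∧≢⇒< i≤a i≢a))) h

  left⇔ : ∀ φ a i → sat u (⟨B⟩ ¬′ (⟨B⟩ ⊤ᶠ ∨′ ¬′ φ)) a i ⇔ (i < a × sat u φ a a)
  left⇔ φ a i = mk⇔ (λ { (i' , i'≤a , lt , h) → case to (point⇔ φ a i' (s≤s⁻¹ i'≤a)) h of λ { (refl , p) → lt , p } })
    (λ { (lt , p) → a , ≤-refl , lt , from (point⇔ φ a a ≤-refl) (refl , p) })

  right⇔ : ∀ p a i → sat u (⟨A⟩ ¬′ (⟨B⟩ ⊤ᶠ ∨′ ¬′ ` p)) a i ⇔ T (u i p)
  right⇔ p a i = mk⇔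
    (λ { (i' , i'≤i , h) → to (letter⇔ p i) (proj₂ (to (point⇔ (` p) i i' (s≤s⁻¹ i'≤i)) h)) })
    (λ t → i , ≤-refl , from (point⇔ (` p) i i ≤-refl) (refl , from (letter⇔ p i) t))

  leftLetter⇔ : ∀ p a i → sat u (⟨B⟩ ¬′ (⟨B⟩ ⊤ᶠ ∨′ ¬′ ` p)) a i ⇔ T ((i <ᵇ a) ∧ u a p)
  leftLetter⇔ p a i = left⇔ (` p) a i ⟨⇔⟩ ×-⇔ (<ᵇ⇔ i a) (letter⇔ p a) ⟨⇔⟩ ⇔-flip T-∧

  all⇔ : ∀ {φ f} a i → (∀ k → sat u (φ k) a i ⇔ T (f k)) → ∀ k → sat u (allᶠ φ k) a i ⇔ T (conjunction f k)
  all⇔ a i e zero    = mk⇔ (λ _ → tt) (λ _ → ⊤ᶠ-holds a i)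
  all⇔ {f = f} a i e (suc k) = not-T (not (f k) ∨ not (conjunction f k)) (or-T (not (f k)) (not (conjunction f k)) (not-T (f k) (e k)) (not-T (conjunction f k) (all⇔ a i e k)))

  valueAt : ∀ {b} → ℕ → ℕ → ℕ → Expr b → Bool
  valueAt a i = Evaluation.value' K (i <ᵇ a) (u a) (u i)

  scheme⇔ : ∀ {b} (e : Expr b) k a i → sat u (formulaOf K k (scheme e)) a i ⇔ T (valueAt a i k e)
  scheme⇔ properᵉ k a i = proper⇔ a i ⟨⇔⟩ <ᵇ⇔ i a
  scheme⇔ (letterᵉ leftEnd c) k a i = leftLetter⇔ (toℕ c) a i
  scheme⇔ (letterᵉ rightEnd c) k a i = right⇔ (toℕ c) a i
  scheme⇔ (bitᵉ leftEnd j s) k a i = leftLetter⇔ (bitLetter j (k + s)) a i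
  scheme⇔ (bitᵉ rightEnd j s) k a i = right⇔ (bitLetter j (k + s)) a i
  scheme⇔ (¬ᵉ e) k a i = not-T (valueAt a i k e) (scheme⇔ e k a i)
  scheme⇔ (e ∨ᵉ f) k a i = or-T (valueAt a i k e) (valueAt a i k f) (scheme⇔ e k a i) (scheme⇔ f k a i)
  scheme⇔ (allᵉ e) k a i = all⇔ {f = λ i' → valueAt a i i' e} a i (λ i' → scheme⇔ e i' a i) K

  and⇔ : ∀ φ ψ {a i} → sat u (¬′ (¬′ φ ∨′ ¬′ ψ)) a i ⇔ (sat u φ a i × sat u ψ a i)
  and⇔ φ ψ {a} {i} = mk⇔ (λ h → stable φ {a} {i} (h ∘ inj₁) , stable ψ {a} {i} (h ∘ inj₂))
    (λ { (p , q) (inj₁ np) → np p ; (p , q) (inj₂ nq) → nq q })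

  Holds' : Expr false → ℕ → ℕ → Set
  Holds' e a i = T (valueAt a i 0 e)

  Rule' : ℕ → Expr false → Expr false → Set
  Rule' n e c = ∀ a i → 0 < a → a ≤ n → i ≤ a → Holds' e a i → (∀ i' → i < i' → i' ≤ a → ¬ Holds' e a i') → Holds' c a i

  rule⇔ : ∀ n e c → sat u (formulaOf K 0 (ruleˢ e c)) n 0 ⇔ Rule' n e c
  rule⇔ n e c = mk⇔
    (λ h a i 0<a a≤n i≤a p first → T-stable (valueAt a i 0 c) λ nc →
      h (a , s≤s a≤n , 0<a , i , s≤s i≤a , λ
        { (inj₁ np) → np (from (scheme⇔ e 0 a i) p)
        ; (inj₂ (inj₁ (i' , i'≤a , lt , q))) → first i' lt (s≤s⁻¹ i'≤a) (to (scheme⇔ e 0 a i') q)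
        ; (inj₂ (inj₂ q)) → nc (to (scheme⇔ c 0 a i) q) }))
    (λ { h (a , a≤n , 0<a , i , i≤a , nh) → nh (inj₁ λ p → nh (inj₂ (inj₂ (from (scheme⇔ c 0 a i)
      (h a i 0<a (s≤s⁻¹ a≤n) (s≤s⁻¹ i≤a) (to (scheme⇔ e 0 a i) p)
        λ i' lt i'≤a q → nh (inj₂ (inj₁ (i' , s≤s i'≤a , lt , from (scheme⇔ e 0 a i') q)))))))) })

  step⇔ : ∀ a i → (¬ sat u (formulaOf K 0 stepˢ) a i) ⇔ (a ≡ suc i)
  step⇔ a i = mk⇔
    (λ h → ≤-antisym (≮⇒≥ λ lt → h (inj₂ (suc i , lt ≤∙ n≤1+n a , ≤-refl , from (proper⇔ a (suc i)) lt)))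
                      (≮⇒≥ λ lt → h (inj₁ λ p → <⇒≱ (to (proper⇔ a i) p) (s≤s⁻¹ lt))))
    (λ { refl (inj₁ np) → np (from (proper⇔ (suc i) i) ≤-refl)
       ; refl (inj₂ (i' , _ , lt , p)) → <⇒≱ (to (proper⇔ (suc i) i') p) lt })

  chain⇔ : ∀ {P : Bool → ℕ → Set} {Q : ℕ → Set} {φ ξ} →
           (∀ b a i → (¬ sat u (φ b) a i) ⇔ P b i) → (∀ a i → sat u ξ a i ⇔ Q i) →
           ∀ v a i → sat u (chainᶠ φ (formulaOf K 0 stepˢ) ξ v) a i ⇔ Chain P Q i v
  chain⇔ p q [] a i = q a i
  chain⇔ {P} {Q} {φ} {ξ} p q (b ∷ v) a i = mk⇔
    (λ h → to (p b a i) (h ∘ inj₁) , go h)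
    (λ { (pb , i' , eq , c) (inj₁ np) → contradiction np (from (p b a i) pb)
       ; (pb , i' , eq , c) (inj₂ nh) → nh (i' , s≤s (n≤1+n i' ≤∙≡ sym eq) , λ
           { (inj₁ s) → from (step⇔ i i') eq s ; (inj₂ nc) → nc (from (chain⇔ p q v i i') c) }) })
    where
    ψ : Formula
    ψ = formulaOf K 0 stepˢ
    go : sat u (linkᶠ φ ψ b (chainᶠ φ ψ ξ v)) a i → ∃[ i' ] i ≡ suc i' × Chain P Q i' v
    go h = let i' , _ , nh = stable (⟨A⟩ ¬′ (ψ ∨′ ¬′ chainᶠ φ ψ ξ v)) {a} {i} (h ∘ inj₂)
           in i' , to (step⇔ i i') (nh ∘ inj₁) , to (chain⇔ p q v i i') (stable (chainᶠ φ ψ ξ v) {i} {i'} (nh ∘ inj₂))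

module Derived' where

  ⊤ᵉ : ∀ {b} → Expr b
  ⊤ᵉ = properᵉ ∨ᵉ ¬ᵉ properᵉ

  when : Bool → Expr false
  when true  = ⊤ᵉ
  when false = ¬ᵉ ⊤ᵉ

  infixr 15 _∧ᵉ_ _↔ᵉ_
  _∧ᵉ_ _↔ᵉ_ : ∀ {b} → Expr b → Expr b → Expr b
  e ∧ᵉ f = ¬ᵉ (¬ᵉ e ∨ᵉ ¬ᵉ f)
  e ↔ᵉ f = (e ∧ᵉ f) ∨ᵉ (¬ᵉ e ∧ᵉ ¬ᵉ f)

  someᵉ everyᵉ : ∀ n → (Fin n → Expr false) → Expr false
  someᵉ zero f = ¬ᵉ ⊤ᵉ
  someᵉ (suc n) f = f zero ∨ᵉ someᵉ n (f ∘ suc)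
  everyᵉ zero f = ⊤ᵉ
  everyᵉ (suc n) f = f zero ∧ᵉ everyᵉ n (f ∘ suc)

  and-T : ∀ x y → T (not (not x ∨ not y)) ⇔ (T x × T y)
  and-T true y = mk⇔ (λ h → tt , T-stable y (from (not-T (not y) (not-T y ⇔-id)) h)) (λ (_ , t) → to (not-T (not y) (not-T y ⇔-id)) (λ ny → ny t))
  and-T false y = mk⇔ ⊥-elim proj₁

  iff-T : ∀ x y → T (not (not x ∨ not y) ∨ not (not (not x) ∨ not (not y))) ⇔ (x ≡ y)
  iff-T true true  = mk⇔ (λ _ → refl) _
  iff-T false false = mk⇔ (λ _ → refl) _
  iff-T true false = mk⇔ (λ ()) (λ ())
  iff-T false true  = mk⇔ (λ ()) (λ ())

  allBelow-T : ∀ f k → T (conjunction f k) ⇔ (∀ i → i < k → T (f i))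
  allBelow-T f zero    = mk⇔ (λ _ _ ()) (λ _ → tt)
  allBelow-T f (suc k) = and-T (f k) (conjunction f k) ⟨⇔⟩ mk⇔
    (λ { (t , h) i lt → case m≤n⇒m<n∨m≡n (s≤s⁻¹ lt) of λ { (inj₁ i<k) → to (allBelow-T f k) h i i<k ; (inj₂ refl) → t } })
    (λ h → h k ≤-refl , from (allBelow-T f k) (λ i lt → h i (lt ≤∙ n≤1+n k)))

  excluded-middle : ∀ x → T (x ∨ not x)
  excluded-middle true  = tt
  excluded-middle false = tt

  module Values' (K : ℕ) (proper : Bool) (l r : Letter → Bool) where

    open Evaluation K proper l r

    ⊤ᵉ-true : ∀ {b k} → T (value' {b} k ⊤ᵉ)
    ⊤ᵉ-true = excluded-middle proper

    when-T : ∀ b → T (value' 0 (when b)) ⇔ T b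
    when-T true  = mk⇔ _ (λ _ → ⊤ᵉ-true {false} {0})
    when-T false = mk⇔ (λ t → from (not-T (value' {false} 0 ⊤ᵉ) ⇔-id) t (⊤ᵉ-true {false} {0})) ⊥-elim

    some-T : ∀ n f → T (value' 0 (someᵉ n f)) ⇔ (∃[ i ] T (value' 0 (f i)))
    some-T zero f = when-T false ⟨⇔⟩ mk⇔ (λ ()) λ ()
    some-T (suc n) f = T-∨ {value' 0 (f zero)} ⟨⇔⟩ mk⇔
      (λ { (inj₁ t) → zero , t ; (inj₂ t) → let i , t' = to (some-T n (f ∘ suc)) t in suc i , t' })
      (λ { (zero , t) → inj₁ t ; (suc i , t) → inj₂ (from (some-T n (f ∘ suc)) (i , t)) })

    every-T : ∀ n f → T (value' 0 (everyᵉ n f)) ⇔ (∀ i → T (value' 0 (f i)))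
    every-T zero f = mk⇔ (λ _ ()) (λ _ → ⊤ᵉ-true {false} {0})
    every-T (suc n) f = and-T (value' 0 (f zero)) (value' 0 (everyᵉ n (f ∘ suc))) ⟨⇔⟩ mk⇔
      (λ { (t , h) zero → t ; (t , h) (suc i) → to (every-T n (f ∘ suc)) h i })
      (λ h → h zero , from (every-T n (f ∘ suc)) (h ∘ suc))

-- The formula that describes accepting computations.

open Finite

finite-Fin : ∀ n → Finite (Fin n)
finite-Fin n = record { card = n ; index = id ; element = id ; element-index = λ _ → refl }

finite-× : ∀ {A B} → Finite A → Finite B → Finite (A × B)
finite-× F G = record
  { card = card F * card G ; index = λ (x , y) → Fin.combine (index F x) (index G y) ; element = back ∘ Fin.remQuot (card G)
  ; element-index = λ (x , y) → cong back (remQuot-combine (index F x) (index G y)) ∙ cong₂ _,_ (element-index F x) (element-index G y) }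
  where
  back : Fin (card F) × Fin (card G) → _
  back (i , j) = element F i , element G j

finite-retract : ∀ {A B : Set} (f : A → B) (g : B → A) → (∀ x → f (g x) ≡ x) → Finite A → Finite B
finite-retract f g eq F = record
  { card = card F ; index = index F ∘ g ; element = f ∘ element F ; element-index = λ x → cong f (element-index F (g x)) ∙ eq x }

finite-Vec : ∀ {A} n → Finite A → Finite (Vec A n)
finite-Vec zero F = finite-retract (λ _ → []) (λ _ → tt) (λ { [] → refl }) finite-⊤
finite-Vec (suc n) F = finite-retract (uncurry _∷_) (λ { (x ∷ xs) → x , xs }) (λ { (x ∷ xs) → refl }) (finite-× F (finite-Vec n F))

finite-Symbol : ∀ a → Finite (Symbol a)
finite-Symbol a = finite-retract (λ { nothing → blank ; (just (inj₁ b)) → bit b ; (just (inj₂ i)) → aux i })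
  (λ { blank → nothing ; (bit b) → just (inj₁ b) ; (aux i) → just (inj₂ i) })
  (λ { blank → refl ; (bit b) → refl ; (aux i) → refl }) (finite-Maybe (finite-⊎ finite-Bool (finite-Fin a)))

index-injective : ∀ {A} (F : Finite A) {x y} → index F x ≡ index F y → x ≡ y
index-injective F {x} {y} eq = sym (element-index F x) ∙ cong (element F) eq ∙ element-index F y

xor-values : ∀ x y z → not (not (not x ∨ not (not (not y ∨ not (not z)))) ∨ not (not (not x) ∨ not (not (not (not y ∨ not (not z)))))) ≡ x xor (y ∧ not z)
xor-values true true true  = refl
xor-values true true false = refl
xor-values true false z     = refl
xor-values false true true  = refl
xor-values false true false = refl
xor-values false false z     = refl

-- v' is the binary representation of the successor of the number that v represents, up to bit K.
record Increments (K : ℕ) (v v' : ℕ → Bool) : Set where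
  constructor increments
  field
    first  : v' 0 ≡ not (v 0)
    others : ∀ i → i < K → v' (suc i) ≡ v (suc i) xor (v i ∧ not (v' i))

-- Bit `K` is included because the increment conditions for `i < K` govern the bits up to `suc i`.
-- Visits are compared by the bits below `K`.
Agrees : ℕ → (ℕ → Bool) → ℕ → Set
Agrees K v x = ∀ i → i ≤ K → v i ≡ bitOf x i

module _ {K : ℕ} {v v' : ℕ → Bool} where

  open Increments

  agrees-suc : ∀ {x} → Agrees K v x → Increments K v v' → Agrees K v' (suc x)
  agrees-suc ag ic zero le = first ic ∙ cong not (ag 0 z≤n)
  agrees-suc {x} ag ic (suc i) le = others ic i le ∙ cong₂ _xor_ (ag (suc i) le) (cong₂ (λ a b → a ∧ not b) (ag i (<⇒≤ le)) (agrees-suc {x} ag ic i (<⇒≤ le))) ∙ sym (bitOf-suc x i)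

  -- A move to the left is checked as an increment in the opposite direction. The lower bits being
  -- known, so is the carry, and exclusive or cancels.
  agrees-pred : ∀ {x} → Agrees K v' (suc x) → Increments K v v' → Agrees K v x
  agrees-pred ag ic zero le = sym (not-involutive (v 0)) ∙ cong not (sym (first ic) ∙ ag 0 z≤n) ∙ not-involutive _
  agrees-pred {x} ag ic (suc i) le = xor-cancel (v i ∧ not (v' i)) (sym (others ic i le) ∙ ag (suc i) le ∙ bitOf-suc x i ∙
    cong (bitOf x (suc i) xor_) (sym (cong₂ (λ a b → a ∧ not b) (agrees-pred {x} ag ic i (<⇒≤ le)) (ag i (<⇒≤ le)))))
    where
    xor-cancel : ∀ {a b} c → a xor c ≡ b xor c → a ≡ b
    xor-cancel {true} {true} c eq = refl
    xor-cancel {false} {false} c eq = refl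
    xor-cancel {true} {false} true ()
    xor-cancel {true} {false} false ()
    xor-cancel {false} {true} true ()
    xor-cancel {false} {true} false ()

  agrees-increments : ∀ {x} → Agrees K v x → Agrees K v' (suc x) → Increments K v v'
  agrees-increments {x} ag ag' = increments (ag' 0 z≤n ∙ cong not (sym (ag 0 z≤n)))
    (λ i lt → ag' (suc i) lt ∙ bitOf-suc x i ∙
      sym (cong₂ _xor_ (ag (suc i) lt) (cong₂ (λ a b → a ∧ not b) (ag i (<⇒≤ lt)) (ag' i (<⇒≤ lt)))))

module Constraints (𝕄 : Machine) where

  open Machine 𝕄
  open Labels 𝕄
  open Derived'

  symbols : Finite (Symbol auxSymbols)
  symbols = finite-Symbol auxSymbols

  labels : Finite Label
  labels = finite-⊎ (finite-Maybe finite-Bool) (finite-× (finite-Fin states) (finite-Vec R symbols))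

  code : Label → ℕ
  code l = Fin.toℕ (index labels l)

  noneBelow : Side → ℕ → Expr false
  noneBelow z zero    = ⊤ᵉ
  noneBelow z (suc k) = ¬ᵉ letterᵉ z (labelCode k) ∧ᵉ noneBelow z k

  -- The label of a point is given by the least of the label letters that hold there, so that it is unique.
  isLabel : Side → Label → Expr false
  isLabel z l = letterᵉ z (labelCode (code l)) ∧ᵉ noneBelow z (code l)

  HasLabel : (Letter → Bool) → Label → Set
  HasLabel v l = T (v (labelLetter (code l))) × (∀ k → k < code l → ¬ T (v (labelLetter k)))

  HasLabel-unique : ∀ {v l l'} → HasLabel v l → HasLabel v l' → l ≡ l'
  HasLabel-unique {v} {l} {l'} (t , least) (t' , least') = index-injective labels (Fin.toℕ-injective
    (≤-antisym (≮⇒≥ λ gt → least (code l') gt t') (≮⇒≥ λ lt → least' (code l) lt t)))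

  InputFrom : (ℕ → Letter → Bool) → ℕ → List Bool → Set
  InputFrom u = Chain (λ b z → HasLabel (u z) (inj₁ (just b))) (λ z → HasLabel (u z) (inj₁ nothing))

  someLabel : (Label → Expr false) → Expr false
  someLabel f = someᵉ (card labels) (f ∘ element labels)

  labelled : Label → Label → Expr false → Expr false
  labelled l l' e = isLabel leftEnd l ∧ᵉ isLabel rightEnd l' ∧ᵉ e

  someLabels : (Label → Label → Expr false) → Expr false
  someLabels f = someLabel λ l → someLabel λ l' → labelled l l' (f l l')

  -- In the sweep the position of head 0 equals the time, so the address `M - 1` announces its last
  -- step.
  onesᵉ : Expr false
  onesᵉ = allᵉ (bitᵉ leftEnd 0 0)

  -- The input chain fixes the labels up to the first blank; this condition extends the blanks to
  -- the rest of the sweep.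
  follows : Maybe Bool → Maybe Bool → Bool
  follows nothing (just _) = false
  follows _ _        = true

  proceeds : Maybe (Fin states × Vec (Symbol auxSymbols × Move) R) → Fin states → Bool
  proceeds nothing q' = false
  proceeds (just (q , _)) q' = ⌊ q Fin.≟ q' ⌋

  adjacent : Label → Label → Expr false
  adjacent (inj₁ s) (inj₁ s')       = ¬ᵉ onesᵉ ∧ᵉ when (follows s s')
  adjacent (inj₁ s) (inj₂ (q , _))  = onesᵉ ∧ᵉ when ⌊ q Fin.≟ start ⌋
  adjacent (inj₂ _) (inj₁ _)        = when false
  adjacent (inj₂ (q , h)) (inj₂ (q' , _)) = when (proceeds (δ q h) q')

  sameBits : ℕ → ℕ → Expr false
  sameBits s j = allᵉ (bitᵉ leftEnd j s ↔ᵉ bitᵉ rightEnd j s)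

  increment : Side → Side → ℕ → Expr false
  increment z z' j = (letterᵉ z' (bitCode j 0) ↔ᵉ ¬ᵉ letterᵉ z (bitCode j 0)) ∧ᵉ
    allᵉ (bitᵉ z' j 1 ↔ᵉ ¬ᵉ (bitᵉ z j 1 ↔ᵉ bitᵉ z j 0 ∧ᵉ ¬ᵉ bitᵉ z' j 0))

  update : Move → ℕ → Expr false
  update left j = increment rightEnd leftEnd j
  update stay j = sameBits 0 j ∧ᵉ sameBits 1 j
  update right j = increment leftEnd rightEnd j

  next'ᵉ : Expr false
  next'ᵉ = someLabels λ l l' → adjacent l l' ∧ᵉ everyᵉ R (λ j → update (moves l j) (Fin.toℕ j))

  revisit : Fin R → Expr false
  revisit j = properᵉ ∧ᵉ sameBits 0 (Fin.toℕ j)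

  -- Nothing is read during the sweep, so an interval whose right end lies there imposes no
  -- condition.
  consistent : Fin R → Label → Label → Bool
  consistent j l (inj₁ _)       = true
  consistent j l (inj₂ (_ , h)) = ⌊ index symbols (writes l j) Fin.≟ index symbols (lookup h j) ⌋

  remembers : Fin R → Expr false
  remembers j = someLabels λ l l' → when (consistent j l l')

  zeros : ℕ → Expr false
  zeros j = allᵉ (¬ᵉ bitᵉ leftEnd j 0) ∧ᵉ allᵉ (¬ᵉ bitᵉ leftEnd j 1)

  undefined : Maybe (Fin states × Vec (Symbol auxSymbols × Move) R) → Bool
  undefined nothing  = true
  undefined (just _) = false

  final : Label → Bool
  final (inj₁ _)       = false
  final (inj₂ (q , h)) = undefined (δ q h) ∧ accepting q

  ending : Label → Expr false
  ending l = isLabel rightEnd l ∧ᵉ when (final l)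

  endsᵉ : Expr false
  endsᵉ = everyᵉ R (λ j → zeros (Fin.toℕ j)) ∧ᵉ someLabel ending

  everyˢ : ∀ n → (Fin n → Scheme false) → Scheme false
  everyˢ zero f = ⊤ˢ
  everyˢ (suc n) f = f zero ∧ˢ everyˢ n (f ∘ suc)

  rules : Fin R → Scheme false
  rules j = ruleˢ (revisit j) (remembers j)

  labelˢ : Maybe Bool → Scheme false
  labelˢ s = scheme (isLabel rightEnd (inj₁ s))

  inputˢ : Bool → Scheme false
  inputˢ b = ¬ˢ labelˢ (just b)

  restˢ : Scheme false
  restˢ = scheme endsᵉ ∧ˢ ruleˢ properᵉ next'ᵉ ∧ˢ everyˢ R rules

  module _ (K : ℕ) (w : List Bool) where

    inputᶠ reductionᶠ : Formula
    inputᶠ = chainᶠ (λ b → formulaOf K 0 (inputˢ b)) (formulaOf K 0 stepˢ) (formulaOf K 0 (labelˢ nothing)) w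
    reductionᶠ = framedᶠ K inputˢ stepˢ (labelˢ nothing) restˢ w

  bitsAt : (Letter → Bool) → ℕ → ℕ → Bool
  bitsAt v j i = v (bitLetter j i)

  module Meaning (K : ℕ) (l r : Letter → Bool) where

    open Evaluation K true l r
    open Values' K true l r

    noneBelow-T : ∀ {pr} z n → T (Evaluation.value' K pr l r 0 (noneBelow z n)) ⇔ (∀ k → k < n → ¬ T (Evaluation.endValue K pr l r z (labelLetter k)))
    noneBelow-T {pr} z zero    = mk⇔ (λ _ _ ()) (λ _ → excluded-middle pr)
    noneBelow-T {pr} z (suc n) = and-T (not (Evaluation.endValue K pr l r z (labelLetter n))) _ ⟨⇔⟩
      ×-⇔ (⇔-flip (not-T (Evaluation.endValue K pr l r z (labelLetter n)) ⇔-id)) (noneBelow-T z n) ⟨⇔⟩ mk⇔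
        (λ { (nt , h) k lt → case m≤n⇒m<n∨m≡n (s≤s⁻¹ lt) of λ { (inj₁ k<n) → h k k<n ; (inj₂ refl) → nt } })
        (λ h → h n ≤-refl , λ k lt → h k (lt ≤∙ n≤1+n n))

    isLabel-T : ∀ {pr} z l' → T (Evaluation.value' K pr l r 0 (isLabel z l')) ⇔ HasLabel (Evaluation.endValue K pr l r z) l'
    isLabel-T z l' = and-T (Evaluation.endValue K _ l r z (labelLetter (code l'))) _ ⟨⇔⟩ ×-⇔ ⇔-id (noneBelow-T z (code l'))

    someLabel-T : ∀ f → T (value' 0 (someLabel f)) ⇔ (∃[ m ] T (value' 0 (f m)))
    someLabel-T f = some-T (card labels) (f ∘ element labels) ⟨⇔⟩
      mk⇔ (λ (i , t) → element labels i , t) (λ (m , t) → index labels m , subst (λ m → T (value' 0 (f m))) (sym (element-index labels m)) t)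

    and-value : ∀ (e f : Expr false) → T (value' 0 (e ∧ᵉ f)) ⇔ (T (value' 0 e) × T (value' 0 f))
    and-value e f = and-T (value' 0 e) (value' 0 f)

    labelled-T : ∀ m m' e → T (value' 0 (labelled m m' e)) ⇔ (HasLabel l m × HasLabel r m' × T (value' 0 e))
    labelled-T m m' e = and-value (isLabel leftEnd m) (isLabel rightEnd m' ∧ᵉ e) ⟨⇔⟩ ×-⇔ (isLabel-T {true} leftEnd m)
      (and-value (isLabel rightEnd m') e ⟨⇔⟩ ×-⇔ (isLabel-T {true} rightEnd m') ⇔-id)

    someLabels-T : ∀ f → T (value' 0 (someLabels f)) ⇔ (∃[ m ] ∃[ m' ] HasLabel l m × HasLabel r m' × T (value' 0 (f m m')))
    someLabels-T f = someLabel-T (λ m → someLabel λ m' → labelled m m' (f m m')) ⟨⇔⟩ mk⇔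
      (λ (m , t) → let m' , t' = to (someLabel-T (λ m' → labelled m m' (f m m'))) t in m , m' , to (labelled-T m m' (f m m')) t')
      (λ (m , m' , t) → m , from (someLabel-T (λ m' → labelled m m' (f m m'))) (m' , from (labelled-T m m' (f m m')) t))

    ones-T : T (value' 0 onesᵉ) ⇔ (∀ i → i < K → T (bitsAt l 0 i))
    ones-T = allBelow-T _ K ⟨⇔⟩ mk⇔ (λ h i lt → subst (T ∘ bitsAt l 0) (+-identityʳ i) (h i lt)) (λ h i lt → subst (T ∘ bitsAt l 0) (sym (+-identityʳ i)) (h i lt))

    shifted : ∀ s {P : ℕ → Set} → (∀ i → i < K → P (i + s)) ⇔ (∀ i → i < K → P (s + i))
    shifted s {P} = mk⇔ (λ h i lt → subst P (+-comm i s) (h i lt)) (λ h i lt → subst P (+-comm s i) (h i lt))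

    sameBits-T : ∀ s j → T (value' 0 (sameBits s j)) ⇔ (∀ i → i < K → bitsAt l j (s + i) ≡ bitsAt r j (s + i))
    sameBits-T s j = allBelow-T _ K ⟨⇔⟩ mk⇔ (λ h i lt → to (iff-T _ _) (h i lt)) (λ h i lt → from (iff-T _ _) (h i lt)) ⟨⇔⟩
      shifted s {λ i → bitsAt l j i ≡ bitsAt r j i}

    increment-T : ∀ z z' j → T (value' 0 (increment z z' j)) ⇔ Increments K (bitsAt (endValue z) j) (bitsAt (endValue z') j)
    increment-T z z' j = and-T _ _ ⟨⇔⟩ ×-⇔ (iff-T _ _) (allBelow-T _ K ⟨⇔⟩ mk⇔
        (λ h i lt → subst₂ Other (+-comm i 1) (+-identityʳ i) (to (iff-T _ _) (h i lt) ∙ xor-values (v (i + 1)) (v (i + 0)) (v' (i + 0))))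
        (λ h i lt → from (iff-T _ _) (subst₂ Other (+-comm 1 i) (sym (+-identityʳ i)) (h i lt) ∙ sym (xor-values (v (i + 1)) (v (i + 0)) (v' (i + 0))))))
      ⟨⇔⟩ mk⇔ (λ (f , o) → increments f o) (λ (increments f o) → f , o)
      where
      v v' : ℕ → Bool
      v = bitsAt (endValue z) j
      v' = bitsAt (endValue z') j
      Other : ℕ → ℕ → Set
      Other i₁ i₀ = v' i₁ ≡ v i₁ xor (v i₀ ∧ not (v' i₀))

    update-sound : 0 < K → ∀ m j {x} → (m ≡ left → 0 < x) → Agrees K (bitsAt l j) x → T (value' 0 (update m j)) → Agrees K (bitsAt r j) (shiftHead m x)
    update-sound 0<K left j {zero} pos ag t = contradiction (pos refl) (λ ())
    update-sound 0<K left j {suc x} pos ag t = agrees-pred ag (to (increment-T rightEnd leftEnd j) t)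
    update-sound 0<K right j pos ag t = agrees-suc ag (to (increment-T leftEnd rightEnd j) t)
    update-sound 0<K stay j pos ag t zero le = sym (to (sameBits-T 0 j) (proj₁ (to (and-T _ _) t)) 0 0<K) ∙ ag 0 le
    update-sound 0<K stay j pos ag t (suc i) le = sym (to (sameBits-T 1 j) (proj₂ (to (and-T _ _) t)) i le) ∙ ag (suc i) le

    update-complete : ∀ m j {x} → (m ≡ left → 0 < x) → Agrees K (bitsAt l j) x → Agrees K (bitsAt r j) (shiftHead m x) → T (value' 0 (update m j))
    update-complete left j {zero} pos ag ag' = contradiction (pos refl) (λ ())
    update-complete left j {suc x} pos ag ag' = from (increment-T rightEnd leftEnd j) (agrees-increments ag' ag)
    update-complete right j pos ag ag' = from (increment-T leftEnd rightEnd j) (agrees-increments ag ag')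
    update-complete stay j pos ag ag' = from (and-T _ _)
      (from (sameBits-T 0 j) (λ i lt → ag i (<⇒≤ lt) ∙ sym (ag' i (<⇒≤ lt))) , from (sameBits-T 1 j) (λ i lt → ag (suc i) lt ∙ sym (ag' (suc i) lt)))

    zeros-T : 0 < K → ∀ j → T (value' 0 (zeros j)) ⇔ Agrees K (bitsAt l j) 0
    zeros-T 0<K j = and-T _ _ ⟨⇔⟩ ×-⇔ (zero-T 0) (zero-T 1) ⟨⇔⟩ mk⇔
      (λ { (h , h') zero _ → h 0 0<K ; (h , h') (suc i) le → h' i le ∙ sym (bitOf-0 i) })
      (λ h → (λ i lt → h i (<⇒≤ lt) ∙ bitOf-0 i) , λ i lt → h (suc i) lt ∙ bitOf-0 (suc i))
      where
      not-false : ∀ x → T (not x) ⇔ (x ≡ false)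
      not-false true  = mk⇔ (λ ()) λ ()
      not-false false = mk⇔ (λ _ → refl) _
      zero-T : ∀ s → T (value' 0 (allᵉ (¬ᵉ bitᵉ leftEnd j s))) ⇔ (∀ i → i < K → bitsAt l j (s + i) ≡ false)
      zero-T s = allBelow-T _ K ⟨⇔⟩ mk⇔ (λ h i lt → to (not-false _) (h i lt)) (λ h i lt → from (not-false _) (h i lt)) ⟨⇔⟩ shifted s {λ i → bitsAt l j i ≡ false}

    endsᵉ-T : 0 < K → T (value' 0 endsᵉ) ⇔ ((∀ j → Agrees K (bitsAt l (Fin.toℕ {R} j)) 0) × ∃[ m ] HasLabel r m × T (final m))
    endsᵉ-T 0<K = and-value (everyᵉ R (λ j → zeros (Fin.toℕ j))) (someLabel ending) ⟨⇔⟩ ×-⇔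
      (every-T R (λ j → zeros (Fin.toℕ j)) ⟨⇔⟩ mk⇔ (λ h j → to (zeros-T 0<K (Fin.toℕ j)) (h j)) (λ h j → from (zeros-T 0<K (Fin.toℕ j)) (h j)))
      (someLabel-T ending ⟨⇔⟩ mk⇔ (λ (m , t) → m , to (ending-T m) t) (λ (m , t) → m , from (ending-T m) t))
      where
      ending-T : ∀ m → T (value' 0 (ending m)) ⇔ (HasLabel r m × T (final m))
      ending-T m = and-value (isLabel rightEnd m) (when (final m)) ⟨⇔⟩ ×-⇔ (isLabel-T {true} rightEnd m) (when-T (final m))

    Ones : Set
    Ones = ∀ i → i < K → T (bitsAt l 0 i)

    Adjacent : Label → Label → Set
    Adjacent (inj₁ s) (inj₁ s')       = ¬ Ones × T (follows s s')
    Adjacent (inj₁ s) (inj₂ (q , _))  = Ones × q ≡ start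
    Adjacent (inj₂ _) (inj₁ _)        = ⊥
    Adjacent (inj₂ (q , h)) (inj₂ (q' , _)) = T (proceeds (δ q h) q')

    adjacent-T : ∀ m m' → T (value' 0 (adjacent m m')) ⇔ Adjacent m m'
    adjacent-T (inj₁ s) (inj₁ s') = and-value (¬ᵉ onesᵉ) (when (follows s s')) ⟨⇔⟩ ×-⇔ (⇔-flip (not-T (value' 0 onesᵉ) (⇔-flip ones-T))) (when-T (follows s s'))
    adjacent-T (inj₁ s) (inj₂ (q , h)) = and-value onesᵉ (when ⌊ q Fin.≟ start ⌋) ⟨⇔⟩ ×-⇔ ones-T (when-T ⌊ q Fin.≟ start ⌋ ⟨⇔⟩ mk⇔ toWitness fromWitness)
    adjacent-T (inj₂ _) (inj₁ _) = when-T false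
    adjacent-T (inj₂ (q , h)) (inj₂ (q' , _)) = when-T (proceeds (δ q h) q')

    updates : Label → Expr false
    updates m = everyᵉ R (λ j → update (moves m j) (Fin.toℕ j))

    next-T : T (value' 0 next'ᵉ) ⇔ (∃[ m ] ∃[ m' ] HasLabel l m × HasLabel r m' × Adjacent m m' × (∀ j → T (value' 0 (update (moves m j) (Fin.toℕ j)))))
    next-T = someLabels-T (λ m m' → adjacent m m' ∧ᵉ updates m) ⟨⇔⟩
      mk⇔ (λ (m , m' , h , h' , t) → m , m' , h , h' , to (body m m') t) (λ (m , m' , h , h' , t) → m , m' , h , h' , from (body m m') t)
      where
      body : ∀ m m' → T (value' 0 (adjacent m m' ∧ᵉ updates m)) ⇔ (Adjacent m m' × (∀ j → T (value' 0 (update (moves m j) (Fin.toℕ j)))))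
      body m m' = and-value (adjacent m m') (updates m) ⟨⇔⟩ ×-⇔ (adjacent-T m m') (every-T R (λ j → update (moves m j) (Fin.toℕ j)))

    remembers-T : ∀ j → T (value' 0 (remembers j)) ⇔ (∃[ m ] ∃[ m' ] HasLabel l m × HasLabel r m' × T (consistent j m m'))
    remembers-T j = someLabels-T (λ m m' → when (consistent j m m')) ⟨⇔⟩
      mk⇔ (λ (m , m' , h , h' , t) → m , m' , h , h' , to (when-T (consistent j m m')) t) (λ (m , m' , h , h' , t) → m , m' , h , h' , from (when-T (consistent j m m')) t)

module Conditions (𝕄 : Machine) (w : List Bool) (K : ℕ) (0<K : 0 < K) (u : ℕ → Letter → Bool) (n : ℕ) where

  open Machine 𝕄
  open Labels 𝕄
  open Constraints 𝕄
  open Derived'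
  open Semantics' u K

  properly : ℕ → ℕ → Expr false → Set
  properly a i e = T (Evaluation.value' K true (u a) (u i) 0 e)

  SamePosition : Fin R → ℕ → ℕ → Set
  SamePosition j a i = ∀ k → k < K → bitsAt (u a) (Fin.toℕ j) k ≡ bitsAt (u i) (Fin.toℕ j) k

  -- Points are numbered from the right: time runs from `n` down to 0, and the earlier end of an
  -- interval has the larger number.
  record Valid : Set where
    field
      nonempty-model : 0 < n
      input   : InputFrom u n w
      zero-positions : ∀ j → Agrees K (bitsAt (u n) (Fin.toℕ {R} j)) 0
      accepts : ∃[ m ] HasLabel (u 0) m × T (final m)
      steps   : ∀ z → z < n → properly (suc z) z next'ᵉ
      visits  : ∀ j a i → a ≤ n → i < a → SamePosition j a i → (∀ i' → i < i' → i' < a → ¬ SamePosition j a i') → properly a i (remembers j)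

  open Valid

  properly⇔ : ∀ {a i} e → i < a → Holds' e a i ⇔ properly a i e
  properly⇔ {a} {i} e lt = mk⇔ (subst P eq) (subst P (sym eq))
    where
    P : Bool → Set
    P b = T (Evaluation.value' K b (u a) (u i) 0 e)
    T-true : ∀ {b} → T b → b ≡ true
    T-true {true} _ = refl
    eq : (i <ᵇ a) ≡ true
    eq = T-true (<⇒<ᵇ lt)

  -- The shortest proper interval with a given left end has length 1, so a rule for proper intervals
  -- is a rule for successive points.
  steps⇔ : ∀ e → Rule' n properᵉ e ⇔ (∀ z → z < n → properly (suc z) z e)
  steps⇔ e = mk⇔
    (λ h z z<n → to (properly⇔ e ≤-refl) (h (suc z) z (s≤s z≤n) z<n (n≤1+n z) (<⇒<ᵇ (≤-refl {suc z})) (λ i' lt _ t → <⇒≱ (<ᵇ⇒< i' (suc z) t) lt)))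
    (λ h a i 0<a a≤n i≤a p first → go h a≤n (≤-antisym (≮⇒≥ λ lt → first (suc i) ≤-refl (<⇒≤ lt) (<⇒<ᵇ lt)) (<ᵇ⇒< i a p)))
    where
    go : ∀ {a i} → (∀ z → z < n → properly (suc z) z e) → a ≤ n → a ≡ suc i → Holds' e a i
    go {i = i} h le refl = from (properly⇔ e ≤-refl) (h i le)

  revisit⇔ : ∀ j a i → Holds' (revisit j) a i ⇔ (i < a × SamePosition j a i)
  revisit⇔ j a i = mk⇔
    (λ t → let lt = <ᵇ⇒< i a (proj₁ (to (and-T (i <ᵇ a) (valueAt a i 0 (sameBits 0 (Fin.toℕ j)))) t))
           in lt , to (Meaning.sameBits-T K (u a) (u i) 0 (Fin.toℕ j)) (proj₂ (to (and-T true _) (to (properly⇔ (revisit j) lt) t))))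
    (λ (lt , s) → from (properly⇔ (revisit j) lt) (from (and-T true _) (tt , from (Meaning.sameBits-T K (u a) (u i) 0 (Fin.toℕ j)) s)))

  visits⇔ : ∀ j → Rule' n (revisit j) (remembers j) ⇔
    (∀ a i → a ≤ n → i < a → SamePosition j a i → (∀ i' → i < i' → i' < a → ¬ SamePosition j a i') → properly a i (remembers j))
  visits⇔ j = mk⇔
    (λ h a i a≤n lt s first → to (properly⇔ (remembers j) lt) (h a i (s≤s z≤n ≤∙ lt) a≤n (<⇒≤ lt) (from (revisit⇔ j a i) (lt , s))
       (λ i' lt' _ t → let lt'' , s' = to (revisit⇔ j a i') t in first i' lt' lt'' s')))
    (λ h a i _ a≤n _ t first → let lt , s = to (revisit⇔ j a i) t in from (properly⇔ (remembers j) lt)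
       (h a i a≤n lt s (λ i' lt' lt'' s' → first i' lt' (<⇒≤ lt'') (from (revisit⇔ j a i') (lt'' , s')))))

  every⇔ : ∀ m (f : Fin m → Scheme false) {a i} → sat u (formulaOf K 0 (everyˢ m f)) a i ⇔ (∀ j → sat u (formulaOf K 0 (f j)) a i)
  every⇔ zero f {a} {i} = mk⇔ (λ _ ()) (λ _ → ⊤ᶠ-holds a i)
  every⇔ (suc m) f = and⇔ (formulaOf K 0 (f zero)) (formulaOf K 0 (everyˢ m (f ∘ suc))) ⟨⇔⟩ ×-⇔ ⇔-id (every⇔ m (f ∘ suc)) ⟨⇔⟩
    mk⇔ (λ { (p , h) zero → p ; (p , h) (suc j) → h j }) (λ h → h zero , h ∘ suc)

  labelled⇔ : ∀ l a i → sat u (formulaOf K 0 (scheme (isLabel rightEnd l))) a i ⇔ HasLabel (u i) l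
  labelled⇔ l a i = scheme⇔ (isLabel rightEnd l) 0 a i ⟨⇔⟩ Meaning.isLabel-T K (u a) (u i) rightEnd l

  input⇔ : sat u (⟨B⟩ ¬′ (⟨B⟩ ⊤ᶠ ∨′ ¬′ inputᶠ K w)) n 0 ⇔ (0 < n × InputFrom u n w)
  input⇔ = left⇔ (inputᶠ K w) n 0 ⟨⇔⟩ ×-⇔ ⇔-id (chain⇔
    (λ b a i → mk⇔ (λ h → to (labelled⇔ (inj₁ (just b)) a i) (stable (formulaOf K 0 (labelˢ (just b))) {a} {i} h)) (λ h nh → nh (from (labelled⇔ (inj₁ (just b)) a i) h)))
    (labelled⇔ (inj₁ nothing)) w n n)

  ends⇔ : 0 < n → sat u (formulaOf K 0 (scheme endsᵉ)) n 0 ⇔ ((∀ j → Agrees K (bitsAt (u n) (Fin.toℕ {R} j)) 0) × ∃[ m ] HasLabel (u 0) m × T (final m))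
  ends⇔ 0<n = scheme⇔ endsᵉ 0 n 0 ⟨⇔⟩ properly⇔ endsᵉ 0<n ⟨⇔⟩ Meaning.endsᵉ-T K (u n) (u 0) 0<K

  rules⇔ : ∀ j → sat u (formulaOf K 0 (rules j)) n 0 ⇔ Rule' n (revisit j) (remembers j)
  rules⇔ j = rule⇔ n (revisit j) (remembers j)

  Parts : Set
  Parts = sat u (⟨B⟩ ¬′ (⟨B⟩ ⊤ᶠ ∨′ ¬′ inputᶠ K w)) n 0 × sat u (formulaOf K 0 (scheme endsᵉ)) n 0 ×
          sat u (formulaOf K 0 (ruleˢ properᵉ next'ᵉ)) n 0 × sat u (formulaOf K 0 (everyˢ R rules)) n 0

  and₃⇔ : ∀ φ (f g h : Scheme false) {a i} → sat u (¬′ (¬′ φ ∨′ ¬′ formulaOf K 0 (f ∧ˢ g ∧ˢ h))) a i ⇔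
          (sat u φ a i × sat u (formulaOf K 0 f) a i × sat u (formulaOf K 0 g) a i × sat u (formulaOf K 0 h) a i)
  and₃⇔ φ f g h = and⇔ φ (formulaOf K 0 (f ∧ˢ g ∧ˢ h)) ⟨⇔⟩ ×-⇔ ⇔-id
    (and⇔ (formulaOf K 0 f) (formulaOf K 0 (g ∧ˢ h)) ⟨⇔⟩ ×-⇔ ⇔-id (and⇔ (formulaOf K 0 g) (formulaOf K 0 h)))

  every-rule⇔ : sat u (formulaOf K 0 (everyˢ R rules)) n 0 ⇔ (∀ j → sat u (formulaOf K 0 (rules j)) n 0)
  every-rule⇔ = every⇔ R rules {n} {0}

  next-rule⇔ : sat u (formulaOf K 0 (ruleˢ properᵉ next'ᵉ)) n 0 ⇔ (∀ z → z < n → properly (suc z) z next'ᵉ)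
  next-rule⇔ = rule⇔ n properᵉ next'ᵉ ⟨⇔⟩ steps⇔ next'ᵉ

  parts-valid : Parts → Valid
  parts-valid (i , e , s , v) = record
    { nonempty-model = proj₁ (to input⇔ i) ; input = proj₂ (to input⇔ i)
    ; zero-positions = proj₁ (to (ends⇔ (proj₁ (to input⇔ i))) e) ; accepts = proj₂ (to (ends⇔ (proj₁ (to input⇔ i))) e)
    ; steps = to next-rule⇔ s ; visits = λ j → to (visits⇔ j) (to (rules⇔ j) (to every-rule⇔ v j)) }

  valid-parts : Valid → Parts
  valid-parts g = from input⇔ (nonempty-model g , input g) , from (ends⇔ (nonempty-model g)) (zero-positions g , accepts g) ,
    from next-rule⇔ (steps g) , from every-rule⇔ (λ j → from (rules⇔ j) (from (visits⇔ j) (visits g j)))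

  reduction-parts : sat u (reductionᶠ K w) n 0 ⇔ Parts
  reduction-parts = and₃⇔ (⟨B⟩ ¬′ (⟨B⟩ ⊤ᶠ ∨′ ¬′ inputᶠ K w)) (scheme endsᵉ) (ruleˢ properᵉ next'ᵉ) (everyˢ R rules) {n} {0}

  reduction⇔ : sat u (reductionᶠ K w) n 0 ⇔ Valid
  reduction⇔ = reduction-parts ⟨⇔⟩ mk⇔ parts-valid valid-parts

-- Correctness of the reduction.

vec-ext : ∀ {A : Set} {n} (xs ys : Vec A n) → (∀ j → lookup xs j ≡ lookup ys j) → xs ≡ ys
vec-ext [] [] h = refl
vec-ext (x ∷ xs) (y ∷ ys) h = cong₂ _∷_ (h zero) (vec-ext xs ys (h ∘ suc))

onFin : ∀ {A : Set} {n} → (Fin n → A) → A → ℕ → A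
onFin {n = zero} f d j       = d
onFin {n = suc n} f d zero    = f zero
onFin {n = suc n} f d (suc j) = onFin (f ∘ suc) d j

onFin-toℕ : ∀ {A : Set} {n} (f : Fin n → A) d j → onFin f d (Fin.toℕ j) ≡ f j
onFin-toℕ f d zero    = refl
onFin-toℕ f d (suc j) = onFin-toℕ (f ∘ suc) d j

-- Inverts the letter codes digit by digit: leading 1s count up the bit index, then 2 followed by 1s
-- names a head and 22 followed by 1s a label.
letterValue : ℕ → (ℕ → ℕ → Bool) → ℕᵇ → ℕ → Bool
letterValue l β zero i = false
letterValue l β 1+[2 b ] i = letterValue l β b (suc i)
letterValue l β 2[1+ 2[1+ b ] ] i = countOnes b ≡ᵇ l
letterValue l β 2[1+ b ] i = β (countOnes b) i

letterValue-bit : ∀ l β j i → letterValue l β (bitCode j i) 0 ≡ β j i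
letterValue-bit l β j i = go i 0 ∙ cong (β j) (+-identityʳ i)
  where
  tail : ∀ j k → letterValue l β 2[1+ iterate₁ j zero ] k ≡ β j k
  tail zero k = refl
  tail (suc j) k = cong (λ c → β (suc c) k) (countOnes-iterate₁ j)
  go : ∀ i k → letterValue l β (bitCode j i) k ≡ β j (i + k)
  go zero k = tail j k
  go (suc i) k = go i (suc k) ∙ cong (β j) (+-suc i k)

module Reduction (𝕄 : Machine) (w : List Bool) (K S M : ℕ) (0<K : 0 < K) (M≡2^K : M ≡ 2 ^ K) (M≡S+S : M ≡ S + S)
                 (bounded : ∀ n c → Run 𝕄 n (initial 𝕄 w) c → space 𝕄 c ≤ S) where

  open Machine 𝕄
  open Constraints 𝕄
  open Derived'
  open Computation 𝕄 w K S M M≡2^K M≡S+S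
  open Bounded bounded
  open LastVisit

  0<M : 0 < M
  0<M = s≤s z≤n ≤∙ S<M 0<S

  undefined⇔ : ∀ c → T (final (simulation c)) ⇔ (step 𝕄 c ≡ nothing × Accepting 𝕄 c)
  undefined⇔ (q , ts) with δ q (Vec.map head ts)
  ... | nothing = mk⇔ (refl ,_) proj₂
  ... | just _  = mk⇔ (λ ()) (λ ())

  proceeds-step : ∀ c {q} → T (proceeds (δ (proj₁ c) (Vec.map head (proj₂ c))) q) → ∃[ c' ] step 𝕄 c ≡ just c' × proj₁ c' ≡ q
  proceeds-step (q , ts) t with δ q (Vec.map head ts)
  ... | just (q' , as) = _ , refl , toWitness t

  step-proceeds : ∀ c {c'} → step 𝕄 c ≡ just c' → T (proceeds (δ (proj₁ c) (Vec.map head (proj₂ c))) (proj₁ c'))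
  step-proceeds (q , ts) eq with δ q (Vec.map head ts) | eq
  ... | just (q' , as) | refl = fromWitness refl

  data Phase (t : ℕ) : Set where
    sweeping   : suc t < M → Phase t
    turning    : suc t ≡ M → Phase t
    simulating : ∀ s → t ≡ M + s → Phase t

  phase : ∀ t → Phase t
  phase t with suc t <? M
  ... | yes lt = sweeping lt
  ... | no nlt with suc t ≟ M
  ... | yes eq = turning eq
  ... | no neq = simulating (t ∸ M) (sym (m+[n∸m]≡n (s≤s⁻¹ (≤∧≢⇒< (≮⇒≥ nlt) (neq ∘ sym)))))

  label-start : ∀ {t} → suc t ≡ M → label (suc t) ≡ simulation (config 0)
  label-start eq = cong label (eq ∙ sym (+-identityʳ M)) ∙ label-simulation 0

  label-next : ∀ {t} s → t ≡ M + s → label (suc t) ≡ simulation (config (suc s))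
  label-next s refl = cong label (sym (+-suc M s)) ∙ label-simulation (suc s)

  -- Only the simulation moves heads to the left, and it never reaches cell 0.
  position-pos : ∀ {t} → (∀ s → t ≡ M + s → Alive s) → ∀ j → moves (label t) j ≡ left → 0 < position j t
  position-pos {t} alive j eq with t <? M
  ... | yes lt = contradiction (sym (cong (λ l → moves l j) (label-sweep lt)) ∙ eq) λ ()
  ... | no nlt = subst (λ t → 0 < position j t) t≡ (near-pos (position-near (t ∸ M) (alive (t ∸ M) (sym t≡)) j))
    where
    t≡ : M + (t ∸ M) ≡ t
    t≡ = m+[n∸m]≡n (≮⇒≥ nlt)

  module Model' (u : ℕ → Letter → Bool) (n : ℕ) where

    open Conditions 𝕄 w K 0<K u n public
    open Valid

    record Shows (z t : ℕ) : Set where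
      field
        has-label : HasLabel (u z) (label t)
        positions : ∀ j → Agrees K (bitsAt (u z) (Fin.toℕ j)) (position j t)

    open Shows

    ones⇔ : ∀ {z t} → Shows z t → suc t ≤ M → (∀ i → i < K → T (bitsAt (u z) 0 i)) ⇔ (suc t ≡ M)
    ones⇔ {z} {t} sh t<M = mk⇔
      (λ h → ones-last K (λ i lt → subst T (eq i lt) (h i lt)) (t<M ≤∙≡ M≡2^K) ∙ sym M≡2^K)
      (λ t≡ i lt → subst T (sym (eq i lt)) (last-ones K (t≡ ∙ M≡2^K) i lt))
      where
      eq : ∀ i → i < K → bitsAt (u z) 0 i ≡ bitOf t i
      eq i lt = positions sh zero i (<⇒≤ lt) ∙ cong (λ x → bitOf x i) (position-sweep zero (<⇒≤ t<M))

    same⇔ : ∀ {z t z' t'} → Shows z t → Shows z' t' → ∀ j → SamePosition j z z' ⇔ (position j t ~ position j t')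
    same⇔ sh sh' j = mk⇔ (λ h k lt → sym (positions sh j k (<⇒≤ lt)) ∙ h k lt ∙ positions sh' j k (<⇒≤ lt))
      (λ h k lt → positions sh j k (<⇒≤ lt) ∙ h k lt ∙ sym (positions sh' j k (<⇒≤ lt)))

    input-label : ∀ {z v} → InputFrom u z v →
                  ∀ t z' → t + z' ≡ z → t ≤ length v → HasLabel (u z') (inj₁ (top (drop t v)))
    input-label {v = []} h zero z' refl _ = h
    input-label {v = b ∷ v} h zero z' refl _ = proj₁ h
    input-label {v = b ∷ v} (_ , _ , eq , h) (suc t) z' refl (s≤s le) = input-label h t z' (suc-injective eq) le

    module Sound (valid : Valid) where

      record Progress (T' : ℕ) : Set where
        field
          shows : ∀ t z → t + z ≡ n → t ≤ T' → Shows z t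
          alive : ∀ s → T' ≡ M + s → Alive s

      open Progress

      -- The symbols in the label of a point are guessed by the model. The last visit to the cell
      -- under head `j` belongs to an earlier point already identified, and no point in between has
      -- this address; so `visits` applies, and the symbol written there is by `memory-reads` the
      -- one under the head.
      reads-memory : ∀ {T' s} → Progress T' → Alive s → suc T' ≡ M + s → ∀ {z q h} → suc T' + z ≡ n → HasLabel (u z) (inj₂ (q , h)) →
                     (∀ j → Agrees K (bitsAt (u z) (Fin.toℕ j)) (position j (suc T'))) → h ≡ Vec.map head (proj₂ (config s))
      reads-memory {T'} {s} pr al eq {z} {q} {h} z≡ hl ag = vec-ext h _ λ j →
        let v , written = memory-reads s al j
            t<T : time v ≤ T'
            t<T = s≤s⁻¹ (earlier v ≤∙≡ sym eq)
            a = n ∸ time v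
            a≡ : time v + a ≡ n
            a≡ = m+[n∸m]≡n (t<T ≤∙ n≤1+n T' ≤∙ m≤m+n (suc T') z ≤∙≡ z≡)
            sh = shows pr (time v) a a≡ t<T
            z<a : z < a
            z<a = +-cancelˡ-< (time v) z a (+-monoˡ-< z (s≤s t<T) ≤∙≡ z≡ ∙ sym a≡)
            here' : SamePosition j a z
            here' k lt = positions sh j k (<⇒≤ lt) ∙ same v k lt ∙ cong (λ t → bitOf (position j t) k) (sym eq) ∙ sym (ag j k (<⇒≤ lt))
            first : ∀ i' → z < i' → i' < a → ¬ SamePosition j a i'
            first i' lt lt' sp =
              let t' = n ∸ i'
                  i'≤n = (<⇒≤ lt') ≤∙ m∸n≤m n (time v)
                  t'≡ : t' + i' ≡ n
                  t'≡ = m∸n+n≡m i'≤n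
                  t'≤T : t' ≤ T'
                  t'≤T = s≤s⁻¹ (+-cancelʳ-< z t' (suc T') (+-monoʳ-< t' lt ≤∙≡ t'≡ ∙ sym z≡))
                  v<t' : time v < t'
                  v<t' = +-cancelʳ-< i' (time v) t' (+-monoʳ-< (time v) lt' ≤∙≡ a≡ ∙ sym t'≡)
                  sp' = to (same⇔ sh (shows pr t' i' t'≡ t'≤T) j) sp
              in last v t' v<t' (s≤s t'≤T ≤∙≡ eq) (λ k lt → sym (sp' k lt) ∙ same v k lt)
            m , m' , hm , hm' , ok = to (Meaning.remembers-T K (u a) (u z) j) (visits valid j a z (m∸n≤m n (time v)) z<a here' first)
        in consistent-reads j {m} {m'} {label (time v)} (HasLabel-unique {u a} {m} hm (has-label sh)) (HasLabel-unique {u z} {m'} {inj₂ (q , h)} hm' hl) ok ∙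
             written ∙ sym (heads (proj₂ (config s)) j)
        where
        consistent-reads : ∀ j {m m' l} → m ≡ l → m' ≡ inj₂ (q , h) → T (consistent j m m') → lookup h j ≡ writes l j
        consistent-reads j refl refl t = sym (index-injective symbols (toWitness t))

      -- `next'ᵉ` settles the kind of the new label, its state and the head positions. Only then are
      -- the addresses available from which the symbols read are inferred.
      advance' : ∀ {T'} → suc T' ≤ n → Progress T' → Progress (suc T')
      advance' {T'} T<n pr = record
        { shows = λ t z eq le → case m≤n⇒m<n∨m≡n le of λ { (inj₁ lt) → shows pr t z eq (s≤s⁻¹ lt) ; (inj₂ refl) → at-end z eq }
        ; alive = proj₂ next-label }
        where
        z₀ : ℕ
        z₀ = n ∸ suc T'
        z₀≡ : suc T' + z₀ ≡ n
        z₀≡ = m+[n∸m]≡n T<n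
        sh : Shows (suc z₀) T'
        sh = shows pr T' (suc z₀) (+-suc T' z₀ ∙ z₀≡) ≤-refl
        z₀<n : z₀ < n
        z₀<n = s≤s (m≤n+m z₀ T') ≤∙≡ z₀≡
        open Meaning K (u (suc z₀)) (u z₀)
        Successor : Label → Set
        Successor l = HasLabel (u z₀) l × Adjacent (label T') l
        found : ∃[ l ] Successor l × (∀ j → properly (suc z₀) z₀ (update (moves (label T') j) (Fin.toℕ j)))
        found = let m , m' , h , h' , a , t = to next-T (steps valid z₀ z₀<n)
                    m≡ = HasLabel-unique {u (suc z₀)} {m} {label T'} h (has-label sh)
                in m' , (h' , subst (λ m → Adjacent m m') {m} {label T'} m≡ a) , subst (λ m → ∀ j → properly (suc z₀) z₀ (update (moves m j) (Fin.toℕ j))) {m} {label T'} m≡ t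
        agree : ∀ j → Agrees K (bitsAt (u z₀) (Fin.toℕ j)) (position j (suc T'))
        agree j = update-sound 0<K (moves (label T') j) (Fin.toℕ j) (position-pos (alive pr) j) (positions sh j) (proj₂ (proj₂ found) j)
        memory' : ∀ {s q h} → Alive s → suc T' ≡ M + s → HasLabel (u z₀) (inj₂ (q , h)) → h ≡ Vec.map head (proj₂ (config s))
        memory' al eq hl = reads-memory pr al eq z₀≡ hl agree
        Outcome : Label → Set
        Outcome l' = l' ≡ label (suc T') × (∀ s → suc T' ≡ M + s → Alive s)
        follows-input : ∀ {s} → HasLabel (u z₀) (inj₁ s) → T (follows (top (drop T' w)) s) → s ≡ top (drop (suc T') w)
        follows-input {s} hl t with suc T' ≤? length w
        ... | yes le = inj₁-injective (HasLabel-unique {u z₀} {inj₁ s} {inj₁ (top (drop (suc T') w))} hl (input-label {n} {w} (input valid) (suc T') z₀ z₀≡ le))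
        ... | no nle = ends (drop-beyond w (s≤s⁻¹ (≰⇒> nle))) t ∙ sym (drop-beyond w (<⇒≤ (≰⇒> nle)))
          where
          ends : ∀ {a s} → a ≡ nothing → T (follows a s) → s ≡ nothing
          ends {s = nothing} refl _ = refl
        sweep : suc T' < M → ∀ m → HasLabel (u z₀) m → Adjacent (inj₁ (top (drop T' w))) m → Outcome m
        sweep lt (inj₂ (q , _)) hl (ones , _) = contradiction (to (ones⇔ sh (<⇒≤ lt)) ones) (<⇒≢ lt)
        sweep lt (inj₁ s) hl (_ , fol) = cong inj₁ (follows-input hl fol) ∙ sym (label-sweep lt) ,
          λ s' eq → contradiction (lt ≤∙ m≤m+n M s') (<-irrefl eq)
        turn : suc T' ≡ M → ∀ m → HasLabel (u z₀) m → Adjacent (inj₁ (top (drop T' w))) m → Outcome m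
        turn T≡ (inj₁ s) hl (nones , _) = contradiction (from (ones⇔ sh (≤-reflexive T≡)) T≡) nones
        turn T≡ (inj₂ (q , h)) hl (_ , q≡) =
          cong inj₂ (cong₂ _,_ q≡ (memory' (λ _ ()) (T≡ ∙ sym (+-identityʳ M)) hl)) ∙ sym (label-start T≡) ,
          λ s eq → subst Alive (+-cancelˡ-≡ M 0 s (+-identityʳ M ∙ sym T≡ ∙ eq)) (λ _ ())
        simulate' : ∀ s → T' ≡ M + s → ∀ m → HasLabel (u z₀) m → Adjacent (simulation (config s)) m → Outcome m
        simulate' s T≡ (inj₂ (q , h)) hl t =
          let c' , st , q≡ = proceeds-step (config s) t
              al = Alive-suc (alive pr s T≡) st
              T≡' = cong suc T≡ ∙ sym (+-suc M s)
          in cong inj₂ (cong₂ _,_ (sym q≡ ∙ cong proj₁ (just-injective (sym st ∙ al s ≤-refl))) (memory' al T≡' hl)) ∙ sym (label-next s T≡) ,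
             λ s' eq → subst Alive (+-cancelˡ-≡ M (suc s) s' (sym T≡' ∙ eq)) al
        next-result : Phase T' → ∀ m → HasLabel (u z₀) m → Adjacent (label T') m → Outcome m
        next-result (sweeping lt) m hl adj = sweep lt m hl (subst (λ l → Adjacent l m) (label-sweep (<⇒≤ lt)) adj)
        next-result (turning eq) m hl adj = turn eq m hl (subst (λ l → Adjacent l m) (label-sweep (≤-reflexive eq)) adj)
        next-result (simulating s eq) m hl adj = simulate' s eq m hl (subst (λ l → Adjacent l m) (cong label eq ∙ label-simulation s) adj)
        next-label : Outcome (proj₁ found)
        next-label = next-result (phase T') (proj₁ found) (proj₁ (proj₁ (proj₂ found))) (proj₂ (proj₁ (proj₂ found)))
        at-end : ∀ z → suc T' + z ≡ n → Shows z (suc T')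
        at-end z eq with refl ← +-cancelˡ-≡ (suc T') z₀ z (z₀≡ ∙ sym eq) =
          record { has-label = subst (HasLabel (u z₀)) (proj₁ next-label) (proj₁ (proj₁ (proj₂ found))) ; positions = agree }

      progress : ∀ t → t ≤ n → Progress t
      progress zero _ = record
        { shows = λ { zero z refl _ → record
            { has-label = subst (HasLabel (u n)) (sym (label-sweep 0<M)) (input-label {n} {w} (input valid) 0 n refl z≤n) ; positions = zero-positions valid } }
        ; alive = λ s eq → contradiction (0<M ≤∙ m≤m+n M s) (<-irrefl eq) }
      progress (suc t) lt = advance' lt (progress t (<⇒≤ lt))

      halting : ∃[ s ] ∃[ c ] HaltsIn 𝕄 s w c × Accepting 𝕄 c
      halting = go (n <? M)
        where
        sh : Shows 0 n
        sh = shows (progress n ≤-refl) n 0 (+-identityʳ n) ≤-refl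
        final-label : T (final (label n))
        final-label = let m , h , t = accepts valid in subst (T ∘ final) {m} {label n} (HasLabel-unique {u 0} {m} {label n} h (has-label sh)) t
        go : Dec (n < M) → ∃[ s ] ∃[ c ] HaltsIn 𝕄 s w c × Accepting 𝕄 c
        go (yes lt) = ⊥-elim (subst (T ∘ final) {label n} (label-sweep lt) final-label)
        go (no nlt) = s , config s , (Alive-run s (alive (progress n ≤-refl) s n≡) , proj₁ halted') , proj₂ halted'
          where
          s : ℕ
          s = n ∸ M
          n≡ : n ≡ M + s
          n≡ = sym (m+[n∸m]≡n (≮⇒≥ nlt))
          halted' : step 𝕄 (config s) ≡ nothing × Accepting 𝕄 (config s)
          halted' = to (undefined⇔ (config s)) (subst (T ∘ final) {label n} (cong label n≡ ∙ label-simulation s) final-label)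

  Alive-≤ : ∀ {s s'} → s ≤ s' → Alive s' → Alive s
  Alive-≤ le alive s'' lt = alive s'' (lt ≤∙ le)

  follows-drop : ∀ v t → T (follows (top (drop t v)) (top (drop (suc t) v)))
  follows-drop [] zero    = tt
  follows-drop [] (suc t) = tt
  follows-drop (b ∷ v) zero    = tt
  follows-drop (b ∷ v) (suc t) = follows-drop v t

  module Complete (m : ℕ) (alive : Alive m) (fin : T (final (simulation (config m)))) where

    n : ℕ
    n = M + m

    traceWord : ℕ → Letter → Bool
    traceWord z p = letterValue (code (label (n ∸ z))) (λ j → bitOf (onFin (λ j → position j (n ∸ z)) 0 j)) (fromℕ p) 0

    open Model' traceWord n
    open Shows

    word-at : ∀ {t z} → t + z ≡ n → ∀ b → traceWord z (toℕ b) ≡ letterValue (code (label t)) (λ j → bitOf (onFin (λ j → position j t) 0 j)) b 0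
    word-at {t} {z} eq b = cong₂ (λ t b → letterValue (code (label t)) (λ j → bitOf (onFin (λ j → position j t) 0 j)) b 0)
      (cong (_∸ z) (sym eq) ∙ m+n∸n≡m t z) (fromℕ-toℕ b)

    shows : ∀ {t z} → t + z ≡ n → Shows z t
    shows {t} {z} eq = record
      { has-label = subst T (sym (label-at (code (label t)))) (≡⇒≡ᵇ (code (label t)) (code (label t)) refl) ,
          λ k lt h → <⇒≢ lt (≡ᵇ⇒≡ k (code (label t)) (subst T (label-at k) h))
      ; positions = λ j i _ → word-at eq (bitCode (Fin.toℕ j) i) ∙ letterValue-bit (code (label t)) (λ j → bitOf (onFin (λ j → position j t) 0 j)) (Fin.toℕ j) i ∙
          cong (λ x → bitOf x i) (onFin-toℕ (λ j → position j t) 0 j) }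
      where
      label-at : ∀ k → traceWord z (labelLetter k) ≡ (k ≡ᵇ code (label t))
      label-at k = word-at eq (labelCode k) ∙ cong (_≡ᵇ code (label t)) (countOnes-iterate₁ k)

    input-chain : ∀ v {t z} → t + z ≡ n → drop t w ≡ v → length v + t < M →
                  InputFrom traceWord z v
    input-chain [] {t} {z} eq d lt = subst (HasLabel (traceWord z)) (label-sweep lt ∙ cong (inj₁ ∘ top) d) (has-label (shows eq))
    input-chain (b ∷ v) {t} {zero} eq d lt = contradiction (eq' ≡∙≤ m≤n+m t (length v)) (<⇒≱ ((<⇒≤ lt) ≤∙ m≤m+n M m))
      where
      eq' : n ≡ t
      eq' = sym (sym (+-identityʳ t) ∙ eq)
    input-chain (b ∷ v) {t} {suc z} eq d lt =
      subst (HasLabel (traceWord (suc z))) (label-sweep (s≤s (m≤n+m t (suc (length v))) ≤∙ lt) ∙ cong (inj₁ ∘ top) d) (has-label (shows eq)) ,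
      z , refl , input-chain v (sym (+-suc t z) ∙ eq) (cong (λ k → drop k w) (+-comm 1 t) ∙ sym (drop-drop t 1 w) ∙ cong (drop 1) d)
        (s≤s (≤-reflexive (+-suc (length v) t)) ≤∙ lt)

    step-valid : ∀ z → z < n → properly (suc z) z next'ᵉ
    step-valid z z<n = from next-T (label t , label (suc t) , has-label sh , has-label sh' , adjacency (phase t) ,
      λ j → update-complete (moves (label t) j) (Fin.toℕ j) (position-pos alive-t j) (positions sh j) (positions sh' j))
      where
      open Meaning K (traceWord (suc z)) (traceWord z)
      t : ℕ
      t = n ∸ suc z
      t≡ : suc t + z ≡ n
      t≡ = sym (+-suc t z) ∙ m∸n+n≡m z<n
      sh : Shows (suc z) t
      sh = shows (m∸n+n≡m z<n)
      sh' : Shows z (suc t)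
      sh' = shows t≡
      s<m : ∀ {s} → t ≡ M + s → s < m
      s<m {s} eq = +-cancelˡ-< M s m (cong suc (sym eq) ≡∙≤ m≤m+n (suc t) z ≤∙≡ t≡)
      alive-t : ∀ s → t ≡ M + s → Alive s
      alive-t s eq = Alive-≤ (<⇒≤ (s<m eq)) alive
      adjacency : Phase t → Adjacent (label t) (label (suc t))
      adjacency (sweeping lt) = subst₂ Adjacent (sym (label-sweep (<⇒≤ lt))) (sym (label-sweep lt))
        ((λ ones → <⇒≢ lt (to (ones⇔ sh (<⇒≤ lt)) ones)) , follows-drop w t)
      adjacency (turning eq) = subst₂ Adjacent (sym (label-sweep (≤-reflexive eq))) (sym (label-start eq)) (from (ones⇔ sh (≤-reflexive eq)) eq , refl)
      adjacency (simulating s eq) = subst₂ Adjacent (sym (cong label eq ∙ label-simulation s)) (sym (label-next s eq))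
        (step-proceeds (config s) (alive s (s<m eq)))

    -- The left end of the interval is itself a last visit, so by `last-unique` it is the one whose
    -- written symbol `memory-reads` compares with the tape.
    visit-valid : ∀ j a i → a ≤ n → i < a → SamePosition j a i → (∀ i' → i < i' → i' < a → ¬ SamePosition j a i') → properly a i (remembers j)
    visit-valid j a i a≤n i<a sp first = from (Meaning.remembers-T K (traceWord a) (traceWord i) j) (label t , label t' , has-label sh , has-label sh' , consistency (t' <? M))
      where
      t t' : ℕ
      t = n ∸ a
      t' = n ∸ i
      i≤n : i ≤ n
      i≤n = (<⇒≤ i<a) ≤∙ a≤n
      sh : Shows a t
      sh = shows (m∸n+n≡m a≤n)
      sh' : Shows i t'
      sh' = shows (m∸n+n≡m i≤n)
      same' : position j t ~ position j t'
      same' = to (same⇔ sh sh' j) sp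
      v : LastVisit j t' (position j t')
      v = visit t (∸-monoʳ-< i<a a≤n) same' λ t'' lt lt' c →
        let t''≤n = (<⇒≤ lt') ≤∙ m∸n≤m n i
        in first (n ∸ t'') (cong suc (sym (m∸[m∸n]≡n i≤n)) ≡∙≤ ∸-monoʳ-< lt' (m∸n≤m n i))
             (∸-monoʳ-< lt t''≤n ≤∙≡ m∸[m∸n]≡n a≤n)
             (from (same⇔ {a} {t} {n ∸ t''} {t''} sh (shows (m+[n∸m]≡n t''≤n)) j) (λ k lt → same' k lt ∙ sym (c k lt)))
      consistency : Dec (t' < M) → T (consistent j (label t) (label t'))
      consistency (yes lt) = subst (T ∘ consistent j (label t)) (sym (label-sweep lt)) tt
      consistency (no nlt) = subst (T ∘ consistent j (label t)) (sym (cong label (sym t'≡) ∙ label-simulation s))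
        (fromWitness (cong (index') (written (memory-reads s (Alive-≤ s≤m alive) j))))
        where
        index' = Finite.index symbols
        s : ℕ
        s = t' ∸ M
        t'≡ : M + s ≡ t'
        t'≡ = m+[n∸m]≡n (≮⇒≥ nlt)
        s≤m : s ≤ m
        s≤m = +-cancelˡ-≤ M s m (t'≡ ≡∙≤ m∸n≤m n i)
        time-subst : ∀ {x} (eq : t' ≡ x) → time (subst (λ x → LastVisit j x (position j x)) eq v) ≡ t
        time-subst refl = refl
        written : ∃[ v' ] writes (label (time {j} {M + s} {position j (M + s)} v')) j ≡ head (tapeAt j s) →
                  writes (label t) j ≡ lookup (Vec.map head (proj₂ (config s))) j
        written (v' , eq) = cong (λ x → writes (label x) j) (sym (time-subst (sym t'≡)) ∙ last-unique (subst (λ x → LastVisit j x (position j x)) (sym t'≡) v) v') ∙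
          eq ∙ sym (heads (proj₂ (config s)) j)

    valid : Valid
    valid = record
      { nonempty-model = 0<M ≤∙ m≤m+n M m
      ; input = input-chain w refl refl (s≤s (≤-reflexive (+-identityʳ (length w))) ≤∙ s≤s length-w ≤∙ S<M 0<S)
      ; zero-positions = λ j → positions (shows {0} {n} refl) j
      ; accepts = simulation (config m) , subst (HasLabel (traceWord 0)) (label-simulation m) (has-label (shows (+-identityʳ n))) , fin
      ; steps = step-valid ; visits = visit-valid }

-- Printing the formula in polynomial time.

open Semantics {6} (λ _ → ⊤) public

pattern outputStack = zero
pattern inputStack  = suc zero
pattern sizeStack   = suc (suc zero)
pattern boundStack  = suc (suc (suc zero))
pattern indexStack  = suc (suc (suc (suc zero)))
pattern spareStack  = suc (suc (suc (suc (suc zero))))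

Runs : Prog 6 → ℕ → Store 6 → Store 6 → Set
Runs P t σ σ' = ∃[ s ] s ≤ t × Exec P s σ σ'

infixr 5 _»_
_»_ : ∀ {P Q s t σ σ' σ''} → Runs P s σ σ' → Runs Q t σ' σ'' → Runs (P ⨾ Q) (s + t) σ σ''
(_ , s≤ , e) » (_ , t≤ , f) = _ , +-mono-≤ s≤ t≤ , e ⨾ f

runs-push : ∀ {i b σ} → Runs (push i b) 2 σ (updateAt σ i (b ∷_))
runs-push = _ , ≤-refl , push tt

runs-pop : ∀ {i σ} → Runs (pop i) 1 σ (updateAt σ i (List.drop 1))
runs-pop = _ , ≤-refl , pop

runs-≤ : ∀ {P s t σ σ'} → s ≤ t → Runs P s σ σ' → Runs P t σ σ'
runs-≤ le (_ , s≤ , e) = _ , s≤ ≤∙ le , e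

oneMore : ∀ {a P c t σ σ' σ''} → nonempty (top (lookup σ a)) ≡ true → Runs P c σ σ' → Runs (while a nonempty P) (1 + t * suc c) σ' σ'' →
        Runs (while a nonempty P) (1 + suc t * suc c) σ σ''
oneMore {c = c} {t} eq (_ , s≤ , e) (_ , t≤ , f) = _ , s≤s (+-mono-≤ s≤ t≤ ≤∙≡ +-suc c (t * suc c)) , repeat eq e f

-- One stack counts the remaining m rounds; k rounds are finished.
loopᴺ : ∀ {a P c} (σ : ℕ → ℕ → Store 6) N → (∀ m k → nonempty (top (lookup (σ (suc m) k) a)) ≡ true) → (∀ k → nonempty (top (lookup (σ 0 k) a)) ≡ false) →
       (∀ m k → suc m + k ≡ N → Runs P c (σ (suc m) k) (σ m (suc k))) → Runs (while a nonempty P) (1 + N * suc c) (σ N 0) (σ 0 N)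
loopᴺ {a} {P} {c} σ N full empty body = go N 0 (+-identityʳ N)
  where
  go : ∀ m k → m + k ≡ N → Runs (while a nonempty P) (1 + m * suc c) (σ m k) (σ 0 N)
  go zero k refl = 1 , ≤-refl , stop (empty k)
  go (suc m) k eq   = oneMore {t = m} (full m k) (body m k eq) (go m (suc k) (+-suc m k ∙ eq))

loopᴸ : ∀ {a P c} (σ : List Bool → List Bool → Store 6) zs → (∀ xs ys → lookup (σ xs ys) a ≡ xs) →
        (∀ b xs ys → (b ∷ xs) ʳ++ ys ≡ zs → Runs P c (σ (b ∷ xs) ys) (σ xs (b ∷ ys))) →
        ∀ xs ys → xs ʳ++ ys ≡ zs → Runs (while a nonempty P) (1 + length xs * suc c) (σ xs ys) (σ [] zs)
loopᴸ σ zs at-a body [] ys refl = 1 , ≤-refl , stop (cong (nonempty ∘ top) (at-a [] ys))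
loopᴸ σ zs at-a body (b ∷ xs) ys eq   = oneMore {t = length xs} (cong (nonempty ∘ top) (at-a (b ∷ xs) ys)) (body b xs ys eq) (loopᴸ σ zs at-a body xs (b ∷ ys) eq)

isTrue : Maybe Bool → Bool
isTrue (just true) = true
isTrue _           = false

emitBits : List Bool → Prog 6
emitBits []       = skip
emitBits (b ∷ bs) = emitBits bs ⨾ push outputStack b

emitCost : List Bool → ℕ
emitCost []       = 1
emitCost (b ∷ bs) = emitCost bs + 2

runs-emitBits : ∀ bs {o ρ} → Runs (emitBits bs) (emitCost bs) (o ∷ ρ) ((bs ++ o) ∷ ρ)
runs-emitBits []       = _ , ≤-refl , skip
runs-emitBits (b ∷ bs) = runs-emitBits bs » runs-push

emit : List Token → Prog 6
emit = emitBits ∘ word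

cost₀ : List Token → ℕ
cost₀ = emitCost ∘ word

runs-emit : ∀ ts {o ρ} → Runs (emit ts) (cost₀ ts) (o ∷ ρ) ((word ts ++ o) ∷ ρ)
runs-emit ts = runs-emitBits (word ts)

iterate₁-+ : ∀ i s b → iterate₁ (i + s) b ≡ iterate₁ i (iterate₁ s b)
iterate₁-+ zero s b = refl
iterate₁-+ (suc i) s b = cong 1+[2_] (iterate₁-+ i s b)

encode-letter : ∀ c o → word (digits c) ++ o ≡ encode (` toℕ c) ++ o
encode-letter c o = cong (λ b → word (digits b) ++ o) (sym (fromℕ-toℕ c))

encode-or : ∀ φ ψ o → bits or ++ (encode φ ++ (encode ψ ++ o)) ≡ encode (φ ∨′ ψ) ++ o
encode-or φ ψ o = cong (bits or ++_) (sym (++-assoc (encode φ) (encode ψ) o) ∙ cong (_++ o) (sym (concatMap-++ bits (tokens φ) (tokens ψ))))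

ones : ℕ → List Bool
ones n = replicate n true

-- The programs write their output from right to left.
bitProg : ℕ → ℕ → Prog 6
bitProg j s = emit (digits (iterate₁ s 2[1+ iterate₁ j zero ])) ⨾ while indexStack nonempty (emit (digit1 ∷ []) ⨾ pop indexStack ⨾ push spareStack true) ⨾
              while spareStack nonempty (pop spareStack ⨾ push indexStack true)

allRound : Scheme true → Prog 6
write : ∀ {b} → Scheme b → Prog 6

allRound e = emit (neg ∷ []) ⨾ write e ⨾ emit (neg ∷ or ∷ neg ∷ []) ⨾ pop boundStack ⨾ push indexStack true

write (letterˢ c)    = emit (digits c)
write (bitˢ j s)     = bitProg j s
write (¬ˢ e)         = write e ⨾ emit (neg ∷ [])
write (e ∨ˢ f)       = write f ⨾ write e ⨾ emit (or ∷ [])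
write (Aˢ e)         = write e ⨾ emit (diaA ∷ [])
write (Bˢ e)         = write e ⨾ emit (diaB ∷ [])
write (allˢ e)       = emit (tokens ⊤ᶠ) ⨾
  while boundStack nonempty (allRound e) ⨾
  while indexStack nonempty (pop indexStack ⨾ push boundStack true)

allCost : Scheme true → ℕ → ℕ
cost : ∀ {b} → Scheme b → ℕ → ℕ

allCost e K = cost₀ (neg ∷ []) + (cost e K + (cost₀ (neg ∷ or ∷ neg ∷ []) + 3))

cost (letterˢ c) K = cost₀ (digits c)
cost (bitˢ j s) K = cost₀ (digits (iterate₁ s 2[1+ iterate₁ j zero ])) + ((1 + K * suc (cost₀ (digit1 ∷ []) + 3)) + (1 + K * 4))
cost (¬ˢ e) K = cost e K + cost₀ (neg ∷ [])
cost (e ∨ˢ f) K = cost f K + (cost e K + cost₀ (or ∷ []))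
cost (Aˢ e) K = cost e K + cost₀ (diaA ∷ [])
cost (Bˢ e) K = cost e K + cost₀ (diaB ∷ [])
cost (allˢ e) K = cost₀ (tokens ⊤ᶠ) + ((1 + K * suc (allCost e K)) + (1 + K * 4))

module Writing (K : ℕ) (ν : List Bool) where

  state : List Bool → List Bool → ℕ → ℕ → Store 6
  state w o m k = o ∷ w ∷ ν ∷ ones m ∷ ones k ∷ [] ∷ []

  -- Outside `allˢ` the index stack is empty, ready to count the rounds; inside it holds the current
  -- index in unary.
  Fits' : Bool → ℕ → ℕ → Set
  Fits' false m k = m ≡ K × k ≡ 0
  Fits' true m k = k ≤ K

  -- The part of the code that does not depend on `k` is pushed first. The `k` further 1s are driven
  -- by the index stack, whose contents pass to the spare stack and back.
  runs-bit : ∀ j s w m k o → k ≤ K → Runs (bitProg j s) (cost (bitˢ j s) K) (state w o m k) (state w (encode (` bitLetter j (k + s)) ++ o) m k)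
  runs-bit j s w m k o k≤K = subst (λ o' → Runs (bitProg j s) (cost (bitˢ j s) K) (state w o m k) (state w o' m k)) coded
    (runs-emit (digits b) » runs-≤ (s≤s (*-monoˡ-≤ _ k≤K)) (loopᴺ σ k (λ _ _ → refl) (λ _ → refl) (λ _ _ _ → runs-emit (digit1 ∷ []) » runs-pop » runs-push)) »
      runs-≤ (s≤s (*-monoˡ-≤ 4 k≤K)) (loopᴺ τ k (λ _ _ → refl) (λ _ → refl) (λ _ _ _ → runs-pop » runs-push)))
    where
    b : ℕᵇ
    b = iterate₁ s 2[1+ iterate₁ j zero ]
    coded : word (digits (iterate₁ k b)) ++ o ≡ encode (` bitLetter j (k + s)) ++ o
    coded = cong (λ b → word (digits b) ++ o) (sym (iterate₁-+ k s 2[1+ iterate₁ j zero ])) ∙ encode-letter (bitCode j (k + s)) o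
    σ τ : ℕ → ℕ → Store 6
    σ m' k' = (word (digits (iterate₁ k' b)) ++ o) ∷ w ∷ ν ∷ ones m ∷ ones m' ∷ ones k' ∷ []
    τ m' k' = (word (digits (iterate₁ k b)) ++ o) ∷ w ∷ ν ∷ ones m ∷ ones k' ∷ ones m' ∷ []

  runs-write : ∀ {b} (e : Scheme b) w m k o → Fits' b m k → Runs (write e) (cost e K) (state w o m k) (state w (encode (formulaOf K k e) ++ o) m k)
  runs-write (letterˢ c) w m k o ok = subst (λ o' → Runs (emit (digits c)) (cost₀ (digits c)) (state w o m k) (state w o' m k)) (encode-letter c o) (runs-emit (digits c))
  runs-write (bitˢ j s) w m k o ok = runs-bit j s w m k o ok
  runs-write (¬ˢ e) w m k o ok = runs-write e w m k o ok » runs-emit (neg ∷ [])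
  runs-write (e ∨ˢ f) w m k o ok = subst (λ o' → Runs (write (e ∨ˢ f)) (cost (e ∨ˢ f) K) (state w o m k) (state w o' m k))
    (encode-or (formulaOf K k e) (formulaOf K k f) o)
    (runs-write f w m k o ok » runs-write e w m k (encode (formulaOf K k f) ++ o) ok » runs-emit (or ∷ []))
  runs-write (Aˢ e) w m k o ok = runs-write e w m k o ok » runs-emit (diaA ∷ [])
  runs-write (Bˢ e) w m k o ok = runs-write e w m k o ok » runs-emit (diaB ∷ [])
  runs-write (allˢ e) w m k o (refl , refl) =
    runs-emit (tokens ⊤ᶠ) » loopᴺ σ K (λ _ _ → refl) (λ _ → refl) body » loopᴺ τ K (λ _ _ → refl) (λ _ → refl) (λ _ _ _ → runs-pop » runs-push)
    where
    φ : ℕ → Formula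
    φ i = formulaOf K i e
    σ τ : ℕ → ℕ → Store 6
    σ m' k' = state w (encode (allᶠ φ k') ++ o) m' k'
    τ m' k' = (encode (allᶠ φ K) ++ o) ∷ w ∷ ν ∷ ones k' ∷ ones m' ∷ [] ∷ []
    body : ∀ m' k' → suc m' + k' ≡ K → Runs (allRound e) (allCost e K) (σ (suc m') k') (σ m' (suc k'))
    body m' k' eq = subst (λ o' → Runs (allRound e) (allCost e K) (σ (suc m') k') (state w o' m' (suc k'))) (cong (bits neg ++_) (encode-or (¬′ φ k') (¬′ allᶠ φ k') o))
      (runs-emit (neg ∷ []) » runs-write e w (suc m') k' (bits neg ++ (encode (allᶠ φ k') ++ o)) (m≤n+m k' (suc m') ≤∙≡ eq) »
        runs-emit (neg ∷ or ∷ neg ∷ []) » runs-pop » runs-push)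

-- The chain is nested to the right and the output grows to the left, so the input is consumed from
-- its last letter, which `gather` has left on top.
linkRound : (Bool → Scheme false) → Scheme false → Prog 6
linkRound e f = emit (neg ∷ []) ⨾ write f ⨾ emit (neg ∷ diaA ∷ neg ∷ or ∷ []) ⨾
  cond inputStack isTrue (write (e true)) (write (e false)) ⨾ emit (neg ∷ or ∷ []) ⨾ pop inputStack

linkCost : (Bool → Scheme false) → Scheme false → ℕ → ℕ
linkCost e f K = cost₀ (neg ∷ []) + (cost f K + (cost₀ (neg ∷ diaA ∷ neg ∷ or ∷ []) + (suc (cost (e true) K + cost (e false) K) + (cost₀ (neg ∷ or ∷ []) + 1))))

frame : List Token
frame = neg ∷ or ∷ neg ∷ diaB ∷ neg ∷ or ∷ tokens (⟨B⟩ ⊤ᶠ) ++ neg ∷ []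

writeFramed : (Bool → Scheme false) → (f g h : Scheme false) → Prog 6
writeFramed e f g h = write h ⨾ emit (neg ∷ []) ⨾ write g ⨾ while inputStack nonempty (linkRound e f) ⨾ emit frame

framedCost : (Bool → Scheme false) → (f g h : Scheme false) → ℕ → ℕ → ℕ
framedCost e f g h K n = cost h K + (cost₀ (neg ∷ []) + (cost g K + ((1 + n * suc (linkCost e f K)) + cost₀ frame)))

runs-framed : ∀ K ν e f g h w → let open Writing K ν in
              Runs (writeFramed e f g h) (framedCost e f g h K (length w)) (state (reverse w) [] K 0) (state [] (encode (framedᶠ K e f g h w) ++ []) K 0)
runs-framed K ν e f g h w = subst (λ o → Runs (writeFramed e f g h) (framedCost e f g h K (length w)) (state (reverse w) [] K 0) (state [] o K 0)) framed
  (runs-write h (reverse w) K 0 [] (refl , refl) » runs-emit (neg ∷ []) » runs-write g (reverse w) K 0 o₁ (refl , refl) »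
    runs-≤ (s≤s (*-monoˡ-≤ (suc (linkCost e f K)) (≤-reflexive (length-reverse w)))) (loopᴸ σ w (λ _ _ → refl) round (reverse w) [] (reverse-involutive w)) » runs-emit frame)
  where
  open Writing K ν
  φ : Bool → Formula
  φ b = formulaOf K 0 (e b)
  ψ ξ ζ β : Formula
  ψ = formulaOf K 0 f
  ξ = formulaOf K 0 g
  ζ = formulaOf K 0 h
  β = chainᶠ φ ψ ξ w
  o₁ : List Bool
  o₁ = encode (¬′ ζ) ++ []
  σ : List Bool → List Bool → Store 6
  σ xs ys = state xs (encode (chainᶠ φ ψ ξ ys) ++ o₁) K 0
  link : ∀ b χ' → bits neg ++ (bits or ++ (encode (φ b) ++ (bits neg ++ (bits diaA ++ (bits neg ++ (bits or ++ (encode ψ ++ (bits neg ++ (encode χ' ++ o₁)))))))))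
         ≡ encode (linkᶠ φ ψ b χ') ++ o₁
  link b χ' = cong (λ z → bits neg ++ (bits or ++ (encode (φ b) ++ (bits neg ++ (bits diaA ++ (bits neg ++ z)))))) (encode-or ψ (¬′ χ') o₁) ∙
    cong (bits neg ++_) (encode-or (φ b) (¬′ ⟨A⟩ ¬′ (ψ ∨′ ¬′ χ')) o₁)
  pick : ∀ b xs o →
      Runs (cond inputStack isTrue (write (e true)) (write (e false))) (suc (cost (e true) K + cost (e false) K)) (state (b ∷ xs) o K 0) (state (b ∷ xs) (encode (φ b) ++ o) K 0)
  pick true xs o = let _ , le , ex = runs-write (e true) (true ∷ xs) K 0 o (refl , refl) in _ , s≤s (le ≤∙ m≤m+n _ _) , then refl ex
  pick false xs o = let _ , le , ex = runs-write (e false) (false ∷ xs) K 0 o (refl , refl) in _ , s≤s (le ≤∙ m≤n+m _ _) , else refl ex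
  round : ∀ b xs ys → (b ∷ xs) ʳ++ ys ≡ w → Runs (linkRound e f) (linkCost e f K) (σ (b ∷ xs) ys) (σ xs (b ∷ ys))
  round b xs ys _ = subst (λ o → Runs (linkRound e f) (linkCost e f K) (σ (b ∷ xs) ys) (state xs o K 0)) (link b (chainᶠ φ ψ ξ ys))
    (runs-emit (neg ∷ []) » runs-write f (b ∷ xs) K 0 (bits neg ++ (encode (chainᶠ φ ψ ξ ys) ++ o₁)) (refl , refl) » runs-emit (neg ∷ diaA ∷ neg ∷ or ∷ []) »
      pick b xs o₂ »
      runs-emit (neg ∷ or ∷ []) » runs-pop)
    where
    o₂ : List Bool
    o₂ = bits neg ++ (bits diaA ++ (bits neg ++ (bits or ++ (encode ψ ++ (bits neg ++ (encode (chainᶠ φ ψ ξ ys) ++ o₁))))))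
  framed : word frame ++ (encode β ++ o₁) ≡ encode (framedᶠ K e f g h w) ++ []
  framed = cong (λ z → bits neg ++ (bits or ++ (bits neg ++ (bits diaB ++ (bits neg ++ z))))) (encode-or (⟨B⟩ ⊤ᶠ) (¬′ β) o₁) ∙
    cong (bits neg ++_) (encode-or (¬′ ⟨B⟩ ¬′ (⟨B⟩ ⊤ᶠ ∨′ ¬′ β)) (¬′ ζ) [])

gather : Prog 6
gather = while outputStack nonempty
  (cond outputStack isTrue (pop outputStack ⨾ push inputStack true) (pop outputStack ⨾ push inputStack false) ⨾ push sizeStack true)

runs-gather : ∀ w → Runs gather (1 + length w * 7) (w ∷ Vec.replicate 5 []) ([] ∷ reverse w ∷ ones (length w) ∷ [] ∷ [] ∷ [] ∷ [])
runs-gather w = subst (λ n → Runs gather (1 + length w * 7) (w ∷ Vec.replicate 5 []) ([] ∷ reverse w ∷ ones n ∷ [] ∷ [] ∷ [] ∷ [])) (length-reverse w)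
  (loopᴸ (λ xs ys → xs ∷ ys ∷ ones (length ys) ∷ [] ∷ [] ∷ [] ∷ []) (reverse w) (λ _ _ → refl)
    (λ b xs ys _ → take b xs ys » runs-push) w [] refl)
  where
  take : ∀ b xs ys → Runs (cond outputStack isTrue (pop outputStack ⨾ push inputStack true) (pop outputStack ⨾ push inputStack false)) 4
           ((b ∷ xs) ∷ ys ∷ ones (length ys) ∷ [] ∷ [] ∷ [] ∷ []) (xs ∷ (b ∷ ys) ∷ ones (length ys) ∷ [] ∷ [] ∷ [] ∷ [])
  take true xs ys = _ , ≤-refl , then refl (pop ⨾ push tt)
  take false xs ys = _ , ≤-refl , else refl (pop ⨾ push tt)

addSize : Prog 6
addSize = while sizeStack nonempty (pop sizeStack ⨾ push spareStack true ⨾ push boundStack true) ⨾ while spareStack nonempty (pop spareStack ⨾ push sizeStack true)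

multiply : Prog 6
multiply = while boundStack nonempty (pop boundStack ⨾ push indexStack true) ⨾ while indexStack nonempty (pop indexStack ⨾ addSize)

pushOnes : ℕ → Prog 6
pushOnes zero    = skip
pushOnes (suc a) = pushOnes a ⨾ push boundStack true

horner : Polynomial → Prog 6
horner []      = skip
horner (a ∷ p) = horner p ⨾ multiply ⨾ pushOnes a

pushCost : ℕ → ℕ
pushCost zero    = 1
pushCost (suc a) = pushCost a + 2

addCost : ℕ → ℕ
addCost n = (1 + n * 6) + (1 + n * 4)

hornerCost : Polynomial → ℕ → ℕ
hornerCost [] n = 1
hornerCost (a ∷ p) n = hornerCost p n + (((1 + eval p n * 4) + (1 + eval p n * suc (1 + addCost n))) + pushCost a)

module Unary (w : List Bool) (n : ℕ) where

  registers : ℕ → ℕ → ℕ → ℕ → Store 6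
  registers s k i j = [] ∷ w ∷ ones s ∷ ones k ∷ ones i ∷ ones j ∷ []

  runs-addSize : ∀ k i → Runs addSize (addCost n) (registers n k i 0) (registers n (n + k) i 0)
  runs-addSize k i = loopᴺ (λ m l → registers m (l + k) i l) n (λ _ _ → refl) (λ _ → refl) (λ _ _ _ → runs-pop » runs-push » runs-push) »
    loopᴺ (λ m l → registers l (n + k) i m) n (λ _ _ → refl) (λ _ → refl) (λ _ _ _ → runs-pop » runs-push)

  runs-multiply : ∀ r → Runs multiply ((1 + r * 4) + (1 + r * suc (1 + addCost n))) (registers n r 0 0) (registers n (r * n) 0 0)
  runs-multiply r = loopᴺ (λ m l → registers n m l 0) r (λ _ _ → refl) (λ _ → refl) (λ _ _ _ → runs-pop » runs-push) »
    loopᴺ (λ m l → registers n (l * n) m 0) r (λ _ _ → refl) (λ _ → refl) (λ m l _ → runs-pop » runs-addSize (l * n) m)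

  runs-pushes : ∀ a k → Runs (pushOnes a) (pushCost a) (registers n k 0 0) (registers n (a + k) 0 0)
  runs-pushes zero k = _ , ≤-refl , skip
  runs-pushes (suc a) k = runs-pushes a k » runs-push

  runs-horner : ∀ p → Runs (horner p) (hornerCost p n) (registers n 0 0 0) (registers n (eval p n) 0 0)
  runs-horner []      = _ , ≤-refl , skip
  runs-horner (a ∷ p) = runs-horner p » runs-multiply (eval p n) »
    subst (λ k → Runs (pushOnes a) (pushCost a) (registers n (eval p n * n) 0 0) (registers n k 0 0)) (cong (a +_) (*-comm (eval p n) n)) (runs-pushes a (eval p n * n))

module Output (p : Polynomial) (e : Bool → Scheme false) (f g h : Scheme false) where

  -- One bit more than the exponent of the space bound, so that the addresses count twice the space.
  addressBits : ℕ → ℕ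
  addressBits n = suc (eval p n)

  program : Prog 6
  program = gather ⨾ horner p ⨾ push boundStack true ⨾ writeFramed e f g h

  time : ℕ → ℕ
  time n = (1 + n * 7) + (hornerCost p n + (2 + framedCost e f g h (addressBits n) n))

  runs-program : ∀ w → ∃[ σ ] Runs program (time (length w)) (w ∷ Vec.replicate 5 []) (encode (framedᶠ (addressBits (length w)) e f g h w) ∷ σ)
  runs-program w = Vec.tail final , subst (λ o → Runs program (time (length w)) (w ∷ Vec.replicate 5 []) (o ∷ Vec.tail final)) (++-identityʳ _)
    (runs-gather w » Unary.runs-horner (reverse w) (length w) p » runs-push » runs-framed (addressBits (length w)) (ones (length w)) e f g h w)
    where
    final : Store 6
    final = Writing.state (addressBits (length w)) (ones (length w)) [] [] (addressBits (length w)) 0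

  poly-suc : ∀ {t} → PolyBounded t → PolyBounded (λ n → suc (t n))
  poly-suc = poly-+ (poly-const 1)

  poly-loop : ∀ {s t} → PolyBounded s → PolyBounded t → PolyBounded (λ n → 1 + s n * suc (t n))
  poly-loop ps pt = poly-suc (poly-* ps (poly-suc pt))

  poly-bound : PolyBounded addressBits
  poly-bound = poly-suc (poly-eval p)

  poly-cost : ∀ {b} (e : Scheme b) → PolyBounded (λ n → cost e (addressBits n))
  poly-cost (letterˢ c) = poly-const (cost₀ (digits c))
  poly-cost (bitˢ j s)  = poly-+ (poly-const (cost₀ (digits (iterate₁ s 2[1+ iterate₁ j zero ]))))
    (poly-+ (poly-loop poly-bound (poly-const (cost₀ (digit1 ∷ []) + 3))) (poly-loop poly-bound (poly-const 3)))
  poly-cost (¬ˢ e)      = poly-+ (poly-cost e) (poly-const (cost₀ (neg ∷ [])))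
  poly-cost (e ∨ˢ f)    = poly-+ (poly-cost f) (poly-+ (poly-cost e) (poly-const (cost₀ (or ∷ []))))
  poly-cost (Aˢ e)      = poly-+ (poly-cost e) (poly-const (cost₀ (diaA ∷ [])))
  poly-cost (Bˢ e)      = poly-+ (poly-cost e) (poly-const (cost₀ (diaB ∷ [])))
  poly-cost (allˢ e)    = poly-+ (poly-const (cost₀ (tokens ⊤ᶠ))) (poly-+ (poly-loop poly-bound
    (poly-+ (poly-const (cost₀ (neg ∷ []))) (poly-+ (poly-cost e) (poly-const (cost₀ (neg ∷ or ∷ neg ∷ []) + 3))))) (poly-loop poly-bound (poly-const 3)))

  poly-link : PolyBounded (λ n → linkCost e f (addressBits n))
  poly-link = poly-+ (poly-const (cost₀ (neg ∷ []))) (poly-+ (poly-cost f) (poly-+ (poly-const (cost₀ (neg ∷ diaA ∷ neg ∷ or ∷ [])))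
    (poly-+ (poly-suc (poly-+ (poly-cost (e true)) (poly-cost (e false)))) (poly-const (cost₀ (neg ∷ or ∷ []) + 1)))))

  poly-horner : ∀ p → PolyBounded (hornerCost p)
  poly-horner []      = poly-const 1
  poly-horner (a ∷ p) = poly-+ (poly-horner p) (poly-+ (poly-+ (poly-loop (poly-eval p) (poly-const 3))
    (poly-loop (poly-eval p) (poly-suc (poly-+ (poly-loop poly-id (poly-const 5)) (poly-loop poly-id (poly-const 3)))))) (poly-const (pushCost a)))

  poly-time : PolyBounded time
  poly-time = poly-+ (poly-loop poly-id (poly-const 6)) (poly-+ (poly-horner p) (poly-+ (poly-const 2) (poly-+ (poly-cost h)
    (poly-+ (poly-const (cost₀ (neg ∷ []))) (poly-+ (poly-cost g) (poly-+ (poly-loop poly-id poly-link) (poly-const (cost₀ frame))))))))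

  polyTime : PolyTime (λ w → encode (framedᶠ (addressBits (length w)) e f g h w))
  polyTime = machine program , proj₁ bounded' , λ w →
    let σ , t , t≤ , ex = runs-program w
        k , c , halts , k≤ , out = computes program ex
    in k , c , halts , k≤ ≤∙ +-monoˡ-≤ 1 t≤ ≤∙ proj₂ bounded' (length w) , out
    where
    bounded' : PolyBounded (λ n → time n + 1)
    bounded' = poly-+ poly-time (poly-const 1)

module Hardness (𝕄 : Machine) (p : Polynomial) (L : Language) (decision : DecidesInSpace 𝕄 (λ n → 2 ^ eval p n) L) where

  open Constraints 𝕄
  open Output p inputˢ stepˢ (labelˢ nothing) restˢ

  reduce : List Bool → Formula
  reduce w = reductionᶠ (addressBits (length w)) w

  module For (w : List Bool) (S M : ℕ) (S≡ : S ≡ 2 ^ eval p (length w)) (M≡ : M ≡ 2 ^ addressBits (length w)) where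

    M≡S+S : M ≡ S + S
    M≡S+S = M≡ ∙ cong (λ s → s + (s + 0)) (sym S≡) ∙ cong (S +_) (+-identityʳ S)

    bounded : ∀ n c → Run 𝕄 n (initial 𝕄 w) c → space 𝕄 c ≤ S
    bounded n c r = proj₂ (decision w) n c r ≤∙≡ sym S≡

    open Reduction 𝕄 w (addressBits (length w)) S M (s≤s z≤n) M≡ M≡S+S bounded

    -- The accepting run read off the model and the run of the decision procedure both halt, so
    -- determinism identifies their last configurations.
    sound : ∀ n u → sat u (reduce w) n 0 → L w
    sound n u h =
      let (_ , _ , (r , halt) , acc⇔) , _ = decision w
          _ , _ , (r' , halt') , accepts' = Model'.Sound.halting u n (to (Model'.reduction⇔ u n) h)
      in to acc⇔ (subst (Accepting 𝕄) (halt-unique r' halt' r halt) accepts')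

    complete : L w → ∃[ n ] ∃[ u ] sat u (reduce w) n 0
    complete l =
      let (m , c , (r , halt) , acc⇔) , _ = decision w
          alive , eq = Computation.run-config 𝕄 w (addressBits (length w)) S M M≡ M≡S+S {s = 0} (λ _ ()) r
          fin = from (undefined⇔ _) (subst (λ c → step 𝕄 c ≡ nothing × Accepting 𝕄 c) (sym eq) (halt , from acc⇔ l))
      in Complete.n m alive fin , Complete.traceWord m alive fin , from (Model'.reduction⇔ _ _) (Complete.valid m alive fin)

  reduce-correct : ∀ w → L w ⇔ ABDhom-SAT (encode (reduce w))
  reduce-correct w = mk⇔
    (λ l → reduce w , refl , from (satisfiable⇔sat (reduce w)) (For.complete w _ _ refl refl l))
    (λ (φ , eq , s) → let n , u , h = to (satisfiable⇔sat (reduce w)) (subst Satisfiable (encode-injective {φ} {reduce w} eq) s) in For.sound w _ _ refl refl n u h)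

ABDhom-SAT-hard : EXPSPACE-hard ABDhom-SAT
ABDhom-SAT-hard L (𝕄 , p , decision) = encode ∘ reduce , polyTime , reduce-correct
  where
  open Hardness 𝕄 p L decision
  open Constraints 𝕄
  open Output p inputˢ stepˢ (labelˢ nothing) restˢ

theorem1 : EXPSPACE-complete ABDhom-SAT
theorem1 = ABDhom-SAT-in-EXPSPACE , ABDhom-SAT-hard
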